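{- For every deterministic context-free language $L$, the problem $\mathrm{DAGREACH}(L)$ is in $\mathsf{LogCFL}$, and there exists a deterministic context-free language $L$ for which $\mathrm{DAGREACH}(L)$ is $\mathsf{LogCFL}$-hard under logspace many-one reductions. That is, $\mathrm{DAGREACH}(\mathsf{DCFL})$ is $\mathsf{LogCFL}$-complete.
   Context: Fix a language $L\subseteq\Sigma^*$ over a finite alphabet $\Sigma$. An instance of $\mathrm{DAGREACH}(L)$ is a triple $(G,s,t)$ where $G$ is a directed acyclic graph whose edges are each labelled by a symbol of $\Sigma$, and $s,t$ are vertices; the yield of a path is the concatenation of the labels of its edges in order. $(G,s,t)$ is a yes-instance iff there is a path from $s$ to $t$ in $G$ whose yield lies in $L$. $\mathsf{DCFL}$ is the class of deterministic context-free languages (those accepted by deterministic pushdown automata). $\mathsf{LogCFL}$ is the class of languages logspace many-one reducible to a context-free language (equivalently, languages accepted by nondeterministic logspace auxiliary pushdown automata running in polynomial time). -}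

module Defs where

open import Data.Nat using (ℕ; zero; suc; _+_; _*_; _≤_; _<ᵇ_; pred)
open import Data.Nat.Logarithm using (⌈log₂_⌉)
open import Data.Fin using (Fin; zero; suc; toℕ)
open import Data.List using (List; []; _∷_; _++_; length; replicate; concatMap; [_])
open import Data.List.Membership.Propositional using (_∈_)
open import Data.Maybe using (Maybe; just; nothing)
open import Data.Bool using (Bool; true; false; if_then_else_)
open import Data.Product using (Σ; _×_; _,_; ∃)
open import Data.Sum using (_⊎_; inj₁; inj₂)
open import Relation.Binary.PropositionalEquality using (_≡_)
open import Relation.Binary.Construct.Closure.ReflexiveTransitive using (Star)

Word : ℕ → Set
Word k = List (Fin k)

Language : ℕ → Set₁
Language k = Word k → Set

-- Deterministic logspace transducers
-- One read-only input tape  ⊢ w ⊣  (positions 0 .. |w|+1), one work tape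
-- (one-way infinite to the right, blank = zero) and a write-only output.

data Move : Set where
  left stay right : Move

data InSym (a : ℕ) : Set where
  lend rend : InSym a
  sym : Fin a → InSym a

record Transducer (a b : ℕ) : Set where
  field
    Q W   : ℕ
    start : Fin Q
    -- nothing = halt; otherwise: new state, symbol written on the work cell,
    -- input-head move, work-head move, optional output symbol
    δ     : Fin Q → InSym a → Fin (suc W) →
            Maybe (Fin Q × Fin (suc W) × Move × Move × Maybe (Fin b))

record TConfig (Q W b : ℕ) : Set where
  constructor tcfg
  field
    state : Fin Q
    ipos  : ℕ
    wl    : List (Fin (suc W))   -- work cells left of the head (nearest first)
    wc    : Fin (suc W)
    wr    : List (Fin (suc W))
    out   : List (Fin b)

readInput : ∀ {a} → Word a → ℕ → InSym a
readInput w zero = lend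
readInput [] (suc i) = rend
readInput (x ∷ w) (suc zero) = sym x
readInput (x ∷ w) (suc (suc i)) = readInput w (suc i)

moveIn : ℕ → Move → ℕ → ℕ
moveIn n left i = pred i
moveIn n stay i = i
moveIn n right i = if i <ᵇ suc n then suc i else i

module _ {a b : ℕ} (T : Transducer a b) where
  open Transducer T

  Config : Set
  Config = TConfig Q W b

  moveWork : Move → List (Fin (suc W)) → Fin (suc W) → List (Fin (suc W)) →
             List (Fin (suc W)) × Fin (suc W) × List (Fin (suc W))
  moveWork left [] c r = [] , c , r
  moveWork left (x ∷ l) c r = l , x , c ∷ r
  moveWork stay l c r = l , c , r
  moveWork right l c [] = c ∷ l , zero , []
  moveWork right l c (x ∷ r) = c ∷ l , x , r

  emit : Maybe (Fin b) → List (Fin b) → List (Fin b)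
  emit nothing o = o
  emit (just y) o = o ++ [ y ]

  tstep : Word a → Config → Maybe Config
  tstep w (tcfg q i l c r o) with δ q (readInput w i) c
  ... | nothing = nothing
  ... | just (q' , c' , mi , mw , y) with moveWork mw l c' r
  ...   | (l' , c'' , r') = just (tcfg q' (moveIn (length w) mi i) l' c'' r' (emit y o))

  initConfig : Config
  initConfig = tcfg start 0 [] zero [] []

  run : Word a → ℕ → Config → Config
  run w zero c = c
  run w (suc t) c with tstep w c
  ... | nothing = c
  ... | just c' = run w t c'

  Halted : Word a → Config → Set
  Halted w c = tstep w c ≡ nothing

  space : Config → ℕ
  space (tcfg _ _ l _ r _) = suc (length l + length r)

LogspaceComputable : ∀ {a b} → (Word a → Word b) → Set
LogspaceComputable {a} {b} f =
  Σ (Transducer a b) λ T → Σ ℕ λ c →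
    ((w : Word a) → ∃ λ t →
        Halted T w (run T w t (initConfig T)) ×
        TConfig.out (run T w t (initConfig T)) ≡ f w)
    × ((w : Word a) (t : ℕ) →
        space T (run T w t (initConfig T)) ≤ c * ⌈log₂ (suc (length w)) ⌉ + c)

_≤L_ : ∀ {a b} → Language a → Language b → Set
_≤L_ {a} {b} A B = Σ (Word a → Word b) λ f → LogspaceComputable f ×
  ((w : Word a) → (A w → B (f w)) × (B (f w) → A w))

record CFG (a : ℕ) : Set where
  field
    N     : ℕ
    S     : Fin N
    rules : List (Fin N × List (Fin N ⊎ Fin a))

module _ {a : ℕ} (G : CFG a) where
  open CFG G
  data Gen : Fin N → Word a → Set
  data GenSeq : List (Fin N ⊎ Fin a) → Word a → Set
  data Gen where
    apply : ∀ {X rhs w} → (X , rhs) ∈ rules → GenSeq rhs w → Gen X w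
  data GenSeq where
    nil  : GenSeq [] []
    term : ∀ {x rest w} → GenSeq rest w → GenSeq (inj₂ x ∷ rest) (x ∷ w)
    nont : ∀ {Y rest u v} → Gen Y u → GenSeq rest v → GenSeq (inj₁ Y ∷ rest) (u ++ v)

CFGLang : ∀ {a} → CFG a → Language a
CFGLang G = Gen G (CFG.S G)

LogCFL : ∀ {a} → Language a → Set
LogCFL A = Σ ℕ λ b → Σ (CFG b) λ G → A ≤L CFGLang G

LogCFLHard : ∀ {a} → Language a → Set₁
LogCFLHard B = ∀ k (A : Language k) → LogCFL A → A ≤L B

record DPDA (a : ℕ) : Set where
  field
    Q Γ   : ℕ
    q₀    : Fin Q
    Z₀    : Fin Γ
    final : Fin Q → Bool
    δ     : Fin Q → Fin a → Fin Γ → Maybe (Fin Q × List (Fin Γ))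
    δε    : Fin Q → Fin Γ → Maybe (Fin Q × List (Fin Γ))
    deterministic : ∀ q X x → δε q X ≡ nothing ⊎ δ q x X ≡ nothing

module _ {a : ℕ} (P : DPDA a) where
  open DPDA P
  PConfig : Set
  PConfig = Fin Q × Word a × List (Fin Γ)

  data PStep : PConfig → PConfig → Set where
    read : ∀ {q x w X γ q' α} → δ q x X ≡ just (q' , α) →
           PStep (q , x ∷ w , X ∷ γ) (q' , w , α ++ γ)
    eps  : ∀ {q w X γ q' α} → δε q X ≡ just (q' , α) →
           PStep (q , w , X ∷ γ) (q' , w , α ++ γ)

  DPDALang : Language a
  DPDALang w = Σ (Fin Q) λ q → Σ (List (Fin Γ)) λ γ →
    Star PStep (q₀ , w , Z₀ ∷ []) (q , [] , γ) × final q ≡ true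

module _ {a n : ℕ} (E : List (Fin n × Fin a × Fin n)) where
  data Path : Fin n → Fin n → Word a → Set where
    here : ∀ {u} → Path u u []
    step : ∀ {u x m v y} → (u , x , m) ∈ E → Path m v y → Path u v (x ∷ y)

record Instance (a : ℕ) : Set where
  field
    n   : ℕ
    E   : List (Fin n × Fin a × Fin n)
    s t : Fin n
    acyclic : ∀ v y → Path E v v y → y ≡ []

YesInstance : ∀ {a} → Language a → Instance a → Set
YesInstance L I = Σ (Word _) λ y → Path (Instance.E I) (Instance.s I) (Instance.t I) y × L y

-- Encoding over alphabet Fin (2 + a): zero = '1', suc zero = '#', suc (suc x) = label x
unary : ∀ {a} → ℕ → Word (2 + a)
unary k = replicate k zero ++ [ suc zero ]

encodeEdge : ∀ {a n} → Fin n × Fin a × Fin n → Word (2 + a)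
encodeEdge (u , x , v) = unary (toℕ u) ++ (suc (suc x) ∷ unary (toℕ v))

encode : ∀ {a} → Instance a → Word (2 + a)
encode I = unary (Instance.n I) ++ unary (toℕ (Instance.s I)) ++
           unary (toℕ (Instance.t I)) ++ concatMap encodeEdge (Instance.E I)

DAGREACH : ∀ {a} → Language a → Language (2 + a)
DAGREACH L w = Σ (Instance _) λ I → encode I ≡ w × YesInstance L I

module Submission where

-- Hardness: run the transducer of a reduction to a context-free language together with a top-down
-- parser.  Clocked configurations (two-bracket stack moves as edge labels) form a DAG of polynomial
-- size, and the Dyck language on two brackets selects the accepting computations.
-- Membership: acyclicity is checked nondeterministically by inductive counting of the ends of walks
-- with d edges (none for d = n iff the graph is acyclic), then a path is guessed.  The configuration
-- graph is written out in topological order, so that a context-free grammar finds a path by reading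
-- the edge list once, matching the unary target of an edge with the source of the next one.
-- Both graphs are first-order definable over an initial segment of ℕ, which a transducer can evaluate.

open import Defs renaming (sym to letter; here to stop; step to edge)
open import Data.Bool using (Bool; true; false; if_then_else_; T)
open import Data.Empty using (⊥-elim)
open import Data.Fin using (Fin; zero; suc; toℕ; fromℕ; fromℕ<; combine; remQuot; splitAt; join; _↑ˡ_; _↑ʳ_; #_)
import Data.Fin.Properties as Fin
open import Data.List as List using (List; []; _∷_; _++_; length; replicate; concatMap; [_]; map; allFin; _ʳ++_)
open import Data.List.Membership.Propositional using (_∈_) renaming (find to find∈)
open import Data.List.Membership.Propositional.Properties using (∈-++⁺ˡ; ∈-++⁺ʳ; ∈-++⁻; ∈-map⁺; ∈-map⁻; ∈-concatMap⁺; ∈-concatMap⁻; ∈-allFin; ∈-lookup)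
open import Data.List.Properties using (++-assoc; ++-identityʳ; length-++; length-map; length-replicate; ∷-injective; ∷-injectiveʳ)
open import Data.List.Relation.Unary.All as All using (All; []; _∷_)
open import Data.List.Relation.Unary.AllPairs as AllPairs using (AllPairs; []; _∷_)
import Data.List.Relation.Unary.AllPairs.Properties as AllPairsₚ
open import Data.List.Relation.Unary.Any as Any using (here; there)
open import Data.Maybe as Maybe using (Maybe; just; nothing)
open import Data.Maybe.Properties using (just-injective)
open import Data.Nat using (ℕ; zero; suc; _+_; _*_; _∸_; _^_; _⊔_; _≤_; _<_; _<ᵇ_; _≤?_; _<?_; z≤n; s≤s; pred; >-nonZero)
import Data.Nat.ListAction as ListAction
open import Data.Nat.Logarithm using (⌈log₂_⌉; ⌈log₂⌉-mono-≤; ⌈log₂2^n⌉≡n; ⌈log₂2*n⌉≡1+⌈log₂n⌉)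
open import Data.Nat.Properties
open import Data.Nat.Tactic.RingSolver using (solve-∀)
open import Data.Product using (Σ; _×_; _,_; ∃; proj₁; proj₂)
open import Data.Sum using (_⊎_; inj₁; inj₂; [_,_]′)
open import Data.Unit using (⊤; tt)
open import Data.Vec as Vec using (Vec; []; _∷_; lookup)
import Data.Vec.Properties as Vecₚ
open import Function using (_∘_; id; case_of_)
open import Relation.Binary.Construct.Closure.ReflexiveTransitive using (Star; ε; _◅_; _◅◅_)
open import Relation.Binary.Definitions using (tri<; tri≈; tri>)
open import Relation.Binary.PropositionalEquality using (_≡_; _≢_; refl; sym; trans; cong; cong₂; subst; subst₂)
open import Relation.Nullary using (¬_; Dec; yes; no; does)
open import Relation.Nullary.Decidable using (map′; _×-dec_; _⊎-dec_; ¬?)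

-- Transducers from structured machines

-- Derivations of a grammar with empty and unit productions can be arbitrarily longer than the word
-- they produce. A polynomial clock exists only because redundant nodes can be pruned until the size
-- is linear in the word. No two logspace functions are ever composed: in the hardness half the
-- output of the given reduction is never stored, each emitted symbol being popped at once from the
-- parse stack, and that stack exists only in the edge labels. In the membership half a word must be
-- rejected unless it encodes an acyclic graph, and acyclicity is not known to be decidable in
-- deterministic logspace. So the check is moved into the paths of the new graph: its edges carry
-- blank labels, and only the path guessed afterwards contributes letters. What has to be certified
-- is the absence of long walks, hence counting in the manner of Immerman and Szelepcsényi. All
-- polynomial bounds are absorbed by the base of the digits: the number of columns is always about
-- the binary logarithm of the input length, and a larger base lets a register reach any fixed
-- polynomial.

record Finite (A : Set) : Set where
  field
    size    : ℕ
    enc     : A → Fin size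
    dec     : Fin size → A
    dec-enc : ∀ x → dec (enc x) ≡ x

open Finite

-- A one-sided inverse suffices: a machine decodes only states that it has encoded itself, so codes
-- outside the image of `enc` may be decoded arbitrarily.
finRetract : {A B : Set} (f : A → B) (g : B → A) → (∀ x → g (f x) ≡ x) → Finite B → Finite A
finRetract f g gf F .size = size F
finRetract f g gf F .enc = enc F ∘ f
finRetract f g gf F .dec = g ∘ dec F
finRetract f g gf F .dec-enc x = trans (cong g (dec-enc F (f x))) (gf x)

finFin : ∀ n → Finite (Fin n)
finFin n .size = n
finFin n .enc = id
finFin n .dec = id
finFin n .dec-enc _ = refl

infixr 4 _fin⊎_ _fin×_

_fin⊎_ : {A B : Set} → Finite A → Finite B → Finite (A ⊎ B)
(F fin⊎ G) .size = size F + size G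
(F fin⊎ G) .enc (inj₁ x) = join (size F) (size G) (inj₁ (enc F x))
(F fin⊎ G) .enc (inj₂ y) = join (size F) (size G) (inj₂ (enc G y))
(F fin⊎ G) .dec i = [ inj₁ ∘ dec F , inj₂ ∘ dec G ]′ (splitAt (size F) i)
(F fin⊎ G) .dec-enc (inj₁ x) rewrite Fin.splitAt-join (size F) (size G) (inj₁ (enc F x)) | dec-enc F x = refl
(F fin⊎ G) .dec-enc (inj₂ y) rewrite Fin.splitAt-join (size F) (size G) (inj₂ (enc G y)) | dec-enc G y = refl

_fin×_ : {A B : Set} → Finite A → Finite B → Finite (A × B)
(F fin× G) .size = size F * size G
(F fin× G) .enc (x , y) = combine (enc F x) (enc G y)
(F fin× G) .dec i = let (j , k) = remQuot (size G) i in dec F j , dec G k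
(F fin× G) .dec-enc (x , y) =
  trans (cong (λ p → dec F (proj₁ p) , dec G (proj₂ p)) (Fin.remQuot-combine (enc F x) (enc G y))) (cong₂ _,_ (dec-enc F x) (dec-enc G y))

finUnit : Finite ⊤
finUnit = finRetract (λ _ → zero) (λ _ → tt) (λ _ → refl) (finFin 1)

finMaybe : {A : Set} → Finite A → Finite (Maybe A)
finMaybe F = finRetract (λ { nothing → inj₁ tt ; (just x) → inj₂ x }) (λ { (inj₁ _) → nothing ; (inj₂ x) → just x })
                        (λ { nothing → refl ; (just _) → refl }) (finUnit fin⊎ F)

finBool : Finite Bool
finBool = finRetract (λ { false → inj₁ tt ; true → inj₂ tt }) (λ { (inj₁ _) → false ; (inj₂ _) → true })
                     (λ { false → refl ; true → refl }) (finUnit fin⊎ finUnit)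

finVec : {A : Set} → Finite A → ∀ n → Finite (Vec A n)
finVec F zero = finRetract (λ _ → tt) (λ _ → []) (λ { [] → refl }) finUnit
finVec F (suc n) = finRetract (λ { (x ∷ v) → x , v }) (λ { (x , v) → x ∷ v }) (λ { (x ∷ v) → refl }) (F fin× finVec F n)

-- Structured logspace machines.  The work tape holds a left end marker, then columns of K base-g
-- digits, then a blank; a column stores one digit of each of K registers.
module Machines (a b K g : ℕ) where

  Col : Set
  Col = Vec (Fin g) K

  data Cell : Set where
    blank mark : Cell
    col : Col → Cell

  finCol : Finite Col
  finCol = finVec (finFin g) K

  W′ : ℕ
  W′ = suc (size finCol)

  encC : Cell → Fin (suc W′)
  encC blank = zero
  encC mark = suc zero
  encC (col c) = suc (suc (enc finCol c))

  decC : Fin (suc W′) → Cell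
  decC zero = blank
  decC (suc zero) = mark
  decC (suc (suc c)) = col (dec finCol c)

  decC-encC : ∀ c → decC (encC c) ≡ c
  decC-encC blank = refl
  decC-encC mark = refl
  decC-encC (col c) = cong col (dec-enc finCol c)

  Act : Set → Set
  Act S = S × Cell × Move × Move × Maybe (Fin b)

  -- A machine leaves through one of two exits.
  record Mach : Set₁ where
    no-eta-equality
    field
      St    : Set
      fin   : Finite St
      entry : St
      stepM : St → InSym a → Cell → Act (St ⊎ Bool)
  open Mach public

  redirect : {A B : Set} → (A → B) → (Bool → B ⊎ Bool) → Act (A ⊎ Bool) → Act (B ⊎ Bool)
  redirect ι ρ (x , act) = [ inj₁ ∘ ι , ρ ]′ x , act

  inpM : (InSym a → Bool) → Mach
  inpM p .St = ⊤
  inpM p .fin = finUnit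
  inpM p .entry = tt
  inpM p .stepM _ σ c = inj₂ (p σ) , c , stay , stay , nothing

  mvM : Bool → Move → Mach
  mvM e m .St = ⊤
  mvM e m .fin = finUnit
  mvM e m .entry = tt
  mvM e m .stepM _ σ c = inj₂ e , c , m , stay , nothing

  outM : Fin b → Mach
  outM y .St = ⊤
  outM y .fin = finUnit
  outM y .entry = tt
  outM y .stepM _ σ c = inj₂ true , c , stay , stay , just y

  -- One sweep over the columns, least significant digits first, so that a carry fits into the
  -- state. The sweep may rewrite every column and append one at the end; no other primitive machine
  -- changes the columns.
  record Scan : Set where
    field
      s₀ : Maybe Bool
      δS : Maybe Bool → Col → Maybe Bool × Col
      endS : Maybe Bool → Bool × Maybe Col
  open Scan

  data ScanSt : Set where
    start : ScanSt
    right : Maybe Bool → ScanSt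
    grow left : Bool → ScanSt

  finScanSt : Finite ScanSt
  finScanSt = finRetract
    (λ { start → inj₁ tt ; (right s) → inj₂ (inj₁ s) ; (grow e) → inj₂ (inj₂ (inj₁ e)) ; (left e) → inj₂ (inj₂ (inj₂ e)) })
    (λ { (inj₁ _) → start ; (inj₂ (inj₁ s)) → right s ; (inj₂ (inj₂ (inj₁ e))) → grow e ; (inj₂ (inj₂ (inj₂ e))) → left e })
    (λ { start → refl ; (right _) → refl ; (grow _) → refl ; (left _) → refl })
    (finUnit fin⊎ finMaybe finBool fin⊎ finBool fin⊎ finBool)

  scanStep : Scan → ScanSt → Cell → Act (ScanSt ⊎ Bool)
  scanStep M start c = inj₁ (right (s₀ M)) , c , stay , right , nothing
  scanStep M (right s) (col c) = let (s′ , c′) = δS M s c in inj₁ (right s′) , col c′ , stay , right , nothing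
  scanStep M (right s) c with endS M s
  ... | e , nothing = inj₁ (left e) , c , stay , left , nothing
  -- The extra step to the right visits the cell after the new column, so that the tape again ends
  -- in a blank, as `home` demands.
  ... | e , just c′ = inj₁ (grow e) , col c′ , stay , right , nothing
  scanStep M (grow e) c = inj₁ (left e) , c , stay , left , nothing
  scanStep M (left e) (col c) = inj₁ (left e) , col c , stay , left , nothing
  scanStep M (left e) c = inj₂ e , c , stay , stay , nothing

  scanM : Scan → Mach
  scanM M .St = ScanSt
  scanM M .fin = finScanSt
  scanM M .entry = start
  scanM M .stepM s _ c = scanStep M s c

  iteM : Mach → Mach → Mach → Mach
  iteM P Q R .St = St P ⊎ St Q ⊎ St R
  iteM P Q R .fin = fin P fin⊎ fin Q fin⊎ fin R
  iteM P Q R .entry = inj₁ (entry P)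
  iteM P Q R .stepM (inj₁ s) σ c =
    redirect inj₁ (λ e → inj₁ (inj₂ (if e then inj₁ (entry Q) else inj₂ (entry R)))) (stepM P s σ c)
  iteM P Q R .stepM (inj₂ (inj₁ s)) σ c = redirect (inj₂ ∘ inj₁) inj₂ (stepM Q s σ c)
  iteM P Q R .stepM (inj₂ (inj₂ s)) σ c = redirect (inj₂ ∘ inj₂) inj₂ (stepM R s σ c)

  -- Alternates P and Q until P exits with true (result true) or Q exits with true (result false).
  loopM : Mach → Mach → Mach
  loopM P Q .St = St P ⊎ St Q
  loopM P Q .fin = fin P fin⊎ fin Q
  loopM P Q .entry = inj₁ (entry P)
  loopM P Q .stepM (inj₁ s) σ c = redirect inj₁ (λ e → if e then inj₂ true else inj₁ (inj₂ (entry Q))) (stepM P s σ c)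
  loopM P Q .stepM (inj₂ s) σ c = redirect inj₂ (λ e → if e then inj₂ false else inj₁ (inj₁ (entry P))) (stepM Q s σ c)

  record Tape : Set where
    constructor tape
    field
      ipos : ℕ
      lft  : List Cell
      cur  : Cell
      rgt  : List Cell
  open Tape

  shift : Move → ℕ → List Cell → Cell → List Cell → Tape
  shift left i [] c r = tape i [] c r
  shift left i (x ∷ l) c r = tape i l x (c ∷ r)
  shift stay i l c r = tape i l c r
  shift right i l c [] = tape i (c ∷ l) blank []
  shift right i l c (x ∷ r) = tape i (c ∷ l) x r

  tapeSpace : Tape → ℕ
  tapeSpace (tape _ l _ r) = suc (length l + length r)

  emitted : Maybe (Fin b) → Word b
  emitted nothing = []
  emitted (just y) = [ y ]

  -- The normal form in which every machine is entered and left, with the work head on the mark.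
  -- Runs can then be concatenated without regard to what happened in between.
  home : ℕ → List Col → Tape
  home i cs = tape i [] mark (map col cs ++ [ blank ])

  module Runs (w : Word a) (sp : ℕ) where

    act : Tape → Cell → Move → Move → Tape
    act (tape i l _ r) c mi mw = shift mw (moveIn (length w) mi i) l c r

    view : {M : Mach} → St M → Tape → Act (St M ⊎ Bool)
    view {M} s t = stepM M s (readInput w (ipos t)) (cur t)

    data Steps (M : Mach) : St M → Tape → Word b → Bool → Tape → Set where
      exit : ∀ {s t e c mi mw y} → view {M} s t ≡ (inj₂ e , c , mi , mw , y) → tapeSpace t ≤ sp →
             Steps M s t (emitted y) e (act t c mi mw)
      next : ∀ {s t s′ c mi mw y o e t′} → view {M} s t ≡ (inj₁ s′ , c , mi , mw , y) → tapeSpace t ≤ sp →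
             Steps M s′ (act t c mi mw) o e t′ → Steps M s t (emitted y ++ o) e t′

    Cont : (M : Mach) → St M ⊎ Bool → Tape → Word b → Bool → Tape → Set
    Cont M (inj₁ s) t o e t′ = Steps M s t o e t′
    Cont M (inj₂ e) t o e′ t′ = o ≡ [] × e ≡ e′ × t ≡ t′

    -- A component runs unchanged inside a compound machine, since `redirect` only renames its
    -- states and replaces its exits. `Cont` unites the two fates of an exit: it enters another
    -- component, or it leaves the compound machine. The rules for `iteM` and `loopM` are all
    -- instances.
    embed : {P H : Mach} (ι : St P → St H) (ρ : Bool → St H ⊎ Bool) →
            (∀ s σ c → stepM H (ι s) σ c ≡ redirect ι ρ (stepM P s σ c)) →
            ∀ {s t o e t′ o′ e′ t″} → Steps P s t o e t′ → Cont H (ρ e) t′ o′ e′ t″ → Steps H (ι s) t (o ++ o′) e′ t″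
    embed {P} {H} ι ρ hyp {o′ = o′} {e′} {t″} (exit {s} {t} {e} {c} {mi} {mw} {y} eq q) k = go (ρ e) (trans (hyp _ _ _) (cong (redirect ι ρ) eq)) k
      where
        go : (x : St H ⊎ Bool) → view {H} (ι s) t ≡ (x , c , mi , mw , y) → Cont H x (act t c mi mw) o′ e′ t″ →
             Steps H (ι s) t (emitted y ++ o′) e′ t″
        go (inj₁ _) eq′ k = next eq′ q k
        go (inj₂ _) eq′ (refl , refl , refl) = subst (λ o → Steps H (ι s) t o e′ t″) (sym (++-identityʳ _)) (exit eq′ q)
    embed {P} {H} ι ρ hyp {o′ = o′} {e′} {t″} (next {s} {t} {y = y} {o = o} eq q r) k =
      subst (λ o → Steps H (ι s) t o e′ t″) (sym (++-assoc (emitted y) o o′))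
            (next (trans (hyp _ _ _) (cong (redirect ι ρ) eq)) q (embed ι ρ hyp r k))

    Exec : Mach → ℕ → List Col → Word b → Bool → ℕ → List Col → Set
    Exec M i cs o e i′ cs′ = Steps M (entry M) (home i cs) o e (home i′ cs′)

    private
      from : ∀ {M s t u o e t′} → t ≡ u → Steps M s t o e t′ → Steps M s u o e t′
      from refl r = r

      upto : ∀ {M s t o e t′ u} → t′ ≡ u → Steps M s t o e t′ → Steps M s t o e u
      upto refl r = r

      reindex : ∀ {M s t o o′ e t′} → o ≡ o′ → Steps M s t o e t′ → Steps M s t o′ e t′
      reindex refl r = r

    ite-true : ∀ {P Q R i cs o i′ cs′ o′ e i″ cs″} → Exec P i cs o true i′ cs′ → Exec Q i′ cs′ o′ e i″ cs″ →
               Exec (iteM P Q R) i cs (o ++ o′) e i″ cs″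
    ite-true {P} {Q} {R} r q = embed {P} {iteM P Q R} inj₁ _ (λ _ _ _ → refl) r
      (reindex (++-identityʳ _) (embed {Q} {iteM P Q R} (inj₂ ∘ inj₁) inj₂ (λ _ _ _ → refl) q (refl , refl , refl)))

    ite-false : ∀ {P Q R i cs o i′ cs′ o′ e i″ cs″} → Exec P i cs o false i′ cs′ → Exec R i′ cs′ o′ e i″ cs″ →
                Exec (iteM P Q R) i cs (o ++ o′) e i″ cs″
    ite-false {P} {Q} {R} r q = embed {P} {iteM P Q R} inj₁ _ (λ _ _ _ → refl) r
      (reindex (++-identityʳ _) (embed {R} {iteM P Q R} (inj₂ ∘ inj₂) inj₂ (λ _ _ _ → refl) q (refl , refl , refl)))

    loop-true : ∀ {P Q i cs o i′ cs′} → Exec P i cs o true i′ cs′ → Exec (loopM P Q) i cs o true i′ cs′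
    loop-true {P} {Q} r = reindex (++-identityʳ _) (embed {P} {loopM P Q} inj₁ _ (λ _ _ _ → refl) r (refl , refl , refl))

    loop-false : ∀ {P Q i cs o i′ cs′ o′ i″ cs″} → Exec P i cs o false i′ cs′ → Exec Q i′ cs′ o′ true i″ cs″ →
                 Exec (loopM P Q) i cs (o ++ o′) false i″ cs″
    loop-false {P} {Q} r q = embed {P} {loopM P Q} inj₁ _ (λ _ _ _ → refl) r
      (reindex (++-identityʳ _) (embed {Q} {loopM P Q} inj₂ _ (λ _ _ _ → refl) q (refl , refl , refl)))

    loop-next : ∀ {P Q i cs o i′ cs′ o′ i″ cs″ o″ e i‴ cs‴} → Exec P i cs o false i′ cs′ → Exec Q i′ cs′ o′ false i″ cs″ →
                Exec (loopM P Q) i″ cs″ o″ e i‴ cs‴ → Exec (loopM P Q) i cs (o ++ o′ ++ o″) e i‴ cs‴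
    loop-next {P} {Q} r q l = embed {P} {loopM P Q} inj₁ _ (λ _ _ _ → refl) r
      (embed {Q} {loopM P Q} inj₂ _ (λ _ _ _ → refl) q l)

    homeSpace : ∀ cs → length cs + 2 ≤ sp → ∀ i → tapeSpace (home i cs) ≤ sp
    homeSpace cs q i = ≤-trans (≤-reflexive eq) q
      where
        eq : suc (length (map col cs ++ [ blank ])) ≡ length cs + 2
        eq rewrite length-++ (map col cs) {[ blank ]} | length-map col cs = trans (cong suc (+-comm _ 1)) (+-comm 2 _)

    exec-inp : ∀ p i cs → length cs + 2 ≤ sp → Exec (inpM p) i cs [] (p (readInput w i)) i cs
    exec-inp p i cs q = exit refl (homeSpace cs q i)

    exec-mv : ∀ e m i cs → length cs + 2 ≤ sp → Exec (mvM e m) i cs [] e (moveIn (length w) m i) cs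
    exec-mv e m i cs q = exit refl (homeSpace cs q i)

    exec-out : ∀ y i cs → length cs + 2 ≤ sp → Exec (outM y) i cs [ y ] true i cs
    exec-out y i cs q = exit refl (homeSpace cs q i)

    appendix : Maybe Col → List Col
    appendix nothing = []
    appendix (just c) = [ c ]

    scanOut : Scan → Maybe Bool → List Col → Bool × List Col
    scanOut M s [] = proj₁ (endS M s) , appendix (proj₂ (endS M s))
    scanOut M s (c ∷ cs) = let r = scanOut M (proj₁ (δS M s c)) cs in proj₁ r , proj₂ (δS M s c) ∷ proj₂ r

    private
      focus : ℕ → List Cell → List Cell → Tape
      focus i l [] = tape i l blank []
      focus i l (x ∷ r) = tape i l x r

      shift-right : ∀ i l c r → shift right i l c r ≡ focus i (c ∷ l) r
      shift-right i l c [] = refl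
      shift-right i l c (x ∷ r) = refl

      leftFocus : ℕ → List Cell → List Cell → Tape
      leftFocus i [] r = tape i [] mark r
      leftFocus i (x ∷ l) r = tape i l x r

    scanLeft : ∀ M e i ds r → length ds + length r < sp →
               Steps (scanM M) (left e) (leftFocus i (map col ds ++ [ mark ]) r) [] e (tape i [] mark (map col ds ʳ++ r))
    scanLeft M e i [] r q = exit refl q
    scanLeft M e i (d ∷ ds) r q = next refl (sp-ok d) (go ds (scanLeft M e i ds (col d ∷ r) (≤-trans (≤-reflexive (cong suc (+-suc (length ds) (length r)))) q)))
      where
        sp-ok : ∀ x → suc (length (map col ds ++ [ mark ]) + length r) ≤ sp
        sp-ok _ rewrite length-++ (map col ds) {[ mark ]} | length-map col ds | +-comm (length ds) 1 = q
        go : ∀ ds {t} → Steps (scanM M) (left e) (leftFocus i (map col ds ++ [ mark ]) (col d ∷ r)) [] e t →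
             Steps (scanM M) (left e) (shift left i (map col ds ++ [ mark ]) (col d) r) [] e t
        go [] s = s
        go (_ ∷ _) s = s

    private
      ʳ++-map : ∀ ds cs → map col ds ʳ++ (map col cs ++ [ blank ]) ≡ map col (ds ʳ++ cs) ++ [ blank ]
      ʳ++-map [] cs = refl
      ʳ++-map (d ∷ ds) cs = ʳ++-map ds (d ∷ cs)

      room : ∀ m n → m + n + 2 ≤ sp → suc (suc m + n) ≤ sp
      room m n q = ≤-trans (≤-reflexive (+-comm 2 (m + n))) q

      leftLen : ∀ ds → length (map col ds ++ [ mark ]) ≡ suc (length ds)
      leftLen ds = trans (length-++ (map col ds)) (trans (cong (_+ 1) (length-map col ds)) (+-comm _ 1))

    scanRight : ∀ M s i ds cs → length ds + length (proj₂ (scanOut M s cs)) + 2 ≤ sp →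
                Steps (scanM M) (right s) (focus i (map col ds ++ [ mark ]) (map col cs ++ [ blank ])) []
                      (proj₁ (scanOut M s cs)) (home i (ds ʳ++ proj₂ (scanOut M s cs)))
    scanRight M s i ds [] q with endS M s in eq
    ... | e , nothing = next {y = nothing} eq′ (≤-trans (s≤s (≤-reflexive (cong (_+ 0) (leftLen ds)))) (room _ 0 q))
              (go ds (upto (cong (tape i [] mark) (ʳ++-map ds []))
                (scanLeft M e i ds [ blank ] (≤-trans (≤-reflexive (cong suc (+-comm (length ds) 1))) (≤-trans (s≤s (s≤s (m≤m+n _ 0))) (room (length ds) 0 q))))))
        where
          eq′ : scanStep M (right s) blank ≡ (inj₁ (left e) , blank , stay , left , nothing)
          eq′ rewrite eq = refl
          go : ∀ ds {t} → Steps (scanM M) (left e) (leftFocus i (map col ds ++ [ mark ]) (blank ∷ [])) [] e t →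
               Steps (scanM M) (left e) (shift left i (map col ds ++ [ mark ]) blank []) [] e t
          go [] s = s
          go (_ ∷ _) s = s
    ... | e , just c′ = next {y = nothing} eq′ (≤-trans (s≤s (≤-reflexive (cong (_+ 0) (leftLen ds)))) (≤-trans (s≤s (s≤s (+-monoʳ-≤ (length ds) z≤n))) (room _ 1 q)))
              (next {y = nothing} refl (≤-trans (≤-reflexive (cong (λ n → suc (suc n + 0)) (leftLen ds))) (≤-trans (≤-reflexive (cong (λ n → suc (suc n)) (trans (+-identityʳ (suc (length ds))) (+-comm 1 (length ds))))) (room (length ds) 1 q)))
                (upto (cong (tape i [] mark) (ʳ++-map ds [ c′ ]))
                  (scanLeft M e i (c′ ∷ ds) [ blank ] (room (length ds) 1 q))))
        where
          eq′ : scanStep M (right s) blank ≡ (inj₁ (grow e) , col c′ , stay , right , nothing)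
          eq′ rewrite eq = refl
    scanRight M s i ds (c ∷ cs) q =
      next {y = nothing} refl sp-ok
        (from (sym (shift-right i _ (col c′) (map col cs ++ [ blank ])))
          (scanRight M s′ i (c′ ∷ ds) cs (≤-trans (≤-reflexive (cong (_+ 2) (sym (+-suc (length ds) _)))) q)))
      where
        s′ = proj₁ (δS M s c)
        c′ = proj₂ (δS M s c)
        grows : ∀ s cs → length cs ≤ length (proj₂ (scanOut M s cs))
        grows s [] = z≤n
        grows s (c ∷ cs) = s≤s (grows _ cs)
        sp-ok : suc (length (map col ds ++ [ mark ]) + length (map col cs ++ [ blank ])) ≤ sp
        sp-ok rewrite leftLen ds | length-++ (map col cs) {[ blank ]} | length-map col cs =
          ≤-trans (s≤s (s≤s (+-monoʳ-≤ (length ds) (≤-trans (≤-reflexive (+-comm (length cs) 1)) (s≤s (grows s′ cs)))))) (room (length ds) _ q)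

    exec-scan : ∀ M i cs → length (proj₂ (scanOut M (s₀ M) cs)) + 2 ≤ sp → length cs + 2 ≤ sp →
                Exec (scanM M) i cs [] (proj₁ (scanOut M (s₀ M) cs)) i (proj₂ (scanOut M (s₀ M) cs))
    exec-scan M i cs q q′ = next {y = nothing} refl (homeSpace cs q′ i)
      (from (sym (shift-right i [] mark (map col cs ++ [ blank ])))
        (scanRight M (s₀ M) i [] cs q))

-- Binary counters and the logarithm of the input length

iter : {A : Set} → (A → A) → ℕ → A → A
iter f zero x = x
iter f (suc n) x = iter f n (f x)

binc : List Bool → List Bool
binc [] = [ true ]
binc (false ∷ bs) = true ∷ bs
binc (true ∷ bs) = false ∷ binc bs

bval : List Bool → ℕ
bval [] = 0
bval (false ∷ bs) = 2 * bval bs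
bval (true ∷ bs) = suc (2 * bval bs)

bval-binc : ∀ bs → bval (binc bs) ≡ suc (bval bs)
bval-binc [] = refl
bval-binc (false ∷ bs) = refl
bval-binc (true ∷ bs) rewrite bval-binc bs | *-suc 2 (bval bs) = refl

bval<2^ : ∀ bs → suc (bval bs) ≤ 2 ^ length bs
bval<2^ [] = ≤-refl
bval<2^ (false ∷ bs) = ≤-trans (n≤1+n _) (≤-trans (≤-reflexive (sym (*-suc 2 (bval bs)))) (*-monoʳ-≤ 2 (bval<2^ bs)))
bval<2^ (true ∷ bs) = ≤-trans (≤-reflexive (sym (*-suc 2 (bval bs)))) (*-monoʳ-≤ 2 (bval<2^ bs))

length-binc : ∀ bs → length (binc bs) ≡ length bs ⊎ (length (binc bs) ≡ suc (length bs) × suc (bval bs) ≡ 2 ^ length bs)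
length-binc [] = inj₂ (refl , refl)
length-binc (false ∷ bs) = inj₁ refl
length-binc (true ∷ bs) with length-binc bs
... | inj₁ eq = inj₁ (cong suc eq)
... | inj₂ (eq , top) = inj₂ (cong suc eq , trans (sym (*-suc 2 (bval bs))) (cong (2 *_) top))

binc-tight : ∀ bs → 2 ^ length bs ≤ 2 * suc (bval bs) → 2 ^ length (binc bs) ≤ 2 * suc (bval (binc bs))
binc-tight bs h rewrite bval-binc bs with length-binc bs
... | inj₁ eq rewrite eq = ≤-trans h (*-monoʳ-≤ 2 (n≤1+n (suc (bval bs))))
... | inj₂ (eq , top) rewrite eq = *-monoʳ-≤ 2 (≤-trans (≤-reflexive (sym top)) (n≤1+n (suc (bval bs))))

bval-iter : ∀ n bs → bval (iter binc n bs) ≡ n + bval bs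
bval-iter zero bs = refl
bval-iter (suc n) bs = trans (bval-iter n (binc bs)) (trans (cong (n +_) (bval-binc bs)) (+-suc n _))

iter-tight : ∀ n bs → 2 ^ length bs ≤ 2 * suc (bval bs) → 2 ^ length (iter binc n bs) ≤ 2 * suc (bval (iter binc n bs))
iter-tight zero bs h = h
iter-tight (suc n) bs h = iter-tight n (binc bs) (binc-tight bs h)

binc-grows : ∀ bs → length bs ≤ length (binc bs)
binc-grows [] = z≤n
binc-grows (false ∷ bs) = ≤-refl
binc-grows (true ∷ bs) = s≤s (binc-grows bs)

iter-grows : ∀ n bs → length bs ≤ length (iter binc n bs)
iter-grows zero bs = ≤-refl
iter-grows (suc n) bs = ≤-trans (binc-grows bs) (iter-grows n (binc bs))

-- Number of columns allotted to inputs of length n.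
width : ℕ → ℕ
width n = length (iter binc n [ false ])

-- The reason why counting starts from one digit: even on the empty input a register can then hold
-- every constant below the base.
1≤width : ∀ n → 1 ≤ width n
1≤width n = iter-grows n [ false ]

n<2^width : ∀ n → n < 2 ^ width n
n<2^width n = subst (λ x → suc x ≤ 2 ^ width n) (trans (bval-iter n [ false ]) (+-identityʳ n)) (bval<2^ (iter binc n [ false ]))

width≤log : ∀ n → width n ≤ suc ⌈log₂ suc n ⌉
width≤log n = begin
  width n                     ≡⟨ ⌈log₂2^n⌉≡n (width n) ⟨
  ⌈log₂ (2 ^ width n) ⌉       ≤⟨ ⌈log₂⌉-mono-≤ (subst (λ x → 2 ^ width n ≤ 2 * suc x) (trans (bval-iter n [ false ]) (+-identityʳ n)) (iter-tight n [ false ] ≤-refl)) ⟩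
  ⌈log₂ (2 * suc n) ⌉         ≡⟨ ⌈log₂2*n⌉≡1+⌈log₂n⌉ (suc n) ⟩
  suc ⌈log₂ suc n ⌉           ∎
  where open ≤-Reasoning

log≤width : ∀ n → ⌈log₂ suc n ⌉ ≤ width n
log≤width n = ≤-trans (⌈log₂⌉-mono-≤ (n<2^width n)) (≤-reflexive (⌈log₂2^n⌉≡n (width n)))

-- Runs of transducers within a space bound

data Halts {a b} (T : Transducer a b) (w : Word a) (sp : ℕ) : Config T → Word b → Set where
  halted : ∀ {c} → Halted T w c → space T c ≤ sp → Halts T w sp c (TConfig.out c)
  steps  : ∀ {c c′ o} → tstep T w c ≡ just c′ → space T c ≤ sp → Halts T w sp c′ o → Halts T w sp c o

module _ {a b : ℕ} {T : Transducer a b} {w : Word a} {sp : ℕ} where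

  run-suc : ∀ c {c′} t → tstep T w c ≡ just c′ → run T w (suc t) c ≡ run T w t c′
  run-suc c t eq with tstep T w c | eq
  ... | just _ | refl = refl

  run-halted : ∀ c t → Halted T w c → run T w t c ≡ c
  run-halted c zero h = refl
  run-halted c (suc t) h with tstep T w c | h
  ... | nothing | _ = refl

  halts-run : ∀ {c o} → Halts T w sp c o → ∃ λ t → Halted T w (run T w t c) × TConfig.out (run T w t c) ≡ o
  halts-run (halted h _) = 0 , h , refl
  halts-run (steps {c} eq _ r) with halts-run r
  ... | t , h , e = suc t , subst (λ c → Halted T w c × TConfig.out c ≡ _) (sym (run-suc c t eq)) (h , e)

  halts-space : ∀ {c o} → Halts T w sp c o → ∀ t → space T (run T w t c) ≤ sp
  halts-space (halted {c} h q) t = subst (λ c → space T c ≤ sp) (sym (run-halted c t h)) q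
  halts-space (steps _ q _) zero = q
  halts-space (steps {c} eq q r) (suc t) = subst (λ c → space T c ≤ sp) (sym (run-suc c t eq)) (halts-space r t)

-- Compilation of structured machines and allocation of the tape

module Compile (a b K′ g′ : ℕ) where

  K g : ℕ
  K = suc K′
  g = suc (suc g′)

  open Machines a b K g public

  -- Two states are added: one that writes the left end mark, and one without successor, since a
  -- transducer halts only where its `δ` is undefined.
  module Top (M : Mach) (s₁ : St M) where

    TSt : Set
    TSt = ⊤ ⊎ ⊤ ⊎ St M

    finT : Finite TSt
    finT = finUnit fin⊎ finUnit fin⊎ fin M

    topAct : Act (St M ⊎ Bool) → Act TSt
    topAct (x , act) = [ inj₂ ∘ inj₂ , (λ _ → inj₂ (inj₁ tt)) ]′ x , act

    topStep : TSt → InSym a → Cell → Maybe (Act TSt)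
    topStep (inj₁ _) σ c = just (inj₂ (inj₂ s₁) , mark , stay , right , nothing)
    topStep (inj₂ (inj₁ _)) σ c = nothing
    topStep (inj₂ (inj₂ s)) σ c = just (topAct (stepM M s σ c))

    encAct : Act TSt → Fin (size finT) × Fin (suc W′) × Move × Move × Maybe (Fin b)
    encAct (s , c , act) = enc finT s , encC c , act

    transducer : Transducer a b
    transducer .Transducer.Q = size finT
    transducer .Transducer.W = W′
    transducer .Transducer.start = enc finT (inj₁ tt)
    transducer .Transducer.δ q σ x = Maybe.map encAct (topStep (dec finT q) σ (decC x))

    conc : TSt → Tape → Word b → Config transducer
    conc s (tape i l c r) o = tcfg (enc finT s) i (map encC l) (encC c) (map encC r) o

    module _ (w : Word a) (sp : ℕ) where
      open Runs w sp

      after : Tape → Word b → Act TSt → Config transducer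
      after t o (s , c , mi , mw , y) = conc s (act t c mi mw) (emit transducer y o)

      tstep-conc : ∀ s t o → tstep transducer w (conc s t o) ≡
                   Maybe.map (after t o) (topStep s (readInput w (Tape.ipos t)) (Tape.cur t))
      tstep-conc s (tape i l c r) o rewrite dec-enc finT s | decC-encC c with topStep s (readInput w i) c
      ... | nothing = refl
      ... | just (s′ , c′ , mi , mw , y) with mw | l | r
      ... | left | [] | _ = refl
      ... | left | _ ∷ _ | _ = refl
      ... | stay | _ | _ = refl
      ... | right | _ | [] = refl
      ... | right | _ | _ ∷ _ = refl

      space-conc : ∀ s t o → space transducer (conc s t o) ≡ tapeSpace t
      space-conc s (tape i l c r) o rewrite length-map encC l | length-map encC r = refl

      emit-emitted : ∀ y o o′ → emit transducer y o ++ o′ ≡ o ++ emitted y ++ o′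
      emit-emitted nothing o o′ = refl
      emit-emitted (just y) o o′ = ++-assoc o [ y ] o′

      run-halts : ∀ {s t o e t′ i cs} → Steps M s t o e t′ → t′ ≡ home i cs → length cs + 2 ≤ sp →
                  ∀ o₀ → Halts transducer w sp (conc (inj₂ (inj₂ s)) t o₀) (o₀ ++ o)
      run-halts {i = i} {cs} (exit {s} {t} {e} {c} {mi} {mw} {y} eq q) end q′ o₀ =
        steps (trans (tstep-conc (inj₂ (inj₂ s)) t o₀) (cong (just ∘ after t o₀ ∘ topAct) eq))
              (≤-trans (≤-reflexive (space-conc (inj₂ (inj₂ s)) t o₀)) q)
              (subst (Halts transducer w sp (conc stopped t₁ o₁)) eqo
                (halted (tstep-conc stopped t₁ o₁)
                        (≤-trans (≤-reflexive (trans (space-conc stopped t₁ o₁) (cong tapeSpace end))) (homeSpace cs q′ i))))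
        where
          stopped = inj₂ (inj₁ tt)
          t₁ = act t c mi mw
          o₁ = emit transducer y o₀
          eqo : o₁ ≡ o₀ ++ emitted y
          eqo = trans (sym (++-identityʳ _)) (trans (emit-emitted y o₀ []) (cong (o₀ ++_) (++-identityʳ _)))
      run-halts (next {s} {t} {s′} {c} {mi} {mw} {y} {o} eq q r) end q′ o₀ =
        steps (trans (tstep-conc (inj₂ (inj₂ s)) t o₀) (cong (just ∘ after t o₀ ∘ topAct) eq))
              (≤-trans (≤-reflexive (space-conc (inj₂ (inj₂ s)) t o₀)) q)
              (subst (Halts transducer w sp _) (emit-emitted y o₀ o) (run-halts r end q′ (emit transducer y o₀)))

      boot-halts : ∀ {o e i cs} → Steps M s₁ (tape 0 [ mark ] blank []) o e (home i cs) → length cs + 2 ≤ sp →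
                   Halts transducer w sp (initConfig transducer) o
      boot-halts r q = steps (tstep-conc (inj₁ tt) (tape 0 [] blank []) []) (≤-trans (s≤s z≤n) (≤-trans (m≤n+m 2 _) q)) (run-halts r refl q [])

  zeros : Col
  zeros = Vec.replicate K zero

  firstScan : Scan
  firstScan .Scan.s₀ = nothing
  firstScan .Scan.δS s c = s , c
  firstScan .Scan.endS _ = true , just zeros

  -- An increment of the first register in binary, with digits 0 and 1 although the base is `g`: the
  -- number of columns has to depend on the input length alone and not on the base.
  countScan : Scan
  countScan .Scan.s₀ = just true
  countScan .Scan.δS (just true) (zero ∷ c) = just false , suc zero ∷ c
  countScan .Scan.δS (just true) (suc _ ∷ c) = just true , zero ∷ c
  countScan .Scan.δS s c = s , c
  countScan .Scan.endS (just true) = false , just (suc zero ∷ Vec.replicate K′ zero)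
  countScan .Scan.endS _ = false , nothing

  isRend : InSym a → Bool
  isRend rend = true
  isRend _ = false

  -- The length of the binary counter fixes the number of columns.
  countM : Mach
  countM = loopM (iteM (mvM true right) (inpM isRend) (inpM isRend)) (scanM countScan)

  withWidth : Mach → Mach
  withWidth M = iteM (scanM firstScan) (iteM countM M M) M

  bit : Col → Bool
  bit (zero ∷ _) = false
  bit (suc _ ∷ _) = true

  module _ (w : Word a) where

    sp : ℕ
    sp = width (length w) + 2

    open Runs w sp

    countScan-keep : ∀ cs → scanOut countScan (just false) cs ≡ (false , cs)
    countScan-keep [] = refl
    countScan-keep (c ∷ cs) rewrite countScan-keep cs = refl

    countScan-bits : ∀ cs → proj₁ (scanOut countScan (just true) cs) ≡ false ×
                     map bit (proj₂ (scanOut countScan (just true) cs)) ≡ binc (map bit cs)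
    countScan-bits [] = refl , refl
    countScan-bits ((zero ∷ c) ∷ cs) rewrite countScan-keep cs = refl , refl
    countScan-bits ((suc _ ∷ c) ∷ cs) = let (p , q) = countScan-bits cs in p , cong (false ∷_) q

    readInput-end : ∀ (v : Word a) → readInput v (suc (length v)) ≡ rend
    readInput-end [] = refl
    readInput-end (x ∷ v) = readInput-end v

    readInput-mid : ∀ (v : Word a) i → i < length v → isRend (readInput v (suc i)) ≡ false
    readInput-mid (x ∷ v) zero _ = refl
    readInput-mid (x ∷ v) (suc i) (s≤s p) = readInput-mid v i p

    moveIn-right : ∀ n i → i ≤ n → moveIn n right i ≡ suc i
    moveIn-right n i p with i <ᵇ suc n | <⇒<ᵇ (s≤s p)
    ... | true | _ = refl

    isEnd : ∀ i cs → i ≤ length w → length cs + 2 ≤ sp →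
            Exec (iteM (mvM true right) (inpM isRend) (inpM isRend)) i cs [] (isRend (readInput w (suc i))) (suc i) cs
    isEnd i cs p q with exec-mv true right i cs q
    ... | r rewrite moveIn-right (length w) i p = ite-true {R = inpM isRend} r (exec-inp isRend (suc i) cs q)

    countRun : ∀ k i cs → k + i ≡ length w → length (iter binc k (map bit cs)) + 2 ≤ sp →
               Σ (List Col) λ cs′ → length cs′ ≡ length (iter binc k (map bit cs)) × Exec countM i cs [] true (suc (length w)) cs′
    countRun zero i cs refl q = cs , sym (length-map bit cs) ,
      subst (λ e → Exec _ i cs [] e (suc i) cs → Exec countM i cs [] true (suc i) cs) (sym (cong isRend (readInput-end w)))
            (loop-true {Q = scanM countScan}) (isEnd i cs ≤-refl (subst (λ l → l + 2 ≤ sp) (length-map bit cs) q))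
    countRun (suc k) i cs eq q =
      let cs₁ = proj₂ (scanOut countScan (just true) cs)
          (e₁ , e₂) = countScan-bits cs
          q₁ = subst (λ bs → length (iter binc k bs) + 2 ≤ sp) (sym e₂) q
          (cs′ , l , r) = countRun k (suc i) cs₁ (trans (+-suc k i) eq) q₁
          qcs = ≤-trans (+-monoˡ-≤ 2 (≤-trans (≤-reflexive (sym (length-map bit cs))) (iter-grows (suc k) (map bit cs)))) q
          qcs₁ = ≤-trans (+-monoˡ-≤ 2 (≤-trans (≤-reflexive (sym (length-map bit cs₁))) (iter-grows k (map bit cs₁)))) q₁
          i<n = ≤-trans (s≤s (m≤n+m i k)) (≤-reflexive eq)
      in cs′ , trans l (cong (length ∘ iter binc k) e₂) ,
         loop-next (subst (λ e → Exec _ i cs [] e (suc i) cs) (readInput-mid w i i<n) (isEnd i cs (<⇒≤ i<n) qcs))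
                   (subst (λ e → Exec (scanM countScan) (suc i) cs [] e (suc i) cs₁) e₁ (exec-scan countScan (suc i) cs qcs₁ qcs)) r

  -- The machine must cope with any contents of the columns and any head position, because counting
  -- leaves the input length in the first register and the input head at the right end. Only the
  -- number of columns is prescribed.
  logspaceComputable : (M : Mach) (f : Word a → Word b) →
    (∀ w i cs → length cs ≡ width (length w) →
      Σ Bool λ e → Σ ℕ λ i′ → Σ (List Col) λ cs′ → length cs′ ≡ width (length w) × Runs.Exec w (sp w) M i cs (f w) e i′ cs′) →
    LogspaceComputable f
  -- The tape consists of `width` columns, the mark and the final blank, and `width` exceeds the
  -- logarithm by at most one; this gives the constant 3.
  logspaceComputable M f hyp = transducer , 3 , (λ w → halts-run (whole w)) , λ w t → ≤-trans (halts-space (whole w) t) (bound w)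
    where
      -- The boot step leaves the head to the right of the mark on an otherwise empty tape, so the
      -- first scan is entered past its `start` step. It meets the blank at once and appends the
      -- first column.
      s₁ : St (withWidth M)
      s₁ = inj₁ (right nothing)
      open Top (withWidth M) s₁
      whole : ∀ w → Halts transducer w (sp w) (initConfig transducer) (f w)
      whole w =
        let (cs , l , r) = countRun w (length w) 0 [ zeros ] (+-identityʳ _) ≤-refl
            (e , i′ , cs′ , l′ , r′) = hyp w _ cs l
            first = scanRight firstScan nothing 0 [] [] (+-monoˡ-≤ 2 (1≤width (length w)))
        in boot-halts w (sp w) {cs = cs′}
             (embed {scanM firstScan} {withWidth M} inj₁ _ (λ _ _ _ → refl) first
               (subst (λ o → Steps (withWidth M) _ _ o e _) (++-identityʳ (f w))
                 (embed {iteM countM M M} {withWidth M} (inj₂ ∘ inj₁) inj₂ (λ _ _ _ → refl) (ite-true {R = M} {cs = [ zeros ]} r r′) (refl , refl , refl))))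
             (≤-reflexive (cong (_+ 2) l′))
        where open Runs w (sp w)
      bound : ∀ w → sp w ≤ 3 * ⌈log₂ suc (length w) ⌉ + 3
      bound w = ≤-trans (+-monoˡ-≤ 2 (width≤log (length w)))
        (≤-trans (≤-reflexive (sym (+-suc _ 2))) (+-monoˡ-≤ 3 (m≤m+n _ _)))

-- First-order logic

data Tm (m : ℕ) : Set where
  `0 : Tm m
  `_ : Fin m → Tm m

-- First-order logic over an initial segment of ℕ; the Bool of a sum is an incoming carry.
data Form (a : ℕ) : ℕ → Set where
  sum : ∀ {m} → Bool → Tm m → Tm m → Tm m → Form a m
  sees : ∀ {m} → (InSym a → Bool) → Tm m → Form a m
  _and_ _or_ : ∀ {m} → Form a m → Form a m → Form a m
  neg : ∀ {m} → Form a m → Form a m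
  ex : ∀ {m} → Form a (suc m) → Form a m

infixr 6 _and_
infixr 5 _or_

bn : Bool → ℕ
bn false = 0
bn true = 1

tv : ∀ {m} → Vec ℕ m → Tm m → ℕ
tv ρ `0 = 0
tv ρ (` i) = lookup ρ i

-- The number of registers required beyond those of the free variables: one for each nested
-- quantifier, and one for the counter that steers the input head in `sees`.
depth : ∀ {a m} → Form a m → ℕ
depth (sum _ _ _ _) = 0
depth (sees _ _) = 1
depth (φ and ψ) = depth φ ⊔ depth ψ
depth (φ or ψ) = depth φ ⊔ depth ψ
depth (neg φ) = depth φ
depth (ex φ) = suc (depth φ)

module Semantics {a : ℕ} (w : Word a) (B : ℕ) where

  Sat : ∀ {m} → Form a m → Vec ℕ m → Set
  Sat (sum c x y z) ρ = tv ρ x + tv ρ y + bn c ≡ tv ρ z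
  Sat (sees p x) ρ = p (readInput w (tv ρ x)) ≡ true
  Sat (φ and ψ) ρ = Sat φ ρ × Sat ψ ρ
  Sat (φ or ψ) ρ = Sat φ ρ ⊎ Sat ψ ρ
  Sat (neg φ) ρ = ¬ Sat φ ρ
  Sat (ex φ) ρ = ∃ λ x → x < B × Sat φ (x ∷ ρ)

  sat? : ∀ {m} (φ : Form a m) ρ → Dec (Sat φ ρ)
  sat? (sum c x y z) ρ = _ ≟ _
  sat? (sees p x) ρ = p (readInput w (tv ρ x)) Data.Bool.≟ true
  sat? (φ and ψ) ρ = sat? φ ρ ×-dec sat? ψ ρ
  sat? (φ or ψ) ρ = sat? φ ρ ⊎-dec sat? ψ ρ
  sat? (neg φ) ρ = ¬? (sat? φ ρ)
  sat? (ex φ) ρ = anyUpTo? (λ x → sat? φ (x ∷ ρ)) B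

range : ℕ → ℕ → List ℕ
range x zero = []
range x (suc k) = x ∷ range (suc x) k

-- Two digits and a carry sum to less than `g + g`, so the quotients can differ only by a carry of 0
-- or 1. For `s` below `g` this is the uniqueness of base-`g` digits, which later makes codes of
-- tuples and lists injective.
digit-unique : ∀ {g} s d P Z → s < g + g → d < g → s + g * P ≡ d + g * Z → (s ≡ d × P ≡ Z) ⊎ (s ≡ d + g × suc P ≡ Z)
digit-unique {g} s d P Z s< d< eq with <-cmp P Z
... | tri≈ _ refl _ = inj₁ (+-cancelʳ-≡ (g * P) s d eq , refl)
... | tri> _ _ Z<P with m≤n⇒∃[o]m+o≡n Z<P
...   | e , refl = ⊥-elim (<⇒≱ d< (≤-trans (m≤n+m g s) (≤-trans (m≤m+n (s + g) (g * e)) (≤-reflexive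
          (+-cancelʳ-≡ (g * Z) (s + g + g * e) d (trans (lem s g Z e) eq))))))
  where
    lem : ∀ s g Z e → s + g + g * e + g * Z ≡ s + g * (suc Z + e)
    lem = solve-∀
digit-unique {g} s d P Z s< d< eq | tri< P<Z _ _ with m≤n⇒∃[o]m+o≡n P<Z
...   | zero , refl = inj₂ (+-cancelʳ-≡ (g * P) s (d + g) (trans eq (lem d g P)) , sym (+-identityʳ (suc P)))
  where
    lem : ∀ d g P → d + g * (suc P + 0) ≡ d + g + g * P
    lem = solve-∀
...   | suc e , refl = ⊥-elim (<⇒≱ s< (≤-trans (m≤m+n (g + g) (d + g * e)) (≤-reflexive
          (sym (+-cancelʳ-≡ (g * P) s (g + g + (d + g * e)) (trans eq (lem d g P e)))))))
  where
    lem : ∀ d g P e → d + g * (suc P + suc e) ≡ g + g + (d + g * e) + g * P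
    lem = solve-∀

-- Evaluation of formulas by loops over registers

module Logic (a b K′ g′ : ℕ) where

  open Compile a b K′ g′ public

  dig : ∀ {n} → ℕ → Vec (Fin g) n → Fin g
  dig r [] = zero
  dig zero (d ∷ c) = d
  dig (suc r) (d ∷ c) = dig r c

  setDig : ∀ {n} → ℕ → Fin g → Vec (Fin g) n → Vec (Fin g) n
  setDig r d [] = []
  setDig zero d (_ ∷ c) = d ∷ c
  setDig (suc r) d (e ∷ c) = e ∷ setDig r d c

  dig-set : ∀ {n} r d (c : Vec (Fin g) n) → r < n → dig r (setDig r d c) ≡ d
  dig-set zero d (_ ∷ c) _ = refl
  dig-set (suc r) d (_ ∷ c) (s≤s p) = dig-set r d c p

  dig-other : ∀ {n} r r′ d (c : Vec (Fin g) n) → r ≢ r′ → dig r (setDig r′ d c) ≡ dig r c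
  dig-other r r′ d [] _ = refl
  dig-other zero zero d (_ ∷ c) ne = ⊥-elim (ne refl)
  dig-other zero (suc r′) d (_ ∷ c) ne = refl
  dig-other (suc r) zero d (_ ∷ c) ne = refl
  dig-other (suc r) (suc r′) d (_ ∷ c) ne = dig-other r r′ d c (ne ∘ cong suc)

  reg : ℕ → List Col → ℕ
  reg r [] = 0
  reg r (c ∷ cs) = toℕ (dig r c) + g * reg r cs

  digit-bound : ∀ {x y} (d : Fin g) → x < y → toℕ d + g * x < g * y
  digit-bound {x} {y} d p = ≤-trans (+-monoˡ-≤ (g * x) (Fin.toℕ<n d)) (≤-trans (≤-reflexive (sym (*-suc g x))) (*-monoʳ-≤ g p))

  reg< : ∀ r cs → reg r cs < g ^ length cs
  reg< r [] = ≤-refl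
  reg< r (c ∷ cs) = digit-bound (dig r c) (reg< r cs)

  -- Variables are de Bruijn indices; a variable lives in the register numbered by its binding level.
  trk : ∀ {m} → Fin m → ℕ
  trk {suc m} zero = m
  trk {suc m} (suc i) = trk i

  Env : ∀ {m} → Vec ℕ m → List Col → Set
  Env [] cs = ⊤
  Env {suc m} (x ∷ ρ) cs = reg m cs ≡ x × Env ρ cs

  Env-lookup : ∀ {m} (ρ : Vec ℕ m) {cs} → Env ρ cs → ∀ i → reg (trk i) cs ≡ lookup ρ i
  Env-lookup (x ∷ ρ) (e , _) zero = e
  Env-lookup (x ∷ ρ) (_ , E) (suc i) = Env-lookup ρ E i

  Env-cong : ∀ {m} (ρ : Vec ℕ m) {cs cs′} → (∀ r → r < m → reg r cs′ ≡ reg r cs) → Env ρ cs → Env ρ cs′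
  Env-cong [] h E = tt
  Env-cong (x ∷ ρ) h (e , E) = trans (h _ ≤-refl) e , Env-cong ρ (λ r p → h r (m<n⇒m<1+n p)) E

  zeroS : ℕ → Scan
  zeroS r .Scan.s₀ = nothing
  zeroS r .Scan.δS s c = s , setDig r zero c
  zeroS r .Scan.endS _ = true , nothing

  nextDig : Fin g → Maybe (Fin g)
  nextDig d with suc (toℕ d) <? g
  ... | yes p = just (fromℕ< p)
  ... | no _ = nothing

  incCol : ℕ → Col → Maybe (Fin g) → Maybe Bool × Col
  incCol r c (just d) = just false , setDig r d c
  incCol r c nothing = just true , setDig r zero c

  -- The state is the pending carry. A carry left at the end means that the register has wrapped
  -- around to 0; exit `true` thus tells a loop that all values have been tried.
  incS : ℕ → Scan
  incS r .Scan.s₀ = just true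
  incS r .Scan.δS (just true) c = incCol r c (nextDig (dig r c))
  incS r .Scan.δS s c = s , c
  incS r .Scan.endS (just true) = true , nothing
  incS r .Scan.endS _ = false , nothing

  digTm : ∀ {m} → Tm m → Col → ℕ
  digTm `0 c = 0
  digTm (` i) c = toℕ (dig (trk i) c)

  regTm : ∀ {m} → Tm m → List Col → ℕ
  regTm `0 cs = 0
  regTm (` i) cs = reg (trk i) cs

  carry : ℕ → ℕ → Maybe Bool
  carry s d with s ≟ d | s ≟ d + g
  ... | yes _ | _ = just false
  ... | no _ | yes _ = just true
  ... | no _ | no _ = nothing

  -- The sum is verified against `z` rather than computed, so no register is written: the digit of
  -- `z` determines the outgoing carry, and the state `nothing` records a mismatch.
  sumS : ∀ {m} → Bool → Tm m → Tm m → Tm m → Scan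
  sumS k x y z .Scan.s₀ = just k
  sumS k x y z .Scan.δS (just k′) c = carry (digTm x c + digTm y c + bn k′) (digTm z c) , c
  sumS k x y z .Scan.δS nothing c = nothing , c
  sumS k x y z .Scan.endS (just false) = true , nothing
  sumS k x y z .Scan.endS _ = false , nothing

  yesM noM : Mach
  yesM = inpM (λ _ → true)
  noM = inpM (λ _ → false)

  seqM : Mach → Mach → Mach
  seqM P Q = iteM P Q Q

  exM : ℕ → Mach → Mach
  exM r P = iteM (scanM (zeroS r)) (loopM P (scanM (incS r))) noM

  -- A search whose body always fails visits every value; this turns the existential quantifier into
  -- an output loop.
  forM : ℕ → Mach → Mach
  forM r P = exM r (seqM P noM)

  isLend : InSym a → Bool
  isLend lend = true
  isLend _ = false

  wkTm : ∀ {m} → Tm m → Tm (suc m)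
  wkTm `0 = `0
  wkTm (` i) = ` suc i

  rewindM : Mach
  rewindM = loopM (inpM isLend) (mvM false left)

  -- Since the head moves one cell at a time, a fresh register counts its moves up to the value of
  -- the term. This is the register that `depth` charges to `sees`.
  seekM : ∀ {m} → Tm m → Mach
  seekM {m} t = iteM (scanM (zeroS m))
    (loopM (scanM (sumS false (` zero) `0 (wkTm t))) (iteM (mvM true right) (scanM (incS m)) noM)) noM

  tstM : ∀ {m} → Form a m → Mach
  tstM (sum c x y z) = scanM (sumS c x y z)
  tstM (sees p t) = iteM rewindM (iteM (seekM t) (inpM p) noM) noM
  tstM (φ and ψ) = iteM (tstM φ) (tstM ψ) noM
  tstM (φ or ψ) = iteM (tstM φ) yesM (tstM ψ)
  tstM (neg φ) = iteM (tstM φ) noM yesM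
  tstM {m} (ex φ) = exM m (tstM φ)

  module Over (w : Word a) where

    open Runs w (sp w) public

    len B : ℕ
    len = width (length w)
    B = g ^ len

    open Semantics w B public

    -- Only the registers of the variables in `ρ` are preserved. Those of higher level and the
    -- position of the input head are scratch space that each machine initialises for itself.
    Runs : ∀ {m} → Vec ℕ m → Mach → Word b → Bool → Set
    Runs ρ M o e = ∀ i cs → length cs ≡ len → Env ρ cs →
      Σ ℕ λ i′ → Σ (List Col) λ cs′ → length cs′ ≡ len × Env ρ cs′ × Exec M i cs o e i′ cs′

    fits : (cs : List Col) → length cs ≡ len → length cs + 2 ≤ sp w
    fits cs l = ≤-reflexive (cong (_+ 2) l)

    runs-ite-true : ∀ {m} {ρ : Vec ℕ m} {P Q R o o′ e} → Runs ρ P o true → Runs ρ Q o′ e → Runs ρ (iteM P Q R) (o ++ o′) e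
    runs-ite-true {Q = Q} {R} p q i cs l E =
      let (i₁ , cs₁ , l₁ , E₁ , r₁) = p i cs l E
          (i₂ , cs₂ , l₂ , E₂ , r₂) = q i₁ cs₁ l₁ E₁
      in i₂ , cs₂ , l₂ , E₂ , ite-true {R = R} {cs′ = cs₁} {cs″ = cs₂} r₁ r₂

    runs-ite-false : ∀ {m} {ρ : Vec ℕ m} {P Q R o o′ e} → Runs ρ P o false → Runs ρ R o′ e → Runs ρ (iteM P Q R) (o ++ o′) e
    runs-ite-false {Q = Q} p q i cs l E =
      let (i₁ , cs₁ , l₁ , E₁ , r₁) = p i cs l E
          (i₂ , cs₂ , l₂ , E₂ , r₂) = q i₁ cs₁ l₁ E₁
      in i₂ , cs₂ , l₂ , E₂ , ite-false {Q = Q} {cs′ = cs₁} {cs″ = cs₂} r₁ r₂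

    runs-seq : ∀ {m} {ρ : Vec ℕ m} {P Q o o′ e e′} → Runs ρ P o e → Runs ρ Q o′ e′ → Runs ρ (seqM P Q) (o ++ o′) e′
    runs-seq {Q = Q} {e = true} p q = runs-ite-true {R = Q} p q
    runs-seq {Q = Q} {e = false} p q = runs-ite-false {Q = Q} p q

    runs-yes : ∀ {m} {ρ : Vec ℕ m} → Runs ρ yesM [] true
    runs-yes i cs l E = i , cs , l , E , exec-inp _ i cs (fits cs l)

    runs-no : ∀ {m} {ρ : Vec ℕ m} → Runs ρ noM [] false
    runs-no i cs l E = i , cs , l , E , exec-inp _ i cs (fits cs l)

    runs-out : ∀ {m} {ρ : Vec ℕ m} y → Runs ρ (outM y) [ y ] true
    runs-out y i cs l E = i , cs , l , E , exec-out y i cs (fits cs l)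

    zeroed : ℕ → List Col → List Col
    zeroed r = map (setDig r zero)

    zeroS-out : ∀ r s cs → scanOut (zeroS r) s cs ≡ (true , zeroed r cs)
    zeroS-out r s [] = refl
    zeroS-out r s (c ∷ cs) rewrite zeroS-out r s cs = refl

    reg-zeroed : ∀ r cs → r < K → reg r (zeroed r cs) ≡ 0
    reg-zeroed r [] p = refl
    reg-zeroed r (c ∷ cs) p rewrite dig-set r zero c p | reg-zeroed r cs p = *-zeroʳ g

    reg-zeroed-other : ∀ r r′ cs → r ≢ r′ → reg r (zeroed r′ cs) ≡ reg r cs
    reg-zeroed-other r r′ [] ne = refl
    reg-zeroed-other r r′ (c ∷ cs) ne rewrite dig-other r r′ zero c ne | reg-zeroed-other r r′ cs ne = refl

    exec-zero : ∀ {m} (ρ : Vec ℕ m) → m < K → ∀ i cs → length cs ≡ len → Env ρ cs →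
                Σ (List Col) λ cs′ → length cs′ ≡ len × Env (0 ∷ ρ) cs′ × Exec (scanM (zeroS m)) i cs [] true i cs′
    exec-zero {m} ρ m<K i cs l E = zeroed m cs , l′ , (reg-zeroed m cs m<K , Env-cong ρ (λ r r<m → reg-zeroed-other r m cs (<⇒≢ r<m)) E) ,
      subst (λ r → Exec (scanM (zeroS m)) i cs [] (proj₁ r) i (proj₂ r)) (zeroS-out m nothing cs)
        (exec-scan (zeroS m) i cs (fits (proj₂ (scanOut (zeroS m) nothing cs)) (trans (cong (length ∘ proj₂) (zeroS-out m nothing cs)) l′)) (fits cs l))
      where
        l′ : length (zeroed m cs) ≡ len
        l′ = trans (length-map _ cs) l

    incS-keep : ∀ r cs → scanOut (incS r) (just false) cs ≡ (false , cs)
    incS-keep r [] = refl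
    incS-keep r (c ∷ cs) rewrite incS-keep r cs = refl

    inced : ℕ → List Col → Bool × List Col
    inced r cs = scanOut (incS r) (just true) cs

    data Incremented (r : ℕ) (cs : List Col) : Bool × List Col → Set where
      wrapped : ∀ {cs′} → suc (reg r cs) ≡ g ^ length cs → reg r cs′ ≡ 0 → Incremented r cs (true , cs′)
      bumped  : ∀ {cs′} → reg r cs′ ≡ suc (reg r cs) → Incremented r cs (false , cs′)

    inced-spec : ∀ r cs → r < K → Incremented r cs (inced r cs) × length (proj₂ (inced r cs)) ≡ length cs ×
                 (∀ r′ → r′ ≢ r → reg r′ (proj₂ (inced r cs)) ≡ reg r′ cs)
    inced-spec r [] p = wrapped refl refl , refl , λ _ _ → refl
    inced-spec r (c ∷ cs) p with suc (toℕ (dig r c)) <? g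
    ... | yes q rewrite incS-keep r cs = bumped (cong (_+ g * reg r cs) (trans (cong toℕ (dig-set r (fromℕ< q) c p)) (Fin.toℕ-fromℕ< q))) ,
                  refl , λ r′ ne → cong (λ d → toℕ d + g * reg r′ cs) (dig-other r′ r (fromℕ< q) c ne)
    ... | no q with scanOut (incS r) (just true) cs | inced-spec r cs p
    ...   | true , cs′ | wrapped top z , l , h = wrapped eq (trans (cong₂ (λ d x → toℕ d + g * x) (dig-set r zero c p) z) (*-zeroʳ g)) ,
              cong suc l , λ r′ ne → cong₂ (λ d x → toℕ d + g * x) (dig-other r′ r zero c ne) (h r′ ne)
      where
        maxDig : suc (toℕ (dig r c)) ≡ g
        maxDig = ≤-antisym (Fin.toℕ<n (dig r c)) (≮⇒≥ q)
        eq : suc (toℕ (dig r c) + g * reg r cs) ≡ g * g ^ length cs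
        eq = trans (cong (_+ g * reg r cs) maxDig) (trans (sym (*-suc g (reg r cs))) (cong (g *_) top))
    ...   | false , cs′ | bumped z , l , h = bumped eq , cong suc l , λ r′ ne → cong₂ (λ d x → toℕ d + g * x) (dig-other r′ r zero c ne) (h r′ ne)
      where
        maxDig : suc (toℕ (dig r c)) ≡ g
        maxDig = ≤-antisym (Fin.toℕ<n (dig r c)) (≮⇒≥ q)
        eq : toℕ (dig r (setDig r zero c)) + g * reg r cs′ ≡ suc (toℕ (dig r c) + g * reg r cs)
        eq = trans (cong₂ (λ d x → toℕ d + g * x) (dig-set r zero c p) z) (trans (*-suc g (reg r cs)) (cong (_+ g * reg r cs) (sym maxDig)))

    IncResult : ∀ {m} → Vec ℕ m → ℕ → ℕ → List Col → Set
    IncResult {m} ρ x i cs =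
      (suc x ≡ B × Σ (List Col) λ cs′ → length cs′ ≡ len × Env (0 ∷ ρ) cs′ × Exec (scanM (incS m)) i cs [] true i cs′) ⊎
      (suc x < B × Σ (List Col) λ cs′ → length cs′ ≡ len × Env (suc x ∷ ρ) cs′ × Exec (scanM (incS m)) i cs [] false i cs′)

    exec-inc : ∀ {m x} (ρ : Vec ℕ m) → m < K → ∀ i cs → length cs ≡ len → Env (x ∷ ρ) cs → IncResult ρ x i cs
    exec-inc {m} ρ m<K i cs l (refl , E) with inced m cs in eq | inced-spec m cs m<K
    ... | true , cs′ | wrapped top z , l′ , h = inj₁ (trans top (cong (g ^_) l) , cs′ , trans l′ l , (z , Env-cong ρ (λ r r<m → h r (<⇒≢ r<m)) E) ,
            subst (λ r → Exec (scanM (incS m)) i cs [] (proj₁ r) i (proj₂ r)) eq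
              (exec-scan (incS m) i cs (fits (proj₂ (inced m cs)) (trans (cong (length ∘ proj₂) eq) (trans l′ l))) (fits cs l)))
    ... | false , cs′ | bumped z , l′ , h = inj₂ (subst₂ _<_ z (cong (g ^_) (trans l′ l)) (reg< m cs′) , cs′ , trans l′ l ,
            (z , Env-cong ρ (λ r r<m → h r (<⇒≢ r<m)) E) ,
            subst (λ r → Exec (scanM (incS m)) i cs [] (proj₁ r) i (proj₂ r)) eq
              (exec-scan (incS m) i cs (fits (proj₂ (inced m cs)) (trans (cong (length ∘ proj₂) eq) (trans l′ l))) (fits cs l)))

    0<B : 0 < B
    0<B = m^n>0 g len

    runs-ex : ∀ {m} {ρ : Vec ℕ m} {P} (f : ℕ → Bool) → m < K → (∀ x → x < B → Runs (x ∷ ρ) P [] (f x)) →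
      Σ Bool λ e → Runs ρ (exM m P) [] e × (e ≡ true → ∃ λ x → x < B × f x ≡ true) × (e ≡ false → ∀ x → x < B → f x ≡ false)
    runs-ex {m} {ρ} {P} f m<K body =
      let (e , r , t , n) = scan-from B 0 0<B (+-identityʳ B)
      in e , (λ i cs l E → let (cs₁ , l₁ , E₁ , r₁) = exec-zero ρ m<K i cs l E
                               (i₂ , cs₂ , l₂ , E₂ , r₂) = r i cs₁ l₁ E₁
                           in i₂ , cs₂ , l₂ , E₂ , ite-true {R = noM} {cs = cs} {cs′ = cs₁} {cs″ = cs₂} r₁ r₂) , t , λ eq x p → n eq x z≤n p
      where
        L : Mach
        L = loopM P (scanM (incS m))
        From : ℕ → Bool → Set
        From x e = ∀ i cs → length cs ≡ len → Env (x ∷ ρ) cs →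
          Σ ℕ λ i′ → Σ (List Col) λ cs′ → length cs′ ≡ len × Env ρ cs′ × Exec L i cs [] e i′ cs′
        scan-from : ∀ k x → x < B → k + x ≡ B → Σ Bool λ e → From x e × (e ≡ true → ∃ λ x → x < B × f x ≡ true) ×
                    (e ≡ false → ∀ y → x ≤ y → y < B → f y ≡ false)
        scan-from zero x x< refl = ⊥-elim (<-irrefl refl x<)
        scan-from (suc k) x x< eq with f x in fx | body x x<
        ... | true | r = true , (λ i cs l E → let (i₁ , cs₁ , l₁ , E₁ , r₁) = r i cs l E in
                i₁ , cs₁ , l₁ , proj₂ E₁ , loop-true {Q = scanM (incS m)} {cs = cs} {cs′ = cs₁} r₁) , (λ _ → x , x< , fx) , λ ()
        ... | false | r with k ≟ 0
        ...   | yes refl = false , (λ i cs l E → let (i₁ , cs₁ , l₁ , E₁ , r₁) = r i cs l E in last i₁ cs₁ l₁ E₁ (exec-inc ρ m<K i₁ cs₁ l₁ E₁) i cs r₁) , (λ ()) ,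
                  λ _ y x≤y y<B → subst (λ y → f y ≡ false) (≤-antisym x≤y (≤-pred (≤-trans y<B (≤-reflexive (sym eq))))) fx
          where
            last : ∀ i₁ cs₁ → length cs₁ ≡ len → Env (x ∷ ρ) cs₁ → IncResult ρ x i₁ cs₁ → ∀ i cs → Exec P i cs [] false i₁ cs₁ →
                   Σ ℕ λ i′ → Σ (List Col) λ cs′ → length cs′ ≡ len × Env ρ cs′ × Exec L i cs [] false i′ cs′
            last i₁ cs₁ l₁ E₁ (inj₁ (_ , cs₂ , l₂ , E₂ , r₂)) i cs r₁ = i₁ , cs₂ , l₂ , proj₂ E₂ , loop-false {P = P} {cs = cs} {cs′ = cs₁} {cs″ = cs₂} r₁ r₂
            last i₁ cs₁ l₁ E₁ (inj₂ (lt , _)) i cs r₁ = ⊥-elim (<-irrefl eq lt)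
        ...   | no k≢0 with scan-from k (suc x) (≤-trans (s≤s (+-monoˡ-≤ x (n≢0⇒n>0 k≢0))) (≤-reflexive eq)) (trans (+-suc k x) eq)
        ...     | e , rec , t , n = e , (λ i cs l E → let (i₁ , cs₁ , l₁ , E₁ , r₁) = r i cs l E in more i₁ cs₁ l₁ E₁ (exec-inc ρ m<K i₁ cs₁ l₁ E₁) i cs r₁) , t ,
                    λ eq′ y x≤y y<B → case m≤n⇒m<n∨m≡n x≤y of λ { (inj₁ x<y) → n eq′ y x<y y<B ; (inj₂ refl) → fx }
          where
            more : ∀ i₁ cs₁ → length cs₁ ≡ len → Env (x ∷ ρ) cs₁ → IncResult ρ x i₁ cs₁ → ∀ i cs → Exec P i cs [] false i₁ cs₁ →
                   Σ ℕ λ i′ → Σ (List Col) λ cs′ → length cs′ ≡ len × Env ρ cs′ × Exec L i cs [] e i′ cs′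
            more i₁ cs₁ l₁ E₁ (inj₁ (top , _)) i cs r₁ =
              ⊥-elim (<-irrefl top (≤-trans (s≤s (+-monoˡ-≤ x (n≢0⇒n>0 k≢0))) (≤-reflexive eq)))
            more i₁ cs₁ l₁ E₁ (inj₂ (_ , cs₂ , l₂ , E₂ , r₂)) i cs r₁ =
              let (i₃ , cs₃ , l₃ , E₃ , r₃) = rec i₁ cs₂ l₂ E₂
              in i₃ , cs₃ , l₃ , E₃ , loop-next {P = P} {cs = cs} {cs′ = cs₁} {cs″ = cs₂} {cs‴ = cs₃} r₁ r₂ r₃

does-true : {P : Set} (d : Dec P) → does d ≡ true → P
does-true (yes p) _ = p

does-false : {P : Set} (d : Dec P) → does d ≡ false → ¬ P
does-false (no ¬p) _ = ¬p

does-unique : {P : Set} {e : Bool} → (e ≡ true → P) → (e ≡ false → ¬ P) → (d : Dec P) → e ≡ does d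
does-unique {e = true} t n (yes p) = refl
does-unique {e = true} t n (no ¬p) = ⊥-elim (¬p (t refl))
does-unique {e = false} t n (yes p) = ⊥-elim (n refl p)
does-unique {e = false} t n (no ¬p) = refl

module LogicRuns (a b K′ g′ : ℕ) where

  open Logic a b K′ g′ public

  module _ {m : ℕ} where

    regTm-∷ : ∀ (t : Tm m) c cs → regTm t (c ∷ cs) ≡ digTm t c + g * regTm t cs
    regTm-∷ `0 c cs = sym (*-zeroʳ g)
    regTm-∷ (` i) c cs = refl

    regTm-[] : ∀ (t : Tm m) → regTm t [] ≡ 0
    regTm-[] `0 = refl
    regTm-[] (` i) = refl

    digTm< : ∀ (t : Tm m) c → digTm t c < g
    digTm< `0 c = s≤s z≤n
    digTm< (` i) c = Fin.toℕ<n (dig (trk i) c)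

  module _ (w : Word a) where

    

    open Over w public

    data Carry (s d : ℕ) : Maybe Bool → Set where
      low  : s ≡ d → Carry s d (just false)
      high : s ≡ d + g → Carry s d (just true)
      bad  : s ≢ d → s ≢ d + g → Carry s d nothing

    carry-spec : ∀ s d → Carry s d (carry s d)
    carry-spec s d with s ≟ d | s ≟ d + g
    ... | yes p | _ = low p
    ... | no _ | yes q = high q
    ... | no p | no q = bad p q

    module _ {m : ℕ} (c₀ : Bool) (x y z : Tm m) where

      private
        M = sumS c₀ x y z

        shuffle : ∀ dx dy k g X Y → dx + g * X + (dy + g * Y) + k ≡ dx + dy + k + g * (X + Y)
        shuffle = solve-∀

      sumS-keep : ∀ s cs → proj₂ (scanOut M s cs) ≡ cs
      sumS-keep nothing [] = refl
      sumS-keep (just false) [] = refl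
      sumS-keep (just true) [] = refl
      sumS-keep nothing (c ∷ cs) = cong (c ∷_) (sumS-keep nothing cs)
      sumS-keep (just k) (c ∷ cs) = cong (c ∷_) (sumS-keep (carry (digTm x c + digTm y c + bn k) (digTm z c)) cs)

      sumS-fail : ∀ cs → proj₁ (scanOut M nothing cs) ≡ false
      sumS-fail [] = refl
      sumS-fail (c ∷ cs) = sumS-fail cs

      Adds : Bool → List Col → Set
      Adds k cs = regTm x cs + regTm y cs + bn k ≡ regTm z cs

      -- Removing the lowest digit of all three numbers leaves the same kind of equation, with the
      -- outgoing carry in place of `k`; by `digit-unique` any other digit sum refutes the equation.
      sumS-spec : ∀ k cs → (proj₁ (scanOut M (just k) cs) ≡ true → Adds k cs) × (proj₁ (scanOut M (just k) cs) ≡ false → ¬ Adds k cs)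
      sumS-spec k [] rewrite regTm-[] x | regTm-[] y | regTm-[] z with k
      ... | false = (λ _ → refl) , λ ()
      ... | true = (λ ()) , λ _ ()
      sumS-spec k (c ∷ cs) rewrite regTm-∷ x c cs | regTm-∷ y c cs | regTm-∷ z c cs
        with carry (digTm x c + digTm y c + bn k) (digTm z c) | carry-spec (digTm x c + digTm y c + bn k) (digTm z c)
      ... | just false | low e = (λ t → trans (shuffle (digTm x c) (digTm y c) (bn k) g X Y)
              (cong₂ (λ s P → s + g * P) e (trans (sym (+-identityʳ _)) (proj₁ (sumS-spec false cs) t)))) ,
              λ f eq → proj₂ (sumS-spec false cs) f (trans (+-identityʳ _)
                (*-cancelˡ-≡ (X + Y) (regTm z cs) g (+-cancelˡ-≡ (digTm z c) _ _ (trans (cong (_+ g * (X + Y)) (sym e)) (trans (sym (shuffle (digTm x c) (digTm y c) (bn k) g X Y)) eq)))))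
        where
          X = regTm x cs
          Y = regTm y cs
      ... | just true | high e = (λ t → trans (shuffle (digTm x c) (digTm y c) (bn k) g X Y)
              (trans (cong (_+ g * (X + Y)) e) (trans (lem (digTm z c) g (X + Y)) (cong (λ P → digTm z c + g * P) (proj₁ (sumS-spec true cs) t))))) ,
              λ f eq → proj₂ (sumS-spec true cs) f
                (*-cancelˡ-≡ (X + Y + 1) (regTm z cs) g (+-cancelˡ-≡ (digTm z c) _ _ (trans (sym (lem (digTm z c) g (X + Y))) (trans (cong (_+ g * (X + Y)) (sym e)) (trans (sym (shuffle (digTm x c) (digTm y c) (bn k) g X Y)) eq)))))
        where
          X = regTm x cs
          Y = regTm y cs
          lem : ∀ d g P → d + g + g * P ≡ d + g * (P + 1)
          lem = solve-∀
      ... | nothing | bad p q = (λ t → case trans (sym t) (sumS-fail cs) of λ ()) ,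
              λ _ eq → [ p ∘ proj₁ , q ∘ proj₁ ]′ (digit-unique {g} (digTm x c + digTm y c + bn k) (digTm z c) (X + Y) (regTm z cs) s<
                (digTm< z c) (trans (sym (shuffle (digTm x c) (digTm y c) (bn k) g X Y)) eq))
        where
          X = regTm x cs
          Y = regTm y cs
          bn≤1 : ∀ k → bn k ≤ 1
          bn≤1 false = z≤n
          bn≤1 true = ≤-refl
          s< : digTm x c + digTm y c + bn k < g + g
          s< = ≤-trans (s≤s (+-monoʳ-≤ _ (bn≤1 k))) (≤-trans (≤-reflexive (lem₂ (digTm x c) (digTm y c))) (+-mono-≤ (digTm< x c) (digTm< y c)))
            where
              lem₂ : ∀ a b → suc (a + b + 1) ≡ suc a + suc b
              lem₂ = solve-∀

      Env-tv : ∀ (ρ : Vec ℕ m) {cs} → Env ρ cs → ∀ t → regTm t cs ≡ tv ρ t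
      Env-tv ρ E `0 = refl
      Env-tv ρ E (` i) = Env-lookup ρ E i

      exec-sum : ∀ (ρ : Vec ℕ m) i cs → length cs ≡ len → Env ρ cs →
                 Exec (scanM M) i cs [] (does (tv ρ x + tv ρ y + bn c₀ ≟ tv ρ z)) i cs
      exec-sum ρ i cs l E = subst₂ (λ e cs′ → Exec (scanM M) i cs [] e i cs′) exits (sumS-keep (just c₀) cs)
          (exec-scan M i cs (fits (proj₂ (scanOut M (just c₀) cs)) (trans (cong length (sumS-keep (just c₀) cs)) l)) (fits cs l))
        where
          value : Adds c₀ cs ≡ (tv ρ x + tv ρ y + bn c₀ ≡ tv ρ z)
          value rewrite Env-tv ρ E x | Env-tv ρ E y | Env-tv ρ E z = refl
          exits : proj₁ (scanOut M (just c₀) cs) ≡ does (tv ρ x + tv ρ y + bn c₀ ≟ tv ρ z)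
          exits = does-unique (λ t → subst id value (proj₁ (sumS-spec c₀ cs) t))
                              (λ f p → proj₂ (sumS-spec c₀ cs) f (subst id (sym value) p)) (_ ≟ _)

    tv-wk : ∀ {m} x (ρ : Vec ℕ m) t → tv (x ∷ ρ) (wkTm t) ≡ tv ρ t
    tv-wk x ρ `0 = refl
    tv-wk x ρ (` i) = refl

    tv<B : ∀ {m} (ρ : Vec ℕ m) cs → length cs ≡ len → Env ρ cs → ∀ t → tv ρ t < B
    tv<B ρ cs l E `0 = 0<B
    tv<B ρ cs l E (` i) = subst₂ _<_ (Env-lookup ρ E i) (cong (g ^_) l) (reg< (trk i) cs)

    headAt : ℕ → ℕ
    headAt zero = 0
    headAt (suc x) = moveIn (length w) right (headAt x)

    moveIn-stuck : ∀ n → moveIn n right (suc n) ≡ suc n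
    moveIn-stuck n with suc n <ᵇ suc n in eq
    ... | false = refl
    ... | true = ⊥-elim (<-irrefl refl (<ᵇ⇒< (suc n) (suc n) (subst T (sym eq) tt)))

    headAt-spec : ∀ x → headAt x ≡ x ⊎ (headAt x ≡ suc (length w) × length w < x)
    headAt-spec zero = inj₁ refl
    headAt-spec (suc x) with headAt-spec x
    ... | inj₂ (eq , p) = inj₂ (trans (cong (moveIn (length w) right) eq) (moveIn-stuck (length w)) , m<n⇒m<1+n p)
    ... | inj₁ eq rewrite eq with x ≤? length w
    ...   | yes p = inj₁ (moveIn-right w (length w) x p)
    ...   | no p = inj₂ (clamped , m<n⇒m<1+n (≰⇒> p))
      where
        clamped : moveIn (length w) right x ≡ suc (length w)
        clamped with headAt-spec x
        ... | inj₂ (eq′ , _) rewrite trans (sym eq) eq′ = moveIn-stuck (length w)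
        ... | inj₁ _ = go (m≤n⇒m<n∨m≡n (≰⇒> p))
          where
            headAt≤ : ∀ x → headAt x ≤ suc (length w)
            headAt≤ zero = z≤n
            headAt≤ (suc x) with headAt x <ᵇ suc (length w) in lt
            ... | true = <ᵇ⇒< (headAt x) (suc (length w)) (subst T (sym lt) tt)
            ... | false = headAt≤ x
            go : suc (length w) < x ⊎ suc (length w) ≡ x → moveIn (length w) right x ≡ suc (length w)
            go (inj₂ refl) = moveIn-stuck (length w)
            go (inj₁ lt) = ⊥-elim (<⇒≱ lt (subst (_≤ suc (length w)) eq (headAt≤ x)))

    readInput-beyond : ∀ (v : Word a) x → length v < x → readInput v x ≡ rend
    readInput-beyond [] (suc x) _ = refl
    readInput-beyond (_ ∷ v) (suc (suc x)) (s≤s p) = readInput-beyond v (suc x) p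

    -- The head stops at the right end marker, but `readInput` yields that marker at every later
    -- position too, so the clamping cannot be observed.
    readInput-headAt : ∀ x → readInput w (headAt x) ≡ readInput w x
    readInput-headAt x with headAt-spec x
    ... | inj₁ eq = cong (readInput w) eq
    ... | inj₂ (eq , p) = trans (cong (readInput w) eq) (trans (readInput-beyond w _ ≤-refl) (sym (readInput-beyond w x p)))

    exec-rewind : ∀ i cs → length cs ≡ len → Exec rewindM i cs [] true 0 cs
    exec-rewind zero cs l = loop-true {Q = mvM false left} (exec-inp isLend 0 cs (fits cs l))
    exec-rewind (suc i) cs l = loop-next {P = inpM isLend} {cs = cs}
      (subst (λ e → Exec (inpM isLend) (suc i) cs [] e (suc i) cs) (notLend w i) (exec-inp isLend (suc i) cs (fits cs l)))
      (exec-mv false left (suc i) cs (fits cs l)) (exec-rewind i cs l)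
      where
        notLend : ∀ (v : Word a) i → isLend (readInput v (suc i)) ≡ false
        notLend [] i = refl
        notLend (_ ∷ v) zero = refl
        notLend (_ ∷ v) (suc i) = notLend v i

    exec-seek : ∀ {m} (ρ : Vec ℕ m) t → m < K → ∀ cs → length cs ≡ len → Env ρ cs →
      Σ (List Col) λ cs′ → length cs′ ≡ len × Env ρ cs′ × Exec (seekM t) 0 cs [] true (headAt (tv ρ t)) cs′
    exec-seek {m} ρ t m<K cs l E =
      let (cs₁ , l₁ , E₁ , r₁) = exec-zero ρ m<K 0 cs l E
          (cs₂ , l₂ , E₂ , r₂) = go (tv ρ t) 0 (+-identityʳ _) cs₁ l₁ E₁
      in cs₂ , l₂ , E₂ , ite-true {R = noM} {cs = cs} {cs′ = cs₁} {cs″ = cs₂} r₁ r₂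
      where
        Test Adv L : Mach
        Test = scanM (sumS false (` zero) `0 (wkTm t))
        Adv = iteM (mvM true right) (scanM (incS m)) noM
        L = loopM Test Adv
        test : ∀ x cs → length cs ≡ len → Env (x ∷ ρ) cs → ∀ i → Exec Test i cs [] (does (x + 0 + 0 ≟ tv ρ t)) i cs
        test x cs l E i = subst (λ v → Exec Test i cs [] (does (x + 0 + 0 ≟ v)) i cs) (tv-wk x ρ t)
                                (exec-sum false (` zero) `0 (wkTm t) (x ∷ ρ) i cs l E)
        go : ∀ k x → k + x ≡ tv ρ t → ∀ cs → length cs ≡ len → Env (x ∷ ρ) cs →
             Σ (List Col) λ cs′ → length cs′ ≡ len × Env ρ cs′ × Exec L (headAt x) cs [] true (headAt (tv ρ t)) cs′
        go zero x eq cs l E = cs , l , proj₂ E , subst (λ y → Exec L (headAt x) cs [] true (headAt y) cs) eq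
          (loop-true {Q = Adv} (subst (λ e → Exec Test (headAt x) cs [] e (headAt x) cs)
            (sym (does-unique {e = true} (λ _ → trans (+-identityʳ _) (trans (+-identityʳ _) eq)) (λ ()) (x + 0 + 0 ≟ tv ρ t))) (test x cs l E (headAt x))))
        go (suc k) x eq cs l E with exec-inc {x = x} ρ m<K (headAt (suc x)) cs l E
        ... | inj₁ (top , _) = ⊥-elim (<-irrefl top (≤-trans (s≤s (≤-trans (s≤s (m≤n+m x k)) (≤-reflexive eq))) (tv<B ρ cs l (proj₂ E) t)))
        ... | inj₂ (_ , cs₁ , l₁ , E₁ , r₁) =
          let (cs₂ , l₂ , E₂ , r₂) = go k (suc x) (trans (+-suc k x) eq) cs₁ l₁ E₁
          in cs₂ , l₂ , E₂ , loop-next {P = Test} {cs = cs} {cs′ = cs} {cs″ = cs₁} {cs‴ = cs₂}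
               (subst (λ e → Exec Test (headAt x) cs [] e (headAt x) cs)
                 (sym (does-unique {e = false} (λ ()) (λ _ p → <-irrefl (trans (sym (trans (+-identityʳ _) (+-identityʳ _))) p) (≤-trans (s≤s (m≤n+m x k)) (≤-reflexive eq))) (x + 0 + 0 ≟ tv ρ t)))
                 (test x cs l E (headAt x)))
               (ite-true {R = noM} {cs = cs} {cs′ = cs} {cs″ = cs₁} (exec-mv true right (headAt x) cs (fits cs l)) r₁) r₂

    private
      max≤ : ∀ m p q → m + (p ⊔ q) ≤ K → (m + p ≤ K) × (m + q ≤ K)
      max≤ m p q h = ≤-trans (+-monoʳ-≤ m (m≤m⊔n p q)) h , ≤-trans (+-monoʳ-≤ m (m≤n⊔m p q)) h

      result : ∀ {m} {ρ : Vec ℕ m} {M e e′} → e ≡ e′ → Runs ρ M [] e → Runs ρ M [] e′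
      result refl r = r

    -- The hypothesis on `depth` guarantees a register with the number `m` for each quantifier met.
    -- Fixing the exit as the decision `sat?` lets the proof branch exactly as the compound machine
    -- does.
    runs-test : ∀ {m} (φ : Form a m) (ρ : Vec ℕ m) → m + depth φ ≤ K → Runs ρ (tstM φ) [] (does (sat? φ ρ))
    runs-test (sum c x y z) ρ h i cs l E = i , cs , l , E , exec-sum c x y z ρ i cs l E
    runs-test {m} (sees p t) ρ h i cs l E =
      let (cs₁ , l₁ , E₁ , r₁) = exec-seek ρ t (≤-trans (≤-reflexive (+-comm 1 m)) h) cs l E
      in headAt (tv ρ t) , cs₁ , l₁ , E₁ ,
         ite-true {R = noM} {cs = cs} {cs′ = cs} {cs″ = cs₁} (exec-rewind i cs l)
           (ite-true {R = noM} {cs = cs} {cs′ = cs₁} {cs″ = cs₁} r₁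
             (subst (λ e → Exec (inpM p) _ cs₁ [] e _ cs₁) bool (exec-inp p (headAt (tv ρ t)) cs₁ (fits cs₁ l₁))))
      where
        bool : p (readInput w (headAt (tv ρ t))) ≡ does (p (readInput w (tv ρ t)) Data.Bool.≟ true)
        bool = trans (cong p (readInput-headAt (tv ρ t))) (does-unique id (λ f t → case trans (sym f) t of λ ()) (_ Data.Bool.≟ true))
    runs-test {m} (φ and ψ) ρ h with does (sat? φ ρ) | runs-test φ ρ (proj₁ (max≤ m (depth φ) (depth ψ) h))
    ... | true | r = runs-ite-true {R = noM} r (runs-test ψ ρ (proj₂ (max≤ m (depth φ) (depth ψ) h)))
    ... | false | r = runs-ite-false {Q = tstM ψ} r runs-no
    runs-test {m} (φ or ψ) ρ h with does (sat? φ ρ) | runs-test φ ρ (proj₁ (max≤ m (depth φ) (depth ψ) h))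
    ... | true | r = runs-ite-true {R = tstM ψ} r runs-yes
    ... | false | r = runs-ite-false {Q = yesM} r (runs-test ψ ρ (proj₂ (max≤ m (depth φ) (depth ψ) h)))
    runs-test (neg φ) ρ h with does (sat? φ ρ) | runs-test φ ρ h
    ... | true | r = runs-ite-true {R = yesM} r runs-no
    ... | false | r = runs-ite-false {Q = noM} r runs-yes
    runs-test {m} (ex φ) ρ h =
      let h′ = ≤-trans (≤-reflexive (sym (+-suc m (depth φ)))) h
          (e , r , t , n) = runs-ex {ρ = ρ} {P = tstM φ} (λ x → does (sat? φ (x ∷ ρ))) (≤-trans (s≤s (m≤m+n m _)) h′) (λ x _ → runs-test φ (x ∷ ρ) h′)
      in result (does-unique (λ q → let (x , x< , s) = t q in x , x< , does-true (sat? φ (x ∷ ρ)) s)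
                             (λ q (x , x< , s) → does-false (sat? φ (x ∷ ρ)) (n q x x<) s) (sat? (ex φ) ρ)) r

    runs-for : ∀ {m} {ρ : Vec ℕ m} {P} (o : ℕ → Word b) → m < K → (∀ x → x < B → ∃ λ e → Runs (x ∷ ρ) P (o x) e) →
               Runs ρ (forM m P) (concatMap o (range 0 B)) false
    runs-for {m} {ρ} {P} o m<K body i cs l E =
      let (cs₁ , l₁ , E₁ , r₁) = exec-zero ρ m<K i cs l E
          (i₂ , cs₂ , l₂ , E₂ , r₂) = from B 0 0<B (+-identityʳ B) i cs₁ l₁ E₁
      in i₂ , cs₂ , l₂ , E₂ , ite-true {R = noM} {cs = cs} {cs′ = cs₁} {cs″ = cs₂} r₁ r₂
      where
        P′ L : Mach
        P′ = seqM P noM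
        L = loopM P′ (scanM (incS m))
        body′ : ∀ x → x < B → Runs (x ∷ ρ) P′ (o x) false
        body′ x x< = subst (λ o → Runs (x ∷ ρ) P′ o false) (++-identityʳ (o x)) (runs-seq {P = P} {Q = noM} (proj₂ (body x x<)) runs-no)
        Result : ℕ → ℕ → ℕ → List Col → Set
        Result k x i cs = Σ ℕ λ i′ → Σ (List Col) λ cs′ → length cs′ ≡ len × Env ρ cs′ × Exec L i cs (concatMap o (range x k)) false i′ cs′
        from : ∀ k x → x < B → k + x ≡ B → ∀ i cs → length cs ≡ len → Env (x ∷ ρ) cs → Result k x i cs
        continue : ∀ k x → suc k + x ≡ B → ∀ {i cs i₁ cs₁} → IncResult ρ x i₁ cs₁ → Exec P′ i cs (o x) false i₁ cs₁ → Result (suc k) x i cs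
        from zero x x< refl = ⊥-elim (<-irrefl refl x<)
        from (suc k) x x< eq i cs l E =
          let (i₁ , cs₁ , l₁ , E₁ , r₁) = body′ x x< i cs l E
          in continue k x eq {cs = cs} {cs₁ = cs₁} (exec-inc {x = x} ρ m<K i₁ cs₁ l₁ E₁) r₁
        continue zero x eq {cs = cs} {i₁} {cs₁} (inj₁ (_ , cs₂ , l₂ , E₂ , r₂)) r₁ =
          i₁ , cs₂ , l₂ , proj₂ E₂ , loop-false {P = P′} {cs = cs} {cs′ = cs₁} {cs″ = cs₂} r₁ r₂
        continue zero x eq (inj₂ (lt , _)) r₁ = ⊥-elim (<-irrefl eq lt)
        continue (suc k) x eq (inj₁ (top , _)) r₁ = ⊥-elim (<-irrefl (trans top (sym eq)) (s≤s (s≤s (m≤n+m x k))))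
        continue (suc k) x eq {cs = cs} {i₁} {cs₁} (inj₂ (lt , cs₂ , l₂ , E₂ , r₂)) r₁ =
          let (i₃ , cs₃ , l₃ , E₃ , r₃) = from (suc k) (suc x) lt (trans (+-suc (suc k) x) eq) i₁ cs₂ l₂ E₂
          in i₃ , cs₃ , l₃ , E₃ , loop-next {P = P′} {cs = cs} {cs′ = cs₁} {cs″ = cs₂} {cs‴ = cs₃} r₁ r₂ r₃

-- First-order definable graphs

-- With plain numbers as vertices, encodings of graphs of different sizes can be compared directly;
-- `Fin` returns only in `finEdges`, once a bound on the vertices is known.
EdgeN : ℕ → Set
EdgeN c = ℕ × Fin c × ℕ

edgeℕ : ∀ {c n} → Fin n × Fin c × Fin n → EdgeN c
edgeℕ (u , x , v) = toℕ u , x , toℕ v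

encEdge : ∀ {c} → EdgeN c → Word (2 + c)
encEdge (u , x , v) = unary u ++ (suc (suc x) ∷ unary v)

encEdges : ∀ {c} → List (EdgeN c) → Word (2 + c)
encEdges = concatMap encEdge

encodeN : ∀ {c} → ℕ → ℕ → ℕ → List (EdgeN c) → Word (2 + c)
encodeN n s t es = unary n ++ unary s ++ unary t ++ encEdges es

encode-encodeN : ∀ {c} (I : Instance c) → let open Instance I in encode I ≡ encodeN n (toℕ s) (toℕ t) (map edgeℕ E)
encode-encodeN I = cong (λ z → unary n ++ unary (toℕ s) ++ unary (toℕ t) ++ z) (go E)
  where
    open Instance I
    go : ∀ E → concatMap encodeEdge E ≡ encEdges (map edgeℕ E)
    go [] = refl
    go (e ∷ E) = cong (encodeEdge e ++_) (go E)

unary-injective : ∀ {c} m m′ {z z′ : Word (2 + c)} → unary m ++ z ≡ unary m′ ++ z′ → m ≡ m′ × z ≡ z′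
unary-injective zero zero refl = refl , refl
unary-injective (suc m) (suc m′) eq = let (p , q) = unary-injective m m′ (∷-injectiveʳ eq) in cong suc p , q

unary-label : ∀ {c} m {x} {z z′ : Word (2 + c)} → unary m ++ z ≢ suc (suc x) ∷ z′
unary-label zero ()
unary-label (suc m) ()

encEdge-++ : ∀ {c} u (x : Fin c) v z → encEdge (u , x , v) ++ z ≡ unary u ++ (suc (suc x) ∷ unary v ++ z)
encEdge-++ u x v z = ++-assoc (unary u) _ z

encEdges-injective : ∀ {c} (es es′ : List (EdgeN c)) → encEdges es ≡ encEdges es′ → es ≡ es′
encEdges-injective [] [] eq = refl
encEdges-injective [] ((zero , _) ∷ _) ()
encEdges-injective [] ((suc _ , _) ∷ _) ()
encEdges-injective ((zero , _) ∷ _) [] ()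
encEdges-injective ((suc _ , _) ∷ _) [] ()
encEdges-injective ((u , x , v) ∷ es) ((u′ , x′ , v′) ∷ es′) eq
  with unary-injective u u′ (trans (sym (encEdge-++ u x v (encEdges es))) (trans eq (encEdge-++ u′ x′ v′ (encEdges es′))))
... | refl , eq₁ with ∷-injective eq₁
... | refl , eq₂ with unary-injective v v′ eq₂
... | refl , eq₃ = cong (_ ∷_) (encEdges-injective es es′ eq₃)

encodeN-injective : ∀ {c} n n′ s s′ t t′ (es es′ : List (EdgeN c)) → encodeN n s t es ≡ encodeN n′ s′ t′ es′ →
                    n ≡ n′ × s ≡ s′ × t ≡ t′ × es ≡ es′
encodeN-injective n n′ s s′ t t′ es es′ eq =
  let (p , eq₁) = unary-injective n n′ eq
      (q , eq₂) = unary-injective s s′ eq₁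
      (r , eq₃) = unary-injective t t′ eq₂
  in p , q , r , encEdges-injective es es′ eq₃

module _ {c : ℕ} (es : List (EdgeN c)) where
  data PathN : ℕ → ℕ → Word c → Set where
    stopN : ∀ {u} → PathN u u []
    stepN : ∀ {u x m v y} → (u , x , m) ∈ es → PathN m v y → PathN u v (x ∷ y)

-- The edges of the path form a subsequence of the edge list, which is what a grammar reading the
-- list once can follow. When the list is sorted by source and every edge increases, each path has
-- this form.
data InOrder {c : ℕ} : List (EdgeN c) → ℕ → ℕ → Word c → Set where
  done : ∀ {es t} → InOrder es t t []
  skip : ∀ {es e u t y} → InOrder es u t y → InOrder (e ∷ es) u t y
  take : ∀ {es u x v t y} → InOrder es v t y → InOrder ((u , x , v) ∷ es) u t (x ∷ y)

skips : ∀ {c} (es : List (EdgeN c)) {es′ u t y} → InOrder es′ u t y → InOrder (es ++ es′) u t y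
skips [] p = p
skips (_ ∷ es) p = skip (skips es p)

PathN-there : ∀ {c e} {es : List (EdgeN c)} {u t y} → PathN es u t y → PathN (e ∷ es) u t y
PathN-there stopN = stopN
PathN-there (stepN i p) = stepN (there i) (PathN-there p)

InOrder→PathN : ∀ {c} {es : List (EdgeN c)} {u t y} → InOrder es u t y → PathN es u t y
InOrder→PathN done = stopN
InOrder→PathN (skip p) = PathN-there (InOrder→PathN p)
InOrder→PathN (take p) = stepN (here refl) (PathN-there (InOrder→PathN p))

Path→PathN : ∀ {c n} {E : List (Fin n × Fin c × Fin n)} {u v y} → Path E u v y → PathN (map edgeℕ E) (toℕ u) (toℕ v) y
Path→PathN stop = stopN
Path→PathN (edge i p) = stepN (∈-map⁺ edgeℕ i) (Path→PathN p)

PathN→Path : ∀ {c n} {E : List (Fin n × Fin c × Fin n)} {u v y} {p q : ℕ} → toℕ u ≡ p → toℕ v ≡ q →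
             PathN (map edgeℕ E) p q y → Path E u v y
PathN→Path {u = u} {v} eu ev stopN rewrite Fin.toℕ-injective {i = u} {v} (trans eu (sym ev)) = stop
PathN→Path {E = E} eu ev (stepN i p) with ∈-map⁻ edgeℕ i
... | (u′ , x , m) , i′ , refl rewrite Fin.toℕ-injective eu = edge i′ (PathN→Path refl ev p)

inRange : ∀ {c} n (es : List (EdgeN c)) → Set
inRange n es = ∀ {u x v} → (u , x , v) ∈ es → u < n × v < n

finEdges : ∀ {c} n (es : List (EdgeN c)) → inRange n es → Σ (List (Fin n × Fin c × Fin n)) λ E → map edgeℕ E ≡ es
finEdges n [] h = [] , refl
finEdges n ((u , x , v) ∷ es) h =
  let (u< , v<) = h (here refl)
      (E , eq) = finEdges n es (h ∘ there)
  in (fromℕ< u< , x , fromℕ< v<) ∷ E , cong₂ _∷_ (cong₂ (λ p q → p , x , q) (Fin.toℕ-fromℕ< u<) (Fin.toℕ-fromℕ< v<)) eq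

concatMap-++ : {A B : Set} (f : A → List B) (xs ys : List A) → concatMap f (xs ++ ys) ≡ concatMap f xs ++ concatMap f ys
concatMap-++ f [] ys = refl
concatMap-++ f (x ∷ xs) ys = trans (cong (f x ++_) (concatMap-++ f xs ys)) (sym (++-assoc (f x) _ _))

concatMap-concatMap : {A B C : Set} (f : B → List C) (h : A → List B) (xs : List A) →
                      concatMap f (concatMap h xs) ≡ concatMap (concatMap f ∘ h) xs
concatMap-concatMap f h [] = refl
concatMap-concatMap f h (x ∷ xs) = trans (concatMap-++ f (h x) _) (cong (concatMap f (h x) ++_) (concatMap-concatMap f h xs))

concatMap-map : {A B C : Set} (f : B → List C) (h : A → B) (xs : List A) → concatMap f (map h xs) ≡ concatMap (f ∘ h) xs
concatMap-map f h [] = refl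
concatMap-map f h (x ∷ xs) = cong (f (h x) ++_) (concatMap-map f h xs)

replicate-+ : {A : Set} (m n : ℕ) (x : A) → replicate m x ++ replicate n x ≡ replicate (m + n) x
replicate-+ zero n x = refl
replicate-+ (suc m) n x = cong (x ∷_) (replicate-+ m n x)

concatMap-replicate : {A : Set} (x : A) (m i n : ℕ) → concatMap (λ _ → replicate m x) (range i n) ≡ replicate (n * m) x
concatMap-replicate x m i zero = refl
concatMap-replicate x m i (suc n) = trans (cong (replicate m x ++_) (concatMap-replicate x m (suc i) n)) (replicate-+ m (n * m) x)

-- This is how a number leaves a register in unary: while `y` runs through the whole range, a symbol
-- is printed whenever `y` lies below `v`.
concatMap-below : {A : Set} (x : A) (v : ℕ) (f : ℕ → Bool) → (∀ y → f y ≡ true → y < v) → (∀ y → f y ≡ false → ¬ (y < v)) →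
                  ∀ i n → v ≤ i + n → concatMap (λ y → if f y then [ x ] else []) (range i n) ≡ replicate (v ∸ i) x
concatMap-below x v f t u i zero v≤ = cong (λ k → replicate k x) (sym (m≤n⇒m∸n≡0 (≤-trans v≤ (≤-reflexive (+-identityʳ i)))))
concatMap-below x v f t u i (suc n) v≤ with f i in eq
... | true = trans (cong (x ∷_) (concatMap-below x v f t u (suc i) n (≤-trans v≤ (≤-reflexive (+-suc i n)))))
                   (cong (λ k → replicate k x) (sym (∸-suc-< i v (t i eq))))
  where
    ∸-suc-< : ∀ i v → i < v → v ∸ i ≡ suc (v ∸ suc i)
    ∸-suc-< i (suc v) (s≤s p) = +-∸-assoc 1 p
... | false = trans (concatMap-below x v f t u (suc i) n (≤-trans v≤ (≤-reflexive (+-suc i n))))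
                    (cong (λ k → replicate k x) (trans (m≤n⇒m∸n≡0 (≤-trans v≤i (n≤1+n i))) (sym (m≤n⇒m∸n≡0 v≤i))))
  where
    v≤i : v ≤ i
    v≤i = ≮⇒≥ (u i eq)

range-∈ : ∀ {x} i n → i ≤ x → x < i + n → x ∈ range i n
range-∈ i zero p q = ⊥-elim (<⇒≱ q (≤-trans (≤-reflexive (+-identityʳ i)) p))
range-∈ i (suc n) p q with m≤n⇒m<n∨m≡n p
... | inj₁ i<x = there (range-∈ (suc i) n i<x (≤-trans q (≤-reflexive (+-suc i n))))
... | inj₂ refl = here refl

∈-range : ∀ {x} i n → x ∈ range i n → i ≤ x × x < i + n
∈-range i (suc n) (here refl) = ≤-refl , m<m+n i (s≤s z≤n)
∈-range i (suc n) (there p) = let (q , r) = ∈-range (suc i) n p in <⇒≤ q , ≤-trans r (≤-reflexive (sym (+-suc i n)))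

Bounded : ∀ {k} → ℕ → Vec ℕ k → Set
Bounded B [] = ⊤
Bounded B (x ∷ u) = x < B × Bounded B u

-- The first component is the least significant digit. The last component, where a clock or a phase
-- will be kept, therefore dominates the order of the vertices.
code : ∀ {k} → ℕ → Vec ℕ k → ℕ
code B [] = 0
code B (x ∷ u) = x + B * code B u

code-tail-< : ∀ {k} B {x y} (u v : Vec ℕ k) → x < B → code B u < code B v → code B (x ∷ u) < code B (y ∷ v)
code-tail-< B {x} {y} u v x< p = ≤-trans (+-monoˡ-≤ (B * code B u) x<)
  (≤-trans (≤-reflexive (sym (*-suc B (code B u)))) (≤-trans (*-monoʳ-≤ B p) (m≤n+m _ y)))

code-head-< : ∀ {k} B {x y} (u : Vec ℕ k) → x < y → code B (x ∷ u) < code B (y ∷ u)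
code-head-< B u p = +-monoˡ-≤ (B * code B u) p

code< : ∀ {k} B (u : Vec ℕ k) → Bounded B u → code B u < B ^ k
code< B [] _ = ≤-refl
code< B (x ∷ u) (x< , bu) = ≤-trans (+-monoˡ-≤ (B * code B u) x<) (≤-trans (≤-reflexive (sym (*-suc B _))) (*-monoʳ-≤ B (code< B u bu)))

code-injective : ∀ {k} B (u v : Vec ℕ k) → Bounded B u → Bounded B v → code B u ≡ code B v → u ≡ v
code-injective B [] [] _ _ _ = refl
code-injective B (x ∷ u) (y ∷ v) (x< , bu) (y< , bv) eq with digit-unique {B} x y (code B u) (code B v) (≤-trans x< (m≤m+n B B)) y< eq
... | inj₁ (refl , eq′) = cong (x ∷_) (code-injective B u v bu bv eq′)
... | inj₂ (p , _) = ⊥-elim (<⇒≱ x< (≤-trans (m≤n+m B y) (≤-reflexive (sym p))))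

tuples : ℕ → ∀ k → List (Vec ℕ k)
tuples B zero = [ [] ]
tuples B (suc k) = concatMap (λ u → map (_∷ u) (range 0 B)) (tuples B k)

tuples-∈ : ∀ {k} B (u : Vec ℕ k) → Bounded B u → u ∈ tuples B k
tuples-∈ B [] _ = here refl
tuples-∈ B (x ∷ u) (x< , bu) = ∈-concatMap⁺ (λ u → map (_∷ u) (range 0 B)) (Any.map (λ { refl → ∈-map⁺ (_∷ u) (range-∈ 0 B z≤n x<) }) (tuples-∈ B u bu))

∈-tuples : ∀ {k} B (u : Vec ℕ k) → u ∈ tuples B k → Bounded B u
∈-tuples {zero} B [] _ = tt
∈-tuples {suc k} B (x ∷ u) i with find∈ (∈-concatMap⁻ (λ u → map (_∷ u) (range 0 B)) {xs = tuples B k} i)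
... | u′ , u′∈ , j with ∈-map⁻ (_∷ u′) j
... | x′ , x′∈ , refl = proj₂ (∈-range 0 B x′∈) , ∈-tuples B u u′∈

module _ {A : Set} {R : A → A → Set} where

  AllPairs-++ : ∀ {xs ys} → AllPairs R xs → AllPairs R ys → (∀ {x y} → x ∈ xs → y ∈ ys → R x y) → AllPairs R (xs ++ ys)
  AllPairs-++ [] q h = q
  AllPairs-++ (_∷_ {x} px p) q h = append px (λ j → h (here refl) j) ∷ AllPairs-++ p q (λ i j → h (there i) j)
    where
      append : ∀ {x xs ys} → All (R x) xs → (∀ {y} → y ∈ ys → R x y) → All (R x) (xs ++ ys)
      append {ys = []} [] h = []
      append {ys = _ ∷ _} [] h = h (here refl) ∷ append [] (h ∘ there)
      append (p ∷ ps) h = p ∷ append ps h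

  AllPairs-lookup : ∀ {x xs y} → AllPairs R (x ∷ xs) → y ∈ xs → R x y
  AllPairs-lookup (p ∷ _) i = All.lookup p i

range-sorted : ∀ i n → AllPairs _<_ (range i n)
range-sorted i zero = []
range-sorted i (suc n) = All.tabulate (λ j → proj₁ (∈-range (suc i) n j)) ∷ range-sorted (suc i) n

tuples-sorted : ∀ B k → AllPairs (λ u v → code B u < code B v) (tuples B k)
tuples-sorted B zero = [] ∷ []
tuples-sorted B (suc k) = go (tuples B k) (tuples-sorted B k)
  where
    row : ∀ u → AllPairs (λ u v → code B u < code B v) (map (_∷ u) (range 0 B))
    row u = AllPairsₚ.map⁺ (AllPairs.map (code-head-< B u) (range-sorted 0 B))
    go : ∀ us → AllPairs (λ u v → code B u < code B v) us → AllPairs (λ u v → code B u < code B v) (concatMap (λ u → map (_∷ u) (range 0 B)) us)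
    go [] [] = []
    go (u ∷ us) (p ∷ ps) = AllPairs-++ (row u) (go us ps) λ i j → cross (∈-map⁻ (_∷ u) i) (find∈ (∈-concatMap⁻ (λ u → map (_∷ u) (range 0 B)) {xs = us} j))
      where
        cross : ∀ {x y} → ∃ (λ d → d ∈ range 0 B × x ≡ d ∷ u) → ∃ (λ v → v ∈ us × y ∈ map (_∷ v) (range 0 B)) → code B x < code B y
        cross (d , d∈ , refl) (v , v∈ , j) with ∈-map⁻ (_∷ v) j
        ... | e , _ , refl = code-tail-< B u v (proj₂ (∈-range 0 B d∈)) (All.lookup p v∈)

-- Printing a definable graph

module Graph (a c k g′ : ℕ) (φ : Fin c → Form a (k + (k + 0))) (ψ : Form a (k + 0)) (xf : Fin c) where

  maxDepth : List (Fin c) → ℕ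
  maxDepth [] = depth ψ
  maxDepth (x ∷ xs) = depth (φ x) ⊔ maxDepth xs

  depthψ≤ : ∀ xs → depth ψ ≤ maxDepth xs
  depthψ≤ [] = ≤-refl
  depthψ≤ (x ∷ xs) = ≤-trans (depthψ≤ xs) (m≤n⊔m _ _)

  depthφ≤ : ∀ {x} xs → x ∈ xs → depth (φ x) ≤ maxDepth xs
  depthφ≤ (x ∷ xs) (here refl) = m≤m⊔n _ _
  depthφ≤ (x ∷ xs) (there i) = ≤-trans (depthφ≤ xs i) (m≤n⊔m _ _)

  -- Registers for the two tuples, followed by room for the `k` nested loops that print a number,
  -- for the two variables of its comparison `below`, and for the quantifiers of any edge formula.
  D K″ : ℕ
  D = maxDepth (allFin c)
  K″ = k + (k + 0) + (k + (D + 2))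

  open LogicRuns a (2 + c) K″ g′ public

  level≤ : ∀ m → m ≤ k + (D + 2) → k + (k + 0) + m ≤ K
  level≤ m q = ≤-trans (+-monoʳ-≤ _ q) (n≤1+n _)

  one hash : Fin (2 + c)
  one = zero
  hash = suc zero

  below : ∀ {m} → Fin m → Form a (suc m)
  below i = ex (sum true (` zero) (` suc zero) (` suc (suc i)))

  -- Horner's scheme in unary: the code of the tail is printed `B` times, followed by the value of
  -- the head. A code can reach `B ^ k`, too large for a register, so it is never computed.
  valueM : ∀ {m j} → Vec (Fin m) j → Mach
  valueM [] = noM
  valueM {m} (i ∷ is) = seqM (forM m (valueM (Vec.map suc is))) (forM m (iteM (tstM (below i)) (outM one) noM))

  powerM : ℕ → ℕ → Mach
  powerM m zero = outM one
  powerM m (suc j) = forM m (powerM (suc m) j)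

  nestM : ℕ → ℕ → Mach → Mach
  nestM m zero P = P
  nestM m (suc j) P = nestM m j (forM (j + m) P)

  unaryM : ∀ {m j} → Vec (Fin m) j → Mach
  unaryM is = seqM (valueM is) (outM hash)

  edgeM : ∀ {m} → Vec (Fin m) k → Fin c → Mach → Mach
  edgeM is x T = seqM (unaryM is) (seqM (outM (suc (suc x))) (seqM T (outM hash)))

  sources : ∀ m → Vec (Fin (k + m)) k
  sources m = Vec.tabulate (_↑ˡ m)

  -- The target is bound by the inner loops, so its variables come first and those of the source are
  -- shifted by `k`. Having the sources in the outer loops is what sorts the edge list by source.
  outerM innerM : Mach
  innerM = List.foldr (λ x P → seqM (iteM (tstM (φ x)) (edgeM (Vec.map (k ↑ʳ_) (sources 0)) x (valueM (sources (k + 0)))) noM) P) noM (allFin c)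
  outerM = seqM (iteM (tstM ψ) (edgeM (sources 0) xf (powerM (k + 0) k)) noM) (nestM (k + 0) k innerM)

  headerM : Mach
  headerM = seqM (outM one) (seqM (powerM 0 k) (seqM (outM hash) (seqM (outM hash) (seqM (powerM 0 k) (outM hash)))))

  graphM : Mach
  graphM = seqM headerM (nestM 0 k outerM)

  ext : Vec ℕ k → Vec ℕ (k + 0)
  ext u = u Vec.++ []

  module _ (w : Word a) where

    N : ℕ
    N = B w ^ k

    edgeTo : Vec ℕ k → Vec ℕ k → Fin c → List (EdgeN c)
    edgeTo u v x = if does (sat? w (φ x) (v Vec.++ ext u)) then [ (code (B w) u , x , code (B w) v) ] else []

    edgesTo : Vec ℕ k → Vec ℕ k → List (EdgeN c)
    edgesTo u v = concatMap (edgeTo u v) (allFin c)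

    finalEdge : Vec ℕ k → List (EdgeN c)
    finalEdge u = if does (sat? w ψ (ext u)) then [ (code (B w) u , xf , N) ] else []

    edgesFrom : Vec ℕ k → List (EdgeN c)
    edgesFrom u = finalEdge u ++ concatMap (edgesTo u) (tuples (B w) k)

    edges : List (EdgeN c)
    edges = concatMap edgesFrom (tuples (B w) k)

    graphWord : Word (2 + c)
    graphWord = encodeN (suc N) 0 N edges

    private
      R : ∀ {m} → Vec ℕ m → Mach → Word (2 + c) → Set
      R ρ M o = ∃ λ e → Runs w ρ M o e

      emits : ∀ {m} {ρ : Vec ℕ m} {M o o′} → o ≡ o′ → R ρ M o → R ρ M o′
      emits refl r = r

      then : ∀ {m} {ρ : Vec ℕ m} {P Q o o′} → R ρ P o → R ρ Q o′ → R ρ (seqM P Q) (o ++ o′)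
      then {P = P} {Q} (_ , p) (_ , q) = _ , runs-seq w {P = P} {Q = Q} p q

      out : ∀ {m} {ρ : Vec ℕ m} y → R ρ (outM y) [ y ]
      out y = true , runs-out w y

      test : ∀ {m} (φ : Form a m) (ρ : Vec ℕ m) {P o} → m + depth φ ≤ K → R ρ P o →
             R ρ (iteM (tstM φ) P noM) (if does (sat? w φ ρ) then o else [])
      test φ ρ {P} q (e , p) with does (sat? w φ ρ) | runs-test w φ ρ q
      ... | true | t = e , runs-ite-true w {R = noM} t p
      ... | false | t = false , runs-ite-false w {Q = P} t (runs-no w)

    ones : ℕ → Word (2 + c)
    ones n = replicate n one

    value-runs : ∀ {m j} (ρ : Vec ℕ m) (is : Vec (Fin m) j) → m + j + 2 ≤ K → Bounded (B w) ρ →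
                 R ρ (valueM is) (ones (code (B w) (Vec.map (lookup ρ) is)))
    value-runs ρ [] q bρ = false , runs-no w
    value-runs {m} {suc j} ρ (i ∷ is) q bρ = emits sums (then
        {P = forM m (valueM (Vec.map suc is))} {Q = forM m (iteM (tstM (below i)) (outM one) noM)}
        (false , runs-for w (λ _ → ones (code (B w) (Vec.map (lookup ρ) is))) m<K
          (λ x x< → emits (cong (ones ∘ code (B w)) (weaken x is)) (value-runs (x ∷ ρ) (Vec.map suc is) q′ (x< , bρ))))
        (false , runs-for w (λ y → if does (sat? w (below i) (y ∷ ρ)) then [ one ] else []) m<K
          (λ y _ → test (below i) (y ∷ ρ) q″ (out one))))
      where
        q′ : suc m + j + 2 ≤ K
        q′ = ≤-trans (≤-reflexive (cong (_+ 2) (sym (+-suc m j)))) q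
        q″ : suc m + 1 ≤ K
        q″ = ≤-trans (+-mono-≤ (s≤s (m≤m+n m j)) (s≤s z≤n)) q′
        m<K : m < K
        m<K = ≤-trans (m≤m+n (suc m) 1) q″
        weaken : ∀ {j} x (is : Vec (Fin m) j) → Vec.map (lookup (x ∷ ρ)) (Vec.map suc is) ≡ Vec.map (lookup ρ) is
        weaken x [] = refl
        weaken x (i ∷ is) = cong (lookup ρ i ∷_) (weaken x is)
        lookup< : ∀ {m} (ρ : Vec ℕ m) → Bounded (B w) ρ → ∀ i → lookup ρ i < B w
        lookup< (_ ∷ _) (p , _) zero = p
        lookup< (_ ∷ ρ) (_ , b) (suc i) = lookup< ρ b i
        v = lookup ρ i
        cs = code (B w) (Vec.map (lookup ρ) is)
        to : ∀ y → Sat w (below i) (y ∷ ρ) → y < v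
        to y (d , _ , eq) = ≤-trans (m≤n+m (suc y) d) (≤-reflexive (trans (trans (+-suc d y) (+-comm 1 (d + y))) eq))
        from : ∀ y → y < v → Sat w (below i) (y ∷ ρ)
        from y p = v ∸ suc y , ≤-trans (s≤s (m∸n≤m v (suc y))) (lookup< ρ bρ i) ,
          trans (+-assoc (v ∸ suc y) y 1) (trans (cong (v ∸ suc y +_) (+-comm y 1)) (m∸n+n≡m p))
        sums : concatMap (λ _ → ones cs) (range 0 (B w)) ++ concatMap (λ y → if does (sat? w (below i) (y ∷ ρ)) then [ one ] else []) (range 0 (B w)) ≡ ones (v + B w * cs)
        sums = trans (cong₂ _++_ (concatMap-replicate one cs 0 (B w))
                 (concatMap-below one v (λ y → does (sat? w (below i) (y ∷ ρ))) (λ y t → to y (does-true (sat? w (below i) (y ∷ ρ)) t))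
                   (λ y f p → does-false (sat? w (below i) (y ∷ ρ)) f (from y p)) 0 (B w) (<⇒≤ (lookup< ρ bρ i))))
               (trans (replicate-+ (B w * cs) v one) (cong ones (+-comm (B w * cs) v)))

    power-runs : ∀ {m} j (ρ : Vec ℕ m) → m + j ≤ K → R ρ (powerM m j) (ones (B w ^ j))
    power-runs zero ρ q = out one
    power-runs {m} (suc j) ρ q = emits (concatMap-replicate one (B w ^ j) 0 (B w))
      (false , runs-for w (λ _ → ones (B w ^ j)) (≤-trans (s≤s (m≤m+n m j)) q′) (λ x _ → power-runs j (x ∷ ρ) q′))
      where
        q′ : suc m + j ≤ K
        q′ = ≤-trans (≤-reflexive (sym (+-suc m j))) q

    nest-runs : ∀ {m} j (ρ : Vec ℕ m) {P} (o : Vec ℕ j → Word (2 + c)) → j + m ≤ K →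
                (∀ u → Bounded (B w) u → R (u Vec.++ ρ) P (o u)) → R ρ (nestM m j P) (concatMap o (tuples (B w) j))
    nest-runs zero ρ o q body = emits (sym (++-identityʳ (o []))) (body [] tt)
    nest-runs {m} (suc j) ρ {P} o q body = emits fused
      (nest-runs j ρ {forM (j + m) P} (λ u → concatMap (λ x → o (x ∷ u)) (range 0 (B w))) (<⇒≤ q)
        (λ u bu → false , runs-for w (λ x → o (x ∷ u)) q (λ x x< → body (x ∷ u) (x< , bu))))
      where
        concatMap-cong : {A C : Set} {f h : A → List C} → (∀ x → f x ≡ h x) → ∀ xs → concatMap f xs ≡ concatMap h xs
        concatMap-cong p [] = refl
        concatMap-cong p (x ∷ xs) = cong₂ _++_ (p x) (concatMap-cong p xs)
        fused : concatMap (λ u → concatMap (λ x → o (x ∷ u)) (range 0 (B w))) (tuples (B w) j) ≡ concatMap o (tuples (B w) (suc j))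
        fused = sym (trans (concatMap-concatMap o _ (tuples (B w) j)) (concatMap-cong (λ u → concatMap-map o (_∷ u) (range 0 (B w))) (tuples (B w) j)))

    private
      enc1 : Vec ℕ k → Fin c → ℕ → Word (2 + c)
      enc1 u x t = encEdges [ (code (B w) u , x , t) ]

      Bounded-++ : ∀ {i j} (u : Vec ℕ i) (v : Vec ℕ j) → Bounded (B w) u → Bounded (B w) v → Bounded (B w) (u Vec.++ v)
      Bounded-++ [] v _ bv = bv
      Bounded-++ (x ∷ u) v (p , bu) bv = p , Bounded-++ u v bu bv

      sources-lookup : ∀ {m} (u : Vec ℕ k) (ρ : Vec ℕ m) → Vec.map (lookup (u Vec.++ ρ)) (sources m) ≡ u
      sources-lookup {m} u ρ = trans (sym (Vecₚ.tabulate-∘ (lookup (u Vec.++ ρ)) (_↑ˡ m)))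
        (trans (Vecₚ.tabulate-cong (Vecₚ.lookup-++ˡ u ρ)) (Vecₚ.tabulate∘lookup u))

      lookup-drop : ∀ {m j} (v : Vec ℕ k) (ρ : Vec ℕ m) (is : Vec (Fin m) j) →
                    Vec.map (lookup (v Vec.++ ρ)) (Vec.map (k ↑ʳ_) is) ≡ Vec.map (lookup ρ) is
      lookup-drop v ρ [] = refl
      lookup-drop v ρ (i ∷ is) = cong₂ _∷_ (Vecₚ.lookup-++ʳ v ρ i) (lookup-drop v ρ is)

      edge-runs : ∀ {m} (ρ : Vec ℕ m) (is : Vec (Fin m) k) (u : Vec ℕ k) x {T t} → Vec.map (lookup ρ) is ≡ u → m + k + 2 ≤ K → Bounded (B w) ρ →
                  R ρ T (ones t) → R ρ (edgeM is x T) (enc1 u x t)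
      edge-runs ρ is u x {T} {t} refl q bρ r = emits eq
        (then {P = unaryM is} {Q = seqM (outM (suc (suc x))) (seqM T (outM hash))}
          (then {P = valueM is} {Q = outM hash} (value-runs ρ is q bρ) (out hash))
          (then {P = outM (suc (suc x))} {Q = seqM T (outM hash)} (out _) (then {P = T} {Q = outM hash} r (out hash))))
        where
          eq : (ones (code (B w) u) ++ [ hash ]) ++ [ suc (suc x) ] ++ (ones t ++ [ hash ]) ≡ enc1 u x t
          eq = sym (++-identityʳ _)

      if-enc : ∀ (e : Bool) (x : EdgeN c) → (if e then encEdges [ x ] else []) ≡ encEdges (if e then [ x ] else [])
      if-enc true x = refl
      if-enc false x = refl

    inner-runs : ∀ u v → Bounded (B w) u → Bounded (B w) v → R (v Vec.++ ext u) innerM (encEdges (edgesTo u v))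
    inner-runs u v bu bv = go (allFin c) (λ i → i)
      where
        bρ : Bounded (B w) (v Vec.++ ext u)
        bρ = Bounded-++ v (ext u) bv (Bounded-++ u [] bu tt)
        room : k + (k + 0) + k + 2 ≤ K
        room = ≤-trans (≤-reflexive (+-assoc _ k 2)) (level≤ _ (+-monoʳ-≤ k (m≤n+m 2 D)))
        Px : Fin c → Mach
        Px x = iteM (tstM (φ x)) (edgeM (Vec.map (k ↑ʳ_) (sources 0)) x (valueM (sources (k + 0)))) noM
        go : ∀ xs → (∀ {x} → x ∈ xs → x ∈ allFin c) →
             R (v Vec.++ ext u) (List.foldr (λ x P → seqM (Px x) P) noM xs) (encEdges (concatMap (edgeTo u v) xs))
        go [] h = false , runs-no w
        go (x ∷ xs) h = emits (trans (cong (_++ encEdges (concatMap (edgeTo u v) xs)) (if-enc (does (sat? w (φ x) (v Vec.++ ext u))) _))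
                                     (sym (concatMap-++ encEdge (edgeTo u v x) (concatMap (edgeTo u v) xs))))
          (then {P = Px x} {Q = List.foldr (λ x P → seqM (Px x) P) noM xs}
            (test (φ x) (v Vec.++ ext u) (level≤ _ (≤-trans (depthφ≤ (allFin c) (h (here refl))) (≤-trans (m≤m+n D 2) (m≤n+m _ k))))
              (edge-runs (v Vec.++ ext u) _ u x (trans (lookup-drop v (ext u) (sources 0)) (sources-lookup u [])) room bρ
                (emits (cong (ones ∘ code (B w)) (sources-lookup v (ext u))) (value-runs (v Vec.++ ext u) (sources (k + 0)) room bρ))))
            (go xs (h ∘ there)))

    outer-runs : ∀ u → Bounded (B w) u → R (ext u) outerM (encEdges (edgesFrom u))
    outer-runs u bu = emits (trans (cong₂ _++_ (if-enc (does (sat? w ψ (ext u))) _) (sym (concatMap-concatMap encEdge (edgesTo u) (tuples (B w) k))))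
                                   (sym (concatMap-++ encEdge (finalEdge u) _)))
      (then {P = iteM (tstM ψ) (edgeM (sources 0) xf (powerM (k + 0) k)) noM} {Q = nestM (k + 0) k innerM}
        (test ψ (ext u) (lowLevel (depth ψ) (≤-trans (depthψ≤ (allFin c)) (≤-trans (m≤m+n D 2) (m≤n+m _ k))))
          (edge-runs (ext u) (sources 0) u xf (sources-lookup u []) (≤-trans (≤-reflexive (+-assoc (k + 0) k 2)) (lowLevel _ (+-monoʳ-≤ k (m≤n+m 2 D))))
            (Bounded-++ u [] bu tt) (power-runs k (ext u) (lowLevel k (m≤m+n k _)))))
        (nest-runs k (ext u) {innerM} (λ v → encEdges (edgesTo u v)) (≤-trans (m≤m+n _ _) (level≤ 0 z≤n))
          (λ v bv → inner-runs u v bu bv)))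
      where
        lowLevel : ∀ m → m ≤ k + (D + 2) → k + 0 + m ≤ K
        lowLevel m q = ≤-trans (+-monoˡ-≤ m (m≤n+m (k + 0) k)) (level≤ m q)

    private
      header : Word (2 + c) → Word (2 + c)
      header xs = one ∷ xs ++ hash ∷ hash ∷ xs ++ [ hash ]

      header-++ : ∀ xs z → header xs ++ z ≡ (one ∷ xs ++ [ hash ]) ++ [ hash ] ++ (xs ++ [ hash ]) ++ z
      header-++ xs z = cong (one ∷_) (trans (++-assoc xs _ z) (sym (++-assoc xs [ hash ] _)))

    header-runs : R [] headerM (header (ones N))
    header-runs = r₅
      where
        k≤K : 0 + k ≤ K
        k≤K = ≤-trans (m≤n+m k (k + (k + 0))) (level≤ k (m≤m+n k _))
        M₁ M₂ M₃ M₄ : Mach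
        M₁ = seqM (powerM 0 k) (outM hash)
        M₂ = seqM (outM hash) M₁
        M₃ = seqM (outM hash) M₂
        M₄ = seqM (powerM 0 k) M₃
        r₁ : R [] M₁ (ones N ++ [ hash ])
        r₁ = then {P = powerM 0 k} {Q = outM hash} (power-runs k [] k≤K) (out hash)
        r₂ : R [] M₂ (hash ∷ ones N ++ [ hash ])
        r₂ = then {P = outM hash} {Q = M₁} {o = [ hash ]} (out hash) r₁
        r₃ : R [] M₃ (hash ∷ hash ∷ ones N ++ [ hash ])
        r₃ = then {P = outM hash} {Q = M₂} {o = [ hash ]} (out hash) r₂
        r₄ : R [] M₄ (ones N ++ hash ∷ hash ∷ ones N ++ [ hash ])
        r₄ = then {P = powerM 0 k} {Q = M₃} {o = ones N} (power-runs k [] k≤K) r₃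
        r₅ : R [] headerM (header (ones N))
        r₅ = then {P = outM one} {Q = M₄} {o = [ one ]} (out one) r₄

    graph-runs : R [] graphM graphWord
    graph-runs = emits {M = graphM} (trans (header-++ (ones N) body) (cong (λ z → unary (suc N) ++ unary 0 ++ unary N ++ z) (sym (concatMap-concatMap encEdge edgesFrom (tuples (B w) k)))))
      (then {P = headerM} {Q = nestM 0 k outerM} {o = header (ones N)} {o′ = body} header-runs body-runs)
      where
        body : Word (2 + c)
        body = concatMap (λ u → encEdges (edgesFrom u)) (tuples (B w) k)
        k≤K : k + 0 ≤ K
        k≤K = ≤-trans (m≤n+m (k + 0) k) (≤-trans (m≤m+n (k + (k + 0)) 0) (level≤ 0 z≤n))
        body-runs : R [] (nestM 0 k outerM) body
        body-runs = nest-runs k [] {outerM} (λ u → encEdges (edgesFrom u)) k≤K outer-runs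

  graph-logspace : LogspaceComputable graphWord
  graph-logspace = logspaceComputable graphM graphWord λ w i cs l →
    let (e , r) = graph-runs w
        (i′ , cs′ , l′ , _ , x) = r i cs l tt
    in e , i′ , cs′ , l′ , x

∈-if⁻ : {A P : Set} (d : Dec P) {x y : A} → x ∈ (if does d then [ y ] else []) → x ≡ y × P
∈-if⁻ (yes p) (here refl) = refl , p

∈-if⁺ : {A P : Set} (d : Dec P) {y : A} → P → y ∈ (if does d then [ y ] else [])
∈-if⁺ (yes _) p = here refl
∈-if⁺ (no ¬p) p = ⊥-elim (¬p p)

∈-concat⁺ : {A B : Set} (f : A → List B) {x : A} {y : B} {xs : List A} → x ∈ xs → y ∈ f x → y ∈ concatMap f xs
∈-concat⁺ f i j = ∈-concatMap⁺ f (Any.map (λ { refl → j }) i)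

∈-concat⁻ : {A B : Set} (f : A → List B) {y : B} (xs : List A) → y ∈ concatMap f xs → ∃ λ x → x ∈ xs × y ∈ f x
∈-concat⁻ f xs i = find∈ (∈-concatMap⁻ f {xs = xs} i)

take-∈ : ∀ {c} {es rest : List (EdgeN c)} {p x q t y} → (p , x , q) ∈ es → InOrder rest q t y → InOrder (es ++ rest) p t (x ∷ y)
take-∈ {es = _ ∷ es} (here refl) r = take (skips es r)
take-∈ (there i) r = skip (take-∈ i r)

-- Paths of the printed graph as runs

module GraphRuns (a c k g′ : ℕ) (φ : Fin c → Form a (k + (k + 0))) (ψ : Form a (k + 0)) (xf : Fin c) where

  open Graph a c k g′ φ ψ xf public

  module _ (w : Word a) where

    -- Paths to the extra vertex `N`, read as computations on tuples; the numbering of the vertices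
    -- disappears from all later arguments.
    data Run (u : Vec ℕ k) : Word c → Set where
      accept : Sat w ψ (ext u) → Run u [ xf ]
      move   : ∀ {v x y} → Bounded (B w) v → Sat w (φ x) (v Vec.++ ext u) → Run v y → Run u (x ∷ y)

    vtx : Vec ℕ k → ℕ
    vtx = code (B w)

    data IsEdge : EdgeN c → Set where
      final : ∀ {u} → Bounded (B w) u → Sat w ψ (ext u) → IsEdge (vtx u , xf , N w)
      inner : ∀ {u v x} → Bounded (B w) u → Bounded (B w) v → Sat w (φ x) (v Vec.++ ext u) → IsEdge (vtx u , x , vtx v)

    ∈-edges⁻ : ∀ {e} → e ∈ edges w → IsEdge e
    ∈-edges⁻ i with ∈-concat⁻ (edgesFrom w) (tuples (B w) k) i
    ... | u , u∈ , j with ∈-++⁻ (finalEdge w u) j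
    ...   | inj₁ j′ with ∈-if⁻ (sat? w ψ (ext u)) j′
    ...     | refl , s = final (∈-tuples (B w) u u∈) s
    ∈-edges⁻ i | u , u∈ , j | inj₂ j′ with ∈-concat⁻ (edgesTo w u) (tuples (B w) k) j′
    ... | v , v∈ , l with ∈-concat⁻ (edgeTo w u v) (allFin c) l
    ...   | x , _ , l′ with ∈-if⁻ (sat? w (φ x) (v Vec.++ ext u)) l′
    ...     | refl , s = inner (∈-tuples (B w) u u∈) (∈-tuples (B w) v v∈) s

    ∈-final : ∀ {u} → Sat w ψ (ext u) → (vtx u , xf , N w) ∈ edgesFrom w u
    ∈-final {u} s = ∈-++⁺ˡ (∈-if⁺ (sat? w ψ (ext u)) s)

    ∈-inner : ∀ {u v x} → Bounded (B w) v → Sat w (φ x) (v Vec.++ ext u) → (vtx u , x , vtx v) ∈ edgesFrom w u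
    ∈-inner {u} {v} {x} bv s = ∈-++⁺ʳ (finalEdge w u) (∈-concat⁺ (edgesTo w u) (tuples-∈ (B w) v bv)
      (∈-concat⁺ (edgeTo w u v) (∈-allFin x) (∈-if⁺ (sat? w (φ x) (v Vec.++ ext u)) s)))

    vtx<N : ∀ u → Bounded (B w) u → vtx u < N w
    vtx<N = code< (B w)

    -- Codes of bounded tuples are injective and below `N`, so every vertex of the path other than
    -- `N` determines its tuple, and no edge leaves `N`.
    path→run : ∀ {u y} → Bounded (B w) u → PathN (edges w) (vtx u) (N w) y → Run u y
    path→run {u} bu p = go p refl {u} {bu} {refl}
      where
        stay-final : ∀ {p q y} → p ≡ N w → PathN (edges w) p q y → y ≡ []
        stay-final eq stopN = refl
        stay-final eq (stepN i _) with ∈-edges⁻ i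
        ... | final {u} bu _ = ⊥-elim (<-irrefl eq (vtx<N u bu))
        ... | inner {u} bu _ _ = ⊥-elim (<-irrefl eq (vtx<N u bu))
        go : ∀ {p t y} → PathN (edges w) p t y → t ≡ N w → ∀ {u} {bu : Bounded (B w) u} {eq : p ≡ vtx u} → Run u y
        go stopN refl {u} {bu} {eq} = ⊥-elim (<-irrefl (sym eq) (vtx<N u bu))
        go (stepN i r) et {u} {bu} {eq} with ∈-edges⁻ i
        ... | final {u′} bu′ s with code-injective (B w) u′ u bu′ bu eq
        ...   | refl with stay-final refl r
        ...     | refl = accept s
        go (stepN i r) et {u} {bu} {eq} | inner {u′} {v} bu′ bv s with code-injective (B w) u′ u bu′ bu eq
        ...   | refl = move bv s (go r et {v} {bv} {refl})

    module _ (increasing : ∀ {u v x} → Bounded (B w) u → Bounded (B w) v → Sat w (φ x) (v Vec.++ ext u) → vtx u < vtx v) where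

      private
        Up : List (Vec ℕ k) → Set
        Up us = ∀ {u v} → u ∈ us → Bounded (B w) v → vtx u < vtx v → v ∈ us

      -- Once an edge has been taken in the block of its source, the next vertex has a larger code,
      -- hence its block is still to come. `Up` records that the remaining list contains every tuple
      -- larger than one of its members.
      run→inOrder : ∀ {u y} → Bounded (B w) u → Run u y → InOrder (edges w) (vtx u) (N w) y
      run→inOrder {u} bu r = go (tuples (B w) k) (tuples-sorted (B w) k) (λ _ bv _ → tuples-∈ (B w) _ bv) bu (tuples-∈ (B w) u bu) r
        where
          Sorted : List (Vec ℕ k) → Set
          Sorted = AllPairs (λ u v → vtx u < vtx v)
          up-tail : ∀ {u₀ us} → Sorted (u₀ ∷ us) → Up (u₀ ∷ us) → Up us
          up-tail s h i bv lt with h (there i) bv lt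
          ... | here refl = ⊥-elim (<-asym lt (AllPairs-lookup s i))
          ... | there j = j
          go : ∀ us → Sorted us → Up us → ∀ {u y} → Bounded (B w) u → u ∈ us → Run u y → InOrder (concatMap (edgesFrom w) us) (vtx u) (N w) y
          go (u₀ ∷ us) s@(_ ∷ s′) h bu (there i) r = skips (edgesFrom w u₀) (go us s′ (up-tail s h) bu i r)
          go (u₀ ∷ us) s h bu (here refl) (accept p) = take-∈ (∈-final p) done
          go (u₀ ∷ us) s@(_ ∷ s′) h bu (here refl) (move bv p r) with h (here refl) bv (increasing bu bv p)
          ... | here refl = ⊥-elim (<-irrefl refl (increasing bu bv p))
          ... | there j = take-∈ (∈-inner bv p) (go us s′ (up-tail s h) bv j r)

      private
        u₀ : Vec ℕ k
        u₀ = Vec.replicate k 0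

        bounded₀ : ∀ k → Bounded (B w) (Vec.replicate k 0)
        bounded₀ zero = tt
        bounded₀ (suc k) = 0<B w , bounded₀ k

        code₀ : vtx u₀ ≡ 0
        code₀ = go k
          where
            go : ∀ k → code (B w) (Vec.replicate k 0) ≡ 0
            go zero = refl
            go (suc k) = trans (cong (B w *_) (go k)) (*-zeroʳ (B w))

      run₀→inOrder : ∀ {y} → Run u₀ y → InOrder (edges w) 0 (N w) y
      run₀→inOrder r = subst (λ p → InOrder (edges w) p (N w) _) code₀ (run→inOrder (bounded₀ k) r)

      path→run₀ : ∀ {y} → PathN (edges w) 0 (N w) y → Run u₀ y
      path→run₀ p = path→run (bounded₀ k) (subst (λ q → PathN (edges w) q (N w) _) (sym code₀) p)

      edges-inRange : inRange (suc (N w)) (edges w)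
      edges-inRange i with ∈-edges⁻ i
      ... | final {u} bu _ = m<n⇒m<1+n (vtx<N u bu) , ≤-refl
      ... | inner {u} {v} bu bv _ = m<n⇒m<1+n (vtx<N u bu) , m<n⇒m<1+n (vtx<N v bv)

      edges-increasing : ∀ {p x q} → (p , x , q) ∈ edges w → p < q
      edges-increasing i with ∈-edges⁻ i
      ... | final {u} bu _ = vtx<N u bu
      ... | inner {u} {v} bu bv s = increasing bu bv s

      path-increasing : ∀ {p q y} → PathN (edges w) p q y → p ≤ q
      path-increasing stopN = ≤-refl
      path-increasing (stepN i r) = ≤-trans (<⇒≤ (edges-increasing i)) (path-increasing r)

      graphInstance : Σ (Instance c) λ I → encode I ≡ graphWord w × (∀ {y} → PathN (edges w) 0 (N w) y → Path (Instance.E I) (Instance.s I) (Instance.t I) y)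
      graphInstance with finEdges (suc (N w)) (edges w) edges-inRange
      ... | E , eq = I , trans (encode-encodeN I) encodes , λ p → PathN→Path refl (Fin.toℕ-fromℕ (N w)) (subst (λ es → PathN es 0 (N w) _) (sym eq) p)
        where
          acyclic : ∀ v y → Path E v v y → y ≡ []
          acyclic v .[] stop = refl
          acyclic v _ (edge {m = m} i p) = ⊥-elim (<⇒≱ (edges-increasing (subst (_ ∈_) eq (∈-map⁺ edgeℕ i)))
            (path-increasing (subst (λ es → PathN es (toℕ m) (toℕ v) _) eq (Path→PathN p))))
          I : Instance c
          I = record { n = suc (N w) ; E = E ; s = zero ; t = fromℕ (N w) ; acyclic = acyclic }
          encodes : encodeN (suc (N w)) 0 (toℕ (fromℕ (N w))) (map edgeℕ E) ≡ graphWord w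
          encodes rewrite eq | Fin.toℕ-fromℕ (N w) = refl

      module _ (L : Language c) where

        dagreach→run : DAGREACH L (graphWord w) → ∃ λ y → Run u₀ y × L y
        dagreach→run (I , eq , y , p , l)
          with encodeN-injective (Instance.n I) (suc (N w)) (toℕ (Instance.s I)) 0 (toℕ (Instance.t I)) (N w) (map edgeℕ (Instance.E I)) (edges w) (trans (sym (encode-encodeN I)) eq)
        ... | _ , es , et , eE = y , path→run₀ (subst₂ (λ u v → PathN (edges w) u v y) es et
                                   (subst (λ E → PathN E (toℕ (Instance.s I)) (toℕ (Instance.t I)) y) eE (Path→PathN p))) , l

        run→dagreach : ∀ {y} → Run u₀ y → L y → DAGREACH L (graphWord w)
        run→dagreach r l = let (I , eq , f) = graphInstance in I , eq , _ , f (InOrder→PathN (run₀→inOrder r)) , l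

-- Linear-size derivations

module Pruning {a : ℕ} (G : CFG a) where

  open CFG G

  Sym : Set
  Sym = Fin N ⊎ Fin a

  data GenN : Fin N → Word a → ℕ → Set
  data SeqN : List Sym → Word a → ℕ → Set

  data GenN where
    applyN : ∀ {X rhs w m} → (X , rhs) ∈ rules → SeqN rhs w m → GenN X w (suc m)

  data SeqN where
    nilN  : SeqN [] [] 0
    termN : ∀ {x rest w m} → SeqN rest w m → SeqN (inj₂ x ∷ rest) (x ∷ w) (suc m)
    nontN : ∀ {Y rest u v m n} → GenN Y u m → SeqN rest v n → SeqN (inj₁ Y ∷ rest) (u ++ v) (m + n)

  -- Derivation trees in which a node and a proper ancestor with the same yield carry distinct
  -- nonterminals; S lists the ancestors with the same yield.
  data PGen (S : List (Fin N)) : Fin N → Word a → ℕ → Set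
  data PSeq (S : List (Fin N)) (W : Word a) : List Sym → Word a → ℕ → Set

  data PGen S where
    pgen : ∀ {X rhs w m} → ¬ (X ∈ S) → (X , rhs) ∈ rules → PSeq (X ∷ S) w rhs w m → PGen S X w (suc m)

  data PSeq S W where
    pnil  : PSeq S W [] [] 0
    pterm : ∀ {x rest w m} → PSeq S W rest w m → PSeq S W (inj₂ x ∷ rest) (x ∷ w) (suc m)
    same  : ∀ {Y rest v m n} → PGen S Y W m → PSeq S W rest v n → PSeq S W (inj₁ Y ∷ rest) (W ++ v) (m + n)
    short : ∀ {Y rest u v m n} → length u < length W → PGen [] Y u m → PSeq S W rest v n → PSeq S W (inj₁ Y ∷ rest) (u ++ v) (m + n)

  forgetG : ∀ {S X w m} → PGen S X w m → GenN X w m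
  forgetS : ∀ {S W β w m} → PSeq S W β w m → SeqN β w m
  forgetG (pgen _ i s) = applyN i (forgetS s)
  forgetS pnil = nilN
  forgetS (pterm s) = termN (forgetS s)
  forgetS (same t s) = nontN (forgetG t) (forgetS s)
  forgetS (short _ t s) = nontN (forgetG t) (forgetS s)

  _⊆_ : List (Fin N) → List (Fin N) → Set
  S ⊆ S′ = ∀ {X} → X ∈ S → X ∈ S′

  ⊆-∷ : ∀ {S S′ X} → S ⊆ S′ → (X ∷ S) ⊆ (X ∷ S′)
  ⊆-∷ h (here eq) = here eq
  ⊆-∷ h (there i) = there (h i)

  relaxG : ∀ {S S′ X w m} → S′ ⊆ S → PGen S X w m → PGen S′ X w m
  relaxS : ∀ {S S′ W β w m} → S′ ⊆ S → PSeq S W β w m → PSeq S′ W β w m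
  relaxG h (pgen n i s) = pgen (n ∘ h) i (relaxS (⊆-∷ h) s)
  relaxS h pnil = pnil
  relaxS h (pterm s) = pterm (relaxS h s)
  relaxS h (same t s) = same (relaxG h t) (relaxS h s)
  relaxS h (short l t s) = short l t (relaxS h s)

  Pruned : Fin N → Word a → Set
  Pruned X w = ∃ (PGen [] X w)

  -- A node labelled `X` among the descendants with the same yield already roots a pruned tree for
  -- `X`, which can replace the whole. If there is none, `X` may be added as the most distant
  -- ancestor, hence at the far end of the list.
  avoidG : ∀ X {S Y w m} → PGen S Y w m → Pruned X w ⊎ PGen (S ++ [ X ]) Y w m
  avoidS : ∀ X {S W β w m} → PSeq S W β w m → Pruned X W ⊎ PSeq (S ++ [ X ]) W β w m
  avoidG X {S} {Y} t@(pgen n i s) with Y Fin.≟ X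
  ... | yes refl = inj₁ (_ , relaxG (λ ()) t)
  ... | no Y≢X with avoidS X s
  ...   | inj₁ p = inj₁ p
  ...   | inj₂ s′ = inj₂ (pgen (λ j → [ n , (λ { (here eq) → Y≢X eq }) ]′ (∈-++⁻ S j)) i s′)
  avoidS X pnil = inj₂ pnil
  avoidS X (pterm s) = [ inj₁ , inj₂ ∘ pterm ]′ (avoidS X s)
  avoidS X (same t s) with avoidG X t | avoidS X s
  ... | inj₁ p | _ = inj₁ p
  ... | inj₂ _ | inj₁ p = inj₁ p
  ... | inj₂ t′ | inj₂ s′ = inj₂ (same t′ s′)
  avoidS X (short l t s) = [ inj₁ , inj₂ ∘ short l t ]′ (avoidS X s)

  factor-full : (p u v : Word a) → ¬ (length u < length (p ++ u ++ v)) → p ++ u ++ v ≡ u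
  factor-full [] u v h = go u v h
    where
      go : (u v : Word a) → ¬ (length u < length (u ++ v)) → u ++ v ≡ u
      go [] [] h = refl
      go [] (x ∷ v) h = ⊥-elim (h (s≤s z≤n))
      go (x ∷ u) v h = cong (x ∷_) (go u v (h ∘ s≤s))
  factor-full (x ∷ p) u v h = ⊥-elim (h (s≤s (≤-trans (m≤m+n (length u) (length v)) (≤-trans (m≤n+m _ (length p))
    (≤-reflexive (sym (trans (length-++ p) (cong (length p +_) (length-++ u)))))))))

  prune : ∀ {X w} → Gen G X w → Pruned X w
  -- `p` is the part of `W` produced by the siblings to the left. It is needed to see that a child
  -- whose yield is not shorter than `W` must produce all of `W`, by `factor-full`.
  pruneSeq : ∀ X {β w} W p → p ++ w ≡ W → GenSeq G β w → Pruned X W ⊎ ∃ (PSeq (X ∷ []) W β w)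
  prune {X} {w} (apply i s) with pruneSeq X w [] refl s
  ... | inj₁ t = t
  ... | inj₂ (m , s′) = suc m , pgen (λ ()) i s′
  pruneSeq X W p eq nil = inj₂ (_ , pnil)
  pruneSeq X W p eq (term {x} {w = w} s) with pruneSeq X W (p ++ [ x ]) (trans (++-assoc p [ x ] w) eq) s
  ... | inj₁ t = inj₁ t
  ... | inj₂ (m , s′) = inj₂ (_ , pterm s′)
  pruneSeq X W p eq (nont {Y} {u = u} {v} t s) with pruneSeq X W (p ++ u) (trans (++-assoc p u v) eq) s
  ... | inj₁ t = inj₁ t
  ... | inj₂ (n , s′) with prune t | length u <? length W
  ...   | m , t′ | yes l = inj₂ (_ , short l t′ s′)
  ...   | m , t′ | no l with trans (sym eq) (factor-full p u v (λ q → l (subst (λ z → length u < length z) eq q)))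
  ...     | refl with avoidG X t′
  ...       | inj₁ q = inj₁ q
  ...       | inj₂ t″ = inj₂ (_ , same t″ s′)

  maxLen : List (Fin N × List Sym) → ℕ
  maxLen [] = 0
  maxLen ((_ , rhs) ∷ rs) = length rhs ⊔ maxLen rs

  length≤maxLen : ∀ {X rhs} rs → (X , rhs) ∈ rs → length rhs ≤ maxLen rs
  length≤maxLen (_ ∷ rs) (here refl) = m≤m⊔n _ (maxLen rs)
  length≤maxLen ((_ , rhs) ∷ rs) (there i) = ≤-trans (length≤maxLen rs i) (m≤n⊔m (length rhs) _)

  r : ℕ
  r = maxLen rules

  -- The number of nodes of a tree of height `d` in which each node has at most `r` children. In a
  -- derivation of the empty word all nodes have the same yield, so the labels along a branch are
  -- distinct and `N` bounds the height.
  e : ℕ → ℕ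
  e zero = 0
  e (suc d) = suc (r * e d)

  e-mono : ∀ {d d′} → d ≤ d′ → e d ≤ e d′
  e-mono z≤n = z≤n
  e-mono (s≤s p) = s≤s (*-monoʳ-≤ r (e-mono p))

  -- The goal for a tree of size `m` with nonempty yield is `m + D ≤ 2 * D * length w`. `E` bounds a
  -- subtree with empty yield. `C` pays for one node of a chain of nodes with equal yield: the node
  -- itself, up to `r` empty children, and a lone terminal at the end. `D` pays for a whole chain,
  -- whose labels are distinct. Where the yield splits into two nonempty pieces, each saves one `D`;
  -- one of them pays for the chain above and the other remains saved.
  E C D : ℕ
  E = e N
  C = suc (suc (r * E))
  D = C * N

  Unique : List (Fin N) → Set
  Unique = AllPairs _≢_

  lookup-injective : ∀ {S} → Unique S → ∀ i j → List.lookup S i ≡ List.lookup S j → i ≡ j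
  lookup-injective (_ ∷ u) zero zero eq = refl
  lookup-injective {x ∷ S} (p ∷ u) zero (suc j) eq = ⊥-elim (All.lookup p (∈-lookup {xs = S} j) eq)
  lookup-injective {x ∷ S} (p ∷ u) (suc i) zero eq = ⊥-elim (All.lookup p (∈-lookup {xs = S} i) (sym eq))
  lookup-injective (_ ∷ u) (suc i) (suc j) eq = cong suc (lookup-injective u i j eq)

  unique-∷ : ∀ {X S} → ¬ (X ∈ S) → Unique S → Unique (X ∷ S)
  unique-∷ {X} n u = All.tabulate (λ i eq → n (subst (_∈ _) (sym eq) i)) ∷ u

  unique-length : ∀ {S} → Unique S → length S ≤ N
  unique-length u = Fin.injective⇒≤ (λ {i} {j} → lookup-injective u i j)

  -- Distinct labels number at most `N`, so a new label on the chain uses up one unit of the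
  -- allowance `d`. Termination of the size estimate along chains rests on this.
  spare : ∀ {X S d} → ¬ (X ∈ S) → Unique S → d + length S ≡ N → ∃ λ d′ → d ≡ suc d′ × d′ + length (X ∷ S) ≡ N
  spare {d = zero} n u eq = ⊥-elim (<-irrefl eq (unique-length (unique-∷ n u)))
  spare {S = S} {d = suc d′} n u eq = d′ , refl , trans (+-suc d′ (length S)) eq

  empty-boundG : ∀ {S X w m d} → PGen S X w m → w ≡ [] → Unique S → d + length S ≡ N → m ≤ e d
  empty-boundS : ∀ {S W β w m d} → PSeq S W β w m → W ≡ [] → w ≡ [] → Unique S → d + length S ≡ N → m ≤ length β * e d
  empty-boundG (pgen n i s) refl u eq with spare n u eq
  ... | d′ , refl , eq′ = s≤s (≤-trans (empty-boundS s refl refl (unique-∷ n u) eq′) (*-monoˡ-≤ (e d′) (length≤maxLen rules i)))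
  empty-boundS pnil _ _ u eq = z≤n
  empty-boundS (same t s) refl ev u eq = +-mono-≤ (empty-boundG t refl u eq) (empty-boundS s refl ev u eq)
  empty-boundS (short () t s) refl ev u eq

  Bound : List (Fin N) → Word a → ℕ → ℕ → Set
  Bound S w m d = (w ≡ [] × m ≤ E) ⊎ (0 < length w × m + 2 * D ≤ 2 * D * length w + C * d)

  Loose : Word a → ℕ → ℕ → Set
  Loose w m l = 0 < length w × m + D ≤ 2 * D * length w + l * E

  Tight : Word a → ℕ → ℕ → ℕ → Set
  Tight W m l d = m + 2 * D ≤ 2 * D * length W + C * d + l * E

  -- The three shapes of a sequence of siblings: all empty; nonempty with one `D` saved; or
  -- containing the child with the whole yield, which still has the allowance `C * d` of its chain
  -- to spend.
  data SeqBound (W w : Word a) (m l d : ℕ) : Set where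
    nothingB : w ≡ [] → m ≤ l * E → SeqBound W w m l d
    looseB   : Loose w m l → SeqBound W w m l d
    tightB   : length w ≡ length W → Tight W m l d → SeqBound W w m l d

  private
    by : ∀ {x y x′ y′} → x ≡ x′ → y ≡ y′ → x′ ≤ y′ → x ≤ y
    by refl refl p = p

  1≤D : 1 ≤ N → 1 ≤ D
  1≤D p = ≤-trans p (m≤m+n N _)

  0<N : 1 ≤ N
  0<N = ≤-trans (s≤s z≤n) (Fin.toℕ<n S)

  term-cost : ∀ (x : Fin a) → 1 + D ≤ 2 * D * length (x ∷ [])
  term-cost x = by refl (lem D) (+-monoˡ-≤ D (1≤D 0<N))
    where
      lem : ∀ D → 2 * D * 1 ≡ D + D
      lem = solve-∀

  module _ {W : Word a} where

    nil-case : ∀ {v : Word a} {m n l d} → n ≤ E → SeqBound W v m l d → SeqBound W v (n + m) (suc l) d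
    nil-case {l = l} q (nothingB ev p) = nothingB ev (+-mono-≤ q p)
    nil-case {v} {m} {n} {l} q (looseB (nz , p)) = looseB (nz , by (+-assoc n m D) (lem (2 * D * length v) E (l * E)) (+-mono-≤ q p))
      where
        lem : ∀ x y z → x + (y + z) ≡ y + (x + z)
        lem = solve-∀
    nil-case {v} {m} {n} {l} {d} q (tightB ev p) = tightB ev (by (+-assoc n m (2 * D)) (lem (2 * D * length W + C * d) E (l * E)) (+-mono-≤ q p))
      where
        lem : ∀ x y z → x + (y + z) ≡ y + (x + z)
        lem = solve-∀

    -- A nonempty piece u, of cost n, followed by v.
    piece-loose : ∀ (u v : Word a) m n l → n + D ≤ 2 * D * length u → (v ≡ [] × m ≤ l * E) ⊎ Loose v m l → 0 < length u → Loose (u ++ v) (n + m) (suc l)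
    piece-loose u _ m n l p (inj₁ (refl , q)) nz rewrite ++-identityʳ u =
      nz , by (lem n m D) refl (≤-trans (+-mono-≤ p q) (+-monoʳ-≤ (2 * D * length u) (m≤n+m (l * E) E)))
      where
        lem : ∀ n m D → n + m + D ≡ n + D + m
        lem = solve-∀
    piece-loose u v m n l p (inj₂ (nz′ , q)) nz rewrite length-++ u {v} =
      ≤-trans nz (m≤m+n _ _) , ≤-trans (m≤m+n (n + m + D) D) (by (lem n m D) (lem′ D (length u) (length v) (E + l * E)) (+-mono-≤ p (≤-trans q (+-monoʳ-≤ (2 * D * length v) (m≤n+m (l * E) E)))))
      where
        lem : ∀ n m D → n + m + D + D ≡ n + D + (m + D)
        lem = solve-∀
        lem′ : ∀ D u v z → 2 * D * (u + v) + z ≡ 2 * D * u + (2 * D * v + z)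
        lem′ = solve-∀

    piece-tight : ∀ (u v : Word a) m n l d → n + D ≤ 2 * D * length u → Loose v m l → length (u ++ v) ≡ length W → n + m + 2 * D ≤ 2 * D * length W + C * d + suc l * E
    piece-tight u v m n l d p (_ , q) eq rewrite sym eq | length-++ u {v} =
      ≤-trans (by (lem n m D) (lem′ D (length u) (length v) (E + l * E)) (+-mono-≤ p (≤-trans q (+-monoʳ-≤ (2 * D * length v) (m≤n+m (l * E) E)))))
              (+-monoˡ-≤ (E + l * E) (m≤m+n (2 * D * (length u + length v)) (C * d)))
      where
        lem : ∀ n m D → n + m + 2 * D ≡ n + D + (m + D)
        lem = solve-∀
        lem′ : ∀ D u v z → 2 * D * (u + v) + z ≡ 2 * D * u + (2 * D * v + z)
        lem′ = solve-∀

    same-case : ∀ {v : Word a} {m n l d} → Bound [] W n d → 0 < length W → length (W ++ v) ≤ length W → SeqBound W v m l d → length (W ++ v) ≡ length W × Tight W (n + m) (suc l) d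
    same-case (inj₁ (refl , _)) () _ _
    same-case {v} {m} {n} {l} {d} (inj₂ (nz , p)) _ le (nothingB refl q) = cong length (++-identityʳ W) ,
        (by (lem n m D) refl (≤-trans (+-mono-≤ p q) (+-monoʳ-≤ (2 * D * length W + C * d) (m≤n+m (l * E) E))))
      where
        lem : ∀ n m D → n + m + 2 * D ≡ n + 2 * D + m
        lem = solve-∀
    same-case {v} _ nz le (looseB (nz′ , _)) = ⊥-elim (<⇒≱ (m<m+n (length W) nz′) (≤-trans (≤-reflexive (sym (length-++ W {v}))) le))
    same-case {v} _ nz le (tightB ev _) = ⊥-elim (<⇒≱ (m<m+n (length W) (≤-trans nz (≤-reflexive (sym ev)))) (≤-trans (≤-reflexive (sym (length-++ W {v}))) le))

  full-bound : ∀ {S} w m → Bound S w m N → 0 < length w → m + D ≤ 2 * D * length w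
  full-bound _ _ (inj₁ (refl , _)) ()
  full-bound w m (inj₂ (_ , p)) _ = +-cancelʳ-≤ D _ _ (by (lem m D) refl p)
    where
      lem : ∀ m D → m + D + D ≡ m + 2 * D
      lem = solve-∀

  boundG : ∀ {S X w m d} → PGen S X w m → Unique S → d + length S ≡ N → Bound S w m d
  boundS : ∀ {S W β w m d} → PSeq S W β w m → 0 < length W → length w ≤ length W → Unique S → d + length S ≡ N → SeqBound W w m (length β) d
  -- A complete right-hand side has to save `D` twice. Two nonempty pieces save one `D` each. A
  -- single nonempty piece is either a child with the same yield, on which the chain continues, or a
  -- lone terminal, for which the final 1 is reserved.
  topS : ∀ {S W β w m d} → PSeq S W β w m → 0 < length W → length w ≡ length W → Unique S → d + length S ≡ N →
         m + 2 * D ≤ 2 * D * length W + C * d + length β * E + 1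

  boundG {w = []} t u eq = inj₁ (refl , ≤-trans (empty-boundG t refl u eq) (e-mono (≤-trans (m≤m+n _ _) (≤-reflexive eq))))
  boundG {w = w@(_ ∷ _)} (pgen {rhs = rhs} {m = m} n i s) u eq with spare n u eq
  ... | d′ , refl , eq′ = inj₂ (s≤s z≤n , ≤-trans (s≤s (topS s (s≤s z≤n) refl (unique-∷ n u) eq′))
          (by refl (lem (2 * D * length w) C d′) (≤-trans (≤-reflexive (lem₂ (2 * D * length w) (C * d′) (length rhs * E))) (+-monoʳ-≤ (2 * D * length w + C * d′) (s≤s (s≤s (*-monoˡ-≤ E (length≤maxLen rules i))))))))
    where
      lem : ∀ x C d → x + C * suc d ≡ x + C * d + C
      lem = solve-∀
      lem₂ : ∀ x y z → suc (x + y + z + 1) ≡ x + y + (2 + z)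
      lem₂ = solve-∀

  boundS pnil nz le u eq = nothingB refl z≤n
  boundS {W = W} {d = d} (pterm {x} {rest} {w} {m} s) nz le u eq with boundS s nz (<⇒≤ le) u eq
  ... | nothingB ev p = looseB (piece-loose {W} [ x ] w m 1 (length rest) (term-cost x) (inj₁ (ev , p)) (s≤s z≤n))
  ... | looseB p = looseB (piece-loose {W} [ x ] w m 1 (length rest) (term-cost x) (inj₂ p) (s≤s z≤n))
  ... | tightB ev _ = ⊥-elim (<-irrefl ev le)
  boundS {W = W} (same {rest = rest} {v = v} t s) nz le u eq =
    let (ev , p) = same-case {l = length rest} (boundG t u eq) nz le (boundS s nz (≤-trans (m≤n+m (length v) (length W)) (≤-trans (≤-reflexive (sym (length-++ W))) le)) u eq)
    in tightB ev p
  boundS {W = W} (short {u = []} l t s) nz le u eq = nil-case (empty-boundG t refl [] (+-identityʳ N)) (boundS s nz le u eq)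
  boundS {W = W} (short {rest = rest} {w₁@(_ ∷ _)} {v} {m} {n} l t s) nz le u eq
    with boundS s nz (≤-trans (m≤n+m (length v) (length w₁)) (≤-trans (≤-reflexive (sym (length-++ w₁))) le)) u eq
  ... | nothingB ev p = looseB (piece-loose {W} w₁ v n m (length rest) (full-bound {[]} w₁ m (boundG t [] (+-identityʳ N)) (s≤s z≤n)) (inj₁ (ev , p)) (s≤s z≤n))
  ... | looseB p = looseB (piece-loose {W} w₁ v n m (length rest) (full-bound {[]} w₁ m (boundG t [] (+-identityʳ N)) (s≤s z≤n)) (inj₂ p) (s≤s z≤n))
  ... | tightB ev _ = ⊥-elim (<⇒≱ (m<n+m (length v) {length w₁} (s≤s z≤n)) (≤-trans (≤-reflexive (sym (length-++ w₁))) (≤-trans le (≤-reflexive (sym ev)))))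

  topS pnil nz le u eq = ⊥-elim (<-irrefl le nz)
  topS {W = W} {d = d} (pterm {x} {rest} {w} {m} s) nz le u eq with boundS s nz (≤-trans (n≤1+n _) (≤-reflexive le)) u eq
  ... | nothingB refl p rewrite sym le = by refl (lem (2 * D * 1) (C * d) E (length rest * E))
          (≤-trans (s≤s (+-monoˡ-≤ (2 * D) p)) (by (lem₂ (length rest * E) D) refl (+-monoʳ-≤ (2 * D * 1 + length rest * E + 1) (z≤n {C * d + E}))))
    where
      lem : ∀ x y E z → x + y + (E + z) + 1 ≡ x + z + 1 + (y + E)
      lem = solve-∀
      lem₂ : ∀ z D → suc (z + 2 * D) ≡ 2 * D * 1 + z + 1 + 0
      lem₂ = solve-∀
  ... | looseB p = ≤-trans (piece-tight {W} [ x ] w m 1 (length rest) d (term-cost x) p le) (m≤m+n _ 1)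
  ... | tightB ev _ = ⊥-elim (<-irrefl (trans ev (sym le)) ≤-refl)
  topS {W = W} (same {rest = rest} {v = v} t s) nz le u eq = ≤-trans (proj₂ (same-case {l = length rest} (boundG t u eq) nz (≤-reflexive le)
    (boundS s nz (≤-trans (m≤n+m (length v) (length W)) (≤-trans (≤-reflexive (sym (length-++ W))) (≤-reflexive le))) u eq))) (m≤m+n _ 1)
  topS {W = W} {d = d} (short {rest = rest} {[]} {m = m} {n} l t s) nz le u eq =
    by (+-assoc m n (2 * D)) (lem (2 * D * length W + C * d) E (length rest * E)) (+-mono-≤ (empty-boundG t refl [] (+-identityʳ N)) (topS s nz le u eq))
    where
      lem : ∀ x y z → x + (y + z) + 1 ≡ y + (x + z + 1)
      lem = solve-∀
  topS {W = W} {d = d} (short {rest = rest} {w₁@(_ ∷ _)} {v} {m} {n} l t s) nz le u eq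
    with boundS s nz (≤-trans (m≤n+m (length v) (length w₁)) (≤-trans (≤-reflexive (sym (length-++ w₁))) (≤-reflexive le))) u eq
  ... | nothingB refl p = ⊥-elim (<-irrefl (trans (cong length (sym (++-identityʳ w₁))) le) l)
  ... | looseB p = ≤-trans (piece-tight {W} w₁ v n m (length rest) d (full-bound {[]} w₁ m (boundG t [] (+-identityʳ N)) (s≤s z≤n)) p le) (m≤m+n _ 1)
  ... | tightB ev _ = ⊥-elim (<⇒≱ (m<n+m (length v) {length w₁} (s≤s z≤n)) (≤-trans (≤-reflexive (sym (length-++ w₁))) (≤-trans (≤-reflexive le) (≤-reflexive (sym ev)))))

  costRate : ℕ
  costRate = 2 * D + E

  linear-derivation : ∀ {X w} → Gen G X w → ∃ λ m → GenN X w m × m ≤ costRate * suc (length w)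
  linear-derivation {w = w} t with prune t
  ... | m , p with boundG p [] (+-identityʳ N)
  ...   | inj₁ (refl , q) = m , forgetG p , ≤-trans q (≤-trans (m≤n+m E (2 * D)) (≤-reflexive (sym (*-identityʳ costRate))))
  ...   | inj₂ (nz , q) = m , forgetG p , ≤-trans (≤-trans (m≤m+n m D) (full-bound {[]} w m (inj₂ (nz , q)) nz))
            (≤-trans (*-monoʳ-≤ (2 * D) (n≤1+n (length w))) (*-monoˡ-≤ (suc (length w)) (m≤m+n (2 * D) E)))

  -- Runs of the top-down parser with its stack as first index. The count includes matches as well
  -- as expansions, because each of them will cost time in the configuration graph.
  data LM : List Sym → Word a → ℕ → Set where
    lnil  : LM [] [] 0
    lterm : ∀ {x γ o m} → LM γ o m → LM (inj₂ x ∷ γ) (x ∷ o) (suc m)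
    lrule : ∀ {X rhs γ o m} → (X , rhs) ∈ rules → LM (rhs ++ γ) o m → LM (inj₁ X ∷ γ) o (suc m)

  leftmostG : ∀ {X u m γ v n} → GenN X u m → LM γ v n → LM (inj₁ X ∷ γ) (u ++ v) (m + n)
  leftmostS : ∀ {β u m γ v n} → SeqN β u m → LM γ v n → LM (β ++ γ) (u ++ v) (m + n)
  leftmostG (applyN i s) l = lrule i (leftmostS s l)
  leftmostS nilN l = l
  leftmostS (termN s) l = lterm (leftmostS s l)
  leftmostS {γ = γ} {w} {k} (nontN {u = u} {v} {m} {n} t s) l =
    subst₂ (LM _) (sym (++-assoc u v w)) (sym (+-assoc m n k)) (leftmostG t (leftmostS s l))

  leftmost : ∀ {X w} → Gen G X w → ∃ λ m → LM [ inj₁ X ] w m × m ≤ costRate * suc (length w)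
  leftmost {w = w} t = let (m , g , q) = linear-derivation t in
    m , subst₂ (LM _) (++-identityʳ w) (+-identityʳ m) (leftmostG g lnil) , q

  seq-split : ∀ β {γ o} → GenSeq G (β ++ γ) o → ∃ λ u → ∃ λ v → o ≡ u ++ v × GenSeq G β u × GenSeq G γ v
  seq-split [] s = [] , _ , refl , nil , s
  seq-split (inj₂ x ∷ β) (term s) = let (u , v , eq , p , q) = seq-split β s in x ∷ u , v , cong (x ∷_) eq , term p , q
  seq-split (inj₁ Y ∷ β) (nont {u = u₁} t s) = let (u , v , eq , p , q) = seq-split β s in
    u₁ ++ u , v , trans (cong (u₁ ++_) eq) (sym (++-assoc u₁ u v)) , nont t p , q

-- Hardness

pattern blankL = zero
pattern pushA = suc zero
pattern pushB = suc (suc zero)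
pattern popA = suc (suc (suc zero))
pattern popB = suc (suc (suc (suc zero)))
pattern endL = suc (suc (suc (suc (suc zero))))

-- Stack symbols: 0 is the bottom, 1 and 2 are the brackets A and B.
dyckδ : Fin 2 → Fin 6 → Fin 3 → Maybe (Fin 2 × List (Fin 3))
dyckδ zero blankL X = just (zero , [ X ])
dyckδ zero pushA X = just (zero , suc zero ∷ X ∷ [])
dyckδ zero pushB X = just (zero , suc (suc zero) ∷ X ∷ [])
dyckδ zero popA (suc zero) = just (zero , [])
dyckδ zero popB (suc (suc zero)) = just (zero , [])
dyckδ zero endL zero = just (suc zero , [])
dyckδ _ _ _ = nothing

dyckPDA : DPDA 6
dyckPDA = record
  { Q = 2 ; Γ = 3 ; q₀ = zero ; Z₀ = zero
  ; final = λ { zero → false ; (suc _) → true }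
  ; δ = dyckδ ; δε = λ _ _ → nothing ; deterministic = λ _ _ _ → inj₁ refl }

-- Acceptance from the stack `σ`, with the bottom symbol left implicit, as a family in which the
-- label determines the stack move and can be inverted by matching.
data Dyck : List Bool → Word 6 → Set where
  close : Dyck [] [ endL ]
  idle  : ∀ {σ y} → Dyck σ y → Dyck σ (blankL ∷ y)
  push-A : ∀ {σ y} → Dyck (false ∷ σ) y → Dyck σ (pushA ∷ y)
  push-B : ∀ {σ y} → Dyck (true ∷ σ) y → Dyck σ (pushB ∷ y)
  pop-A : ∀ {σ y} → Dyck σ y → Dyck (false ∷ σ) (popA ∷ y)
  pop-B : ∀ {σ y} → Dyck σ y → Dyck (true ∷ σ) (popB ∷ y)

bracket : Bool → Fin 3
bracket false = suc zero
bracket true = suc (suc zero)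

stack : List Bool → List (Fin 3)
stack σ = map bracket σ ++ [ zero ]

dyck-run : ∀ {σ y} → Dyck σ y → Star (PStep dyckPDA) (zero , y , stack σ) (suc zero , [] , [])
dyck-run close = read refl ◅ ε
dyck-run {[]} (idle d) = read refl ◅ dyck-run d
dyck-run {_ ∷ _} (idle d) = read refl ◅ dyck-run d
dyck-run {[]} (push-A d) = read refl ◅ dyck-run d
dyck-run {_ ∷ _} (push-A d) = read refl ◅ dyck-run d
dyck-run {[]} (push-B d) = read refl ◅ dyck-run d
dyck-run {_ ∷ _} (push-B d) = read refl ◅ dyck-run d
dyck-run (pop-A d) = read refl ◅ dyck-run d
dyck-run (pop-B d) = read refl ◅ dyck-run d

run-dyck : ∀ σ y {s γ q} → s ≡ stack σ → Star (PStep dyckPDA) (zero , y , s) (q , [] , γ) → DPDA.final dyckPDA q ≡ true → Dyck σ y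
run-dyck σ y eq ε ()
run-dyck [] _ refl (read {x = blankL} refl ◅ r) f = idle (run-dyck [] _ refl r f)
run-dyck (b ∷ σ) _ refl (read {x = blankL} refl ◅ r) f = idle (run-dyck (b ∷ σ) _ refl r f)
run-dyck [] _ refl (read {x = pushA} refl ◅ r) f = push-A (run-dyck (false ∷ []) _ refl r f)
run-dyck (b ∷ σ) _ refl (read {x = pushA} refl ◅ r) f = push-A (run-dyck (false ∷ b ∷ σ) _ refl r f)
run-dyck [] _ refl (read {x = pushB} refl ◅ r) f = push-B (run-dyck (true ∷ []) _ refl r f)
run-dyck (b ∷ σ) _ refl (read {x = pushB} refl ◅ r) f = push-B (run-dyck (true ∷ b ∷ σ) _ refl r f)
run-dyck (false ∷ σ) _ refl (read {x = popA} refl ◅ r) f = pop-A (run-dyck σ _ refl r f)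
run-dyck (true ∷ σ) _ refl (read {x = popB} refl ◅ r) f = pop-B (run-dyck σ _ refl r f)
run-dyck [] _ refl (read {x = endL} refl ◅ ε) f = close
run-dyck [] _ refl (read {x = endL} refl ◅ (() ◅ r)) f
run-dyck [] _ refl (read {x = popA} () ◅ r) f
run-dyck [] _ refl (read {x = popB} () ◅ r) f
run-dyck (false ∷ σ) _ refl (read {x = popB} () ◅ r) f
run-dyck (true ∷ σ) _ refl (read {x = popA} () ◅ r) f
run-dyck (false ∷ σ) _ refl (read {x = endL} () ◅ r) f
run-dyck (true ∷ σ) _ refl (read {x = endL} () ◅ r) f
run-dyck [] _ refl (eps () ◅ r) f
run-dyck (_ ∷ _) _ refl (eps () ◅ r) f

-- Symbols as blocks of brackets: symbol number i is A^i B, top first.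
module Blocks {Sy : Set} (ix : Sy → ℕ) (ix-injective : ∀ {s t} → ix s ≡ ix t → s ≡ t) where

  block : ℕ → List Bool → List Bool
  block i σ = replicate i false ++ true ∷ σ

  blocks : List Sy → List Bool
  blocks [] = []
  blocks (s ∷ γ) = block (ix s) (blocks γ)

  pushW popW : Sy → Word 6
  pushW s = pushB ∷ replicate (ix s) pushA
  popW s = replicate (ix s) popA ++ [ popB ]

  -- The last symbol is pushed first, so that the head of the list ends on top.
  pushAll : List Sy → Word 6
  pushAll [] = []
  pushAll (s ∷ γ) = pushAll γ ++ pushW s

  pushAs⁺ : ∀ i {σ y} → Dyck (replicate i false ++ σ) y → Dyck σ (replicate i pushA ++ y)
  pushAs⁺ zero d = d
  pushAs⁺ (suc i) {σ} {y} d = push-A (pushAs⁺ i (subst (λ τ → Dyck τ y) (shift i) d))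
    where
      shift : ∀ i → false ∷ replicate i false ++ σ ≡ replicate i false ++ false ∷ σ
      shift zero = refl
      shift (suc i) = cong (false ∷_) (shift i)

  pushAs⁻ : ∀ i {σ y} → Dyck σ (replicate i pushA ++ y) → Dyck (replicate i false ++ σ) y
  pushAs⁻ zero d = d
  pushAs⁻ (suc i) {σ} {y} (push-A d) = subst (λ τ → Dyck τ y) (shift i) (pushAs⁻ i d)
    where
      shift : ∀ i → replicate i false ++ false ∷ σ ≡ false ∷ replicate i false ++ σ
      shift zero = refl
      shift (suc i) = cong (false ∷_) (shift i)

  pushAll⁺ : ∀ β {γ y} → Dyck (blocks (β ++ γ)) y → Dyck (blocks γ) (pushAll β ++ y)
  pushAll⁺ [] d = d
  pushAll⁺ (s ∷ β) {γ} {y} d = subst (Dyck (blocks γ)) (sym (++-assoc (pushAll β) (pushW s) y))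
    (pushAll⁺ β (push-B (pushAs⁺ (ix s) d)))

  pushAll⁻ : ∀ β {γ y} → Dyck (blocks γ) (pushAll β ++ y) → Dyck (blocks (β ++ γ)) y
  pushAll⁻ [] d = d
  pushAll⁻ (s ∷ β) {γ} {y} d with pushAll⁻ β {γ} (subst (Dyck (blocks γ)) (++-assoc (pushAll β) (pushW s) y) d)
  ... | push-B d′ = pushAs⁻ (ix s) d′

  popW⁺ : ∀ s {γ y} → Dyck (blocks γ) y → Dyck (blocks (s ∷ γ)) (popW s ++ y)
  popW⁺ s {γ} {y} d = go (ix s)
    where
      go : ∀ i → Dyck (block i (blocks γ)) ((replicate i popA ++ [ popB ]) ++ y)
      go zero = pop-B d
      go (suc i) = pop-A (go i)

  -- Blocks form a prefix code: popping the block of `s` can succeed only against an equal block,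
  -- and injectivity of `ix` then identifies the symbol.
  popW⁻ : ∀ s γ {y} → Dyck (blocks γ) (popW s ++ y) → ∃ λ γ′ → γ ≡ s ∷ γ′ × Dyck (blocks γ′) y
  popW⁻ s [] d = ⊥-elim (stuck (ix s) d)
    where
      stuck : ∀ i {y} → ¬ Dyck [] ((replicate i popA ++ [ popB ]) ++ y)
      stuck zero ()
      stuck (suc i) ()
  popW⁻ s (t ∷ γ) {y} d = let (eq , d′) = go (ix s) (ix t) d in γ , cong (_∷ γ) (sym (ix-injective eq)) , d′
    where
      go : ∀ i j → Dyck (block j (blocks γ)) ((replicate i popA ++ [ popB ]) ++ y) → i ≡ j × Dyck (blocks γ) y
      go zero zero (pop-B d) = refl , d
      go (suc i) (suc j) (pop-A d) = let (eq , d′) = go i j d in cong suc eq , d′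

-- Numerical codes of tapes and formulas that decode them

-- Lists as numbers in base suc n with nonzero digits, hence injectively.
codeD : ∀ {n} → List (Fin n) → ℕ
codeD [] = 0
codeD {n} (x ∷ l) = suc (toℕ x) + suc n * codeD l

-- Since a digit is never 0, a code with a nonzero lowest digit belongs to a nonempty list. A single
-- equation with `linF` can therefore split off a tape cell or a pending bracket.
codeD-∷ : ∀ {n} (x : Fin n) m l → codeD l ≡ suc (toℕ x) + suc n * m → ∃ λ l′ → l ≡ x ∷ l′ × m ≡ codeD l′
codeD-∷ {n} x m (y ∷ l) eq with digit-unique {suc n} (suc (toℕ y)) (suc (toℕ x)) (codeD l) m
  (≤-trans (s≤s (Fin.toℕ<n y)) (m≤m+n (suc n) (suc n))) (s≤s (Fin.toℕ<n x)) eq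
... | inj₁ (e , e′) = l , cong (_∷ l) (Fin.toℕ-injective (suc-injective e)) , sym e′
... | inj₂ (e , _) = ⊥-elim (<⇒≱ (s≤s (Fin.toℕ<n y)) (≤-trans (m≤n+m (suc n) (suc (toℕ x))) (≤-reflexive (sym e))))

codeD-[] : ∀ {n} (l : List (Fin n)) → codeD l ≡ 0 → l ≡ []
codeD-[] [] _ = refl

codeD-injective : ∀ {n} (l l′ : List (Fin n)) → codeD l ≡ codeD l′ → l ≡ l′
codeD-injective l [] eq = codeD-[] l eq
codeD-injective l (x ∷ l′) eq with codeD-∷ x (codeD l′) l eq
... | l₁ , refl , eq′ = cong (x ∷_) (codeD-injective l₁ l′ (sym eq′))

codeD< : ∀ {n} (l : List (Fin n)) → codeD l < suc n ^ length l
codeD< [] = ≤-refl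
codeD< {n} (x ∷ l) = ≤-trans (s≤s (+-monoˡ-≤ (suc n * codeD l) (Fin.toℕ<n x)))
  (≤-trans (≤-reflexive (sym (*-suc (suc n) (codeD l)))) (*-monoʳ-≤ (suc n) (codeD< l)))

eqF sucF : ∀ {a m} → Fin m → Fin m → Form a m
eqF x y = sum false (` x) `0 (` y)
sucF x y = sum true (` x) `0 (` y)

zeroF : ∀ {a m} → Fin m → Form a m
zeroF x = sum false `0 `0 (` x)

falseF : ∀ {a m} → Form a m
falseF = sum true `0 `0 `0

-- z = c + m y
linF : ∀ {a j} → ℕ → ℕ → Fin j → Fin j → Form a j
linF zero zero y z = zeroF z
linF zero (suc m) y z = ex (sum false (` suc y) (` zero) (` suc z) and linF zero m (suc y) zero)
linF (suc c) m y z = ex (sucF zero (suc z) and linF c m (suc y) zero)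

constF : ∀ {a j} → ℕ → Fin j → Form a j
constF c z = linF c 0 z z

orMap : ∀ {A : Set} {a m} → List A → (A → Form a m) → Form a m
orMap [] f = falseF
orMap (x ∷ xs) f = f x or orMap xs f

sameSym : ∀ {a} → InSym a → InSym a → Bool
sameSym lend lend = true
sameSym rend rend = true
sameSym (letter x) (letter y) = does (x Fin.≟ y)
sameSym _ _ = false

sameSym⇒ : ∀ {a} (σ τ : InSym a) → sameSym σ τ ≡ true → τ ≡ σ
sameSym⇒ lend lend _ = refl
sameSym⇒ rend rend _ = refl
sameSym⇒ (letter x) (letter y) p with x Fin.≟ y
... | yes refl = refl
... | no _ = case p of λ ()

sameSym-refl : ∀ {a} (σ : InSym a) → sameSym σ σ ≡ true
sameSym-refl lend = refl
sameSym-refl rend = refl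
sameSym-refl (letter x) with x Fin.≟ x
... | yes _ = refl
... | no ne = ⊥-elim (ne refl)

-- Meaning of the arithmetical formulas

module FormulaSemantics {a : ℕ} (w : Word a) (B : ℕ) where

  open Semantics w B

  module At {m : ℕ} (ρ : Vec ℕ m) where

    eq⇒ : ∀ x y → Sat (eqF x y) ρ → lookup ρ x ≡ lookup ρ y
    eq⇒ x y s = trans (sym (trans (+-identityʳ _) (+-identityʳ _))) s

    eq⇐ : ∀ x y → lookup ρ x ≡ lookup ρ y → Sat (eqF x y) ρ
    eq⇐ x y s = trans (trans (+-identityʳ _) (+-identityʳ _)) s

    suc⇒ : ∀ x y → Sat (sucF x y) ρ → suc (lookup ρ x) ≡ lookup ρ y
    suc⇒ x y s = trans (sym (trans (+-comm _ 1) (cong suc (+-identityʳ _)))) s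

    suc⇐ : ∀ x y → suc (lookup ρ x) ≡ lookup ρ y → Sat (sucF x y) ρ
    suc⇐ x y s = trans (trans (+-comm _ 1) (cong suc (+-identityʳ _))) s

    or⇒ : ∀ {A : Set} (xs : List A) f → Sat (orMap xs f) ρ → ∃ λ x → x ∈ xs × Sat (f x) ρ
    or⇒ (x ∷ xs) f (inj₁ s) = x , here refl , s
    or⇒ (x ∷ xs) f (inj₂ s) = let (y , i , t) = or⇒ xs f s in y , there i , t

    or⇐ : ∀ {A : Set} {xs : List A} {x} f → x ∈ xs → Sat (f x) ρ → Sat (orMap xs f) ρ
    or⇐ f (here refl) s = inj₁ s
    or⇐ f (there i) s = inj₂ (or⇐ f i s)

  lin⇒ : ∀ {j} (ρ : Vec ℕ j) c m y z → Sat (linF c m y z) ρ → lookup ρ z ≡ c + m * lookup ρ y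
  lin⇒ ρ zero zero y z s = sym s
  lin⇒ ρ zero (suc m) y z (t , _ , s , r) = trans (sym s) (trans (+-identityʳ _) (cong (lookup ρ y +_) (lin⇒ (t ∷ ρ) zero m (suc y) zero r)))
  lin⇒ ρ (suc c) m y z (t , _ , s , r) = trans (sym (At.suc⇒ (t ∷ ρ) zero (suc z) s)) (cong suc (lin⇒ (t ∷ ρ) c m (suc y) zero r))

  -- The quantified values are partial results and do not exceed the value of `z`, so one bound on
  -- `z` keeps all of them in the range of the quantifiers.
  lin⇐ : ∀ {j} (ρ : Vec ℕ j) c m y z → lookup ρ z < B → lookup ρ z ≡ c + m * lookup ρ y → Sat (linF c m y z) ρ
  lin⇐ ρ zero zero y z q eq = sym eq
  lin⇐ ρ zero (suc m) y z q eq = m * lookup ρ y , t< , trans (+-identityʳ _) (sym eq) , lin⇐ _ zero m (suc y) zero t< refl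
    where
      t< : m * lookup ρ y < B
      t< = ≤-trans (s≤s (≤-trans (m≤n+m _ (lookup ρ y)) (≤-reflexive (sym eq)))) q
  lin⇐ ρ (suc c) m y z q eq = c + m * lookup ρ y , t< , At.suc⇐ (_ ∷ ρ) zero (suc z) (sym eq) , lin⇐ _ c m (suc y) zero t< refl
    where
      t< : c + m * lookup ρ y < B
      t< = ≤-trans (≤-reflexive (sym eq)) (<⇒≤ q)

  const⇒ : ∀ {j} (ρ : Vec ℕ j) c z → Sat (constF c z) ρ → lookup ρ z ≡ c
  const⇒ ρ c z s = trans (lin⇒ ρ c 0 z z s) (+-identityʳ c)

  const⇐ : ∀ {j} (ρ : Vec ℕ j) c z → lookup ρ z < B → lookup ρ z ≡ c → Sat (constF c z) ρ
  const⇐ ρ c z q eq = lin⇐ ρ c 0 z z q (trans eq (sym (+-identityʳ c)))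

allSyms : ∀ {a} → List (InSym a)
allSyms = lend ∷ rend ∷ map letter (allFin _)

∈-allSyms : ∀ {a} (σ : InSym a) → σ ∈ allSyms
∈-allSyms lend = here refl
∈-allSyms rend = there (here refl)
∈-allSyms (letter x) = there (there (∈-map⁺ letter (∈-allFin x)))

module _ {a : ℕ} (w : Word a) where

  readInput-rend⇒ : ∀ i → readInput w i ≡ rend → length w < i
  readInput-rend⇒ = go w
    where
      go : ∀ (w : Word a) i → readInput w i ≡ rend → length w < i
      go [] (suc i) _ = s≤s z≤n
      go (x ∷ w) (suc (suc i)) eq = s≤s (go w (suc i) eq)

  readInput-rend⇐ : ∀ i → length w < i → readInput w i ≡ rend
  readInput-rend⇐ = go w
    where
      go : ∀ (w : Word a) i → length w < i → readInput w i ≡ rend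
      go [] (suc i) _ = refl
      go (x ∷ w) (suc (suc i)) (s≤s p) = go w (suc i) p

  moveIn-inside : ∀ i → readInput w i ≢ rend → moveIn (length w) right i ≡ suc i
  moveIn-inside i ne with i <ᵇ suc (length w) in eq
  ... | true = refl
  ... | false = ⊥-elim (ne (readInput-rend⇐ i (≮⇒≥ (λ p → case trans (sym (<ᵇ-true p)) eq of λ ()))))
    where
      <ᵇ-true : ∀ {m n} → m < n → (m <ᵇ n) ≡ true
      <ᵇ-true {m} {n} p with m <ᵇ n | <⇒<ᵇ p
      ... | true | _ = refl

  moveIn-end : ∀ i → readInput w i ≡ rend → moveIn (length w) right i ≡ i
  moveIn-end i e with i <ᵇ suc (length w) in eq
  ... | false = refl
  ... | true = ⊥-elim (<⇒≱ (readInput-rend⇒ i e) (≤-pred (<ᵇ⇒< i (suc (length w)) (subst T (sym eq) tt))))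

-- Configuration graph of a reduction followed by a parser

module Hardness {a bt : ℕ} (T : Transducer a bt) (G : CFG bt) where

  open Transducer T renaming (Q to QT; W to WT; start to qT; δ to δT)
  open CFG G renaming (S to S₀)
  open Pruning G public

  ix : Sym → ℕ
  ix (inj₁ X) = toℕ X
  ix (inj₂ x) = N + toℕ x

  ix-injective : ∀ {s t} → ix s ≡ ix t → s ≡ t
  ix-injective {inj₁ X} {inj₁ Y} eq = cong inj₁ (Fin.toℕ-injective eq)
  ix-injective {inj₁ X} {inj₂ y} eq = ⊥-elim (<⇒≱ (Fin.toℕ<n X) (≤-trans (m≤m+n N _) (≤-reflexive (sym eq))))
  ix-injective {inj₂ x} {inj₁ Y} eq = ⊥-elim (<⇒≱ (Fin.toℕ<n Y) (≤-trans (m≤m+n N _) (≤-reflexive eq)))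
  ix-injective {inj₂ x} {inj₂ y} eq = cong inj₂ (Fin.toℕ-injective (+-cancelˡ-≡ N _ _ eq))

  open Blocks ix ix-injective public

  base : ℕ
  base = suc (suc WT)

  -- A configuration without the output tape: the output may be longer than logarithmic space allows
  -- and is handed to the parser symbol by symbol.
  record Core : Set where
    constructor core
    field
      state : Fin QT
      hpos  : ℕ
      lcell : List (Fin (suc WT))
      cell  : Fin (suc WT)
      rcell : List (Fin (suc WT))
  open Core

  Action : Set
  Action = Fin QT × Fin (suc WT) × Move × Move × Maybe (Fin bt)

  advance : ℕ → Core → Action → Core × Maybe (Fin bt)
  advance n (core q i l c r) (q′ , c′ , mi , mw , y) =
    let (l′ , c″ , r′) = moveWork T mw l c′ r in core q′ (moveIn n mi i) l′ c″ r′ , y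

  nextCore : Word a → Core → Maybe (Core × Maybe (Fin bt))
  nextCore w c = Maybe.map (advance (length w) c) (δT (state c) (readInput w (hpos c)) (cell c))

  initCore : Core
  initCore = core qT 0 [] zero []

  outW : Maybe (Fin bt) → Word 6
  outW nothing = []
  outW (just y) = popW (inj₂ y)

  ruleW : Fin N × List Sym → Word 6
  ruleW (X , rhs) = popW (inj₁ X) ++ pushAll rhs

  -- π is the bracket word still to be emitted.
  rep : ℕ → Core → Word 6 → Vec ℕ 7
  -- The successor leaves state code 0 to the origin. The clock stands last and is thus the most
  -- significant digit of the vertex.
  rep τ (core q i l c r) π = codeD π ∷ codeD r ∷ toℕ c ∷ codeD l ∷ i ∷ suc (toℕ q) ∷ τ ∷ []

  -- A turn either advances the transducer, and pops the terminal it emits, or expands a nonterminal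
  -- on the stack. The choice is free because vertices do not contain the stack; wrong choices are
  -- excluded by the bracket word alone.
  data Turn (w : Word a) (c : Core) : Core → Word 6 → Set where
    tstepM : ∀ {c′ y} → nextCore w c ≡ just (c′ , y) → Turn w c c′ (outW y)
    ruleM  : ∀ {ρ} → ρ ∈ rules → Turn w c c (ruleW ρ)

  F : Set
  F = Form a 14

  private
    -- Primed variables are those of the target configuration.
    p′ r′ c′ l′ i′ q′ τ′ p r₁ c l i q τ : Fin 14
    p′ = # 0
    r′ = # 1
    c′ = # 2
    l′ = # 3
    i′ = # 4
    q′ = # 5
    τ′ = # 6
    p = # 7
    r₁ = # 8
    c = # 9
    l = # 10
    i = # 11
    q = # 12
    τ = # 13

  entries : List (Fin QT × InSym a × Fin (suc WT))
  entries = concatMap (λ q → concatMap (λ σ → map (λ c → q , σ , c) (allFin _)) allSyms) (allFin _)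

  ∈-entries : ∀ q σ c → (q , σ , c) ∈ entries
  ∈-entries q σ c = ∈-concat⁺ _ (∈-allFin q) (∈-concat⁺ (λ σ → map (λ c → q , σ , c) (allFin _)) (∈-allSyms σ) (∈-map⁺ (λ c → q , σ , c) (∈-allFin c)))

  headF : InSym a → Move → F
  headF σ left = (zeroF i and zeroF i′) or sucF i′ i
  headF σ stay = eqF i i′
  headF rend right = eqF i i′
  headF σ right = sucF i i′

  workF : Move → Fin (suc WT) → F
  workF left d = (zeroF l and zeroF l′ and constF (toℕ d) c′ and eqF r₁ r′) or
    orMap (allFin (suc WT)) (λ x → linF (suc (toℕ x)) base l′ l and constF (toℕ x) c′ and linF (suc (toℕ d)) base r₁ r′)
  workF stay d = eqF l l′ and constF (toℕ d) c′ and eqF r₁ r′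
  workF right d = linF (suc (toℕ d)) base l l′ and
    ((zeroF r₁ and zeroF r′ and zeroF c′) or
     orMap (allFin (suc WT)) (λ x → linF (suc (toℕ x)) base r′ r₁ and constF (toℕ x) c′))

  resF : InSym a → Maybe Action → F
  resF σ nothing = falseF
  resF σ (just (q₂ , d , mi , mw , y)) = constF (suc (toℕ q₂)) q′ and headF σ mi and workF mw d and constF (codeD (outW y)) p′

  actF : Fin QT × InSym a × Fin (suc WT) → F
  actF (q₁ , σ , d) = constF (suc (toℕ q₁)) q and constF (toℕ d) c and sees (sameSym σ) (` i) and resF σ (δT q₁ σ d)

  keepF : F
  keepF = eqF q q′ and eqF i i′ and eqF l l′ and eqF c c′ and eqF r₁ r′

  ruleF : Fin N × List Sym → F
  ruleF ρ = keepF and constF (codeD (ruleW ρ)) p′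

  bootF : F
  bootF = zeroF q and constF (suc (toℕ qT)) q′ and zeroF i′ and zeroF l′ and zeroF c′ and zeroF r′ and constF (codeD (pushW (inj₁ S₀))) p′

  turnF : F
  -- The negation bars rule turns from the origin, which represents no configuration; `actF` bars it
  -- already by asking for a positive state code.
  turnF = zeroF p and (bootF or orMap entries actF or (neg (zeroF q) and orMap rules ruleF))

  pendF : Fin 6 → F
  pendF x = linF (suc (toℕ x)) 7 p′ p and keepF

  bodyF : Fin 6 → F
  bodyF zero = turnF or pendF zero
  bodyF (suc x) = pendF (suc x)

  -- Every edge advances the clock, even one that merely emits a pending bracket. The increase of
  -- vertex numbers, and with it acyclicity, follows from this alone.
  stepF : Fin 6 → F
  stepF x = sucF τ τ′ and bodyF x

  haltAct : Maybe Action → Form a 7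
  haltAct nothing = zeroF (# 0)
  haltAct (just _) = falseF

  haltF : Fin QT × InSym a × Fin (suc WT) → Form a 7
  haltF (q₁ , σ , d) = constF (suc (toℕ q₁)) (# 5) and constF (toℕ d) (# 2) and sees (sameSym σ) (` (# 4)) and haltAct (δT q₁ σ d)

  acceptF : Form a 7
  acceptF = zeroF (# 0) and orMap entries haltF

  module StepSemantics (w : Word a) (B : ℕ) where

    open Semantics w B
    open FormulaSemantics w B

    env : Vec ℕ 7 → Vec ℕ 7 → Vec ℕ 14
    env v u = v Vec.++ (u Vec.++ [])

    -- The components of the target are independent variables, so that each equation read off from a
    -- formula can instantiate one of them; that they code a configuration is a conclusion.
    module Sound (q₁ : Fin QT) (i₁ : ℕ) (L : List (Fin (suc WT))) (d₁ : Fin (suc WT)) (R : List (Fin (suc WT))) (π : Word 6) (t : ℕ)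
                 (vp vr vc vl vi vq vt : ℕ) where

      u v : Vec ℕ 7
      u = rep t (core q₁ i₁ L d₁ R) π
      v = vp ∷ vr ∷ vc ∷ vl ∷ vi ∷ vq ∷ vt ∷ []

      ρ : Vec ℕ 14
      ρ = env v u

      open At ρ

      head⇒ : ∀ σ m → readInput w i₁ ≡ σ → Sat (headF σ m) ρ → vi ≡ moveIn (length w) m i₁
      head⇒ σ left e (inj₁ (z , z′)) = trans (sym z′) (cong pred z)
      head⇒ σ left e (inj₂ s) = cong pred (suc⇒ i′ i s)
      head⇒ σ stay e s = sym (eq⇒ i i′ s)
      head⇒ rend right e s = trans (sym (eq⇒ i i′ s)) (sym (moveIn-end w i₁ e))
      head⇒ lend right e s = trans (sym (suc⇒ i i′ s)) (sym (moveIn-inside w i₁ (λ e′ → case trans (sym e) e′ of λ ())))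
      head⇒ (letter x) right e s = trans (sym (suc⇒ i i′ s)) (sym (moveIn-inside w i₁ (λ e′ → case trans (sym e) e′ of λ ())))

      work⇒ : ∀ m d → Sat (workF m d) ρ → let (L′ , d′ , R′) = moveWork T m L d R in vl ≡ codeD L′ × vc ≡ toℕ d′ × vr ≡ codeD R′
      work⇒ left d (inj₁ (z , z′ , e , e′)) with codeD-[] L (sym z)
      ... | refl = sym z′ , const⇒ ρ (toℕ d) c′ e , sym (eq⇒ r₁ r′ e′)
      work⇒ left d (inj₂ s) with or⇒ (allFin (suc WT)) _ s
      ... | x , _ , e₁ , e₂ , e₃ with codeD-∷ x vl L (lin⇒ ρ (suc (toℕ x)) base l′ l e₁)
      ...   | L′ , refl , e = e , const⇒ ρ (toℕ x) c′ e₂ , lin⇒ ρ (suc (toℕ d)) base r₁ r′ e₃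
      work⇒ stay d (e₁ , e₂ , e₃) = sym (eq⇒ l l′ e₁) , const⇒ ρ (toℕ d) c′ e₂ , sym (eq⇒ r₁ r′ e₃)
      work⇒ right d (e₁ , inj₁ (z , z′ , z″)) with codeD-[] R (sym z)
      ... | refl = lin⇒ ρ (suc (toℕ d)) base l l′ e₁ , sym z″ , sym z′
      work⇒ right d (e₁ , inj₂ s) with or⇒ (allFin (suc WT)) _ s
      ... | x , _ , e₂ , e₃ with codeD-∷ x vr R (lin⇒ ρ (suc (toℕ x)) base r′ r₁ e₂)
      ...   | R′ , refl , e = lin⇒ ρ (suc (toℕ d)) base l l′ e₁ , const⇒ ρ (toℕ x) c′ e₃ , e

      keep⇒ : Sat keepF ρ → vq ≡ suc (toℕ q₁) × vi ≡ i₁ × vl ≡ codeD L × vc ≡ toℕ d₁ × vr ≡ codeD R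
      keep⇒ (e₁ , e₂ , e₃ , e₄ , e₅) = sym (eq⇒ q q′ e₁) , sym (eq⇒ i i′ e₂) , sym (eq⇒ l l′ e₃) , sym (eq⇒ c c′ e₄) , sym (eq⇒ r₁ r′ e₅)

      act⇒ : ∀ x → Sat (actF x) ρ → ∃ λ κ → ∃ λ y → nextCore w (core q₁ i₁ L d₁ R) ≡ just (κ , y) × v ≡ rep vt κ (outW y)
      act⇒ (q₂ , σ , d) (e₁ , e₂ , e₃ , s) with Fin.toℕ-injective (suc-injective (const⇒ ρ (suc (toℕ q₂)) q e₁)) | Fin.toℕ-injective (const⇒ ρ (toℕ d) c e₂) | sameSym⇒ σ (readInput w i₁) e₃
      ... | refl | refl | refl with δT q₂ (readInput w i₁) d
      ...   | nothing = case s of λ ()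
      ...   | just (q₃ , d′ , mi , mw , y) with s
      ...     | s₁ , s₂ , s₃ , s₄ with work⇒ mw d′ s₃
      ...       | refl , refl , refl with const⇒ ρ (suc (toℕ q₃)) q′ s₁ | head⇒ _ mi refl s₂ | const⇒ ρ (codeD (outW y)) p′ s₄
      ...         | refl | refl | refl = _ , y , refl , refl

      Pending : Fin 6 → Set
      Pending x = ∃ λ π′ → π ≡ x ∷ π′ × v ≡ rep vt (core q₁ i₁ L d₁ R) π′

      pend⇒ : ∀ x → Sat (pendF x) ρ → Pending x
      pend⇒ x (e , s) with codeD-∷ x vp π (lin⇒ ρ (suc (toℕ x)) 7 p′ p e) | keep⇒ s
      ... | π′ , eq , refl | refl , refl , refl , refl , refl = π′ , eq , refl

      TurnStep : Set
      TurnStep = π ≡ [] × ∃ λ κ → ∃ λ π′ → Turn w (core q₁ i₁ L d₁ R) κ π′ × v ≡ rep vt κ π′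

      turn⇒ : Sat turnF ρ → TurnStep
      turn⇒ (z , inj₁ (() , _))
      turn⇒ (z , inj₂ (inj₁ s)) with or⇒ entries actF s
      ... | x , _ , s′ with act⇒ x s′
      ...   | κ , y , eq , eq′ = codeD-[] π (sym z) , κ , outW y , tstepM eq , eq′
      turn⇒ (z , inj₂ (inj₂ (_ , s))) with or⇒ rules ruleF s
      ... | x , x∈ , k , e with keep⇒ k | const⇒ ρ (codeD (ruleW x)) p′ e
      ...   | refl , refl , refl , refl , refl | refl = codeD-[] π (sym z) , _ , ruleW x , ruleM x∈ , refl

      step⇒ : ∀ x → Sat (stepF x) ρ → vt ≡ suc t × (Pending x ⊎ (x ≡ zero × TurnStep))
      step⇒ zero (e , inj₁ s) = sym (suc⇒ τ τ′ e) , inj₂ (refl , turn⇒ s)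
      step⇒ zero (e , inj₂ s) = sym (suc⇒ τ τ′ e) , inj₁ (pend⇒ zero s)
      step⇒ (suc x) (e , s) = sym (suc⇒ τ τ′ e) , inj₁ (pend⇒ (suc x) s)

    -- Paths start at vertex 0, the tuple of zeros, whereas the initial configuration has a positive
    -- state code and a pending start word. One boot edge leads from here to it.
    origin : Vec ℕ 7
    origin = Vec.replicate 7 0

    boot⇒ : ∀ x v → Sat (stepF x) (env v origin) → x ≡ zero × v ≡ rep 1 initCore (pushW (inj₁ S₀))
    boot⇒ zero v@(vp ∷ vr ∷ vc ∷ vl ∷ vi ∷ vq ∷ vt ∷ []) (e , inj₁ (_ , inj₁ (_ , e₁ , e₂ , e₃ , e₄ , e₅ , e₆)))
      with At.suc⇒ (env v origin) τ τ′ e | const⇒ (env v origin) (suc (toℕ qT)) q′ e₁ | const⇒ (env v origin) (codeD (pushW (inj₁ S₀))) p′ e₆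
    boot⇒ zero (vp ∷ vr ∷ vc ∷ vl ∷ vi ∷ vq ∷ vt ∷ []) (e , inj₁ (_ , inj₁ (_ , e₁ , refl , refl , refl , refl , e₆))) | refl | refl | refl = refl , refl
    boot⇒ zero v (e , inj₁ (_ , inj₂ (inj₁ s))) with At.or⇒ (env v origin) entries actF s
    boot⇒ zero v@(vp ∷ vr ∷ vc ∷ vl ∷ vi ∷ vq ∷ vt ∷ []) (e , inj₁ (_ , inj₂ (inj₁ s))) | x , _ , e₁ , _ = case const⇒ (env v origin) (suc (toℕ (proj₁ x))) q e₁ of λ ()
    boot⇒ zero (vp ∷ vr ∷ vc ∷ vl ∷ vi ∷ vq ∷ vt ∷ []) (e , inj₁ (_ , inj₂ (inj₂ (n , _)))) = ⊥-elim (n refl)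
    boot⇒ zero v@(vp ∷ vr ∷ vc ∷ vl ∷ vi ∷ vq ∷ vt ∷ []) (e , inj₂ (s , _)) = case lin⇒ (env v origin) 1 7 p′ p s of λ ()
    boot⇒ (suc x) v@(vp ∷ vr ∷ vc ∷ vl ∷ vi ∷ vq ∷ vt ∷ []) (e , s , _) = case lin⇒ (env v origin) (suc (toℕ (suc x))) 7 p′ p s of λ ()

    halt⇒ : ∀ t κ π → Sat acceptF (rep t κ π Vec.++ []) → π ≡ [] × nextCore w κ ≡ nothing
    halt⇒ t (core q₁ i₁ L d₁ R) π (z , s) with At.or⇒ (rep t (core q₁ i₁ L d₁ R) π Vec.++ []) entries haltF s
    ... | (q₂ , σ , d) , _ , e₁ , e₂ , e₃ , h
      with Fin.toℕ-injective (suc-injective (const⇒ (rep t (core q₁ i₁ L d₁ R) π Vec.++ []) (suc (toℕ q₂)) (# 5) e₁))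
         | Fin.toℕ-injective (const⇒ (rep t (core q₁ i₁ L d₁ R) π Vec.++ []) (toℕ d) (# 2) e₂) | sameSym⇒ σ (readInput w i₁) e₃
    ... | refl | refl | refl with δT q₂ (readInput w i₁) d
    ...   | nothing = codeD-[] π (sym z) , refl
    ...   | just _ = case h of λ ()

    -- All intermediate values are bounded by entries of the target or the source.
    module Complete (κ κ′ : Core) (π π′ : Word 6) (t : ℕ) (bu : Bounded B (rep t κ π)) (bv : Bounded B (rep (suc t) κ′ π′)) where

      open Core κ renaming (state to q₁; hpos to i₁; lcell to L; cell to d₁; rcell to R)
      open Core κ′ renaming (state to q₂; hpos to i₂; lcell to L₂; cell to d₂; rcell to R₂)

      ρ : Vec ℕ 14
      ρ = env (rep (suc t) κ′ π′) (rep t κ π)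

      open At ρ

      private
        bound : ∀ {m} {u : Vec ℕ m} → Bounded B u → ∀ j → lookup u j < B
        bound {u = x ∷ u} (b , _) zero = b
        bound {u = x ∷ u} (_ , b) (suc j) = bound b j

        append : ∀ {m n} (u : Vec ℕ m) (v : Vec ℕ n) → Bounded B u → Bounded B v → Bounded B (u Vec.++ v)
        append [] v _ b = b
        append (x ∷ u) v (b , bs) b′ = b , append u v bs b′

        ρ< : ∀ j → lookup ρ j < B
        ρ< = bound (append (rep (suc t) κ′ π′) _ bv (append (rep t κ π) [] bu tt))

      head⇐ : ∀ σ m → readInput w i₁ ≡ σ → i₂ ≡ moveIn (length w) m i₁ → Sat (headF σ m) ρ
      head⇐ σ left e eq = go i₁ refl
        where
          go : ∀ j → i₁ ≡ j → Sat (headF σ left) ρ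
          go zero eqj = inj₁ (sym eqj , sym (trans eq (cong pred eqj)))
          go (suc j) eqj = inj₂ (suc⇐ i′ i (trans (cong suc (trans eq (cong pred eqj))) (sym eqj)))
      head⇐ σ stay e eq = eq⇐ i i′ (sym eq)
      head⇐ rend right e eq = eq⇐ i i′ (trans (sym (moveIn-end w i₁ e)) (sym eq))
      head⇐ lend right e eq = suc⇐ i i′ (trans (sym (moveIn-inside w i₁ (λ e′ → case trans (sym e) e′ of λ ()))) (sym eq))
      head⇐ (letter x) right e eq = suc⇐ i i′ (trans (sym (moveIn-inside w i₁ (λ e′ → case trans (sym e) e′ of λ ()))) (sym eq))

      work⇐ : ∀ m d → moveWork T m L d R ≡ (L₂ , d₂ , R₂) → Sat (workF m d) ρ
      work⇐ left d eq = go L refl eq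
        where
          go : ∀ L′ → L ≡ L′ → moveWork T left L′ d R ≡ (L₂ , d₂ , R₂) → Sat (workF left d) ρ
          go [] eL eq = inj₁ (sym (cong codeD eL) , cong (codeD ∘ proj₁) eq , const⇐ ρ (toℕ d) c′ (ρ< c′) (sym (cong (toℕ ∘ proj₁ ∘ proj₂) eq)) , eq⇐ r₁ r′ (cong (codeD ∘ proj₂ ∘ proj₂) eq))
          go (x ∷ L′) eL eq = inj₂ (or⇐ _ (∈-allFin x)
            ( lin⇐ ρ (suc (toℕ x)) base l′ l (ρ< l) (trans (cong codeD eL) (cong (λ z → suc (toℕ x) + base * codeD (proj₁ z)) eq))
            , const⇐ ρ (toℕ x) c′ (ρ< c′) (sym (cong (toℕ ∘ proj₁ ∘ proj₂) eq))
            , lin⇐ ρ (suc (toℕ d)) base r₁ r′ (ρ< r′) (sym (cong (codeD ∘ proj₂ ∘ proj₂) eq))))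
      work⇐ stay d eq = eq⇐ l l′ (cong (codeD ∘ proj₁) eq) , const⇐ ρ (toℕ d) c′ (ρ< c′) (sym (cong (toℕ ∘ proj₁ ∘ proj₂) eq)) , eq⇐ r₁ r′ (cong (codeD ∘ proj₂ ∘ proj₂) eq)
      work⇐ right d eq = go R refl eq
        where
          go : ∀ R′ → R ≡ R′ → moveWork T right L d R′ ≡ (L₂ , d₂ , R₂) → Sat (workF right d) ρ
          go [] eR eq = lin⇐ ρ (suc (toℕ d)) base l l′ (ρ< l′) (sym (cong (codeD ∘ proj₁) eq)) ,
            inj₁ (sym (cong codeD eR) , cong (codeD ∘ proj₂ ∘ proj₂) eq , cong (toℕ ∘ proj₁ ∘ proj₂) eq)
          go (x ∷ R′) eR eq = lin⇐ ρ (suc (toℕ d)) base l l′ (ρ< l′) (sym (cong (codeD ∘ proj₁) eq)) ,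
            inj₂ (or⇐ _ (∈-allFin x)
              ( lin⇐ ρ (suc (toℕ x)) base r′ r₁ (ρ< r₁) (trans (cong codeD eR) (cong (λ z → suc (toℕ x) + base * codeD (proj₂ (proj₂ z))) eq))
              , const⇐ ρ (toℕ x) c′ (ρ< c′) (sym (cong (toℕ ∘ proj₁ ∘ proj₂) eq))))

      keep⇐ : κ ≡ κ′ → Sat keepF ρ
      keep⇐ e = eq⇐ q q′ (cong (suc ∘ toℕ ∘ state) e) , eq⇐ i i′ (cong hpos e) , eq⇐ l l′ (cong (codeD ∘ lcell) e) , eq⇐ c c′ (cong (toℕ ∘ cell) e) , eq⇐ r₁ r′ (cong (codeD ∘ rcell) e)

      time : Sat (sucF τ τ′) ρ
      time = suc⇐ τ τ′ refl

      act⇐ : ∀ y → nextCore w κ ≡ just (κ′ , y) → π′ ≡ outW y → Sat (actF (q₁ , readInput w i₁ , d₁)) ρ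
      act⇐ y eq eπ = const⇐ ρ (suc (toℕ q₁)) q (ρ< q) refl , const⇐ ρ (toℕ d₁) c (ρ< c) refl , sameSym-refl (readInput w i₁) ,
        go (δT q₁ (readInput w i₁) d₁) eq
        where
          go : ∀ m → Maybe.map (advance (length w) κ) m ≡ just (κ′ , y) → Sat (resF (readInput w i₁) m) ρ
          go (just (q₃ , d′ , mi , mw , y′)) e = let e′ = just-injective e in
            const⇐ ρ (suc (toℕ q₃)) q′ (ρ< q′) (sym (cong (suc ∘ toℕ ∘ state ∘ proj₁) e′)) ,
            head⇐ (readInput w i₁) mi refl (sym (cong (hpos ∘ proj₁) e′)) ,
            work⇐ mw d′ (cong (λ z → lcell (proj₁ z) , cell (proj₁ z) , rcell (proj₁ z)) e′) ,
            const⇐ ρ (codeD (outW y′)) p′ (ρ< p′) (cong codeD (trans eπ (sym (cong (outW ∘ proj₂) e′))))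

      turn⇐ : Turn w κ κ′ π′ → π ≡ [] → Sat (stepF zero) ρ
      turn⇐ m e = time , inj₁ (sym (cong codeD e) , inj₂ (go m refl refl))
        where
          go : ∀ {κ₁ π₁} → Turn w κ κ₁ π₁ → κ₁ ≡ κ′ → π₁ ≡ π′ → Sat (orMap entries actF or (neg (zeroF q) and orMap rules ruleF)) ρ
          go (tstepM {y = y} eq) e₁ e₂ = inj₁ (or⇐ actF (∈-entries q₁ (readInput w i₁) d₁) (act⇐ y (trans eq (cong (λ z → just (z , y)) e₁)) (sym e₂)))
          go (ruleM {x} x∈) e₁ e₂ = inj₂ ((λ ()) , or⇐ ruleF x∈ (keep⇐ e₁ , const⇐ ρ (codeD (ruleW x)) p′ (ρ< p′) (cong codeD (sym e₂))))

      pend⇐ : ∀ x → π ≡ x ∷ π′ → κ ≡ κ′ → Sat (stepF x) ρ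
      pend⇐ zero e e′ = time , inj₂ (lin⇐ ρ 1 7 p′ p (ρ< p) (cong codeD e) , keep⇐ e′)
      pend⇐ (suc x) e e′ = time , lin⇐ ρ (suc (toℕ (suc x))) 7 p′ p (ρ< p) (cong codeD e) , keep⇐ e′

    boot⇐ : Bounded B (rep 1 initCore (pushW (inj₁ S₀))) → Sat (stepF zero) (env (rep 1 initCore (pushW (inj₁ S₀))) origin)
    boot⇐ (bp , _ , _ , _ , _ , bq , _) = refl , inj₁ (refl , inj₁ (refl , const⇐ ρ (suc (toℕ qT)) q′ bq refl , refl , refl , refl , refl ,
        const⇐ ρ (codeD (pushW (inj₁ S₀))) p′ bp refl))
      where
        ρ : Vec ℕ 14
        ρ = env (rep 1 initCore (pushW (inj₁ S₀))) origin

    halt⇐ : ∀ t κ → Bounded B (rep t κ []) → nextCore w κ ≡ nothing → Sat acceptF (rep t κ [] Vec.++ [])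
    halt⇐ t κ (_ , _ , bc , _ , _ , bq , _) eq = refl , At.or⇐ ρ haltF (∈-entries (state κ) (readInput w (hpos κ)) (cell κ))
        (const⇐ ρ (suc (toℕ (state κ))) (# 5) bq refl , const⇐ ρ (toℕ (cell κ)) (# 2) bc refl , sameSym-refl (readInput w (hpos κ)) ,
         go (δT (state κ) (readInput w (hpos κ)) (cell κ)) eq)
      where
        ρ : Vec ℕ 7
        ρ = rep t κ [] Vec.++ []
        go : ∀ m → Maybe.map (advance (length w) κ) m ≡ nothing → Sat (haltAct m) ρ
        go nothing _ = refl

moveIn≤ : ∀ n m i → i ≤ suc n → moveIn n m i ≤ suc n
moveIn≤ n left i p = ≤-trans (pred[n]≤n) p
moveIn≤ n stay i p = p
moveIn≤ n right i p with i <ᵇ suc n in eq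
... | true = <ᵇ⇒< i (suc n) (subst T (sym eq) tt)
... | false = p

pow-≤ : ∀ {x g} n → x ≤ g → 1 ≤ g → 1 ≤ n → x ≤ g ^ n
pow-≤ {x} {g} (suc n) p q _ = ≤-trans p (≤-trans (≤-reflexive (sym (*-identityʳ g))) (*-monoʳ-≤ g (m^n>0 g {{>-nonZero q}} n)))

pow-* : ∀ x y n → x ^ n * y ^ n ≡ (x * y) ^ n
pow-* x y zero = refl
pow-* x y (suc n) = trans (lem x y (x ^ n) (y ^ n)) (cong (x * y *_) (pow-* x y n))
  where
    lem : ∀ x y u v → x * u * (y * v) ≡ x * y * (u * v)
    lem = solve-∀

-- Correctness of the hardness reduction

module Reduction {a bt : ℕ} (T : Transducer a bt) (G : CFG bt) (f : Word a → Word bt) (cT : ℕ)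
  (computes : ∀ w → ∃ λ t → Halted T w (run T w t (initConfig T)) × TConfig.out (run T w t (initConfig T)) ≡ f w)
  (frugal : ∀ w t → space T (run T w t (initConfig T)) ≤ cT * ⌈log₂ suc (length w) ⌉ + cT) where

  open Hardness T G
  open Core
  open CFG G renaming (S to S₀) using (rules; N)
  open Transducer T using () renaming (Q to QT; W to WT; δ to δT)

  emitY : Maybe (Fin bt) → Word bt
  emitY nothing = []
  emitY (just y) = [ y ]

  -- The step count is part of the relation because determinism makes it a function of the core;
  -- this is what rules out repeated cores in `time<`.
  data Emits (w : Word a) : Core → Word bt → ℕ → Set where
    halts : ∀ {κ} → nextCore w κ ≡ nothing → Emits w κ [] 0
    quiet : ∀ {κ κ′ o m} → nextCore w κ ≡ just (κ′ , nothing) → Emits w κ′ o m → Emits w κ o (suc m)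
    speak : ∀ {κ κ′ y o m} → nextCore w κ ≡ just (κ′ , just y) → Emits w κ′ o m → Emits w κ (y ∷ o) (suc m)

  then : ∀ {w κ κ′ y o m} → nextCore w κ ≡ just (κ′ , y) → Emits w κ′ o m → Emits w κ (emitY y ++ o) (suc m)
  then {y = nothing} p e = quiet p e
  then {y = just y} p e = speak p e

  emits-unique : ∀ {w κ o o′ m m′} → Emits w κ o m → Emits w κ o′ m′ → o ≡ o′ × m ≡ m′
  emits-unique (halts _) (halts _) = refl , refl
  emits-unique (halts p) (quiet q _) = case trans (sym p) q of λ ()
  emits-unique (halts p) (speak q _) = case trans (sym p) q of λ ()
  emits-unique (quiet p _) (halts q) = case trans (sym p) q of λ ()
  emits-unique (speak p _) (halts q) = case trans (sym p) q of λ ()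
  emits-unique (quiet p _) (speak q _) = case trans (sym p) q of λ ()
  emits-unique (speak p _) (quiet q _) = case trans (sym p) q of λ ()
  emits-unique (quiet p e) (quiet q e′) with just-injective (trans (sym p) q)
  ... | refl with emits-unique e e′
  ...   | refl , refl = refl , refl
  emits-unique (speak p e) (speak q e′) with just-injective (trans (sym p) q)
  ... | refl with emits-unique e e′
  ...   | refl , refl = refl , refl

  emits-length : ∀ {w κ o m} → Emits w κ o m → length o ≤ m
  emits-length (halts _) = z≤n
  emits-length (quiet _ e) = m≤n⇒m≤1+n (emits-length e)
  emits-length (speak _ e) = s≤s (emits-length e)

  coreOf : Config T → Core
  coreOf c = core (TConfig.state c) (TConfig.ipos c) (TConfig.wl c) (TConfig.wc c) (TConfig.wr c)

  module _ (w : Word a) where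

    config : Config T → Core × Maybe (Fin bt) → Config T
    config c (κ , y) = tcfg (state κ) (hpos κ) (lcell κ) (cell κ) (rcell κ) (emit T y (TConfig.out c))

    tstep-core : ∀ c → tstep T w c ≡ Maybe.map (config c) (nextCore w (coreOf c))
    tstep-core (tcfg q i l c r o) with δT q (readInput w i) c
    ... | nothing = refl
    ... | just _ = refl

    tstep-nothing : ∀ c → tstep T w c ≡ nothing → nextCore w (coreOf c) ≡ nothing
    tstep-nothing c eq with nextCore w (coreOf c) | tstep-core c
    ... | nothing | _ = refl
    ... | just _ | eq′ = case trans (sym eq) eq′ of λ ()

    tstep-just : ∀ c {c′} → tstep T w c ≡ just c′ → ∃ λ y → nextCore w (coreOf c) ≡ just (coreOf c′ , y) × TConfig.out c′ ≡ TConfig.out c ++ emitY y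
    tstep-just c eq with nextCore w (coreOf c) | tstep-core c
    ... | nothing | eq′ = case trans (sym eq) eq′ of λ ()
    ... | just (κ , y) | eq′ with just-injective (trans (sym eq) eq′)
    ...   | refl = y , refl , out-emit y
      where
        out-emit : ∀ y → emit T y (TConfig.out c) ≡ TConfig.out c ++ emitY y
        out-emit nothing = sym (++-identityʳ _)
        out-emit (just y) = refl

    next-tstep : ∀ c {κ y} → nextCore w (coreOf c) ≡ just (κ , y) → ∃ λ c′ → tstep T w c ≡ just c′ × coreOf c′ ≡ κ
    next-tstep c eq = _ , trans (tstep-core c) (cong (Maybe.map (config c)) eq) , refl

    run→emits : ∀ t c → Halted T w (run T w t c) → ∃ λ o → ∃ λ m → Emits w (coreOf c) o m × TConfig.out (run T w t c) ≡ TConfig.out c ++ o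
    run→emits t c h = go t (tstep T w c) refl h
      where
        go : ∀ t m → tstep T w c ≡ m → Halted T w (run T w t c) → ∃ λ o → ∃ λ m → Emits w (coreOf c) o m × TConfig.out (run T w t c) ≡ TConfig.out c ++ o
        go t nothing eq h = [] , 0 , halts (tstep-nothing c eq) , trans (cong TConfig.out (run-halted {T = T} {w} {0} c t eq)) (sym (++-identityʳ _))
        go zero (just c′) eq h = case trans (sym eq) h of λ ()
        go (suc t) (just c′) eq h with tstep-just c eq | run→emits t c′ (subst (Halted T w) (run-suc {T = T} {w} {0} c t eq) h)
        ... | y , e , oe | o , m , em , oe′ = emitY y ++ o , suc m , then e em ,
              trans (cong TConfig.out (run-suc {T = T} {w} {0} c t eq)) (trans oe′ (trans (cong (_++ o) oe) (++-assoc (TConfig.out c) (emitY y) o)))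

    c₀ : Config T
    c₀ = initConfig T

    emits : ∃ λ m → Emits w initCore (f w) m
    emits = let (t , h , eq) = computes w
                (o , m , e , eq′) = run→emits t c₀ h
            in m , subst (λ o → Emits w initCore o m) (trans (sym eq′) eq) e

    emits-at : ∀ j {c o m} → Emits w (coreOf c) o m → j ≤ m → ∃ λ o′ → Emits w (coreOf (run T w j c)) o′ (m ∸ j)
    emits-at zero e _ = _ , e
    emits-at (suc j) {c} (quiet p e) (s≤s q) with next-tstep c p
    ... | c′ , eq , refl rewrite run-suc {T = T} {w} {0} c j eq = emits-at j e q
    emits-at (suc j) {c} (speak p e) (s≤s q) with next-tstep c p
    ... | c′ , eq , refl rewrite run-suc {T = T} {w} {0} c j eq = emits-at j e q

    run-step : ∀ j c {c′} → tstep T w (run T w j c) ≡ just c′ → run T w (suc j) c ≡ c′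
    run-step zero c eq = run-suc {T = T} {w} {0} c 0 eq
    run-step (suc j) c eq = go (tstep T w c) refl
      where
        go : ∀ m → tstep T w c ≡ m → run T w (suc (suc j)) c ≡ _
        go nothing e = case trans (sym e) (subst (λ z → tstep T w z ≡ just _) (run-halted {T = T} {w} {0} c (suc j) e) eq) of λ ()
        go (just c₁) e = trans (run-suc {T = T} {w} {0} c (suc j) e) (run-step j c₁ (subst (λ z → tstep T w z ≡ just _) (run-suc {T = T} {w} {0} c j e) eq))

    Reachable : Core → Set
    Reachable κ = ∃ λ j → κ ≡ coreOf (run T w j c₀)

    reach-next : ∀ {κ κ′ y} → Reachable κ → nextCore w κ ≡ just (κ′ , y) → Reachable κ′
    reach-next (j , refl) eq with next-tstep (run T w j c₀) eq
    ... | c′ , e , refl = suc j , cong coreOf (sym (run-step j c₀ e))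

    ipos≤ : ∀ t c → TConfig.ipos c ≤ suc (length w) → TConfig.ipos (run T w t c) ≤ suc (length w)
    ipos≤ zero c p = p
    ipos≤ (suc t) c p = go (nextCore w (coreOf c)) refl
      where
        go : ∀ m → nextCore w (coreOf c) ≡ m → TConfig.ipos (run T w (suc t) c) ≤ suc (length w)
        go nothing e = subst (λ c → TConfig.ipos c ≤ suc (length w)) (sym (run-halted {T = T} {w} {0} c (suc t) (trans (tstep-core c) (cong (Maybe.map (config c)) e)))) p
        go (just (κ , y)) e = subst (λ c → TConfig.ipos c ≤ suc (length w)) (sym (run-suc {T = T} {w} {0} c t (trans (tstep-core c) (cong (Maybe.map (config c)) e))))
          (ipos≤ t (config c (κ , y)) (hpos≤ (δT (TConfig.state c) (readInput w (TConfig.ipos c)) (TConfig.wc c)) e))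
          where
            hpos≤ : ∀ m → Maybe.map (advance (length w) (coreOf c)) m ≡ just (κ , y) → hpos κ ≤ suc (length w)
            hpos≤ (just (_ , _ , mi , _)) e = subst (_≤ suc (length w)) (cong (hpos ∘ proj₁) (just-injective e)) (moveIn≤ (length w) mi (TConfig.ipos c) p)

  -- Each summand serves one component of a core: `QT` the state, `base` the scanned cell,
  -- `base ^ (2 * cT)` the codes of the two tape halves, whose length is at most `2 * cT * ℓ`, and 4
  -- the head position, since `4 ^ ℓ` exceeds `suc n`.
  g₁ : ℕ
  g₁ = QT + base + base ^ (2 * cT) + 4

  coreVec : Core → Vec ℕ 5
  coreVec (core q i l c r) = codeD r ∷ toℕ c ∷ codeD l ∷ i ∷ suc (toℕ q) ∷ []

  coreVec-injective : ∀ {κ κ′} → coreVec κ ≡ coreVec κ′ → κ ≡ κ′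
  coreVec-injective {core q i l c r} {core q′ i′ l′ c′ r′} eq
    with codeD-injective r r′ (cong Vec.head eq) | Fin.toℕ-injective (cong (λ v → lookup v (# 1)) eq)
       | codeD-injective l l′ (cong (λ v → lookup v (# 2)) eq) | cong (λ v → lookup v (# 3)) eq
       | Fin.toℕ-injective (suc-injective (cong (λ v → lookup v (# 4)) eq))
  ... | refl | refl | refl | refl | refl = refl

  words : List (Word 6)
  words = pushW (inj₁ S₀) ∷ map ruleW rules ++ map (popW ∘ inj₂) (allFin bt)

  -- A crude common bound, by a sum, on the codes of all words that a turn may emit; by
  -- `length≤codeD` it bounds their lengths too.
  PC : ℕ
  PC = ListAction.sum (map codeD words)

  word≤ : ∀ π → π ∈ words → codeD π ≤ PC
  word≤ _ i = go words i
    where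
      go : ∀ {π} ws → π ∈ ws → codeD π ≤ ListAction.sum (map codeD ws)
      go (π ∷ ws) (here refl) = m≤m+n (codeD π) _
      go (π ∷ ws) (there i) = ≤-trans (go ws i) (m≤n+m _ (codeD π))

  turn-word≤ : ∀ {w κ κ′ π} → Turn w κ κ′ π → codeD π ≤ PC
  turn-word≤ (tstepM {y = nothing} _) = z≤n
  turn-word≤ (tstepM {y = just y} _) = word≤ (popW (inj₂ y)) (there (∈-++⁺ʳ (map ruleW rules) (∈-map⁺ (popW ∘ inj₂) (∈-allFin y))))
  turn-word≤ (ruleM {ρ} i) = word≤ (ruleW ρ) (there (∈-++⁺ˡ (∈-map⁺ ruleW i)))

  length≤codeD : ∀ (π : Word 6) → length π ≤ codeD π
  length≤codeD [] = z≤n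
  length≤codeD (x ∷ π) = s≤s (≤-trans (length≤codeD π) (≤-trans (m≤m+n _ (6 * codeD π)) (m≤n+m _ (toℕ x))))

  -- A halting run takes fewer than `M = B₁ ^ 5` steps, a parse of its output at most
  -- `costRate * M`, and each turn at most `suc PC` ticks of the clock. So `K₀ * M` bounds the time,
  -- and the base is chosen for `B` to reach it.
  K₀ g′ : ℕ
  K₀ = suc PC * suc costRate + 1
  g′ = g₁ ^ 5 * K₀ + PC

  open GraphRuns a 6 7 g′ stepF acceptF endL public

  module _ (w : Word a) where

    ℓ n B₁ M : ℕ
    ℓ = width (length w)
    n = length w
    B₁ = g₁ ^ ℓ
    M = B₁ ^ 5

    1≤g₁ : 1 ≤ g₁
    1≤g₁ = ≤-trans (s≤s z≤n) (m≤n+m 4 _)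

    1≤B₁ : 1 ≤ B₁
    1≤B₁ = m^n>0 g₁ {{>-nonZero 1≤g₁}} ℓ

    tape< : ∀ (l : List (Fin (suc WT))) t → length l < space T (run T w t (c₀ w)) → codeD l < B₁
    tape< l t p = ≤-trans (codeD< l) (≤-trans (^-monoʳ-≤ base (≤-trans (<⇒≤ p) (frugal w t)))
      (≤-trans (^-monoʳ-≤ base {cT * ⌈log₂ suc n ⌉ + cT} {2 * cT * ℓ} (≤-trans (+-mono-≤ (*-monoʳ-≤ cT (log≤width n)) (≤-trans (≤-reflexive (sym (*-identityʳ cT))) (*-monoʳ-≤ cT (1≤width n)))) (≤-reflexive (lem cT ℓ))))
      (≤-trans (≤-reflexive (sym (^-*-assoc base (2 * cT) ℓ))) (^-monoˡ-≤ ℓ (≤-trans (m≤n+m (base ^ (2 * cT)) (QT + base)) (m≤m+n _ 4))))))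
      where
        lem : ∀ c l → c * l + c * l ≡ 2 * c * l
        lem = solve-∀

    hpos< : ∀ {i} → i ≤ suc n → i < B₁
    hpos< p = ≤-trans (s≤s p) (≤-trans (s≤s (n<2^width n)) (≤-trans (+-monoˡ-≤ (2 ^ ℓ) (m^n>0 2 ℓ))
      (≤-trans (≤-reflexive (lem (2 ^ ℓ))) (≤-trans (*-monoˡ-≤ (2 ^ ℓ) (^-monoʳ-≤ 2 (1≤width n))) (≤-trans (≤-reflexive (pow-* 2 2 ℓ)) (^-monoˡ-≤ ℓ (m≤n+m 4 _)))))))
      where
        lem : ∀ x → x + x ≡ 2 ^ 1 * x
        lem = solve-∀

    reachable-bounded : ∀ {κ} → Reachable w κ → Bounded B₁ (coreVec κ)
    reachable-bounded (j , refl) =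
      tape< (TConfig.wr c) j (s≤s (m≤n+m _ (length (TConfig.wl c)))) ,
      ≤-trans (Fin.toℕ<n (TConfig.wc c)) (≤-trans (n≤1+n (suc WT)) (pow-≤ ℓ (≤-trans (m≤n+m base QT) (≤-trans (m≤m+n _ _) (m≤m+n _ 4))) 1≤g₁ (1≤width n))) ,
      tape< (TConfig.wl c) j (s≤s (m≤m+n _ (length (TConfig.wr c)))) ,
      hpos< (ipos≤ w j (c₀ w) z≤n) ,
      ≤-trans (s≤s (Fin.toℕ<n (TConfig.state c))) (pow-≤ ℓ (≤-trans (≤-reflexive (+-comm 1 QT)) (≤-trans (+-monoʳ-≤ QT (s≤s z≤n)) (≤-trans (m≤m+n (QT + base) _) (m≤m+n _ 4)))) 1≤g₁ (1≤width n)) , tt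
      where
        c : Config T
        c = run T w j (c₀ w)

    -- Equal cores have equal numbers of remaining steps, so a halting run repeats none. Reachable
    -- cores have codes below `M`, and a run of at least `M` steps would contradict the pigeonhole
    -- principle.
    time< : ∀ {o m} → Emits w initCore o m → m < M
    time< {o} {m} e with m <? M
    ... | yes p = p
    ... | no ¬p = ⊥-elim (clash (Fin.pigeonhole ≤-refl idx))
      where
        κ : ℕ → Core
        κ j = coreOf (run T w j (c₀ w))
        idx : Fin (suc M) → Fin M
        idx j = fromℕ< (code< B₁ (coreVec (κ (toℕ j))) (reachable-bounded (toℕ j , refl)))
        late : ∀ (j : Fin (suc M)) → toℕ j ≤ m
        late j = ≤-trans (≤-pred (Fin.toℕ<n j)) (≮⇒≥ ¬p)
        clash : ¬ ∃ (λ i → ∃ λ j → i Data.Fin.< j × idx i ≡ idx j)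
        clash (i , j , i<j , eq) = <⇒≢ i<j (∸-cancelˡ-≡ (late i) (late j) (proj₂ (emits-unique (proj₂ (emits-at w (toℕ i) {c₀ w} e (late i)))
            (subst (λ κ → Emits w κ (proj₁ (emits-at w (toℕ j) {c₀ w} e (late j))) (m ∸ toℕ j)) (sym sameCore) (proj₂ (emits-at w (toℕ j) {c₀ w} e (late j)))))))
          where
            sameCore : κ (toℕ i) ≡ κ (toℕ j)
            sameCore = coreVec-injective (code-injective B₁ _ _ (reachable-bounded (toℕ i , refl)) (reachable-bounded (toℕ j , refl))
              (trans (sym (Fin.toℕ-fromℕ< _)) (trans (cong toℕ eq) (Fin.toℕ-fromℕ< _))))

    K₀M≤B : K₀ * M ≤ B w
    K₀M≤B = ≤-trans (≤-reflexive (*-comm K₀ M)) (≤-trans (*-mono-≤ (≤-reflexive swap) (pow-≤ ℓ (≤-refl {K₀}) (m≤n+m 1 (suc PC * suc costRate)) (1≤width n)))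
      (≤-trans (≤-reflexive (pow-* (g₁ ^ 5) K₀ ℓ)) (^-monoˡ-≤ ℓ (≤-trans (m≤m+n _ PC) (≤-trans (n≤1+n _) (n≤1+n _))))))
      where
        swap : M ≡ (g₁ ^ 5) ^ ℓ
        swap = trans (^-*-assoc g₁ ℓ 5) (trans (cong (g₁ ^_) (*-comm ℓ 5)) (sym (^-*-assoc g₁ 5 ℓ)))

    B₁≤B : B₁ ≤ B w
    B₁≤B = ≤-trans (≤-trans (≤-reflexive (sym (*-identityʳ B₁))) (*-monoʳ-≤ B₁ (m^n>0 B₁ {{>-nonZero 1≤B₁}} 4))) (≤-trans (m≤n*m M K₀ {{>-nonZero (m≤n+m 1 (suc PC * suc costRate))}}) K₀M≤B)

    PC<B : PC < B w
    PC<B = pow-≤ ℓ (≤-trans (s≤s (m≤n+m PC (g₁ ^ 5 * K₀))) (n≤1+n _)) (s≤s z≤n) (1≤width n)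

    rep-bounded : ∀ κ τ π → Reachable w κ → codeD π ≤ PC → τ < B w → Bounded (B w) (rep τ κ π)
    rep-bounded κ τ π r p q with reachable-bounded r
    ... | b₁ , b₂ , b₃ , b₄ , b₅ , _ = ≤-trans (s≤s p) PC<B , ≤-trans b₁ B₁≤B , ≤-trans b₂ B₁≤B , ≤-trans b₃ B₁≤B , ≤-trans b₄ B₁≤B , ≤-trans b₅ B₁≤B , q , tt

    open StepSemantics w (B w)
    open FormulaSemantics w (B w)

    timed : ∀ {u v x} → Bounded (B w) u → Bounded (B w) v → Sat w (stepF x) (v Vec.++ ext u) → vtx w u < vtx w v
    timed {u₀ ∷ u₁ ∷ u₂ ∷ u₃ ∷ u₄ ∷ u₅ ∷ t ∷ []} {v₀ ∷ v₁ ∷ v₂ ∷ v₃ ∷ v₄ ∷ v₅ ∷ t′ ∷ []} (b₀ , b₁ , b₂ , b₃ , b₄ , b₅ , _) _ (e , _) =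
      code-tail-< (B w) (u₁ ∷ u₂ ∷ u₃ ∷ u₄ ∷ u₅ ∷ t ∷ []) (v₁ ∷ v₂ ∷ v₃ ∷ v₄ ∷ v₅ ∷ t′ ∷ []) b₀ (code-tail-< (B w) (u₂ ∷ u₃ ∷ u₄ ∷ u₅ ∷ t ∷ []) (v₂ ∷ v₃ ∷ v₄ ∷ v₅ ∷ t′ ∷ []) b₁
      (code-tail-< (B w) (u₃ ∷ u₄ ∷ u₅ ∷ t ∷ []) (v₃ ∷ v₄ ∷ v₅ ∷ t′ ∷ []) b₂ (code-tail-< (B w) (u₄ ∷ u₅ ∷ t ∷ []) (v₄ ∷ v₅ ∷ t′ ∷ []) b₃
      (code-tail-< (B w) (u₅ ∷ t ∷ []) (v₅ ∷ t′ ∷ []) b₄ (code-tail-< (B w) (t ∷ []) (t′ ∷ []) b₅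
        (code-head-< (B w) [] (≤-reflexive (trans (trans (+-comm 1 t) (cong (_+ 1) (sym (+-identityʳ t)))) e))))))))

    flush : ∀ π t κ {y} → Reachable w κ → codeD π ≤ PC → t + length π < B w → Run w (rep (t + length π) κ []) y → Run w (rep t κ π) (π ++ y)
    flush [] t κ {y} r p q run = subst (λ t → Run w (rep t κ []) y) (+-identityʳ t) run
    flush (x ∷ π) t κ {y} r p q run =
      move (rep-bounded κ (suc t) π r p′ q″) (Complete.pend⇐ κ κ (x ∷ π) π t (rep-bounded κ t (x ∷ π) r p (≤-trans (s≤s (m≤m+n t _)) q)) (rep-bounded κ (suc t) π r p′ q″) x refl refl)
           (flush π (suc t) κ r p′ q′ (subst (λ t → Run w (rep t κ []) y) (+-suc t (length π)) run))
      where
        p′ : codeD π ≤ PC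
        p′ = ≤-trans (≤-trans (m≤m+n _ (6 * codeD π)) (m≤n+m _ (suc (toℕ x)))) p
        q′ : suc t + length π < B w
        q′ = ≤-trans (≤-reflexive (cong suc (sym (+-suc t (length π))))) q
        q″ : suc t < B w
        q″ = ≤-trans (s≤s (m≤m+n (suc t) (length π))) q′

    -- A turn costs one tick for its blank edge and one for each bracket of `π`, at most `suc PC`
    -- together, which is the share of one turn in the time budget.
    later : ∀ π t s → codeD π ≤ PC → t + suc s * suc PC < B w → suc t + length π + s * suc PC < B w
    later π t s p q = ≤-trans (s≤s (≤-trans (≤-reflexive (lem t (length π) (s * suc PC))) (+-monoʳ-≤ t (s≤s (+-monoˡ-≤ (s * suc PC) (≤-trans (length≤codeD π) p)))))) q
      where
        lem : ∀ t l x → suc t + l + x ≡ t + suc (l + x)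
        lem = solve-∀

    turn-run : ∀ {κ κ′ π t s y} → Reachable w κ → Reachable w κ′ → Turn w κ κ′ π → t + suc s * suc PC < B w →
                Run w (rep (suc t + length π) κ′ []) y → Run w (rep t κ []) (blankL ∷ π ++ y)
    turn-run {κ} {κ′} {π} {t} {s} r r′ m q run =
      move bv (Complete.turn⇐ κ κ′ [] π t (rep-bounded κ t [] r z≤n (≤-trans (s≤s (m≤m+n t _)) q)) bv m refl) (flush π (suc t) κ′ r′ pπ qπ run)
      where
        pπ : codeD π ≤ PC
        pπ = turn-word≤ m
        qπ : suc t + length π < B w
        qπ = ≤-trans (s≤s (m≤m+n _ (s * suc PC))) (later π t s pπ q)
        bv : Bounded (B w) (rep (suc t) κ′ π)
        bv = rep-bounded κ′ (suc t) π r′ pπ (≤-trans (s≤s (m≤m+n (suc t) (length π))) qπ)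

    -- The schedule: a nonterminal on top of the stack is expanded at once; otherwise the transducer
    -- advances until it emits the terminal on top, or, if the stack is empty, until it halts.
    build : ∀ {κ o m γ d t} → Emits w κ o m → LM γ o d → Reachable w κ → t + (m + d) * suc PC < B w →
            ∃ λ y → Run w (rep t κ []) y × Dyck (blocks γ) y
    build {κ} {m = m} {t = t} e (lrule {d′} {rhs} {γ} {m = d} i l) r q
      with build {t = suc t + length (ruleW (d′ , rhs))} e l r (later (ruleW (d′ , rhs)) t (m + d) (turn-word≤ {w} {κ} (ruleM i)) (subst (λ s → t + s * suc PC < B w) (+-suc m d) q))
    ... | y , run , dy = _ , turn-run {s = m + d} r r (ruleM i) (subst (λ s → t + s * suc PC < B w) (+-suc m d) q) run ,
          idle (subst (Dyck _) (sym (++-assoc (popW (inj₁ d′)) (pushAll rhs) y)) (popW⁺ (inj₁ d′) {γ} (pushAll⁺ rhs {γ} dy)))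
    build {κ} {t = t} (halts e) lnil r q = _ , accept (halt⇐ t κ (rep-bounded κ t [] r z≤n (≤-trans (s≤s (m≤m+n t _)) q)) e) , close
    build {t = t} (quiet {m = m} p e) lnil r q with build {t = suc t + 0} e lnil (reach-next w r p) (later [] t (m + 0) z≤n q)
    ... | y , run , dy = _ , turn-run {s = m + 0} r (reach-next w r p) (tstepM p) q run , idle dy
    build {t = t} (quiet {m = m} p e) l@(lterm {m = d} _) r q with build {t = suc t + 0} e l (reach-next w r p) (later [] t (m + suc d) z≤n q)
    ... | y , run , dy = _ , turn-run {s = m + suc d} r (reach-next w r p) (tstepM p) q run , idle dy
    build {t = t} (speak {y = b} {m = m} p e) (lterm {γ = γ} {m = d} l) r q
      with build {t = suc t + length (popW (inj₂ b))} e l (reach-next w r p) (later (popW (inj₂ b)) t (m + d) (turn-word≤ (tstepM p)) q′)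
      where
        q′ : t + suc (m + d) * suc PC < B w
        q′ = ≤-trans (s≤s (+-monoʳ-≤ t (*-monoˡ-≤ (suc PC) (s≤s (+-monoʳ-≤ m (n≤1+n d)))))) q
    ... | y , run , dy = _ , turn-run {s = m + suc d} r (reach-next w r p) (tstepM p) q run , idle (popW⁺ (inj₂ b) {γ} dy)

    -- Amid a pending word the bracket stack need not be a list of blocks, so the hypothesis speaks
    -- of the stack after `π` has been emitted. `P` remembers how that stack is related to the one
    -- before the turn, which is what the caller needs to rebuild the derivation.
    sound : ∀ {u y} → Run w u y → ∀ t κ π → u ≡ rep t κ π → (P : List Sym → Set) →
            (∀ y′ → y ≡ π ++ y′ → ∃ λ γ → P γ × Dyck (blocks γ) y′) →
            ∃ λ γ → P γ × ∃ λ o → ∃ λ m → Emits w κ o m × GenSeq G γ o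
    sound (accept s) t κ π refl P H with halt⇒ t κ π s
    ... | refl , e with H _ refl
    ...   | [] , Pγ , _ = [] , Pγ , [] , 0 , halts e , nil
    ...   | (s₀ ∷ γ) , Pγ , d = ⊥-elim (notEnd (ix s₀) d)
      where
        notEnd : ∀ i {σ} → ¬ Dyck (block i σ) [ endL ]
        notEnd zero ()
        notEnd (suc i) ()
    sound (move {vp ∷ vr ∷ vc ∷ vl ∷ vi ∷ vq ∷ vt ∷ []} {x} {y₁} bv s run) t κ@(core q i l c r) π refl P H
      with Sound.step⇒ q i l c r π t vp vr vc vl vi vq vt x s
    ... | _ , inj₁ (π′ , refl , eq) = sound run vt κ π′ eq P (λ y′ e → H y′ (cong (x ∷_) e))
    ... | _ , inj₂ (refl , refl , κ′ , π′ , m , eq) with H _ refl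
    ...   | γ , Pγ , idle d = go m eq
      where
        go : ∀ {κ′ π′} → Turn w κ κ′ π′ → (vp ∷ vr ∷ vc ∷ vl ∷ vi ∷ vq ∷ vt ∷ []) ≡ rep vt κ′ π′ → ∃ λ γ → P γ × ∃ λ o → ∃ λ m → Emits w κ o m × GenSeq G γ o
        go (tstepM {κ′} {nothing} e) eq with sound run vt κ′ [] eq (_≡ γ) (λ y′ e → γ , refl , subst (Dyck (blocks γ)) e d)
        ... | .γ , refl , o , m , em , g = γ , Pγ , o , suc m , then e em , g
        go (tstepM {κ′} {just b} e) eq with sound run vt κ′ (popW (inj₂ b)) eq (λ γ′ → γ ≡ inj₂ b ∷ γ′) (λ y′ e → popW⁻ (inj₂ b) γ (subst (Dyck (blocks γ)) e d))
        ... | γ′ , refl , o , m , em , g = γ , Pγ , b ∷ o , suc m , then e em , term g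
        go (ruleM {X , rhs} i) eq
          with sound run vt κ (ruleW (X , rhs)) eq (λ γ′ → ∃ λ γ₀ → γ ≡ inj₁ X ∷ γ₀ × γ′ ≡ rhs ++ γ₀)
                 (λ y′ e → let (γ₀ , e₁ , d′) = popW⁻ (inj₁ X) γ (subst (Dyck (blocks γ)) (trans e (++-assoc (popW (inj₁ X)) (pushAll rhs) y′)) d)
                           in rhs ++ γ₀ , (γ₀ , e₁ , refl) , pushAll⁻ rhs {γ₀} d′)
        ... | _ , (γ₀ , refl , refl) , o , m , em , g with seq-split rhs g
        ...   | u , v , refl , g₁ , g₂ = γ , Pγ , u ++ v , m , em , nont (apply i g₁) g₂

    startW : Word 6
    startW = pushW (inj₁ S₀)

    startW≤ : codeD startW ≤ PC
    startW≤ = word≤ startW (here refl)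

    start-bounded : 1 < B w → Bounded (B w) (rep 1 initCore startW)
    start-bounded q = rep-bounded initCore 1 startW (0 , refl) startW≤ q

    complete : Gen G S₀ (f w) → ∃ λ y → Run w origin y × Dyck [] y
    complete g =
      let (y , run , dy) = build {t = 1 + length startW} em lm (0 , refl) q
      in blankL ∷ startW ++ y ,
         move {v = rep 1 initCore startW} (start-bounded q₂) (boot⇐ (start-bounded q₂)) (flush startW 1 initCore (0 , refl) startW≤ q₁ run) ,
         idle (pushAll⁺ [ inj₁ S₀ ] {[]} dy)
      where
        d = proj₁ (leftmost g)
        lm = proj₁ (proj₂ (leftmost g))
        m = proj₁ (emits w)
        em = proj₂ (emits w)
        s≤ : suc (m + d) ≤ suc costRate * M
        s≤ = +-mono-≤ (time< em) (≤-trans (proj₂ (proj₂ (leftmost g))) (*-monoʳ-≤ costRate (≤-trans (s≤s (emits-length em)) (time< em))))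
        lem : ∀ c M p → M + c * (M * p) ≡ (p * c + 1) * M
        lem = solve-∀
        -- The boot edge and the start word count as one further turn, hence `suc (m + d)` above;
        -- the summand 1 of `K₀` makes the inequality strict.
        q : 1 + length startW + (m + d) * suc PC < B w
        q = ≤-trans (s≤s (≤-trans (+-monoˡ-≤ ((m + d) * suc PC) (s≤s (≤-trans (length≤codeD startW) startW≤))) (*-monoˡ-≤ (suc PC) s≤)))
              (≤-trans (+-mono-≤ {1} {M} (m^n>0 B₁ {{>-nonZero 1≤B₁}} 5) (≤-reflexive (*-assoc (suc costRate) M (suc PC)))) (≤-trans (≤-reflexive (lem (suc costRate) M (suc PC))) K₀M≤B))
        q₁ : 1 + length startW < B w
        q₁ = ≤-trans (s≤s (m≤m+n _ ((m + d) * suc PC))) q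
        q₂ : 1 < B w
        q₂ = ≤-trans (s≤s (m≤m+n 1 (length startW))) q₁

    correct : ∀ {y} → Run w origin y → Dyck [] y → Gen G S₀ (f w)
    correct (accept (_ , s)) d with At.or⇒ origin entries haltF s
    ... | x , _ , e , _ = case const⇒ origin (suc (toℕ (proj₁ x))) (# 5) e of λ ()
    correct (move {v} {x} bv s run) d with boot⇒ x v s
    correct (move bv s run) (idle d) | refl , refl
      with sound run 1 initCore (pushW (inj₁ S₀)) refl (_≡ [ inj₁ S₀ ]) (λ y′ e → [ inj₁ S₀ ] , refl , pushAll⁻ [ inj₁ S₀ ] {[]} (subst (Dyck []) e d))
    ... | _ , refl , o , m , em , nont {u = u} g nil = subst (Gen G S₀) (trans (sym (++-identityʳ u)) (proj₁ (emits-unique em (proj₂ (emits w))))) g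

  reduction : ∀ w → (Gen G S₀ (f w) → DAGREACH (DPDALang dyckPDA) (graphWord w)) × (DAGREACH (DPDALang dyckPDA) (graphWord w) → Gen G S₀ (f w))
  reduction w =
    (λ g → let (y , run , d) = complete w g in run→dagreach w (timed w) (DPDALang dyckPDA) run (suc zero , [] , dyck-run d , refl)) ,
    λ h → let (y , run , q , γ , star , fin) = dagreach→run w (timed w) (DPDALang dyckPDA) h in correct w run (run-dyck [] y refl star fin)

dagreach-dyck-hard : LogCFLHard (DAGREACH (DPDALang dyckPDA))
dagreach-dyck-hard a A (bt , G , f , (T , cT , computes , frugal) , equiv) =
  graphWord , graph-logspace , λ w → proj₁ (reduction w) ∘ proj₁ (equiv w) , proj₂ (equiv w) ∘ proj₂ (reduction w)
  where open Reduction T G f cT computes frugal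

-- A grammar for the paths of a topologically ordered graph

module FiniteGrammar {NT : Set} (F : Finite NT) {b : ℕ} (start : NT) where

  Symb : Set
  Symb = NT ⊎ Fin b

  module _ (IsRule : NT → List Symb → Set) where
    data Der : NT → Word b → Set
    data DerSeq : List Symb → Word b → Set
    data Der where
      by : ∀ {X rhs w} → IsRule X rhs → DerSeq rhs w → Der X w
    data DerSeq where
      []  : DerSeq [] []
      trm : ∀ {x rest w} → DerSeq rest w → DerSeq (inj₂ x ∷ rest) (x ∷ w)
      ntm : ∀ {Y rest u v} → Der Y u → DerSeq rest v → DerSeq (inj₁ Y ∷ rest) (u ++ v)

  encSy : Symb → Fin (size F) ⊎ Fin b
  encSy (inj₁ X) = inj₁ (enc F X)
  encSy (inj₂ x) = inj₂ x

  encRule : NT × List Symb → Fin (size F) × List (Fin (size F) ⊎ Fin b)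
  encRule (X , rhs) = enc F X , map encSy rhs

  grammar : List (NT × List Symb) → CFG b
  grammar rs = record { N = size F ; S = enc F start ; rules = map encRule rs }

  module _ {IsRule : NT → List Symb → Set} {rs : List (NT × List Symb)} where

    -- Rules given by an inductive predicate can be inverted by matching. The list of rules and the
    -- numbering of nonterminals enter only in this translation and its converse.
    der⇒gen : (∀ {X rhs} → IsRule X rhs → (X , rhs) ∈ rs) → ∀ {X w} → Der IsRule X w → Gen (grammar rs) (enc F X) w
    derSeq⇒gen : (∀ {X rhs} → IsRule X rhs → (X , rhs) ∈ rs) → ∀ {α w} → DerSeq IsRule α w → GenSeq (grammar rs) (map encSy α) w
    der⇒gen h (by r s) = apply (∈-map⁺ encRule (h r)) (derSeq⇒gen h s)
    derSeq⇒gen h [] = nil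
    derSeq⇒gen h (trm s) = term (derSeq⇒gen h s)
    derSeq⇒gen h (ntm d s) = nont (der⇒gen h d) (derSeq⇒gen h s)

    gen⇒der : (∀ {X rhs} → (X , rhs) ∈ rs → IsRule X rhs) → ∀ {i X w} → i ≡ enc F X → Gen (grammar rs) i w → Der IsRule X w
    genSeq⇒der : (∀ {X rhs} → (X , rhs) ∈ rs → IsRule X rhs) → ∀ α {w} → GenSeq (grammar rs) (map encSy α) w → DerSeq IsRule α w
    gen⇒der h {X = X} eq (apply i s) with ∈-map⁻ encRule i
    ... | (Y , rhs) , j , refl = by (subst (λ Z → IsRule Z rhs) (trans (sym (dec-enc F Y)) (trans (cong (dec F) eq) (dec-enc F X))) (h j)) (genSeq⇒der h rhs s)
    genSeq⇒der h [] nil = []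
    genSeq⇒der h (inj₂ x ∷ α) (term s) = trm (genSeq⇒der h α s)
    genSeq⇒der h (inj₁ Y ∷ α) (nont g s) = ntm (gen⇒der h refl g) (genSeq⇒der h α s)

  module _ {IsRule : NT → List Symb → Set} where

    derSeq-++ : ∀ {α β u v} → DerSeq IsRule α u → DerSeq IsRule β v → DerSeq IsRule (α ++ β) (u ++ v)
    derSeq-++ [] t = t
    derSeq-++ (trm s) t = trm (derSeq-++ s t)
    derSeq-++ {v = v} (ntm {u = u} {v = v′} d s) t = subst (DerSeq IsRule _) (sym (++-assoc u v′ v)) (ntm d (derSeq-++ s t))

    derSeq-split : ∀ α {β w} → DerSeq IsRule (α ++ β) w → ∃ λ u → ∃ λ v → w ≡ u ++ v × DerSeq IsRule α u × DerSeq IsRule β v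
    derSeq-split [] s = [] , _ , refl , [] , s
    derSeq-split (inj₂ x ∷ α) (trm s) = let (u , v , eq , p , q) = derSeq-split α s in x ∷ u , v , cong (x ∷_) eq , trm p , q
    derSeq-split (inj₁ Y ∷ α) (ntm {u = u₁} d s) = let (u , v , eq , p , q) = derSeq-split α s in
      u₁ ++ u , v , trans (cong (u₁ ++_) eq) (sym (++-assoc u₁ u v)) , ntm d p , q

pattern blankY = zero
pattern finalY = suc zero
pattern letterY x = suc (suc x)

-- Blank edges contribute nothing, and the final label marks the last edge of a path, so that the
-- end of a path is visible in the text of the edge list.
data Yield {a : ℕ} : Word (2 + a) → Word a → Set where
  end   : Yield [ finalY ] []
  pause : ∀ {y z} → Yield y z → Yield (blankY ∷ y) z
  emitY : ∀ {x y z} → Yield y z → Yield (letterY x ∷ y) (x ∷ z)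

module PathGrammar {a : ℕ} (P : DPDA a) where

  open DPDA P using (Q; Γ; q₀; Z₀; δε; final) renaming (δ to δP)

  -- The triple construction: the word read between exposing `X` in state `p` and popping it into
  -- state `q`.
  data TriW : Fin Q → Fin Γ → Fin Q → Word a → Set
  data SeqW : Fin Q → List (Fin Γ) → Fin Q → Word a → Set
  data TriW where
    triR : ∀ {p x X q p₁ α w} → δP p x X ≡ just (p₁ , α) → SeqW p₁ α q w → TriW p X q (x ∷ w)
    triE : ∀ {p X q p₁ α w} → δε p X ≡ just (p₁ , α) → SeqW p₁ α q w → TriW p X q w
  data SeqW where
    []  : ∀ {p} → SeqW p [] p []
    _∷_ : ∀ {p X r α q u v} → TriW p X r u → SeqW r α q v → SeqW p (X ∷ α) q (u ++ v)

  -- Acceptance is by final state with any stack, so triples do not suffice: these are the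
  -- computations that accept from `X` on top without going below it. In `AccS` the symbols that are
  -- popped contribute triples, and at most one symbol is left to such a computation.
  data AccW : Fin Q → Fin Γ → Word a → Set
  data AccS : Fin Q → List (Fin Γ) → Word a → Set
  data AccW where
    accN : ∀ {p X} → final p ≡ true → AccW p X []
    accR : ∀ {p x X p₁ α w} → δP p x X ≡ just (p₁ , α) → AccS p₁ α w → AccW p X (x ∷ w)
    accE : ∀ {p X p₁ α w} → δε p X ≡ just (p₁ , α) → AccS p₁ α w → AccW p X w
  data AccS where
    acc[] : ∀ {p} → final p ≡ true → AccS p [] []
    accH  : ∀ {p X α w} → AccW p X w → AccS p (X ∷ α) w
    accP  : ∀ {p X r α u v} → TriW p X r u → AccS r α v → AccS p (X ∷ α) (u ++ v)

  accS-split : ∀ α {p β w} → AccS p (α ++ β) w → AccS p α w ⊎ ∃ λ r → ∃ λ u → ∃ λ v → w ≡ u ++ v × SeqW p α r u × AccS r β v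
  accS-split [] s = inj₂ (_ , [] , _ , refl , [] , s)
  accS-split (X ∷ α) (accH t) = inj₁ (accH t)
  accS-split (X ∷ α) (accP {u = u₁} t s) with accS-split α s
  ... | inj₁ s′ = inj₁ (accP t s′)
  ... | inj₂ (r , u , v , eq , q , s′) = inj₂ (r , u₁ ++ u , v , trans (cong (u₁ ++_) eq) (sym (++-assoc u₁ u v)) , t ∷ q , s′)

  star⇒acc : ∀ {p w γ q γ′} → Star (PStep P) (p , w , γ) (q , [] , γ′) → final q ≡ true → AccS p γ w
  star⇒acc {γ = []} ε f = acc[] f
  star⇒acc {γ = X ∷ γ} ε f = accH (accN f)
  star⇒acc (read {α = α} e ◅ s) f with accS-split α (star⇒acc s f)
  ... | inj₁ t = accH (accR e t)
  ... | inj₂ (r , u , v , refl , q , t) = accP (triR e q) t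
  star⇒acc (eps {α = α} e ◅ s) f with accS-split α (star⇒acc s f)
  ... | inj₁ t = accH (accE e t)
  ... | inj₂ (r , u , v , refl , q , t) = accP (triE e q) t

  tri⇒star : ∀ {p X q u} → TriW p X q u → ∀ v γ → Star (PStep P) (p , u ++ v , X ∷ γ) (q , v , γ)
  seq⇒star : ∀ {p α q u} → SeqW p α q u → ∀ v γ → Star (PStep P) (p , u ++ v , α ++ γ) (q , v , γ)
  tri⇒star (triR e s) v γ = read e ◅ seq⇒star s v γ
  tri⇒star (triE e s) v γ = eps e ◅ seq⇒star s v γ
  seq⇒star [] v γ = ε
  seq⇒star (_∷_ {p} {X} {α = α} {u = u} {u′} t s) v γ =
    subst (λ z → Star (PStep P) (p , z , X ∷ α ++ γ) (_ , u′ ++ v , α ++ γ)) (sym (++-assoc u u′ v)) (tri⇒star t (u′ ++ v) (α ++ γ)) ◅◅ seq⇒star s v γ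

  Accepts : Fin Q → Word a → List (Fin Γ) → Set
  Accepts p w γ = Σ (Fin Q) λ q → Σ (List (Fin Γ)) λ γ′ → Star (PStep P) (p , w , γ) (q , [] , γ′) × final q ≡ true

  accW⇒star : ∀ {p X w} → AccW p X w → ∀ γ → Accepts p w (X ∷ γ)
  accS⇒star : ∀ {p α w} → AccS p α w → ∀ γ → Accepts p w (α ++ γ)
  accW⇒star (accN f) γ = _ , _ , ε , f
  accW⇒star (accR e s) γ = let (q , γ′ , t , f) = accS⇒star s γ in q , γ′ , read e ◅ t , f
  accW⇒star (accE e s) γ = let (q , γ′ , t , f) = accS⇒star s γ in q , γ′ , eps e ◅ t , f
  accS⇒star (acc[] f) γ = _ , _ , ε , f
  accS⇒star (accH {α = α} t) γ = accW⇒star t (α ++ γ)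
  accS⇒star (accP {α = α} {v = v} t s) γ = let (q , γ′ , r , f) = accS⇒star s γ in q , γ′ , tri⇒star t v (α ++ γ) ◅◅ r , f

  A : ℕ
  A = 2 + (2 + a)

  -- `junk` covers edges off the path. `mid` derives `1^v # junk 1^v`: the target block of one edge,
  -- skipped edges and the ones of the next source block, matched by nesting. `tok x` runs from a
  -- label `x` up to the next label that is not blank, so it takes the place of the terminal `x` in
  -- the triple construction.
  data NT : Set where
    start ones junk mid blanks : NT
    tok : Fin a → NT
    tri : Fin Q → Fin Γ → Fin Q → NT
    acc : Fin Q → Fin Γ → NT

  finNT : Finite NT
  finNT = finRetract
    (λ { start → inj₁ (# 0) ; ones → inj₁ (# 1) ; junk → inj₁ (# 2) ; mid → inj₁ (# 3) ; blanks → inj₁ (# 4)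
       ; (tok x) → inj₂ (inj₁ x) ; (tri p X q) → inj₂ (inj₂ (inj₁ (p , X , q))) ; (acc p X) → inj₂ (inj₂ (inj₂ (p , X))) })
    (λ { (inj₁ zero) → start ; (inj₁ (suc zero)) → ones ; (inj₁ (suc (suc zero))) → junk ; (inj₁ (suc (suc (suc zero)))) → mid
       ; (inj₁ (suc (suc (suc (suc _))))) → blanks
       ; (inj₂ (inj₁ x)) → tok x ; (inj₂ (inj₂ (inj₁ (p , X , q)))) → tri p X q ; (inj₂ (inj₂ (inj₂ (p , X)))) → acc p X })
    (λ { start → refl ; ones → refl ; junk → refl ; mid → refl ; blanks → refl ; (tok x) → refl ; (tri p X q) → refl ; (acc p X) → refl })
    (finFin 5 fin⊎ finFin a fin⊎ (finFin Q fin× finFin Γ fin× finFin Q) fin⊎ (finFin Q fin× finFin Γ))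

  open FiniteGrammar finNT {A} start

  lab : Fin (2 + a) → Fin A
  lab ℓ = suc (suc ℓ)

  t₁ t# : Symb
  t₁ = inj₂ zero
  t# = inj₂ (suc zero)

  tl : Fin (2 + a) → Symb
  tl ℓ = inj₂ (lab ℓ)

  data Chain : Fin Q → List (Fin Γ) → Fin Q → List Symb → Set where
    []  : ∀ {p} → Chain p [] p []
    via : ∀ {p X α q l} r → Chain r α q l → Chain p (X ∷ α) q (inj₁ (tri p X r) ∷ l)

  data AChain : Fin Q → List (Fin Γ) → List Symb → Set where
    stopA : ∀ {p} → final p ≡ true → AChain p [] []
    lastA : ∀ {p X α} → AChain p (X ∷ α) [ inj₁ (acc p X) ]
    viaA  : ∀ {p X α l} r → AChain r α l → AChain p (X ∷ α) (inj₁ (tri p X r) ∷ l)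

  hop : List Symb
  hop = inj₁ mid ∷ t# ∷ inj₁ blanks ∷ []

  -- The start vertex is 0, so its block is a lone `#`, once in the header and once as the source of
  -- the first path edge. The agreement of the last target with the header comes from the printed
  -- graph, by `final-target`.
  prefix suffix : List Symb
  prefix = inj₁ ones ∷ t# ∷ t# ∷ inj₁ ones ∷ t# ∷ inj₁ junk ∷ t# ∷ inj₁ blanks ∷ []
  suffix = tl finalY ∷ inj₁ ones ∷ t# ∷ inj₁ junk ∷ []

  edgeRhs : Fin (2 + a) → List Symb
  edgeRhs ℓ = inj₁ ones ∷ t# ∷ tl ℓ ∷ inj₁ ones ∷ t# ∷ inj₁ junk ∷ []

  data IsRule : NT → List Symb → Set where
    ones0  : IsRule ones []
    ones1  : IsRule ones (t₁ ∷ inj₁ ones ∷ [])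
    junk0  : IsRule junk []
    junk1  : ∀ ℓ → IsRule junk (edgeRhs ℓ)
    mid0   : IsRule mid (t# ∷ inj₁ junk ∷ [])
    mid1   : IsRule mid (t₁ ∷ inj₁ mid ∷ t₁ ∷ [])
    blank0 : IsRule blanks []
    blank1 : IsRule blanks (tl blankY ∷ hop)
    tokR   : ∀ x → IsRule (tok x) (tl (letterY x) ∷ hop)
    triRR  : ∀ {p x X p₁ α q l} → δP p x X ≡ just (p₁ , α) → Chain p₁ α q l → IsRule (tri p X q) (inj₁ (tok x) ∷ l)
    triER  : ∀ {p X p₁ α q l} → δε p X ≡ just (p₁ , α) → Chain p₁ α q l → IsRule (tri p X q) l
    accNR  : ∀ {p X} → final p ≡ true → IsRule (acc p X) []
    accRR  : ∀ {p x X p₁ α l} → δP p x X ≡ just (p₁ , α) → AChain p₁ α l → IsRule (acc p X) (inj₁ (tok x) ∷ l)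
    accER  : ∀ {p X p₁ α l} → δε p X ≡ just (p₁ , α) → AChain p₁ α l → IsRule (acc p X) l
    startR : ∀ {l} → AChain q₀ [ Z₀ ] l → IsRule start (prefix ++ l ++ suffix)

  -- Enumeration of the rules

  chains : Fin Q → List (Fin Γ) → List (Fin Q × List Symb)
  chains p [] = [ p , [] ]
  chains p (X ∷ α) = concatMap (λ r → map (λ ql → proj₁ ql , inj₁ (tri p X r) ∷ proj₂ ql) (chains r α)) (allFin Q)

  chains⁺ : ∀ {p α q l} → Chain p α q l → (q , l) ∈ chains p α
  chains⁺ [] = here refl
  chains⁺ (via {p} {X} {α} r c) = ∈-concat⁺ (λ r → map (λ ql → proj₁ ql , inj₁ (tri p X r) ∷ proj₂ ql) (chains r α)) (∈-allFin r) (∈-map⁺ _ (chains⁺ c))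

  chains⁻ : ∀ {p} α {q l} → (q , l) ∈ chains p α → Chain p α q l
  chains⁻ [] (here refl) = []
  chains⁻ {p} (X ∷ α) i with ∈-concat⁻ (λ r → map (λ ql → proj₁ ql , inj₁ (tri p X r) ∷ proj₂ ql) (chains r α)) (allFin Q) i
  ... | r , _ , j with ∈-map⁻ (λ ql → proj₁ ql , inj₁ (tri p X r) ∷ proj₂ ql) {xs = chains r α} j
  ...   | _ , k , refl = via r (chains⁻ α k)

  achains : Fin Q → List (Fin Γ) → List (List Symb)
  achains p [] = if final p then [ [] ] else []
  achains p (X ∷ α) = [ inj₁ (acc p X) ] ∷ concatMap (λ r → map (inj₁ (tri p X r) ∷_) (achains r α)) (allFin Q)

  achains⁺ : ∀ {p α l} → AChain p α l → l ∈ achains p α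
  achains⁺ {p} (stopA f) rewrite f = here refl
  achains⁺ lastA = here refl
  achains⁺ (viaA {p} {X} {α} r c) = there (∈-concat⁺ (λ r → map (inj₁ (tri p X r) ∷_) (achains r α)) (∈-allFin r) (∈-map⁺ _ (achains⁺ c)))

  achains⁻ : ∀ {p} α {l} → l ∈ achains p α → AChain p α l
  achains⁻ {p} [] i with final p in f
  achains⁻ {p} [] (here refl) | true = stopA f
  achains⁻ (X ∷ α) (here refl) = lastA
  achains⁻ {p} (X ∷ α) (there i) with ∈-concat⁻ (λ r → map (inj₁ (tri p X r) ∷_) (achains r α)) (allFin Q) i
  ... | r , _ , j with ∈-map⁻ (inj₁ (tri p X r) ∷_) {xs = achains r α} j
  ...   | _ , k , refl = viaA r (achains⁻ α k)

  triRules : Fin Q → Fin Γ → List Symb → Maybe (Fin Q × List (Fin Γ)) → List (NT × List Symb)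
  triRules p X pre nothing = []
  triRules p X pre (just (p₁ , α)) =
    map (λ ql → tri p X (proj₁ ql) , pre ++ proj₂ ql) (chains p₁ α) ++ map (λ l → acc p X , pre ++ l) (achains p₁ α)

  stateRules : Fin Q → Fin Γ → List (NT × List Symb)
  stateRules p X = (if final p then [ acc p X , [] ] else []) ++ triRules p X [] (δε p X) ++
    concatMap (λ x → triRules p X [ inj₁ (tok x) ] (δP p x X)) (allFin a)

  ruleList : List (NT × List Symb)
  ruleList = (ones , []) ∷ (ones , t₁ ∷ inj₁ ones ∷ []) ∷ (junk , []) ∷ (mid , t# ∷ inj₁ junk ∷ []) ∷ (mid , t₁ ∷ inj₁ mid ∷ t₁ ∷ []) ∷
    (blanks , []) ∷ (blanks , tl blankY ∷ hop) ∷
    map (λ ℓ → junk , edgeRhs ℓ) (allFin _) ++ map (λ x → tok x , tl (letterY x) ∷ hop) (allFin a) ++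
    map (λ l → start , prefix ++ l ++ suffix) (achains q₀ [ Z₀ ]) ++
    concatMap (λ p → concatMap (stateRules p) (allFin Γ)) (allFin Q)

  private
    labelled : ∀ {X} → X ∈ (map (λ ℓ → junk , edgeRhs ℓ) (allFin _) ++ map (λ x → tok x , tl (letterY x) ∷ hop) (allFin a) ++
                 map (λ l → start , prefix ++ l ++ suffix) (achains q₀ [ Z₀ ]) ++ concatMap (λ p → concatMap (stateRules p) (allFin Γ)) (allFin Q)) → X ∈ ruleList
    labelled i = there (there (there (there (there (there (there i))))))

    ofState : ∀ {p X r} → r ∈ stateRules p X → r ∈ ruleList
    ofState {p} {X} i = labelled (∈-++⁺ʳ (map (λ ℓ → junk , edgeRhs ℓ) (allFin _)) (∈-++⁺ʳ (map (λ x → tok x , tl (letterY x) ∷ hop) (allFin a))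
      (∈-++⁺ʳ (map (λ l → start , prefix ++ l ++ suffix) (achains q₀ [ Z₀ ])) (∈-concat⁺ (λ p → concatMap (stateRules p) (allFin Γ)) (∈-allFin p) (∈-concat⁺ (stateRules p) (∈-allFin X) i)))))

    fin? : Fin Q → Fin Γ → List (NT × List Symb)
    fin? p X = if final p then [ acc p X , [] ] else []

    ofε : ∀ {p X r} → r ∈ triRules p X [] (δε p X) → r ∈ ruleList
    ofε {p} {X} i = ofState (∈-++⁺ʳ (fin? p X) (∈-++⁺ˡ i))

    ofδ : ∀ {p X x r} → r ∈ triRules p X [ inj₁ (tok x) ] (δP p x X) → r ∈ ruleList
    ofδ {p} {X} {x} i = ofState (∈-++⁺ʳ (fin? p X) (∈-++⁺ʳ (triRules p X [] (δε p X)) (∈-concat⁺ (λ x → triRules p X [ inj₁ (tok x) ] (δP p x X)) (∈-allFin x) i)))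

    triIn : ∀ {p X pre m p₁ α q l} → m ≡ just (p₁ , α) → Chain p₁ α q l → (tri p X q , pre ++ l) ∈ triRules p X pre m
    triIn refl c = ∈-++⁺ˡ (∈-map⁺ _ (chains⁺ c))

    accIn : ∀ {p X pre m p₁ α l} → m ≡ just (p₁ , α) → AChain p₁ α l → (acc p X , pre ++ l) ∈ triRules p X pre m
    accIn {p} {X} {pre} {p₁ = p₁} {α} refl c = ∈-++⁺ʳ (map (λ ql → tri p X (proj₁ ql) , pre ++ proj₂ ql) (chains p₁ α)) (∈-map⁺ _ (achains⁺ c))

    finIn : ∀ {A : Set} {x : A} b → b ≡ true → x ∈ (if b then [ x ] else [])
    finIn true refl = here refl

  rules⁺ : ∀ {X rhs} → IsRule X rhs → (X , rhs) ∈ ruleList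
  rules⁺ ones0 = here refl
  rules⁺ ones1 = there (here refl)
  rules⁺ junk0 = there (there (here refl))
  rules⁺ mid0 = there (there (there (here refl)))
  rules⁺ mid1 = there (there (there (there (here refl))))
  rules⁺ blank0 = there (there (there (there (there (here refl)))))
  rules⁺ blank1 = there (there (there (there (there (there (here refl))))))
  rules⁺ (junk1 ℓ) = labelled (∈-++⁺ˡ (∈-map⁺ _ (∈-allFin ℓ)))
  rules⁺ (tokR x) = labelled (∈-++⁺ʳ (map (λ ℓ → junk , edgeRhs ℓ) (allFin _)) (∈-++⁺ˡ (∈-map⁺ _ (∈-allFin x))))
  rules⁺ (startR c) = labelled (∈-++⁺ʳ (map (λ ℓ → junk , edgeRhs ℓ) (allFin _)) (∈-++⁺ʳ (map (λ x → tok x , tl (letterY x) ∷ hop) (allFin a)) (∈-++⁺ˡ (∈-map⁺ _ (achains⁺ c)))))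
  rules⁺ (triRR e c) = ofδ (triIn e c)
  rules⁺ (triER e c) = ofε (triIn e c)
  rules⁺ (accNR {p} {X} f) = ofState (∈-++⁺ˡ {xs = fin? p X} (finIn (final p) f))
  rules⁺ (accRR e c) = ofδ (accIn e c)
  rules⁺ (accER e c) = ofε (accIn e c)

  private
    triOut : ∀ p X pre m {Y rhs} → (Y , rhs) ∈ triRules p X pre m → ∃ λ p₁ → ∃ λ α → m ≡ just (p₁ , α) ×
             ((∃ λ q → ∃ λ l → Chain p₁ α q l × Y ≡ tri p X q × rhs ≡ pre ++ l) ⊎ (∃ λ l → AChain p₁ α l × Y ≡ acc p X × rhs ≡ pre ++ l))
    triOut p X pre (just (p₁ , α)) i with ∈-++⁻ (map (λ ql → tri p X (proj₁ ql) , pre ++ proj₂ ql) (chains p₁ α)) i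
    ... | inj₁ j with ∈-map⁻ (λ ql → tri p X (proj₁ ql) , pre ++ proj₂ ql) {xs = chains p₁ α} j
    ...   | (q , l) , k , refl = p₁ , α , refl , inj₁ (q , l , chains⁻ α k , refl , refl)
    triOut p X pre (just (p₁ , α)) i | inj₂ j with ∈-map⁻ (λ l → acc p X , pre ++ l) {xs = achains p₁ α} j
    ... | l , k , refl = p₁ , α , refl , inj₂ (l , achains⁻ α k , refl , refl)

    stateOut : ∀ p X {Y rhs} → (Y , rhs) ∈ stateRules p X → IsRule Y rhs
    stateOut p X i with ∈-++⁻ (fin? p X) i
    ... | inj₁ j = fin⁻ (final p) refl j
      where
        fin⁻ : ∀ b → final p ≡ b → ∀ {Y rhs} → (Y , rhs) ∈ (if b then [ acc p X , [] ] else []) → IsRule Y rhs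
        fin⁻ true f (here refl) = accNR f
    ... | inj₂ j with ∈-++⁻ (triRules p X [] (δε p X)) j
    ...   | inj₁ k with triOut p X [] (δε p X) k
    ...     | _ , _ , e , inj₁ (_ , _ , c , refl , refl) = triER e c
    ...     | _ , _ , e , inj₂ (_ , c , refl , refl) = accER e c
    stateOut p X i | inj₂ j | inj₂ k with ∈-concat⁻ (λ x → triRules p X [ inj₁ (tok x) ] (δP p x X)) (allFin a) k
    ... | x , _ , k′ with triOut p X [ inj₁ (tok x) ] (δP p x X) k′
    ...   | _ , _ , e , inj₁ (_ , _ , c , refl , refl) = triRR e c
    ...   | _ , _ , e , inj₂ (_ , c , refl , refl) = accRR e c

  rules⁻ : ∀ {X rhs} → (X , rhs) ∈ ruleList → IsRule X rhs
  rules⁻ (here refl) = ones0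
  rules⁻ (there (here refl)) = ones1
  rules⁻ (there (there (here refl))) = junk0
  rules⁻ (there (there (there (here refl)))) = mid0
  rules⁻ (there (there (there (there (here refl))))) = mid1
  rules⁻ (there (there (there (there (there (here refl)))))) = blank0
  rules⁻ (there (there (there (there (there (there (here refl))))))) = blank1
  rules⁻ (there (there (there (there (there (there (there i))))))) with ∈-++⁻ (map (λ ℓ → junk , edgeRhs ℓ) (allFin _)) i
  ... | inj₁ j with ∈-map⁻ (λ ℓ → junk , edgeRhs ℓ) {xs = allFin _} j
  ...   | ℓ , _ , refl = junk1 ℓ
  rules⁻ (there (there (there (there (there (there (there i))))))) | inj₂ j with ∈-++⁻ (map (λ x → tok x , tl (letterY x) ∷ hop) (allFin a)) j
  ... | inj₁ k with ∈-map⁻ (λ x → tok x , tl (letterY x) ∷ hop) {xs = allFin a} k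
  ...   | x , _ , refl = tokR x
  rules⁻ (there (there (there (there (there (there (there i))))))) | inj₂ j | inj₂ k with ∈-++⁻ (map (λ l → start , prefix ++ l ++ suffix) (achains q₀ [ Z₀ ])) k
  ... | inj₁ h with ∈-map⁻ (λ l → start , prefix ++ l ++ suffix) {xs = achains q₀ [ Z₀ ]} h
  ...   | l , m , refl = startR (achains⁻ [ Z₀ ] m)
  rules⁻ (there (there (there (there (there (there (there i))))))) | inj₂ j | inj₂ k | inj₂ h with ∈-concat⁻ (λ p → concatMap (stateRules p) (allFin Γ)) (allFin Q) h
  ... | p , _ , h′ with ∈-concat⁻ (stateRules p) (allFin Γ) h′
  ...   | X , _ , h″ = stateOut p X h″

-- Correctness of the path grammar

module PathGrammarCorrect {a : ℕ} (P : DPDA a) where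

  open DPDA P using (Q; Γ; q₀; Z₀; δε; final) renaming (δ to δP)
  open PathGrammar P public
  open FiniteGrammar finNT {A} start public

  private
    D : NT → Word A → Set
    D = Der IsRule
    DS : List Symb → Word A → Set
    DS = DerSeq IsRule
    one hash : Fin A
    one = zero
    hash = suc zero

  -- The edge list is cut at the labels of the path rather than at its edges: the source block of
  -- each edge belongs to the preceding piece, where it has been matched with a target.
  data Tail (t : ℕ) : Word (2 + a) → Word A → Set where
    tail-end  : ∀ {ℓ} js → Tail t [ ℓ ] (lab ℓ ∷ unary t ++ encEdges js)
    tail-step : ∀ {ℓ y z} v js → Tail t y z → Tail t (ℓ ∷ y) (lab ℓ ∷ unary v ++ encEdges js ++ unary v ++ z)

  tail⇒ : ∀ {t y z} → Tail t y z → ∀ u → ∃ λ es → encEdges es ≡ unary u ++ z × InOrder es u t y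
  tail⇒ {t} (tail-end {ℓ} js) u = (u , ℓ , t) ∷ js , encEdge-++ u ℓ t (encEdges js) , take done
  tail⇒ (tail-step {ℓ} {y} {z} v js T) u with tail⇒ T v
  ... | es , eq , io = (u , ℓ , v) ∷ js ++ es ,
        trans (encEdge-++ u ℓ v (encEdges (js ++ es))) (cong (λ x → unary u ++ lab ℓ ∷ unary v ++ x) (trans (concatMap-++ encEdge js es) (cong (encEdges js ++_) eq))) ,
        take (skips js io)

  ⇒tail : ∀ {es u t y w} → InOrder es u t y → Yield y w → ∃ λ js → ∃ λ z → encEdges es ≡ encEdges js ++ unary u ++ z × Tail t y z
  ⇒tail (skip {e = e} io) yl with ⇒tail io yl
  ... | js , z , eq , T = e ∷ js , z , trans (cong (encEdge e ++_) eq) (sym (++-assoc (encEdge e) (encEdges js) _)) , T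
  ⇒tail (take {es} {u} {ℓ} {v} io) end with empty-path io
    where
      empty-path : ∀ {es : List (EdgeN (2 + a))} {u t} → InOrder es u t [] → u ≡ t
      empty-path done = refl
      empty-path (skip io) = empty-path io
  ... | refl = [] , _ , encEdge-++ u ℓ v (encEdges es) , tail-end es
  ⇒tail (take {es} {u} {ℓ} {v} io) (pause yl) = let (js , z , eq , T) = ⇒tail io yl in
    [] , _ , trans (encEdge-++ u ℓ v (encEdges es)) (cong (λ x → unary u ++ lab ℓ ∷ unary v ++ x) eq) , tail-step v js T
  ⇒tail (take {es} {u} {ℓ} {v} io) (emitY yl) = let (js , z , eq , T) = ⇒tail io yl in
    [] , _ , trans (encEdge-++ u ℓ v (encEdges es)) (cong (λ x → unary u ++ lab ℓ ∷ unary v ++ x) eq) , tail-step v js T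

  unary-++ : ∀ n (z : Word A) → unary n ++ z ≡ replicate n one ++ hash ∷ z
  unary-++ n z = ++-assoc (replicate n one) [ hash ] z

  onesF : ∀ {v} → D ones v → ∃ λ n → v ≡ replicate n one
  onesF (by ones0 []) = 0 , refl
  onesF (by ones1 (trm (ntm d []))) with onesF d
  ... | n , refl = suc n , cong (one ∷_) (++-identityʳ _)

  onesB : ∀ n → D ones (replicate n one)
  onesB zero = by ones0 []
  onesB (suc n) = by ones1 (trm (subst (DS _) (++-identityʳ _) (ntm (onesB n) [])))

  edge-shape : ∀ u ℓ v (z : Word A) → replicate u one ++ hash ∷ lab ℓ ∷ replicate v one ++ hash ∷ z ≡ encEdge (u , ℓ , v) ++ z
  edge-shape u ℓ v z = sym (trans (encEdge-++ u ℓ v z) (trans (unary-++ u _) (cong (λ x → replicate u one ++ hash ∷ lab ℓ ∷ x) (unary-++ v z))))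

  junkF : ∀ {v} → D junk v → ∃ λ js → v ≡ encEdges js
  junkF (by junk0 []) = [] , refl
  junkF (by (junk1 ℓ) (ntm d (trm (trm (ntm d′ (trm (ntm d″ []))))))) with onesF d | onesF d′ | junkF d″
  ... | u , refl | v , refl | js , refl = (u , ℓ , v) ∷ js ,
        trans (cong (λ x → replicate u one ++ hash ∷ lab ℓ ∷ replicate v one ++ hash ∷ x) (++-identityʳ (encEdges js))) (edge-shape u ℓ v (encEdges js))

  junkB : ∀ js → D junk (encEdges js)
  junkB [] = by junk0 []
  junkB ((u , ℓ , v) ∷ js) = subst (D junk) (trans (cong (λ x → replicate u one ++ hash ∷ lab ℓ ∷ replicate v one ++ hash ∷ x) (++-identityʳ (encEdges js))) (edge-shape u ℓ v (encEdges js)))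
    (by (junk1 ℓ) (ntm (onesB u) (trm (trm (ntm (onesB v) (trm (ntm (junkB js) [])))))))

  link : ℕ → List (EdgeN (2 + a)) → Word A
  link n js = replicate n one ++ hash ∷ encEdges js ++ replicate n one

  link-suc : ∀ n js → one ∷ link n js ++ [ one ] ≡ link (suc n) js
  link-suc n js = cong (one ∷_) (trans (++-assoc (replicate n one) _ [ one ]) (cong (λ x → replicate n one ++ hash ∷ x)
    (trans (++-assoc (encEdges js) (replicate n one) [ one ]) (cong (encEdges js ++_) (trans (replicate-+ n 1 one) (cong (λ k → replicate k one) (+-comm n 1)))))))

  link-shape : ∀ n js z → link n js ++ hash ∷ z ≡ unary n ++ encEdges js ++ unary n ++ z
  link-shape n js z = trans (++-assoc (replicate n one) _ (hash ∷ z)) (trans (cong (λ x → replicate n one ++ hash ∷ x)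
    (trans (++-assoc (encEdges js) (replicate n one) (hash ∷ z)) (cong (encEdges js ++_) (sym (unary-++ n z))))) (sym (unary-++ n _)))

  midF : ∀ {v} → D mid v → ∃ λ n → ∃ λ js → v ≡ link n js
  midF (by mid0 (trm (ntm d []))) with junkF d
  ... | js , refl = 0 , js , refl
  midF (by mid1 (trm (ntm d (trm [])))) with midF d
  ... | n , js , refl = suc n , js , link-suc n js

  midB : ∀ n js → D mid (link n js)
  midB zero js = by mid0 (trm (ntm (junkB js) []))
  midB (suc n) js = subst (D mid) (link-suc n js) (by mid1 (trm (ntm (midB n js) (trm []))))

  TY : ℕ → Word a → Word A → Set
  TY t w z = ∃ λ y → Tail t y z × Yield y w

  hopF : ∀ {t w v z} → DS hop v → TY t w z → ∃ λ y → Yield y w × (∀ ℓ → Tail t (ℓ ∷ y) (lab ℓ ∷ v ++ z))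
  blanksF : ∀ {t w v z} → D blanks v → TY t w z → TY t w (v ++ z)
  hopF {t} {z = z} (ntm d (trm (ntm {u = v} e []))) ty with midF d | blanksF e ty
  ... | n , js , refl | y , T , yl = y , yl , λ ℓ → subst (λ x → Tail t (ℓ ∷ y) (lab ℓ ∷ x)) (sym eq) (tail-step n js T)
    where
      eq : (link n js ++ hash ∷ v ++ []) ++ z ≡ unary n ++ encEdges js ++ unary n ++ v ++ z
      eq = trans (cong (λ x → (link n js ++ hash ∷ x) ++ z) (++-identityʳ v)) (trans (++-assoc (link n js) (hash ∷ v) z) (link-shape n js (v ++ z)))
  blanksF (by blank0 []) ty = ty
  blanksF (by blank1 (trm s)) ty = let (y , yl , T) = hopF s ty in _ , T blankY , pause yl

  tokF : ∀ {t x w v z} → D (tok x) v → TY t w z → TY t (x ∷ w) (v ++ z)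
  tokF (by (tokR x) (trm s)) ty = let (y , yl , T) = hopF s ty in _ , T (letterY x) , emitY yl

  private
    regroup : ∀ {t w} (u v z : Word A) → TY t w (u ++ v ++ z) → TY t w ((u ++ v) ++ z)
    regroup {t} {w} u v z = subst (TY t w) (sym (++-assoc u v z))

    regroupʷ : ∀ {t z} (u v w : Word a) → TY t (u ++ v ++ w) z → TY t ((u ++ v) ++ w) z
    regroupʷ {t} {z} u v w = subst (λ x → TY t x z) (sym (++-assoc u v w))

  -- Derivations are interpreted from right to left: if the text `z` that follows encodes a path
  -- with yield `w`, then prepending the derived text prepends the word read by the automaton. The
  -- converse `triB` consumes text from left to right.
  triF : ∀ {t p X q w v z} → D (tri p X q) v → TY t w z → ∃ λ u → TriW p X q u × TY t (u ++ w) (v ++ z)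
  chainF : ∀ {t p α q l w v z} → Chain p α q l → DS l v → TY t w z → ∃ λ u → SeqW p α q u × TY t (u ++ w) (v ++ z)
  triF {z = z} (by (triRR {x = x} e c) (ntm {u = v₁} {v₂} d s)) ty =
    let (u , sw , ty′) = chainF c s ty in x ∷ u , triR e sw , regroup v₁ v₂ z (tokF d ty′)
  triF (by (triER e c) s) ty = let (u , sw , ty′) = chainF c s ty in u , triE e sw , ty′
  chainF [] [] ty = [] , [] , ty
  chainF {w = w} {z = z} (via r c) (ntm {u = v₁} {v₂} d s) ty =
    let (u₂ , sw , ty₂) = chainF c s ty
        (u₁ , tw , ty₁) = triF d ty₂
    in u₁ ++ u₂ , tw ∷ sw , regroup v₁ v₂ z (regroupʷ u₁ u₂ w ty₁)

  accF : ∀ {t p X v z} → D (acc p X) v → TY t [] z → ∃ λ u → AccW p X u × TY t u (v ++ z)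
  achainF : ∀ {t p α l v z} → AChain p α l → DS l v → TY t [] z → ∃ λ u → AccS p α u × TY t u (v ++ z)
  accF (by (accNR f) []) ty = [] , accN f , ty
  accF {z = z} (by (accRR {x = x} e c) (ntm {u = v₁} {v₂} d s)) ty =
    let (u , sw , ty′) = achainF c s ty in x ∷ u , accR e sw , regroup v₁ v₂ z (tokF d ty′)
  accF (by (accER e c) s) ty = let (u , sw , ty′) = achainF c s ty in u , accE e sw , ty′
  achainF (stopA f) [] ty = [] , acc[] f , ty
  achainF {z = z} lastA (ntm {u = v} d []) ty = let (u , aw , ty′) = accF d ty in u , accH aw , regroup v [] z ty′
  achainF {z = z} (viaA r c) (ntm {u = v₁} {v₂} d s) ty =
    let (u₂ , sw , ty₂) = achainF c s ty
        (u₁ , tw , ty₁) = triF d ty₂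
    in u₁ ++ u₂ , accP tw sw , regroup v₁ v₂ z ty₁

  private
    header-shape : ∀ n N js (z : Word A) → (replicate n one ++ hash ∷ hash ∷ replicate N one ++ hash ∷ encEdges js ++ hash ∷ z) ≡
                   unary n ++ unary 0 ++ unary N ++ encEdges js ++ unary 0 ++ z
    header-shape n N js z = sym (trans (unary-++ n _) (cong (λ x → replicate n one ++ hash ∷ hash ∷ x) (unary-++ N _)))

  grammar-sound : ∀ {W} → D start W → ∃ λ n → ∃ λ N → ∃ λ es → ∃ λ t → ∃ λ y → ∃ λ w →
                  W ≡ encodeN n 0 N es × InOrder es 0 t y × Yield y w × AccS q₀ [ Z₀ ] w
  grammar-sound (by (startR {l} c) s) with derSeq-split prefix s
  ... | _ , _ , refl , ntm d₁ (trm (trm (ntm d₂ (trm (ntm d₃ (trm (ntm {u = b} d₄ []))))))) , s′ with derSeq-split l s′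
  ... | v , _ , refl , sl , trm (ntm d₅ (trm (ntm d₆ []))) with onesF d₁ | onesF d₂ | junkF d₃ | onesF d₅ | junkF d₆
  ... | n , refl | N , refl | js , refl | t , refl | js′ , refl with achainF c sl ty₀
    where
      ty₀ : TY t [] (lab finalY ∷ replicate t one ++ hash ∷ encEdges js′ ++ [])
      ty₀ = [ finalY ] , subst (λ x → Tail t [ finalY ] (lab finalY ∷ x)) (sym (trans (cong (λ x → replicate t one ++ hash ∷ x) (++-identityʳ (encEdges js′))) (sym (unary-++ t (encEdges js′))))) (tail-end js′) , end
  ... | u , aw , ty with blanksF d₄ ty
  ... | y , T , yl with tail⇒ T 0
  ... | es , eq , io = n , N , js ++ es , t , y , u , whole , skips js io , yl , aw
    where
      R : Word A
      R = v ++ lab finalY ∷ replicate t one ++ hash ∷ encEdges js′ ++ []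
      whole : (replicate n one ++ hash ∷ hash ∷ replicate N one ++ hash ∷ encEdges js ++ hash ∷ b ++ []) ++ R ≡ encodeN n 0 N (js ++ es)
      whole = trans (++-assoc (replicate n one) _ R) (trans (cong (λ x → replicate n one ++ hash ∷ hash ∷ x)
                (trans (++-assoc (replicate N one) _ R) (cong (λ x → replicate N one ++ hash ∷ x)
                  (trans (++-assoc (encEdges js) _ R) (cong (λ x → encEdges js ++ hash ∷ x ++ R) (++-identityʳ b))))))
              (trans (header-shape n N js (b ++ R)) (cong (λ x → unary n ++ unary 0 ++ unary N ++ x) (trans (cong (encEdges js ++_) (sym eq)) (sym (concatMap-++ encEdge js es))))))

  -- Every piece of the grammar swallows the blanks that follow it, so a piece begins at a letter or
  -- at the final label; only such paths remain between pieces.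
  data YieldN : Word (2 + a) → Word a → Set where
    end   : YieldN [ finalY ] []
    emitY : ∀ {x y z} → Yield y z → YieldN (letterY x ∷ y) (x ∷ z)

  TN : ℕ → Word a → Word A → Set
  TN t w z = ∃ λ y → Tail t y z × YieldN y w

  hopB : ∀ {t ℓ y z w} → Tail t (ℓ ∷ y) z → Yield y w → ∃ λ v → ∃ λ z′ → z ≡ lab ℓ ∷ v ++ z′ × DS hop v × TN t w z′
  blanksB : ∀ {t y z w} → Tail t y z → Yield y w → ∃ λ v → ∃ λ z′ → z ≡ v ++ z′ × D blanks v × TN t w z′
  hopB (tail-end js) ()
  hopB {ℓ = ℓ} (tail-step n js T) yl with blanksB T yl
  ... | v , z′ , refl , d , tn = link n js ++ hash ∷ v ++ [] , z′ , cong (lab ℓ ∷_) (sym eq) , ntm (midB n js) (trm (ntm d [])) , tn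
    where
      eq : (link n js ++ hash ∷ v ++ []) ++ z′ ≡ unary n ++ encEdges js ++ unary n ++ v ++ z′
      eq = trans (cong (λ x → (link n js ++ hash ∷ x) ++ z′) (++-identityʳ v)) (trans (++-assoc (link n js) (hash ∷ v) z′) (link-shape n js (v ++ z′)))
  blanksB {z = z} T end = [] , z , refl , by blank0 [] , _ , T , end
  blanksB {z = z} T (emitY yl) = [] , z , refl , by blank0 [] , _ , T , emitY yl
  blanksB T (pause yl) = let (v , z′ , eq , s , tn) = hopB T yl in lab blankY ∷ v , z′ , eq , by blank1 (trm s) , tn

  tokB : ∀ {t x w z} → TN t (x ∷ w) z → ∃ λ v → ∃ λ z′ → z ≡ v ++ z′ × D (tok x) v × TN t w z′
  tokB {x = x} (_ , T , emitY yl) = let (v , z′ , eq , s , tn) = hopB T yl in lab (letterY x) ∷ v , z′ , eq , by (tokR x) (trm s) , tn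

  private
    glue : ∀ {z z′ z″ : Word A} u v → z ≡ u ++ z′ → z′ ≡ v ++ z″ → z ≡ (u ++ v) ++ z″
    glue {z″ = z″} u v refl refl = sym (++-assoc u v z″)

  triB : ∀ {t p X q u w z} → TriW p X q u → TN t (u ++ w) z → ∃ λ v → ∃ λ z′ → z ≡ v ++ z′ × D (tri p X q) v × TN t w z′
  chainB : ∀ {t p α q u w z} → SeqW p α q u → TN t (u ++ w) z → ∃ λ l → ∃ λ v → ∃ λ z′ → Chain p α q l × z ≡ v ++ z′ × DS l v × TN t w z′
  triB (triR e s) tn =
    let (v₁ , z₁ , eq₁ , d , tn₁) = tokB tn
        (l , v₂ , z₂ , c , eq₂ , ds , tn₂) = chainB s tn₁
    in v₁ ++ v₂ , z₂ , glue v₁ v₂ eq₁ eq₂ , by (triRR e c) (ntm d ds) , tn₂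
  triB (triE e s) tn = let (l , v , z , c , eq , ds , tn′) = chainB s tn in v , z , eq , by (triER e c) ds , tn′
  chainB [] tn = [] , [] , _ , [] , refl , [] , tn
  chainB {t} {w = w} {z} (_∷_ {r = r} {u = u₁} {u₂} tw sw) tn =
    let (v₁ , z₁ , eq₁ , d , tn₁) = triB tw (subst (λ x → TN t x z) (++-assoc u₁ u₂ w) tn)
        (l , v₂ , z₂ , c , eq₂ , ds , tn₂) = chainB sw tn₁
    in _ , v₁ ++ v₂ , z₂ , via r c , glue v₁ v₂ eq₁ eq₂ , ntm d ds , tn₂

  accB : ∀ {t p X u z} → AccW p X u → TN t u z → ∃ λ v → ∃ λ z′ → z ≡ v ++ z′ × D (acc p X) v × TN t [] z′
  achainB : ∀ {t p α u z} → AccS p α u → TN t u z → ∃ λ l → ∃ λ v → ∃ λ z′ → AChain p α l × z ≡ v ++ z′ × DS l v × TN t [] z′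
  accB (accN f) tn = [] , _ , refl , by (accNR f) [] , tn
  accB (accR e s) tn =
    let (v₁ , z₁ , eq₁ , d , tn₁) = tokB tn
        (l , v₂ , z₂ , c , eq₂ , ds , tn₂) = achainB s tn₁
    in v₁ ++ v₂ , z₂ , glue v₁ v₂ eq₁ eq₂ , by (accRR e c) (ntm d ds) , tn₂
  accB (accE e s) tn = let (l , v , z , c , eq , ds , tn′) = achainB s tn in v , z , eq , by (accER e c) ds , tn′
  achainB (acc[] f) tn = [] , [] , _ , stopA f , refl , [] , tn
  achainB (accH aw) tn = let (v , z , eq , d , tn′) = accB aw tn in _ , v ++ [] , z , lastA , trans eq (cong (_++ z) (sym (++-identityʳ v))) , ntm d [] , tn′
  achainB (accP {r = r} tw s) tn =
    let (v₁ , z₁ , eq₁ , d , tn₁) = triB tw tn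
        (l , v₂ , z₂ , c , eq₂ , ds , tn₂) = achainB s tn₁
    in _ , v₁ ++ v₂ , z₂ , viaA r c , glue v₁ v₂ eq₁ eq₂ , ntm d ds , tn₂

  grammar-complete : ∀ n N {es t y w} → InOrder es 0 t y → Yield y w → AccS q₀ [ Z₀ ] w → D start (encodeN n 0 N es)
  grammar-complete n N {es} {t} io yl aw with ⇒tail io yl
  ... | js , z , eq , T with blanksB T yl
  ... | b , z₁ , refl , db , tn with achainB aw tn
  ... | l , v , _ , c , refl , ds , (_ , tail-step _ _ () , end)
  ... | l , v , _ , c , refl , ds , (_ , tail-end {ℓ} js′ , end) = subst (D start) whole
        (by (startR c) (derSeq-++ {α = prefix} (ntm (onesB n) (trm (trm (ntm (onesB N) (trm (ntm (junkB js) (trm (ntm db []))))))))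
          (derSeq-++ ds (trm (ntm (onesB t) (trm (ntm (junkB js′) [])))))))
    where
      R : Word A
      R = v ++ lab finalY ∷ replicate t one ++ hash ∷ encEdges js′ ++ []
      R≡ : R ≡ v ++ lab finalY ∷ unary t ++ encEdges js′
      R≡ = cong (λ x → v ++ lab finalY ∷ x) (trans (cong (λ x → replicate t one ++ hash ∷ x) (++-identityʳ (encEdges js′))) (sym (unary-++ t (encEdges js′))))
      whole : (replicate n one ++ hash ∷ hash ∷ replicate N one ++ hash ∷ encEdges js ++ hash ∷ b ++ []) ++ R ≡ encodeN n 0 N es
      whole = trans (++-assoc (replicate n one) _ R) (trans (cong (λ x → replicate n one ++ hash ∷ hash ∷ x)
                (trans (++-assoc (replicate N one) _ R) (cong (λ x → replicate N one ++ hash ∷ x)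
                  (trans (++-assoc (encEdges js) _ R) (cong (λ x → encEdges js ++ hash ∷ x ++ R) (++-identityʳ b))))))
              (trans (header-shape n N js (b ++ R)) (cong (λ x → unary n ++ unary 0 ++ unary N ++ x) (trans (cong (λ x → encEdges js ++ unary 0 ++ b ++ x) R≡) (sym eq)))))

-- Recognising instances by inductive counting

ltF : ∀ {a m} → Fin m → Fin m → Form a m
ltF x y = ex (sum true (` suc x) (` zero) (` suc y))

seesL : ∀ {a m} → Fin a → Fin m → Form a m
seesL ℓ x = sees (sameSym (letter ℓ)) (` x)

-- The cells from p on read 1^u #, and p′ is the cell after them.
blkF : ∀ {a m} → Fin m → Fin m → Fin m → Form (2 + a) m
blkF p u p′ = ex (sum false (` suc p) (` suc u) (` zero) and seesL (suc zero) zero and sucF zero (suc p′) and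
  neg (ex (ex (ltF (suc zero) (suc (suc (suc u))) and sum false (` suc (suc (suc p))) (` suc zero) (` zero) and neg (seesL zero zero)))))

-- An edge is found anywhere in the input by the pattern `# 1^u # ℓ 1^v #`. The leading `#` ensures
-- that the whole source block is seen; the header supplies it for the first edge.
edgeF : ∀ {a m} → Fin a → Fin m → Fin m → Form (2 + a) m
edgeF ℓ u v = ex (seesL (suc zero) zero and ex (sucF (suc zero) zero and ex (blkF (suc zero) (suc (suc (suc u))) zero and
  ex (sucF (suc zero) zero and seesL (suc (suc ℓ)) (suc zero) and ex (blkF (suc zero) (suc (suc (suc (suc (suc v))))) zero)))))

-- The blocks of the header: 1^n #, 1^s #, 1^t #, ending at p.
headerF : ∀ {a m} → Fin m → Fin m → Fin m → Fin m → Form (2 + a) m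
headerF n s t p = ex (constF 1 zero and ex (blkF (suc zero) (suc (suc n)) zero and ex (blkF (suc zero) (suc (suc (suc s))) zero and
  blkF zero (suc (suc (suc t))) (suc (suc (suc p))))))

sizeF : ∀ {a m} → Fin m → Form (2 + a) m
sizeF n = ex (constF 1 zero and ex (blkF (suc zero) (suc (suc n)) zero))

hdSym : ∀ {a} → Word a → InSym a
hdSym [] = rend
hdSym (x ∷ _) = letter x

-- Reading the encoding of a graph

module InputSemantics {a : ℕ} (w : Word (2 + a)) (B : ℕ) where

  open Semantics w B
  open FormulaSemantics w B

  one hash : Fin (2 + a)
  one = zero
  hash = suc zero

  lt⇒ : ∀ {m} {ρ : Vec ℕ m} x y → Sat (ltF x y) ρ → lookup ρ x < lookup ρ y
  lt⇒ {ρ = ρ} x y (e , _ , eq) = ≤-trans (s≤s (m≤m+n (lookup ρ x) e)) (≤-reflexive (trans (+-comm 1 _) eq))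

  lt⇐ : ∀ {m} {ρ : Vec ℕ m} x y → lookup ρ y < B → lookup ρ x < lookup ρ y → Sat (ltF x y) ρ
  lt⇐ {ρ = ρ} x y b p with m≤n⇒∃[o]m+o≡n p
  ... | e , eq = e , ≤-trans (s≤s (≤-trans (m≤n+m e (suc (lookup ρ x))) (≤-reflexive eq))) b , trans (+-comm _ 1) eq

  sees⇒ : ∀ {m} {ρ : Vec ℕ m} ℓ x → Sat (seesL ℓ x) ρ → readInput w (lookup ρ x) ≡ letter ℓ
  sees⇒ ℓ x s = sameSym⇒ (letter ℓ) _ s

  sees⇐ : ∀ {m} {ρ : Vec ℕ m} ℓ x → readInput w (lookup ρ x) ≡ letter ℓ → Sat (seesL ℓ x) ρ
  sees⇐ ℓ x eq = trans (cong (sameSym (letter ℓ)) eq) (sameSym-refl (letter ℓ))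

  -- `P` is the input position of the first letter of the suffix `z`; positions of letters start at
  -- 1, after the left end marker.
  Cur : ℕ → Word (2 + a) → Set
  Cur P z = ∃ λ pre → w ≡ pre ++ z × P ≡ suc (length pre)

  read-cur : ∀ {P z} → Cur P z → readInput w P ≡ hdSym z
  read-cur {z = z} (pre , refl , refl) = go pre z
    where
      go : ∀ (pre z : Word (2 + a)) → readInput (pre ++ z) (suc (length pre)) ≡ hdSym z
      go [] [] = refl
      go [] (x ∷ z) = refl
      go (x ∷ pre) z = go pre z

  cur-∷ : ∀ {P x z} → Cur P (x ∷ z) → Cur (suc P) z
  cur-∷ {x = x} {z} (pre , refl , refl) = pre ++ [ x ] , sym (++-assoc pre [ x ] z) , cong suc (sym (trans (length-++ pre) (+-comm (length pre) 1)))

  cur-bound : ∀ {P} {x z} → Cur P (x ++ z) → P + length x ≤ suc (length w)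
  cur-bound {x = x} {z} (pre , refl , refl) = s≤s (≤-trans (m≤m+n (length pre + length x) (length z)) (≤-reflexive
    (trans (+-assoc (length pre) _ _) (trans (cong (length pre +_) (sym (length-++ x))) (sym (length-++ pre))))))

  record Block (P u P′ : ℕ) : Set where
    field
      ends : suc (P + u) ≡ P′
      hashed : readInput w (P + u) ≡ letter hash
      body : ∀ r → r < u → readInput w (P + r) ≡ letter one

  block⇒ : ∀ {m} {ρ : Vec ℕ m} p u p′ → lookup ρ u < B → Sat (blkF p u p′) ρ → Block (lookup ρ p) (lookup ρ u) (lookup ρ p′)
  block⇒ {ρ = ρ} p u p′ u< (t , t< , e , s , e′ , n) = record
    { ends = trans (cong suc eqt) (At.suc⇒ (t ∷ ρ) zero (suc p′) e′)
    ; hashed = trans (cong (readInput w) eqt) (sees⇒ {ρ = t ∷ ρ} hash zero s)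
    ; body = λ r r< → stable r r< }
    where
      eqt : lookup ρ p + lookup ρ u ≡ t
      eqt = trans (sym (+-identityʳ _)) e
      stable : ∀ r → r < lookup ρ u → readInput w (lookup ρ p + r) ≡ letter one
      stable r r< with sat? (seesL one zero) ((lookup ρ p + r) ∷ r ∷ t ∷ ρ)
      ... | yes s = sees⇒ {ρ = (lookup ρ p + r) ∷ r ∷ t ∷ ρ} one zero s
      ... | no ns = ⊥-elim (n (r , <-trans r< u< , lookup ρ p + r , ≤-trans (s≤s (≤-trans (+-monoʳ-≤ (lookup ρ p) (<⇒≤ r<)) (≤-reflexive eqt))) t< ,
                      lt⇐ {ρ = (lookup ρ p + r) ∷ r ∷ t ∷ ρ} (suc zero) (suc (suc (suc u))) u< r< , +-identityʳ _ , ns))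

  block⇐ : ∀ {m} {ρ : Vec ℕ m} p u p′ → lookup ρ p′ < B → Block (lookup ρ p) (lookup ρ u) (lookup ρ p′) → Sat (blkF p u p′) ρ
  block⇐ {ρ = ρ} p u p′ p′< b = t , ≤-trans (≤-reflexive ends) (<⇒≤ p′<) , +-identityʳ _ , sees⇐ {ρ = t ∷ ρ} hash zero hashed , At.suc⇐ (t ∷ ρ) zero (suc p′) ends ,
    λ { (r , _ , s , _ , lt , eq , ns) → ns (sees⇐ {ρ = s ∷ r ∷ t ∷ ρ} one zero
      (trans (cong (readInput w) (trans (sym eq) (+-identityʳ _))) (body r (lt⇒ {ρ = s ∷ r ∷ t ∷ ρ} (suc zero) (suc (suc (suc u))) lt)))) }
    where
      open Block b
      t : ℕ
      t = lookup ρ p + lookup ρ u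

  block-word : ∀ {P u P′ z} → Cur P z → Block P u P′ → ∃ λ z′ → z ≡ unary u ++ z′ × Cur P′ z′
  block-word {P} {u} {P′} {z} c b = go u P z c (Block.ends b) (Block.hashed b) (Block.body b)
    where
      go : ∀ u P z → Cur P z → suc (P + u) ≡ P′ → readInput w (P + u) ≡ letter hash → (∀ r → r < u → readInput w (P + r) ≡ letter one) →
           ∃ λ z′ → z ≡ unary u ++ z′ × Cur P′ z′
      go zero P z c eq s h with trans (sym (read-cur c)) (trans (cong (readInput w) (sym (+-identityʳ P))) s)
      go zero P (x ∷ z) c eq s h | refl = z , refl , subst (λ P → Cur P z) (trans (cong suc (sym (+-identityʳ P))) eq) (cur-∷ c)
      go (suc u) P z c eq s h with trans (sym (read-cur c)) (trans (cong (readInput w) (sym (+-identityʳ P))) (h 0 (s≤s z≤n)))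
      go (suc u) P (x ∷ z) c eq s h | refl =
        let (z′ , e , c′) = go u (suc P) z (cur-∷ c) (trans (cong suc (sym (+-suc P u))) eq) (trans (cong (readInput w) (sym (+-suc P u))) s)
                               (λ r r< → trans (cong (readInput w) (sym (+-suc P r))) (h (suc r) (s≤s r<)))
        in z′ , cong (x ∷_) e , c′

  word-block : ∀ {P} u {z} → Cur P (unary u ++ z) → Block P u (suc (P + u))
  word-block {P} zero c = record { ends = refl ; hashed = trans (cong (readInput w) (+-identityʳ P)) (read-cur c) ; body = λ _ () }
  word-block {P} (suc u) c = record
    { ends = refl ; hashed = trans (cong (readInput w) (+-suc P u)) (Block.hashed b)
    ; body = λ { zero _ → trans (cong (readInput w) (+-identityʳ P)) (read-cur c) ; (suc r) (s≤s p) → trans (cong (readInput w) (+-suc P r)) (Block.body b r p) } }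
    where
      b : Block (suc P) u (suc (suc P + u))
      b = word-block u (cur-∷ c)

  unary-cur : ∀ {P} u {z} → Cur P (unary u ++ z) → Cur (suc (P + u)) z
  unary-cur {P} u {z} c = let (z′ , eq , c′) = block-word c (word-block u c) in subst (Cur (suc (P + u))) (sym (proj₂ (unary-injective u u eq))) c′

  unary-bound : ∀ {P} u {z} → Cur P (unary u ++ z) → suc (P + u) ≤ suc (length w)
  unary-bound {P} u {z} c = ≤-trans (≤-reflexive (trans (sym (+-suc P u)) (cong (P +_) (sym len)))) (cur-bound {x = unary u} {z} c)
    where
      len : length (unary {a} u) ≡ suc u
      len = trans (length-++ (replicate u zero)) (trans (cong (_+ 1) (length-replicate u)) (+-comm u 1))

  start-cur : Cur 1 w
  start-cur = [] , refl , refl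

  lab : Fin a → Fin (2 + a)
  lab ℓ = suc (suc ℓ)

  Sub : ℕ → Fin a → ℕ → Set
  Sub u ℓ v = ∃ λ pre → ∃ λ post → w ≡ pre ++ hash ∷ unary u ++ lab ℓ ∷ unary v ++ post

  edgeF⇒ : ∀ {m} {ρ : Vec ℕ m} ℓ u v → lookup ρ u < B → lookup ρ v < B → Sat (edgeF ℓ u v) ρ → Sub (lookup ρ u) ℓ (lookup ρ v)
  edgeF⇒ {ρ = ρ} ℓ u v u< v< (P , _ , s , P₁ , _ , e₁ , P₂ , _ , b₁ , P₃ , _ , e₂ , s₂ , P₄ , _ , b₂)
    with At.suc⇒ (P₁ ∷ P ∷ ρ) (suc zero) zero e₁ | At.suc⇒ (P₃ ∷ P₂ ∷ P₁ ∷ P ∷ ρ) (suc zero) zero e₂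
       | find P (sees⇒ {ρ = P ∷ ρ} hash zero s)
    where
      find : ∀ P → readInput w P ≡ letter hash → ∃ λ z → Cur P (hash ∷ z)
      find P eq = go w P eq
        where
          go : ∀ (x : Word (2 + a)) P → readInput x P ≡ letter hash → ∃ λ z → ∃ λ pre → x ≡ pre ++ hash ∷ z × P ≡ suc (length pre)
          go (y ∷ x) (suc zero) refl = x , [] , refl , refl
          go (y ∷ x) (suc (suc P)) eq = let (z , pre , e , e′) = go x (suc P) eq in z , y ∷ pre , cong (y ∷_) e , cong suc e′
          go [] (suc P) ()
  ... | refl | refl | z , c with block-word (cur-∷ c) (block⇒ {ρ = P₂ ∷ P₁ ∷ P ∷ ρ} (suc zero) (suc (suc (suc u))) zero u< b₁)
  ...   | z₁ , eq₁ , c₁ with trans (sym (read-cur c₁)) (sees⇒ {ρ = P₃ ∷ P₂ ∷ P₁ ∷ P ∷ ρ} (lab ℓ) (suc zero) s₂)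
  edgeF⇒ {ρ = ρ} ℓ u v u< v< (P , _ , s , P₁ , _ , e₁ , P₂ , _ , b₁ , P₃ , _ , e₂ , s₂ , P₄ , _ , b₂) | refl | refl | z , c@(pre , eq , _) | x ∷ z₁ , eq₁ , c₁ | refl
    with block-word (cur-∷ c₁) (block⇒ {ρ = P₄ ∷ P₃ ∷ P₂ ∷ P₁ ∷ P ∷ ρ} (suc zero) (suc (suc (suc (suc (suc v))))) zero v< b₂)
  ... | z₂ , eq₂ , _ = pre , z₂ , trans eq (cong (λ x → pre ++ hash ∷ x) (trans eq₁ (cong (λ x → unary (lookup ρ u) ++ lab ℓ ∷ x) eq₂)))

  edgeF⇐ : suc (length w) < B → ∀ {m} {ρ : Vec ℕ m} ℓ u v → Sub (lookup ρ u) ℓ (lookup ρ v) → Sat (edgeF ℓ u v) ρ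
  edgeF⇐ w< {ρ = ρ} ℓ u v (pre , post , eq) =
    P , p< , sees⇐ {ρ = P ∷ ρ} hash zero (read-cur c) ,
    P₁ , p₁< , At.suc⇐ (P₁ ∷ P ∷ ρ) (suc zero) zero refl ,
    P₂ , p₂< , block⇐ {ρ = P₂ ∷ P₁ ∷ P ∷ ρ} (suc zero) (suc (suc (suc u))) zero p₂< (word-block U c₁) ,
    P₃ , p₃< , At.suc⇐ (P₃ ∷ P₂ ∷ P₁ ∷ P ∷ ρ) (suc zero) zero refl , sees⇐ {ρ = P₃ ∷ P₂ ∷ P₁ ∷ P ∷ ρ} (lab ℓ) (suc zero) (read-cur c₂) ,
    P₄ , p₄< , block⇐ {ρ = P₄ ∷ P₃ ∷ P₂ ∷ P₁ ∷ P ∷ ρ} (suc zero) (suc (suc (suc (suc (suc v))))) zero p₄< (word-block V c₃)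
    where
      U V P P₁ P₂ P₃ P₄ : ℕ
      U = lookup ρ u
      V = lookup ρ v
      P = suc (length pre)
      P₁ = suc P
      P₂ = suc (P₁ + U)
      P₃ = suc P₂
      P₄ = suc (P₃ + V)
      c : Cur P (hash ∷ unary U ++ lab ℓ ∷ unary V ++ post)
      c = pre , eq , refl
      c₁ : Cur P₁ (unary U ++ lab ℓ ∷ unary V ++ post)
      c₁ = cur-∷ c
      c₂ : Cur P₂ (lab ℓ ∷ unary V ++ post)
      c₂ = unary-cur U c₁
      c₃ : Cur P₃ (unary V ++ post)
      c₃ = cur-∷ c₂
      p₄< : P₄ < B
      p₄< = ≤-trans (s≤s (unary-bound V c₃)) w<
      p₃< : P₃ < B
      p₃< = ≤-trans (s≤s (≤-trans (m≤m+n P₃ V) (n≤1+n _))) p₄<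
      p₂< : P₂ < B
      p₂< = <-trans ≤-refl p₃<
      p₁< : P₁ < B
      p₁< = ≤-trans (s≤s (≤-trans (m≤m+n P₁ U) (n≤1+n _))) p₂<
      p< : P < B
      p< = <-trans ≤-refl p₁<

  sizeF⇒ : ∀ {m} {ρ : Vec ℕ m} n → lookup ρ n < B → Sat (sizeF n) ρ → ∃ λ z → w ≡ unary (lookup ρ n) ++ z
  sizeF⇒ {ρ = ρ} n n< (P , _ , e , P′ , _ , b) with const⇒ (P ∷ ρ) 1 zero e
  ... | refl = let (z , eq , _) = block-word start-cur (block⇒ {ρ = P′ ∷ P ∷ ρ} (suc zero) (suc (suc n)) zero n< b) in z , eq

  sizeF⇐ : suc (length w) < B → ∀ {m} {ρ : Vec ℕ m} n {z} → w ≡ unary (lookup ρ n) ++ z → Sat (sizeF n) ρ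
  sizeF⇐ w< {ρ = ρ} n {z} eq = 1 , 1< , const⇐ (1 ∷ ρ) 1 zero 1< refl , P′ , p′< , block⇐ {ρ = P′ ∷ 1 ∷ ρ} (suc zero) (suc (suc n)) zero p′< (word-block (lookup ρ n) c)
    where
      P′ : ℕ
      P′ = suc (1 + lookup ρ n)
      c : Cur 1 (unary (lookup ρ n) ++ z)
      c = [] , eq , refl
      p′< : P′ < B
      p′< = ≤-trans (s≤s (unary-bound (lookup ρ n) c)) w<
      1< : 1 < B
      1< = ≤-trans (s≤s (s≤s z≤n)) p′<

  headerF⇒ : ∀ {m} {ρ : Vec ℕ m} n s t p → lookup ρ n < B → lookup ρ s < B → lookup ρ t < B → Sat (headerF n s t p) ρ →
             ∃ λ z → w ≡ unary (lookup ρ n) ++ unary (lookup ρ s) ++ unary (lookup ρ t) ++ z × Cur (lookup ρ p) z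
  headerF⇒ {ρ = ρ} n s t p n< s< t< (P , _ , e , P₁ , _ , b₁ , P₂ , _ , b₂ , b₃) with const⇒ (P ∷ ρ) 1 zero e
  ... | refl with block-word start-cur (block⇒ {ρ = P₁ ∷ P ∷ ρ} (suc zero) (suc (suc n)) zero n< b₁)
  ... | z₁ , eq₁ , c₁ with block-word c₁ (block⇒ {ρ = P₂ ∷ P₁ ∷ P ∷ ρ} (suc zero) (suc (suc (suc s))) zero s< b₂)
  ... | z₂ , eq₂ , c₂ with block-word c₂ (block⇒ {ρ = P₂ ∷ P₁ ∷ P ∷ ρ} zero (suc (suc (suc t))) (suc (suc (suc p))) t< b₃)
  ... | z₃ , eq₃ , c₃ = z₃ , trans eq₁ (cong (unary (lookup ρ n) ++_) (trans eq₂ (cong (unary (lookup ρ s) ++_) eq₃))) , c₃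

  headerF⇐ : suc (length w) < B → ∀ {m} {ρ : Vec ℕ m} n s t p {z} → w ≡ unary (lookup ρ n) ++ unary (lookup ρ s) ++ unary (lookup ρ t) ++ z →
             lookup ρ p ≡ suc (suc (suc (suc (lookup ρ n)) + lookup ρ s) + lookup ρ t) → Sat (headerF n s t p) ρ
  headerF⇐ w< {ρ = ρ} n s t p {z} eq eqp =
    1 , 1< , const⇐ (1 ∷ ρ) 1 zero 1< refl , P₁ , p₁< , block⇐ {ρ = P₁ ∷ 1 ∷ ρ} (suc zero) (suc (suc n)) zero p₁< (word-block (lookup ρ n) c₀) ,
    P₂ , p₂< , block⇐ {ρ = P₂ ∷ P₁ ∷ 1 ∷ ρ} (suc zero) (suc (suc (suc s))) zero p₂< (word-block (lookup ρ s) c₁) ,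
    block⇐ {ρ = P₂ ∷ P₁ ∷ 1 ∷ ρ} zero (suc (suc (suc t))) (suc (suc (suc p))) (subst (_< B) (sym eqp) p₃<) (subst (Block P₂ (lookup ρ t)) (sym eqp) (word-block (lookup ρ t) c₂))
    where
      P₁ P₂ : ℕ
      P₁ = suc (1 + lookup ρ n)
      P₂ = suc (P₁ + lookup ρ s)
      c₀ : Cur 1 (unary (lookup ρ n) ++ unary (lookup ρ s) ++ unary (lookup ρ t) ++ z)
      c₀ = [] , eq , refl
      c₁ : Cur P₁ (unary (lookup ρ s) ++ unary (lookup ρ t) ++ z)
      c₁ = unary-cur (lookup ρ n) c₀
      c₂ : Cur P₂ (unary (lookup ρ t) ++ z)
      c₂ = unary-cur (lookup ρ s) c₁
      p₃< : suc (P₂ + lookup ρ t) < B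
      p₃< = ≤-trans (s≤s (unary-bound (lookup ρ t) c₂)) w<
      p₂< : P₂ < B
      p₂< = ≤-trans (s≤s (unary-bound (lookup ρ s) c₁)) w<
      p₁< : P₁ < B
      p₁< = ≤-trans (s≤s (unary-bound (lookup ρ n) c₀)) w<
      1< : 1 < B
      1< = ≤-trans (s≤s (s≤s z≤n)) p₁<

module _ {a : ℕ} where

  private
    one hash : Fin (2 + a)
    one = zero
    hash = suc zero
    lab : Fin a → Fin (2 + a)
    lab ℓ = suc (suc ℓ)

  hash-split : ∀ pre m {X rest : Word (2 + a)} → pre ++ hash ∷ X ≡ unary m ++ rest → X ≡ rest ⊎ ∃ λ pre′ → pre′ ++ hash ∷ X ≡ rest
  hash-split [] zero refl = inj₁ refl
  hash-split (x ∷ pre) zero eq = inj₂ (pre , ∷-injectiveʳ eq)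
  hash-split (x ∷ pre) (suc m) eq = hash-split pre m (∷-injectiveʳ eq)

  -- Only the source block of an edge is preceded by # and followed by a label.
  module _ (u : ℕ) (ℓ : Fin a) (v : ℕ) (post : Word (2 + a)) where

    private
      X : Word (2 + a)
      X = unary u ++ lab ℓ ∷ unary v ++ post

    at-front : ∀ es → X ≡ encEdges es → (u , ℓ , v) ∈ es
    at-front [] eq = ⊥-elim (nonempty u eq)
      where
        nonempty : ∀ u {z : Word (2 + a)} → unary u ++ z ≢ []
        nonempty zero ()
        nonempty (suc u) ()
    at-front ((u′ , ℓ′ , v′) ∷ es) eq with unary-injective u u′ (trans eq (encEdge-++ u′ ℓ′ v′ (encEdges es)))
    ... | refl , eq₁ with ∷-injective eq₁
    ... | refl , eq₂ with unary-injective v v′ eq₂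
    ... | refl , _ = here refl

    inside : ∀ pre es → pre ++ hash ∷ X ≡ encEdges es → (u , ℓ , v) ∈ es
    inside [] [] ()
    inside (_ ∷ _) [] ()
    inside pre ((u′ , ℓ′ , v′) ∷ es) eq with hash-split pre u′ (trans eq (encEdge-++ u′ ℓ′ v′ (encEdges es)))
    ... | inj₁ eq₁ = ⊥-elim (unary-label u eq₁)
    ... | inj₂ (x ∷ pre′ , eq₁) with hash-split pre′ v′ (∷-injectiveʳ eq₁)
    ...   | inj₁ eq₂ = there (at-front es eq₂)
    ...   | inj₂ (pre″ , eq₂) = there (inside pre″ es eq₂)

    not-block : ∀ m {z : Word (2 + a)} → (∀ {x} → z ≢ lab ℓ ∷ x) → X ≢ unary m ++ z
    not-block m h eq = h (sym (proj₂ (unary-injective u m eq)))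

    sub⇒edge : ∀ pre n s t es → pre ++ hash ∷ X ≡ encodeN n s t es → (u , ℓ , v) ∈ es
    sub⇒edge pre n s t es eq with hash-split pre n eq
    ... | inj₁ e = ⊥-elim (not-block s (unary-label t) e)
    ... | inj₂ (pre₁ , e₁) with hash-split pre₁ s e₁
    ...   | inj₁ e = ⊥-elim (not-block t (edges-label es) e)
      where
        edges-label : ∀ es {x} → encEdges es ≢ lab ℓ ∷ x
        edges-label [] ()
        edges-label ((u′ , ℓ′ , v′) ∷ es) eq = unary-label u′ (trans (sym (encEdge-++ u′ ℓ′ v′ (encEdges es))) eq)
    ...   | inj₂ (pre₂ , e₂) with hash-split pre₂ t e₂
    ...     | inj₁ e = at-front es e
    ...     | inj₂ (pre₃ , e₃) = inside pre₃ es e₃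

  edge⇒sub : ∀ {u ℓ v} n s t es → (u , ℓ , v) ∈ es → ∃ λ pre → ∃ λ post → encodeN n s t es ≡ pre ++ hash ∷ unary u ++ lab ℓ ∷ unary v ++ post
  edge⇒sub {u} {ℓ} {v} n s t es i =
    let (pre , post , eq) = go es i (replicate t one)
        header = unary n ++ unary s
    in header ++ pre , post , trans (trans (sym (++-assoc (unary n) (unary s) _)) (cong (header ++_) (trans (++-assoc (replicate t one) [ hash ] _) eq))) (sym (++-assoc header pre _))
    where
      go : ∀ es → (u , ℓ , v) ∈ es → ∀ h → ∃ λ pre → ∃ λ post → h ++ hash ∷ encEdges es ≡ pre ++ hash ∷ unary u ++ lab ℓ ∷ unary v ++ post
      go (_ ∷ es) (here refl) h = h , encEdges es , cong (λ x → h ++ hash ∷ x) (encEdge-++ u ℓ v (encEdges es))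
      go ((u′ , ℓ′ , v′) ∷ es) (there i) h =
        let h′ = h ++ hash ∷ unary u′ ++ lab ℓ′ ∷ replicate v′ one
            (pre , post , eq) = go es i h′
        in pre , post , trans (trans (cong (λ x → h ++ hash ∷ x) (trans (encEdge-++ u′ ℓ′ v′ (encEdges es)) (trans (cong (λ x → unary u′ ++ lab ℓ′ ∷ x) (++-assoc (replicate v′ one) [ hash ] (encEdges es)))
                 (sym (++-assoc (unary u′) _ (hash ∷ encEdges es)))))) (sym (++-assoc h _ (hash ∷ encEdges es)))) eq

-- The last component in which the vectors differ increases, in accordance with `code`, where it is
-- the most significant one.
data Lex : ∀ {k} → Vec ℕ k → Vec ℕ k → Set where
  head : ∀ {k x y} {u : Vec ℕ k} → x < y → Lex (x ∷ u) (y ∷ u)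
  tail : ∀ {k x y} {u v : Vec ℕ k} → Lex u v → Lex (x ∷ u) (y ∷ v)

lex-code : ∀ {k} B {u v : Vec ℕ k} → Bounded B u → Lex u v → code B u < code B v
lex-code B {x ∷ u} b (head p) = code-head-< B u p
lex-code B {x ∷ u} {y ∷ v} (x< , b) (tail l) = code-tail-< B u v x< (lex-code B b l)

-- The counting machine as formulas

module Machine (a : ℕ) where

  α : ℕ
  α = 2 + a

  private
    F : Set
    F = Form α 18

    -- phase h, round d, candidate v, tested vertex u, walk length plus one or cursor j, walk end z,
    -- counts c of the current and e of the next round, witnesses k; primes mark the target.
    k′ e′ c′ z′ j′ u′ v′ d′ h′ k e c z j u v d h : Fin 18
    k′ = # 0
    e′ = # 1
    c′ = # 2
    z′ = # 3
    j′ = # 4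
    u′ = # 5
    v′ = # 6
    d′ = # 7
    h′ = # 8
    k = # 9
    e = # 10
    c = # 11
    z = # 12
    j = # 13
    u = # 14
    v = # 15
    d = # 16
    h = # 17

  adjF : ∀ {m} → Fin m → Fin m → Form α m
  adjF x y = orMap (allFin a) (λ ℓ → edgeF ℓ x y)

  -- `c` is the number of ends of walks with `d` edges. For each candidate `v`, `yesF` ends a
  -- guessed walk of `d + 1` edges at `v`, and `noF` demands `c` witnesses: vertices `u`, in
  -- increasing order, each reached by a guessed walk of `d` edges and without an edge to `v`. When
  -- all candidates are settled, `e` becomes the count of the next round. `doneF` asks for the count
  -- 0 in round `n` and puts the start vertex of the instance into `z`.
  bootF scanF endF skipF beginF walkF noneF noF yesF roundF doneF countF blankF : F
  bootF = zeroF k′ and zeroF e′ and zeroF c′ and zeroF z′ and zeroF u′ and zeroF v′ and zeroF d′ and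
    ex (ex (ex (headerF (# 2) (# 1) (# 0) (suc (suc (suc j′))) and ltF (# 1) (# 2) and ltF (# 0) (# 2))))
  scanF = eqF k k′ and eqF e e′ and eqF c c′ and eqF z z′ and eqF u u′ and eqF v v′ and eqF d d′ and
    ex (ex (ex (sizeF (# 0) and ltF (# 2) (# 0) and ltF (# 1) (# 0) and
      ex (blkF (suc (suc (suc (suc j)))) (# 3) (# 0) and orMap (allFin a) (λ ℓ → seesL (suc (suc ℓ)) (# 0)) and
        ex (sucF (# 1) (# 0) and blkF (# 0) (# 3) (suc (suc (suc (suc (suc j′))))))))))
  endF = zeroF k′ and zeroF e′ and zeroF z′ and zeroF j′ and zeroF u′ and zeroF v′ and zeroF d′ and sees (sameSym rend) (` j) and sizeF c′
  skipF = eqF k k′ and eqF e e′ and eqF c c′ and zeroF z′ and zeroF j and zeroF j′ and sucF u u′ and eqF v v′ and eqF d d′ and ex (sizeF zero and ltF (suc u) zero)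
  beginF = eqF k k′ and eqF e e′ and eqF c c′ and zeroF j and constF 1 j′ and eqF u u′ and eqF v v′ and eqF d d′ and ex (sizeF zero and ltF (suc z′) zero)
  walkF = eqF k k′ and eqF e e′ and eqF c c′ and neg (zeroF j) and sucF j j′ and eqF u u′ and eqF v v′ and eqF d d′ and adjF z z′
  noneF = sucF k k′ and eqF e e′ and eqF c c′ and zeroF z′ and sucF d j and zeroF j′ and sucF u u′ and eqF v v′ and eqF d d′ and eqF z u and neg (adjF u v)
  noF = zeroF k′ and eqF e e′ and eqF c c′ and zeroF z′ and zeroF j′ and zeroF u′ and sucF v v′ and eqF d d′ and eqF k c
  yesF = zeroF k′ and sucF e e′ and eqF c c′ and zeroF z′ and zeroF j′ and zeroF u′ and sucF v v′ and eqF d d′ and eqF z v and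
    ex (sucF (suc d) zero and sucF zero (suc j))
  roundF = zeroF k′ and zeroF e′ and eqF e c′ and zeroF z′ and zeroF j′ and zeroF u′ and zeroF v′ and sucF d d′ and sizeF v
  doneF = zeroF k′ and zeroF e′ and zeroF c′ and zeroF j′ and zeroF u′ and zeroF v′ and zeroF d′ and zeroF c and sizeF d and
    ex (ex (ex (headerF (# 2) (suc (suc (suc z′))) (# 1) (# 0))))
  countF = skipF or beginF or walkF or noneF or noF or yesF or roundF
  blankF = (constF 0 h and constF 1 h′ and bootF) or (constF 1 h and constF 1 h′ and scanF) or (constF 1 h and constF 2 h′ and endF) or
    (constF 2 h and constF 2 h′ and countF) or (constF 2 h and constF 3 h′ and doneF)

  pathF : Fin a → F
  pathF ℓ = constF 3 h and constF 3 h′ and eqF k k′ and eqF e e′ and eqF c c′ and sucF j j′ and eqF u u′ and eqF v v′ and eqF d d′ and edgeF ℓ z z′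

  stepF : Fin (2 + a) → F
  stepF blankY = blankF
  -- The final label is reserved for edges into the extra vertex, on which `final-target` relies.
  stepF finalY = falseF
  stepF (letterY ℓ) = pathF ℓ

  acceptF : Form α 9
  acceptF = constF 3 (# 8) and ex (ex (ex (headerF (# 2) (# 1) (suc (suc (suc (# 3)))) (# 0))))

  State : Set
  State = Vec ℕ 9

  st : (h d v u j z c e k : ℕ) → State
  st h d v u j z c e k = k ∷ e ∷ c ∷ z ∷ j ∷ u ∷ v ∷ d ∷ h ∷ []

  module Transitions (w : Word α) (B : ℕ) (w<B : suc (length w) < B) (3<B : 3 < B) where

    open Semantics w B
    open FormulaSemantics w B
    open InputSemantics {a} w B public

    SizeIs : ℕ → Set
    SizeIs n = ∃ λ x → w ≡ unary n ++ x

    HeaderIs : ℕ → ℕ → ℕ → ℕ → Set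
    HeaderIs n s t P = ∃ λ x → w ≡ unary n ++ unary s ++ unary t ++ x × Cur P x

    Adj : ℕ → ℕ → Set
    Adj x y = ∃ λ ℓ → Sub x ℓ y

    record EdgeAt (P P′ : ℕ) : Set where
      field
        {U V n P₁} : ℕ
        {ℓ}        : Fin a
        sized      : SizeIs n
        U<n        : U < n
        V<n        : V < n
        source     : Block P U P₁
        label      : readInput w P₁ ≡ letter (lab ℓ)
        target     : Block (suc P₁) V P′

    data Count : State → State → Set where
      skip  : ∀ {d v u z c e k n} → SizeIs n → u < n → Count (st 2 d v u 0 z c e k) (st 2 d v (suc u) 0 0 c e k)
      begin : ∀ {d v u z c e k n z′} → SizeIs n → z′ < n → Count (st 2 d v u 0 z c e k) (st 2 d v u 1 z′ c e k)
      walk  : ∀ {d v u i z c e k z′} → Adj z z′ → Count (st 2 d v u (suc i) z c e k) (st 2 d v u (2 + i) z′ c e k)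
      none  : ∀ {d v u c e k} → ¬ Adj u v → Count (st 2 d v u (suc d) u c e k) (st 2 d v (suc u) 0 0 c e (suc k))
      reject : ∀ {d v u j z e k} → Count (st 2 d v u j z k e k) (st 2 d (suc v) 0 0 0 k e 0)
      confirm : ∀ {d v u c e k} → Count (st 2 d v u (2 + d) v c e k) (st 2 d (suc v) 0 0 0 c (suc e) 0)
      round : ∀ {d v u j z c e k} → SizeIs v → Count (st 2 d v u j z c e k) (st 2 (suc d) 0 0 0 0 e 0 0)

    data Change : State → State → Set where
      boot  : ∀ {d v u j z c e k n s t P} → HeaderIs n s t P → s < n → t < n → Change (st 0 d v u j z c e k) (st 1 0 0 0 P 0 0 0 0)
      scan  : ∀ {d v u j z c e k j′} → EdgeAt j j′ → Change (st 1 d v u j z c e k) (st 1 d v u j′ z c e k)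
      end   : ∀ {d v u j z c e k n} → readInput w j ≡ rend → SizeIs n → Change (st 1 d v u j z c e k) (st 2 0 0 0 0 0 n 0 0)
      count : ∀ {x y} → Count x y → Change x y
      done  : ∀ {d v u j z e k n s t P} → SizeIs d → HeaderIs n s t P → Change (st 2 d v u j z 0 e k) (st 3 0 0 0 0 s 0 0 0)

    block-< : ∀ {P U P′} → Block P U P′ → P < P′
    block-< {P} {U} b = ≤-trans (s≤s (m≤m+n P U)) (≤-reflexive (Block.ends b))

    -- Components are reset to 0 only when one of greater significance increases. The order of the
    -- components of `State` is chosen for this.
    count-lex : ∀ {x y} → Count x y → Lex x y
    count-lex (skip _ _) = tail (tail (tail (tail (tail (head ≤-refl)))))
    count-lex (begin _ _) = tail (tail (tail (tail (head ≤-refl))))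
    count-lex (walk _) = tail (tail (tail (tail (head ≤-refl))))
    count-lex (none _) = tail (tail (tail (tail (tail (head ≤-refl)))))
    count-lex reject = tail (tail (tail (tail (tail (tail (head ≤-refl))))))
    count-lex confirm = tail (tail (tail (tail (tail (tail (head ≤-refl))))))
    count-lex (round _) = tail (tail (tail (tail (tail (tail (tail (head ≤-refl)))))))

    change-lex : ∀ {x y} → Change x y → Lex x y
    change-lex (boot _ _ _) = tail (tail (tail (tail (tail (tail (tail (tail (head (s≤s z≤n)))))))))
    change-lex (scan E) = tail (tail (tail (tail (head (<-trans (block-< (EdgeAt.source E)) (<-trans ≤-refl (block-< (EdgeAt.target E))))))))
    change-lex (end _ _) = tail (tail (tail (tail (tail (tail (tail (tail (head ≤-refl))))))))
    change-lex (done _ _) = tail (tail (tail (tail (tail (tail (tail (tail (head ≤-refl))))))))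
    change-lex (count s) = count-lex s

    env : State → State → Vec ℕ 18
    env y x = y Vec.++ (x Vec.++ [])

    private
      bound : ∀ {m} {u : Vec ℕ m} → Bounded B u → ∀ j → lookup u j < B
      bound {u = x ∷ u} (b , _) zero = b
      bound {u = x ∷ u} (_ , b) (suc j) = bound b j

      env< : ∀ x y → Bounded B x → Bounded B y → ∀ j → lookup (env y x) j < B
      env< x y bx by = bound (append y _ by (append x [] bx tt))
        where
          append : ∀ {m n} (u : Vec ℕ m) (v : Vec ℕ n) → Bounded B u → Bounded B v → Bounded B (u Vec.++ v)
          append [] v _ b = b
          append (x ∷ u) v (b , bs) b′ = b , append u v bs b′

    adj⇒ : ∀ {m} {ρ : Vec ℕ m} x y → lookup ρ x < B → lookup ρ y < B → Sat (adjF x y) ρ → Adj (lookup ρ x) (lookup ρ y)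
    adj⇒ {ρ = ρ} x y bx by s = let (ℓ , _ , s′) = At.or⇒ ρ (allFin a) _ s in ℓ , edgeF⇒ {ρ = ρ} ℓ x y bx by s′

    adj⇐ : ∀ {m} {ρ : Vec ℕ m} x y → Adj (lookup ρ x) (lookup ρ y) → Sat (adjF x y) ρ
    adj⇐ {ρ = ρ} x y (ℓ , s) = At.or⇐ ρ (λ ℓ → edgeF ℓ x y) (∈-allFin ℓ) (edgeF⇐ w<B {ρ = ρ} ℓ x y s)

    headerIs⇐ : ∀ {m} {ρ : Vec ℕ m} n s t p → HeaderIs (lookup ρ n) (lookup ρ s) (lookup ρ t) (lookup ρ p) → Sat (headerF n s t p) ρ
    headerIs⇐ {ρ = ρ} n s t p (x , eq , c) = headerF⇐ w<B {ρ = ρ} n s t p eq (cur-unique c (unary-cur T₀ (unary-cur S (unary-cur {1} N ([] , eq , refl)))))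
      where
        N S T₀ : ℕ
        N = lookup ρ n
        S = lookup ρ s
        T₀ = lookup ρ t
        cur-unique : ∀ {P P′ x} → Cur P x → Cur P′ x → P ≡ P′
        cur-unique {x = x} (pre , eq , refl) (pre′ , eq′ , refl) = cong suc (+-cancelʳ-≡ (length x) _ _
          (trans (sym (length-++ pre)) (trans (cong length (trans (sym eq) eq′)) (length-++ pre′))))

    change⇒ : ∀ x y → Bounded B x → Bounded B y → Sat blankF (env y x) → Change x y
    change⇒ x@(k₀ ∷ e₀ ∷ c₀ ∷ z₀ ∷ j₀ ∷ u₀ ∷ v₀ ∷ d₀ ∷ h₀ ∷ []) y@(k₁ ∷ e₁ ∷ c₁ ∷ z₁ ∷ j₁ ∷ u₁ ∷ v₁ ∷ d₁ ∷ h₁ ∷ []) bx by = phases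
      where
        ρ : Vec ℕ 18
        ρ = env y x
        open At ρ
        ρ< : ∀ i → lookup ρ i < B
        ρ< = env< x y bx by

        booted : h₀ ≡ 0 → h₁ ≡ 1 → Sat bootF ρ → Change x y
        booted refl refl (refl , refl , refl , refl , refl , refl , refl , n , n< , s , s< , t , t< , hd , ls , lt) =
          boot (headerF⇒ {ρ = t ∷ s ∷ n ∷ ρ} (# 2) (# 1) (# 0) (suc (suc (suc j′))) n< s< t< hd) (lt⇒ {ρ = t ∷ s ∷ n ∷ ρ} (# 1) (# 2) ls) (lt⇒ {ρ = t ∷ s ∷ n ∷ ρ} (# 0) (# 2) lt)

        scanned : h₀ ≡ 1 → h₁ ≡ 1 → Sat scanF ρ → Change x y
        scanned refl refl (q₁ , q₂ , q₃ , q₄ , q₅ , q₆ , q₇ , U , U< , V , V< , n , n< , sz , lu , lv , P₁ , P₁< , b , s , P₂ , P₂< , e₂ , b₂)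
          with eq⇒ k k′ q₁ | eq⇒ e e′ q₂ | eq⇒ c c′ q₃ | eq⇒ z z′ q₄ | eq⇒ u u′ q₅ | eq⇒ v v′ q₆ | eq⇒ d d′ q₇
        ... | refl | refl | refl | refl | refl | refl | refl with At.or⇒ (P₁ ∷ n ∷ V ∷ U ∷ ρ) (allFin a) _ s | At.suc⇒ (P₂ ∷ P₁ ∷ n ∷ V ∷ U ∷ ρ) (# 1) (# 0) e₂
        ... | ℓ , _ , s′ | refl = scan (record
          { sized = sizeF⇒ {ρ = n ∷ V ∷ U ∷ ρ} (# 0) n< sz ; U<n = lt⇒ {ρ = n ∷ V ∷ U ∷ ρ} (# 2) (# 0) lu ; V<n = lt⇒ {ρ = n ∷ V ∷ U ∷ ρ} (# 1) (# 0) lv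
          ; source = block⇒ {ρ = P₁ ∷ n ∷ V ∷ U ∷ ρ} (suc (suc (suc (suc j)))) (# 3) (# 0) U< b
          ; label = sees⇒ {ρ = P₁ ∷ n ∷ V ∷ U ∷ ρ} (lab ℓ) (# 0) s′
          ; target = block⇒ {ρ = P₂ ∷ P₁ ∷ n ∷ V ∷ U ∷ ρ} (# 0) (# 3) (suc (suc (suc (suc (suc j′))))) V< b₂ })

        ended : h₀ ≡ 1 → h₁ ≡ 2 → Sat endF ρ → Change x y
        ended refl refl (refl , refl , refl , refl , refl , refl , refl , s , sz) = end (sameSym⇒ rend _ s) (sizeF⇒ {ρ = ρ} c′ (ρ< c′) sz)

        counted : h₀ ≡ 2 → h₁ ≡ 2 → Sat countF ρ → Count x y
        counted refl refl (inj₁ (q₁ , q₂ , q₃ , refl , refl , refl , q₇ , q₈ , q₉ , n , n< , sz , lt))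
          with eq⇒ k k′ q₁ | eq⇒ e e′ q₂ | eq⇒ c c′ q₃ | suc⇒ u u′ q₇ | eq⇒ v v′ q₈ | eq⇒ d d′ q₉
        ... | refl | refl | refl | refl | refl | refl = skip (sizeF⇒ {ρ = n ∷ ρ} zero n< sz) (lt⇒ {ρ = n ∷ ρ} (suc u) zero lt)
        counted refl refl (inj₂ (inj₁ (q₁ , q₂ , q₃ , refl , q₅ , q₆ , q₇ , q₈ , n , n< , sz , lt)))
          with eq⇒ k k′ q₁ | eq⇒ e e′ q₂ | eq⇒ c c′ q₃ | const⇒ ρ 1 j′ q₅ | eq⇒ u u′ q₆ | eq⇒ v v′ q₇ | eq⇒ d d′ q₈
        ... | refl | refl | refl | refl | refl | refl | refl = begin (sizeF⇒ {ρ = n ∷ ρ} zero n< sz) (lt⇒ {ρ = n ∷ ρ} (suc z′) zero lt)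
        counted refl refl (inj₂ (inj₂ (inj₁ (q₁ , q₂ , q₃ , nz , q₅ , q₆ , q₇ , q₈ , A))))
          with eq⇒ k k′ q₁ | eq⇒ e e′ q₂ | eq⇒ c c′ q₃ | suc⇒ j j′ q₅ | eq⇒ u u′ q₆ | eq⇒ v v′ q₇ | eq⇒ d d′ q₈ | adj⇒ {ρ = ρ} z z′ (ρ< z) (ρ< z′) A
        ... | refl | refl | refl | refl | refl | refl | refl | A′ = walked j₀ refl
          where
            walked : ∀ i → i ≡ j₀ → Count (st 2 d₀ v₀ u₀ j₀ z₀ c₀ e₀ k₀) (st 2 d₀ v₀ u₀ (suc j₀) z₁ c₀ e₀ k₀)
            walked zero refl = ⊥-elim (nz refl)
            walked (suc i) refl = walk A′
        counted refl refl (inj₂ (inj₂ (inj₂ (inj₁ (q₁ , q₂ , q₃ , refl , q₅ , refl , q₇ , q₈ , q₉ , q₁₀ , A)))))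
          with suc⇒ k k′ q₁ | eq⇒ e e′ q₂ | eq⇒ c c′ q₃ | suc⇒ d j q₅ | suc⇒ u u′ q₇ | eq⇒ v v′ q₈ | eq⇒ d d′ q₉ | eq⇒ z u q₁₀
        ... | refl | refl | refl | refl | refl | refl | refl | refl = none (A ∘ adj⇐ {ρ = ρ} u v)
        counted refl refl (inj₂ (inj₂ (inj₂ (inj₂ (inj₁ (refl , q₂ , q₃ , refl , refl , refl , q₇ , q₈ , q₉))))))
          with eq⇒ e e′ q₂ | eq⇒ c c′ q₃ | suc⇒ v v′ q₇ | eq⇒ d d′ q₈ | eq⇒ k c q₉
        ... | refl | refl | refl | refl | refl = reject
        counted refl refl (inj₂ (inj₂ (inj₂ (inj₂ (inj₂ (inj₁ (refl , q₂ , q₃ , refl , refl , refl , q₇ , q₈ , q₉ , x′ , _ , s₁ , s₂)))))))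
          with suc⇒ e e′ q₂ | eq⇒ c c′ q₃ | suc⇒ v v′ q₇ | eq⇒ d d′ q₈ | eq⇒ z v q₉ | At.suc⇒ (x′ ∷ ρ) (suc d) zero s₁ | At.suc⇒ (x′ ∷ ρ) zero (suc j) s₂
        ... | refl | refl | refl | refl | refl | refl | refl = confirm
        counted refl refl (inj₂ (inj₂ (inj₂ (inj₂ (inj₂ (inj₂ (refl , refl , q₃ , refl , refl , refl , refl , q₈ , sz)))))))
          with eq⇒ e c′ q₃ | suc⇒ d d′ q₈
        ... | refl | refl = round (sizeF⇒ {ρ = ρ} v (ρ< v) sz)

        finished : h₀ ≡ 2 → h₁ ≡ 3 → Sat doneF ρ → Change x y
        finished refl refl (refl , refl , refl , refl , refl , refl , refl , refl , sz , n , n< , t , t< , P , _ , hd) =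
          done {n = n} {s = z₁} {t = t} {P = P} (sizeF⇒ {ρ = ρ} d (ρ< d) sz) (headerF⇒ {ρ = P ∷ t ∷ n ∷ ρ} (# 2) (suc (suc (suc z′))) (# 1) (# 0) n< (ρ< z′) t< hd)

        phases : Sat blankF ρ → Change x y
        phases (inj₁ (p , q , s)) = booted (const⇒ ρ 0 h p) (const⇒ ρ 1 h′ q) s
        phases (inj₂ (inj₁ (p , q , s))) = scanned (const⇒ ρ 1 h p) (const⇒ ρ 1 h′ q) s
        phases (inj₂ (inj₂ (inj₁ (p , q , s)))) = ended (const⇒ ρ 1 h p) (const⇒ ρ 2 h′ q) s
        phases (inj₂ (inj₂ (inj₂ (inj₁ (p , q , s))))) = count (counted (const⇒ ρ 2 h p) (const⇒ ρ 2 h′ q) s)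
        phases (inj₂ (inj₂ (inj₂ (inj₂ (p , q , s))))) = finished (const⇒ ρ 2 h p) (const⇒ ρ 3 h′ q) s

    change⇐ : ∀ {x y} → Bounded B x → Bounded B y → Change x y → Sat blankF (env y x)
    change⇐ {x} {y} bx by (boot {n = n} {s} {t} hd@(_ , eq , _) s<n t<n) = inj₁ (refl , const⇐ ρ 1 h′ (ρ< h′) refl , refl , refl , refl , refl , refl , refl , refl ,
        n , n< , s , <-trans s<n n< , t , <-trans t<n n< , headerIs⇐ {ρ = t ∷ s ∷ n ∷ ρ} (# 2) (# 1) (# 0) (suc (suc (suc j′))) hd ,
        lt⇐ {ρ = t ∷ s ∷ n ∷ ρ} (# 1) (# 2) n< s<n , lt⇐ {ρ = t ∷ s ∷ n ∷ ρ} (# 0) (# 2) n< t<n)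
      where
        ρ = env y x
        ρ< = env< x y bx by
        n< : n < B
        n< = ≤-trans (s≤s (≤-trans (n≤1+n n) (≤-trans (n≤1+n (suc n)) (unary-bound {1} n ([] , eq , refl))))) w<B
    change⇐ {x} {y} bx by (scan E) = inj₂ (inj₁ (const⇐ ρ 1 h (ρ< h) refl , const⇐ ρ 1 h′ (ρ< h′) refl ,
        eq⇐ k k′ refl , eq⇐ e e′ refl , eq⇐ c c′ refl , eq⇐ z z′ refl , eq⇐ u u′ refl , eq⇐ v v′ refl , eq⇐ d d′ refl ,
        U , <-trans U<n n< , V , <-trans V<n n< , n , n< , sizeF⇐ w<B {ρ = n ∷ V ∷ U ∷ ρ} (# 0) (proj₂ sized) ,
        lt⇐ {ρ = n ∷ V ∷ U ∷ ρ} (# 2) (# 0) n< U<n , lt⇐ {ρ = n ∷ V ∷ U ∷ ρ} (# 1) (# 0) n< V<n ,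
        P₁ , p₁< , block⇐ {ρ = P₁ ∷ n ∷ V ∷ U ∷ ρ} (suc (suc (suc (suc j)))) (# 3) (# 0) p₁< source ,
        At.or⇐ (P₁ ∷ n ∷ V ∷ U ∷ ρ) (λ ℓ → seesL (suc (suc ℓ)) (# 0)) (∈-allFin ℓ) (sees⇐ {ρ = P₁ ∷ n ∷ V ∷ U ∷ ρ} (lab ℓ) (# 0) label) ,
        suc P₁ , p₂< , At.suc⇐ (suc P₁ ∷ P₁ ∷ n ∷ V ∷ U ∷ ρ) (# 1) (# 0) refl ,
        block⇐ {ρ = suc P₁ ∷ P₁ ∷ n ∷ V ∷ U ∷ ρ} (# 0) (# 3) (suc (suc (suc (suc (suc j′))))) (ρ< j′) target))
      where
        open EdgeAt E
        ρ = env y x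
        open At ρ
        ρ< = env< x y bx by
        p₂< : suc P₁ < B
        p₂< = <-trans (block-< target) (ρ< j′)
        p₁< : P₁ < B
        p₁< = <-trans ≤-refl p₂<
        n< : n < B
        n< = ≤-trans (s≤s (≤-trans (n≤1+n n) (≤-trans (n≤1+n (suc n)) (unary-bound {1} n ([] , proj₂ sized , refl))))) w<B
    change⇐ {x} {y} bx by (end {n = n} r sz) = inj₂ (inj₂ (inj₁ (const⇐ ρ 1 h (ρ< h) refl , const⇐ ρ 2 h′ (ρ< h′) refl ,
        refl , refl , refl , refl , refl , refl , refl , trans (cong (sameSym rend) r) refl , sizeF⇐ w<B {ρ = ρ} c′ (proj₂ sz))))
      where
        ρ = env y x
        ρ< = env< x y bx by
    change⇐ {x} {y} bx by (done {n = n} {s = s} {t = t} {P = P} sz hd@(_ , eq , cur)) = inj₂ (inj₂ (inj₂ (inj₂ (const⇐ ρ 2 h (ρ< h) refl , const⇐ ρ 3 h′ (ρ< h′) refl ,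
        refl , refl , refl , refl , refl , refl , refl , refl , sizeF⇐ w<B {ρ = ρ} d (proj₂ sz) ,
        n , ≤-trans (s≤s (≤-trans (m≤n+m n 2) (unary-bound {1} n c₀))) w<B , t , ≤-trans (s≤s (≤-trans (m≤n+m t (suc (suc (suc (1 + n)) + s))) (unary-bound t c₂))) w<B ,
        P , ≤-trans (s≤s (≤-trans (≤-reflexive (sym (+-identityʳ P))) (cur-bound {x = []} cur))) w<B ,
        headerIs⇐ {ρ = P ∷ t ∷ n ∷ ρ} (# 2) (suc (suc (suc z′))) (# 1) (# 0) hd))))
      where
        ρ = env y x
        ρ< = env< x y bx by
        c₀ : Cur 1 (unary n ++ unary s ++ unary t ++ _)
        c₀ = [] , eq , refl
        c₂ : Cur (suc (suc (1 + n) + s)) (unary t ++ _)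
        c₂ = unary-cur s (unary-cur n c₀)
    change⇐ {x} {y} bx by (count ch) = inj₂ (inj₂ (inj₂ (inj₁ (const2 ch))))
      where
        ρ = env y x
        open At ρ
        ρ< = env< x y bx by
        size< : ∀ {n} → SizeIs n → n < B
        size< {n} (_ , eq) = ≤-trans (s≤s (≤-trans (m≤n+m n 2) (unary-bound {1} n ([] , eq , refl)))) w<B
        const2 : Count x y → Sat (constF 2 h and constF 2 h′ and countF) ρ
        const2 (skip {n = n} sz u<n) = const⇐ ρ 2 h (ρ< h) refl , const⇐ ρ 2 h′ (ρ< h′) refl , inj₁ (eq⇐ k k′ refl , eq⇐ e e′ refl , eq⇐ c c′ refl , refl , refl , refl , suc⇐ u u′ refl , eq⇐ v v′ refl , eq⇐ d d′ refl ,
          n , size< sz , sizeF⇐ w<B {ρ = n ∷ ρ} zero (proj₂ sz) , lt⇐ {ρ = n ∷ ρ} (suc u) zero (size< sz) u<n)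
        const2 (begin {n = n} sz z<n) = const⇐ ρ 2 h (ρ< h) refl , const⇐ ρ 2 h′ (ρ< h′) refl , inj₂ (inj₁ (eq⇐ k k′ refl , eq⇐ e e′ refl , eq⇐ c c′ refl , refl , const⇐ ρ 1 j′ (ρ< j′) refl , eq⇐ u u′ refl , eq⇐ v v′ refl , eq⇐ d d′ refl ,
          n , size< sz , sizeF⇐ w<B {ρ = n ∷ ρ} zero (proj₂ sz) , lt⇐ {ρ = n ∷ ρ} (suc z′) zero (size< sz) z<n))
        const2 (walk A) = const⇐ ρ 2 h (ρ< h) refl , const⇐ ρ 2 h′ (ρ< h′) refl , inj₂ (inj₂ (inj₁ (eq⇐ k k′ refl , eq⇐ e e′ refl , eq⇐ c c′ refl , (λ ()) , suc⇐ j j′ refl , eq⇐ u u′ refl , eq⇐ v v′ refl , eq⇐ d d′ refl , adj⇐ {ρ = ρ} z z′ A)))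
        const2 (none A) = const⇐ ρ 2 h (ρ< h) refl , const⇐ ρ 2 h′ (ρ< h′) refl , inj₂ (inj₂ (inj₂ (inj₁ (suc⇐ k k′ refl , eq⇐ e e′ refl , eq⇐ c c′ refl , refl , suc⇐ d j refl , refl , suc⇐ u u′ refl , eq⇐ v v′ refl , eq⇐ d d′ refl , eq⇐ z u refl ,
          A ∘ adj⇒ {ρ = ρ} u v (ρ< u) (ρ< v)))))
        const2 reject = const⇐ ρ 2 h (ρ< h) refl , const⇐ ρ 2 h′ (ρ< h′) refl , inj₂ (inj₂ (inj₂ (inj₂ (inj₁ (refl , eq⇐ e e′ refl , eq⇐ c c′ refl , refl , refl , refl , suc⇐ v v′ refl , eq⇐ d d′ refl , eq⇐ k c refl)))))
        const2 (confirm {d = d₀}) = const⇐ ρ 2 h (ρ< h) refl , const⇐ ρ 2 h′ (ρ< h′) refl , inj₂ (inj₂ (inj₂ (inj₂ (inj₂ (inj₁ (refl , suc⇐ e e′ refl , eq⇐ c c′ refl , refl , refl , refl , suc⇐ v v′ refl , eq⇐ d d′ refl , eq⇐ z v refl ,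
          suc d₀ , <-trans ≤-refl (ρ< j) , At.suc⇐ (suc d₀ ∷ ρ) (suc d) zero refl , At.suc⇐ (suc d₀ ∷ ρ) zero (suc j) refl))))))
        const2 (round sz) = const⇐ ρ 2 h (ρ< h) refl , const⇐ ρ 2 h′ (ρ< h′) refl , inj₂ (inj₂ (inj₂ (inj₂ (inj₂ (inj₂ (refl , refl , eq⇐ e c′ refl , refl , refl , refl , refl , suc⇐ d d′ refl , sizeF⇐ w<B {ρ = ρ} v (proj₂ sz)))))))

    data PathStep (ℓ : Fin a) : State → State → Set where
      pathStep : ∀ {d v u j z c e k z′} → Sub z ℓ z′ → PathStep ℓ (st 3 d v u j z c e k) (st 3 d v u (suc j) z′ c e k)

    path⇒ : ∀ ℓ x y → Bounded B x → Bounded B y → Sat (pathF ℓ) (env y x) → PathStep ℓ x y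
    path⇒ ℓ x@(k₀ ∷ e₀ ∷ c₀ ∷ z₀ ∷ j₀ ∷ u₀ ∷ v₀ ∷ d₀ ∷ h₀ ∷ []) y@(k₁ ∷ e₁ ∷ c₁ ∷ z₁ ∷ j₁ ∷ u₁ ∷ v₁ ∷ d₁ ∷ h₁ ∷ []) bx by (p , q , q₁ , q₂ , q₃ , q₄ , q₅ , q₆ , q₇ , s)
      with const⇒ (env y x) 3 h p | const⇒ (env y x) 3 h′ q | eq⇒ k k′ q₁ | eq⇒ e e′ q₂ | eq⇒ c c′ q₃ | suc⇒ j j′ q₄ | eq⇒ u u′ q₅ | eq⇒ v v′ q₆ | eq⇒ d d′ q₇
         | edgeF⇒ {ρ = env y x} ℓ z z′ (env< x y bx by z) (env< x y bx by z′) s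
      where open At (env y x)
    ... | refl | refl | refl | refl | refl | refl | refl | refl | refl | s′ = pathStep s′

    path⇐ : ∀ {ℓ x y} → Bounded B x → Bounded B y → PathStep ℓ x y → Sat (pathF ℓ) (env y x)
    path⇐ {ℓ} {x} {y} bx by (pathStep s) = const⇐ ρ 3 h (ρ< h) refl , const⇐ ρ 3 h′ (ρ< h′) refl , eq⇐ k k′ refl , eq⇐ e e′ refl , eq⇐ c c′ refl , suc⇐ j j′ refl , eq⇐ u u′ refl , eq⇐ v v′ refl , eq⇐ d d′ refl ,
        edgeF⇐ w<B {ρ = ρ} ℓ z z′ s
      where
        ρ = env y x
        ρ< = env< x y bx by
        open At ρ

    path-lex : ∀ {ℓ x y} → PathStep ℓ x y → Lex x y
    path-lex (pathStep _) = tail (tail (tail (tail (head ≤-refl))))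

    accept⇒ : ∀ h d v u j z c e k → Bounded B (st h d v u j z c e k) → Sat acceptF (st h d v u j z c e k Vec.++ []) → h ≡ 3 × ∃ λ n → ∃ λ s → ∃ λ P → HeaderIs n s z P
    accept⇒ h d v u j z c e k (_ , _ , _ , z< , _) (q , n , n< , s , s< , P , _ , hd) =
      const⇒ (st h d v u j z c e k Vec.++ []) 3 (# 8) q , n , s , P ,
      headerF⇒ {ρ = P ∷ s ∷ n ∷ (st h d v u j z c e k Vec.++ [])} (# 2) (# 1) (suc (suc (suc (# 3)))) (# 0) n< s< z< hd

    accept⇐ : ∀ {d v u j z c e k n s P} → HeaderIs n s z P → Sat acceptF (st 3 d v u j z c e k Vec.++ [])
    accept⇐ {d} {v} {u} {j} {z} {c} {e} {k} {n} {s} {P} hd@(_ , eq , cur) = const⇐ ρ 3 (# 8) 3<B refl ,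
        n , ≤-trans (s≤s (≤-trans (m≤n+m n 2) (unary-bound {1} n c₀))) w<B , s , ≤-trans (s≤s (≤-trans (m≤n+m s (suc (suc (1 + n)))) (unary-bound s (unary-cur n c₀)))) w<B ,
        P , ≤-trans (s≤s (≤-trans (≤-reflexive (sym (+-identityʳ P))) (cur-bound {x = []} cur))) w<B ,
        headerIs⇐ {ρ = P ∷ s ∷ n ∷ ρ} (# 2) (# 1) (suc (suc (suc (# 3)))) (# 0) hd
      where
        ρ = st 3 d v u j z c e k Vec.++ []
        c₀ : Cur 1 (unary n ++ unary s ++ unary z ++ _)
        c₀ = [] , eq , refl

-- Counting vertices and walks

module _ {P : ℕ → Set} (P? : ∀ x → Dec (P x)) where

  cnt : ℕ → ℕ
  cnt zero = 0
  cnt (suc m) = (if does (P? m) then 1 else 0) + cnt m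

  cnt-yes : ∀ m → P m → cnt (suc m) ≡ suc (cnt m)
  cnt-yes m p with P? m
  ... | yes _ = refl
  ... | no ¬p = ⊥-elim (¬p p)

  cnt-no : ∀ m → ¬ P m → cnt (suc m) ≡ cnt m
  cnt-no m ¬p with P? m
  ... | yes p = ⊥-elim (¬p p)
  ... | no _ = refl

  cnt≤ : ∀ m → cnt m ≤ m
  cnt≤ zero = z≤n
  cnt≤ (suc m) with P? m
  ... | yes _ = s≤s (cnt≤ m)
  ... | no _ = m≤n⇒m≤1+n (cnt≤ m)

  cnt-mono : ∀ {m n} → m ≤ n → cnt m ≤ cnt n
  cnt-mono {m} {zero} z≤n = z≤n
  cnt-mono {m} {suc n} p with m≤n⇒m<n∨m≡n p
  ... | inj₁ (s≤s q) = ≤-trans (cnt-mono q) (m≤n+m (cnt n) _)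
  ... | inj₂ refl = ≤-refl

  cnt-all : ∀ m → (∀ x → x < m → P x) → cnt m ≡ m
  cnt-all zero h = refl
  cnt-all (suc m) h = trans (cnt-yes m (h m ≤-refl)) (cong suc (cnt-all m (λ x x< → h x (m<n⇒m<1+n x<))))

  cnt-none : ∀ m → (∀ x → ¬ P x) → cnt m ≡ 0
  cnt-none zero h = refl
  cnt-none (suc m) h = trans (cnt-no m (h m)) (cnt-none m h)

  cnt-zero : ∀ m x → x < m → cnt m ≡ 0 → ¬ P x
  cnt-zero (suc m) x (s≤s p) eq Px with m≤n⇒m<n∨m≡n p
  ... | inj₂ refl = case trans (sym (cnt-yes m Px)) eq of λ ()
  ... | inj₁ q = cnt-zero m x q (m+n≡0⇒n≡0 (if does (P? m) then 1 else 0) eq) Px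

module _ {P Q : ℕ → Set} (P? : ∀ x → Dec (P x)) (Q? : ∀ x → Dec (Q x)) (sub : ∀ {x} → P x → Q x) where

  cnt-⊆ : ∀ m → cnt P? m ≤ cnt Q? m
  cnt-⊆ zero = z≤n
  cnt-⊆ (suc m) with P? m | Q? m
  ... | yes _ | yes _ = s≤s (cnt-⊆ m)
  ... | yes p | no ¬q = ⊥-elim (¬q (sub p))
  ... | no _ | yes _ = m≤n⇒m≤1+n (cnt-⊆ m)
  ... | no _ | no _ = cnt-⊆ m

  -- The strict inequality makes rejection conclusive: one end of a walk that is no witness leaves
  -- fewer witnesses than the count demands.
  cnt-⊂ : ∀ m x → x < m → Q x → ¬ P x → cnt P? m < cnt Q? m
  cnt-⊂ (suc m) x (s≤s p) q ¬p with m≤n⇒m<n∨m≡n p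
  ... | inj₂ refl = ≤-trans (s≤s (≤-trans (≤-reflexive (cnt-no P? m ¬p)) (cnt-⊆ m))) (≤-reflexive (sym (cnt-yes Q? m q)))
  ... | inj₁ x<m with P? m | Q? m
  ...   | yes _ | yes _ = s≤s (cnt-⊂ m x x<m q ¬p)
  ...   | yes p′ | no ¬q = ⊥-elim (¬q (sub p′))
  ...   | no _ | yes _ = m≤n⇒m≤1+n (cnt-⊂ m x x<m q ¬p)
  ...   | no _ | no _ = cnt-⊂ m x x<m q ¬p

PathN-++ : ∀ {c} {es : List (EdgeN c)} {u v t y z} → PathN es u v y → PathN es v t z → PathN es u t (y ++ z)
PathN-++ stopN q = q
PathN-++ (stepN i p) q = stepN i (PathN-++ p q)

module Walks {a : ℕ} (n : ℕ) (es : List (EdgeN a)) (inR : inRange n es) where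

  E : ℕ → ℕ → Set
  E x y = ∃ λ ℓ → (x , ℓ , y) ∈ es

  E? : ∀ x y → Dec (E x y)
  E? x y = go es
    where
      go : ∀ es → Dec (∃ λ ℓ → (x , ℓ , y) ∈ es)
      go [] = no λ { (_ , ()) }
      go ((u , ℓ , v) ∷ es) = map′ [ (λ { (refl , refl) → ℓ , here refl }) , (λ (ℓ′ , i) → ℓ′ , there i) ]′
        (λ { (_ , here refl) → inj₁ (refl , refl) ; (ℓ′ , there i) → inj₂ (ℓ′ , i) }) ((u ≟ x ×-dec v ≟ y) ⊎-dec go es)

  -- The graph is acyclic iff R n is empty.
  R : ℕ → ℕ → Set
  R zero z = z < n
  R (suc j) z = ∃ λ x → R j x × E x z

  R< : ∀ j {z} → R j z → z < n
  R< zero p = p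
  R< (suc j) (_ , _ , _ , i) = proj₂ (inR i)

  R? : ∀ j z → Dec (R j z)
  R? zero z = z <? n
  R? (suc j) z = map′ (λ (x , _ , r) → x , r) (λ (x , r , e) → x , R< j r , r , e) (anyUpTo? (λ x → R? j x ×-dec E? x z) n)

  R-path : ∀ i {u v y} → R i u → PathN es u v y → R (i + length y) v
  R-path i {u} r stopN = subst (λ j → R j u) (sym (+-identityʳ i)) r
  R-path i {v = v} r (stepN {x = ℓ} {y = y} e p) = subst (λ j → R j v) (sym (+-suc i (length y))) (R-path (suc i) (_ , r , ℓ , e) p)

  R-down : ∀ i m {z} → R (i + m) z → ∃ (R m)
  R-down zero m r = _ , r
  R-down (suc i) m (_ , r , _) = R-down i m r

  -- Going `n` times around a nonempty cycle gives a walk with at least `n` edges, and cutting it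
  -- back leaves one with exactly `n`.
  no-cycle : (∀ z → ¬ R n z) → ∀ {v y} → v < n → PathN es v v y → y ≡ []
  no-cycle none {v} {[]} v< p = refl
  no-cycle none {v} {ℓ ∷ y} v< p = ⊥-elim (none _ (proj₂ (R-down (n * length y) n (subst (λ j → R j v) eq (laps n)))))
    where
      laps : ∀ m → R (m * length (ℓ ∷ y)) v
      laps zero = v<
      laps (suc m) = subst (λ j → R j v) (+-comm (m * length (ℓ ∷ y)) (length (ℓ ∷ y))) (R-path (m * length (ℓ ∷ y)) (laps m) p)
      eq : n * suc (length y) ≡ n * length y + n
      eq = trans (*-suc n (length y)) (+-comm n _)

  -- The vertices of a walk numbered from its end, following the recursion of `R`.
  vert : ∀ j {z} → R j z → ℕ → ℕ
  vert zero {z} r i = z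
  vert (suc j) {z} r zero = z
  vert (suc j) (x , r , _) (suc i) = vert j r i

  vert< : ∀ j {z} (r : R j z) i → vert j r i < n
  vert< zero r i = r
  vert< (suc j) r zero = R< (suc j) r
  vert< (suc j) (_ , r , _) (suc i) = vert< j r i

  vert-0 : ∀ j {z} (r : R j z) → vert j r 0 ≡ z
  vert-0 zero r = refl
  vert-0 (suc j) r = refl

  segment : ∀ j {z} (r : R j z) i i′ → i ≤ i′ → i′ ≤ j → ∃ λ y → PathN es (vert j r i′) (vert j r i) y × length y ≡ i′ ∸ i
  segment j r zero zero _ _ = [] , stopN , refl
  segment (suc j) {z} (x , r , ℓ , e) zero (suc i′) _ (s≤s q) =
    let (y , p , l) = segment j r zero i′ z≤n q
    in y ++ [ ℓ ] , PathN-++ (subst (λ v → PathN es (vert j r i′) v y) (vert-0 j r) p) (stepN e stopN) , trans (length-++ y) (trans (+-comm (length y) 1) (cong suc l))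
  segment (suc j) (_ , r , _) (suc i) (suc i′) (s≤s p) (s≤s q) = segment j r i i′ p q

  -- A walk with `n` edges visits `n + 1` vertices, so two of them coincide and the segment between
  -- them is a nonempty cycle.
  acyclic⇒none : (∀ {v y} → v < n → PathN es v v y → y ≡ []) → ∀ z → ¬ R n z
  acyclic⇒none ac z r = clash (Fin.pigeonhole ≤-refl f)
    where
      f : Fin (suc n) → Fin n
      f i = fromℕ< (vert< n r (toℕ i))
      clash : ¬ ∃ (λ i → ∃ λ i′ → i Data.Fin.< i′ × f i ≡ f i′)
      clash (i , i′ , i<i′ , eq) =
        let (y , p , l) = segment n r (toℕ i) (toℕ i′) (<⇒≤ i<i′) (≤-pred (Fin.toℕ<n i′))
            same = trans (sym (Fin.toℕ-fromℕ< (vert< n r (toℕ i)))) (trans (cong toℕ eq) (Fin.toℕ-fromℕ< (vert< n r (toℕ i′))))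
            y≡[] = ac (vert< n r (toℕ i)) (subst (λ v → PathN es v (vert n r (toℕ i)) y) (sym same) p)
        in <⇒≱ i<i′ (m∸n≡0⇒m≤n (trans (sym l) (cong length y≡[])))

-- Runs certify instances

module Membership (a : ℕ) where

  open Machine a
  -- A state has 9 components, and the parameter 2 makes the base 4: `4 ^ width` exceeds both
  -- `suc (length w)` and the largest phase 3.
  open GraphRuns α (2 + a) 9 2 stepF acceptF finalY public

  record Valid (w : Word α) (ww : Word a) : Set where
    field
      n s t : ℕ
      es    : List (EdgeN a)
      parse : w ≡ encodeN n s t es
      inR   : inRange n es
      s<n   : s < n
      t<n   : t < n
      none  : ∀ z → ¬ Walks.R n es inR n z
      path  : PathN es s t ww

  module _ (w : Word α) where

    w<B : suc (length w) < B w
    w<B = ≤-trans (s≤s (n<2^width (length w))) (≤-trans (+-monoˡ-≤ (2 ^ ℓ) (m^n>0 2 ℓ)) (≤-trans (≤-reflexive (lem (2 ^ ℓ)))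
            (≤-trans (*-monoˡ-≤ (2 ^ ℓ) (^-monoʳ-≤ 2 (1≤width (length w)))) (≤-reflexive (pow-* 2 2 ℓ)))))
      where
        ℓ : ℕ
        ℓ = width (length w)
        lem : ∀ x → x + x ≡ 2 ^ 1 * x
        lem = solve-∀

    3<B : 3 < B w
    3<B = pow-≤ (width (length w)) (≤-refl {4}) (s≤s z≤n) (1≤width (length w))

    open Transitions w (B w) w<B 3<B

    RunY : State → Word a → Set
    RunY x ww = ∃ λ y → Run w x y × Yield y ww

    increasing : ∀ {u v x} → Bounded (B w) u → Bounded (B w) v → Sat w (stepF x) (v Vec.++ ext u) → vtx w u < vtx w v
    increasing {u} {v} {blankY} bu bv s = lex-code (B w) bu (change-lex (change⇒ u v bu bv s))
    increasing {x = finalY} bu bv ()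
    increasing {u} {v} {letterY ℓ} bu bv s = lex-code (B w) bu (path-lex (path⇒ ℓ u v bu bv s))

    size-unique : ∀ {m} n {x} → w ≡ unary n ++ x → SizeIs m → m ≡ n
    size-unique {m} n eq (_ , eq′) = proj₁ (unary-injective m n (trans (sym eq′) eq))

    -- Phase 1 can be left only at the end marker, and each earlier move consumes one complete edge
    -- with endpoints below `n`. Hence the text after the header is an edge list in range.
    scanned : ∀ {y ww d v u P z c e k x} n → Run w (st 1 d v u P z c e k) y → Yield y ww → Bounded (B w) (st 1 d v u P z c e k) → Cur P x → SizeIs n →
              ∃ λ es → x ≡ encEdges es × inRange n es × Bounded (B w) (st 2 0 0 0 0 0 n 0 0) × RunY (st 2 0 0 0 0 0 n 0 0) ww
    scannedStep : ∀ {y ww d v u P z c e k x} n x′ → Change (st 1 d v u P z c e k) x′ → Bounded (B w) x′ → Run w x′ y → Yield y ww → Cur P x → SizeIs n →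
                  ∃ λ es → x ≡ encEdges es × inRange n es × Bounded (B w) (st 2 0 0 0 0 0 n 0 0) × RunY (st 2 0 0 0 0 0 n 0 0) ww
    scanned {d = d} {v} {u} {P} {z} {c} {e} {k} n (accept s) yl bx cur sz = case proj₁ (accept⇒ 1 d v u P z c e k bx s) of λ ()
    scanned n (move {x = finalY} bv () r) yl bx cur sz
    scanned n (move {v₁} {x = letterY ℓ} bv s r) yl bx cur sz = case path⇒ ℓ _ v₁ bx bv s of λ ()
    scanned n (move {v₁} {x = blankY} bv s r) (pause yl) bx cur sz = scannedStep n v₁ (change⇒ _ v₁ bx bv s) bv r yl cur sz
    scannedStep n _ (count ()) bv r yl cur sz
    scannedStep {y} {ww} n _ (end {n = n′} rd sz′) bv r yl cur sz =
      [] , atEnd cur rd , (λ ()) , subst (λ n → Bounded (B w) (st 2 0 0 0 0 0 n 0 0)) n′≡n bv , y , subst (λ n → Run w (st 2 0 0 0 0 0 n 0 0) y) n′≡n r , yl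
      where
        n′≡n : n′ ≡ n
        n′≡n = size-unique n (proj₂ sz) sz′
        atEnd : ∀ {P x} → Cur P x → readInput w P ≡ rend → x ≡ []
        atEnd {x = []} c e = refl
        atEnd {x = _ ∷ _} c e = case trans (sym (read-cur c)) e of λ ()
    scannedStep {ww = ww} n _ (scan {j′ = P′} E) bv r yl cur sz with block-word cur (EdgeAt.source E)
    ... | x₁ , refl , cur₁ = labelled x₁ cur₁ (trans (sym (read-cur cur₁)) (EdgeAt.label E))
      where
        open EdgeAt E using (U; ℓ; V; U<n; V<n)
        n′≡n : EdgeAt.n E ≡ n
        n′≡n = size-unique n (proj₂ sz) (EdgeAt.sized E)
        Result : Word α → Set
        Result x = ∃ λ es → x ≡ encEdges es × inRange n es × Bounded (B w) (st 2 0 0 0 0 0 n 0 0) × RunY (st 2 0 0 0 0 0 n 0 0) ww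
        extend : ∀ {x} → Result x → Result (unary U ++ lab ℓ ∷ unary V ++ x)
        extend (es , refl , inR , rest) = (U , ℓ , V) ∷ es , sym (encEdge-++ U ℓ V (encEdges es)) ,
          (λ { (here refl) → subst (U <_) n′≡n U<n , subst (V <_) n′≡n V<n ; (there i) → inR i }) , rest
        labelled : ∀ x₁ → Cur (EdgeAt.P₁ E) x₁ → hdSym x₁ ≡ letter (lab ℓ) → Result (unary U ++ x₁)
        labelled (_ ∷ x₁) cur₁ refl with block-word (cur-∷ cur₁) (EdgeAt.target E)
        ... | x₂ , refl , cur₂ = extend (scanned n r yl bv cur₂ sz)

    module Parsed (n s t : ℕ) (es : List (EdgeN a)) (parse : w ≡ encodeN n s t es) (inR : inRange n es) where

      open Walks n es inR

      sizeIs : SizeIs n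
      sizeIs = _ , parse

      size≡ : ∀ {m} → SizeIs m → m ≡ n
      size≡ = size-unique n parse

      header≡ : ∀ {n′ s′ t′ P} → HeaderIs n′ s′ t′ P → s′ ≡ s × t′ ≡ t
      header≡ {n′} {s′} {t′} (x , eq , _) with unary-injective n′ n (trans (sym eq) parse)
      ... | _ , eq₁ with unary-injective s′ s eq₁
      ... | refl , eq₂ with unary-injective t′ t eq₂
      ... | refl , _ = refl , refl

      sub⇒∈ : ∀ {x ℓ y} → Sub x ℓ y → (x , ℓ , y) ∈ es
      sub⇒∈ {x} {ℓ} {y} (pre , post , eq) = sub⇒edge x ℓ y post pre n s t es (trans (sym eq) parse)

      ∈⇒sub : ∀ {x ℓ y} → (x , ℓ , y) ∈ es → Sub x ℓ y
      ∈⇒sub i = let (pre , post , eq) = edge⇒sub n s t es i in pre , post , trans parse eq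

      adj⇒E : ∀ {x y} → Adj x y → E x y
      adj⇒E (ℓ , s) = ℓ , sub⇒∈ s

      E⇒adj : ∀ {x y} → E x y → Adj x y
      E⇒adj (ℓ , i) = ℓ , ∈⇒sub i

      Q : ℕ → ℕ → ℕ → Set
      Q d v x = R d x × ¬ E x v

      Q? : ∀ d v x → Dec (Q d v x)
      Q? d v x = R? d x ×-dec ¬? (E? x v)

      -- `c` and `e` are exact, whereas `k` is only bounded by the number of witnesses: `skip` may
      -- pass over one. Since `reject` asks for `k = c`, every end of a walk with `d` edges must
      -- then be a witness. In `wk` the value 0 of `j` means that no walk is under way.
      record Inv (d v u j z c e k : ℕ) : Set where
        field
          c≡ : c ≡ cnt (R? d) n
          e≡ : e ≡ cnt (R? (suc d)) v
          u≤ : u ≤ n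
          k≤ : k ≤ cnt (Q? d v) u
          wk : j ≡ 0 ⊎ ∃ λ i → j ≡ suc i × R i z
      open Inv

      reached : ∀ {d v u i z c e k} → Inv d v u (suc i) z c e k → R i z
      reached I with wk I
      ... | inj₂ (_ , refl , r) = r

      Counted : Word a → Set
      Counted ww = (∀ z → ¬ R n z) × Bounded (B w) (st 3 0 0 0 0 s 0 0 0) × RunY (st 3 0 0 0 0 s 0 0 0) ww

      counted : ∀ {y ww d v u j z c e k} → Run w (st 2 d v u j z c e k) y → Yield y ww → Bounded (B w) (st 2 d v u j z c e k) → Inv d v u j z c e k → Counted ww
      countedStep : ∀ {y ww d v u j z c e k} x → Change (st 2 d v u j z c e k) x → Bounded (B w) x → Run w x y → Yield y ww → Inv d v u j z c e k → Counted ww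
      countStep : ∀ {y ww d v u j z c e k} x → Count (st 2 d v u j z c e k) x → Bounded (B w) x → Run w x y → Yield y ww → Inv d v u j z c e k → Counted ww
      counted {d = d} {v} {u} {j} {z} {c} {e} {k} (accept s) yl bx I = case proj₁ (accept⇒ 2 d v u j z c e k bx s) of λ ()
      counted (move {x = finalY} bv () r) yl bx I
      counted (move {v₁} {x = letterY ℓ} bv s r) yl bx I = case path⇒ ℓ _ v₁ bx bv s of λ ()
      counted (move {v₁} {x = blankY} bv s r) (pause yl) bx I = countedStep v₁ (change⇒ _ v₁ bx bv s) bv r yl I
      countedStep x (count ch) bv r yl I = countStep x ch bv r yl I
      countedStep {y} _ (done {n = n₂} {s₂} {t₂} {P₂} sz hd) bv r yl I =
        (λ z Rz → cnt-zero (R? n) n z (R< n Rz) (trans (sym (cong (λ d → cnt (R? d) n) (size≡ sz))) (sym (c≡ I))) Rz) ,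
        subst (λ s → Bounded (B w) (st 3 0 0 0 0 s 0 0 0)) s≡ bv , y , subst (λ s → Run w (st 3 0 0 0 0 s 0 0 0) y) s≡ r , yl
        where
          s≡ : s₂ ≡ s
          s≡ = proj₁ (header≡ {n₂} {s₂} {t₂} {P₂} hd)
      countStep {d = d} {v} {u} _ (skip sz u<) bv r yl I =
        counted r yl bv record { c≡ = c≡ I ; e≡ = e≡ I ; u≤ = subst (u <_) (size≡ sz) u< ; k≤ = ≤-trans (k≤ I) (cnt-mono (Q? d v) (n≤1+n u)) ; wk = inj₁ refl }
      countStep _ (begin {z′ = z′} sz z<) bv r yl I =
        counted r yl bv record { c≡ = c≡ I ; e≡ = e≡ I ; u≤ = u≤ I ; k≤ = k≤ I ; wk = inj₂ (0 , refl , subst (z′ <_) (size≡ sz) z<) }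
      countStep _ (walk A) bv r yl I =
        counted r yl bv record { c≡ = c≡ I ; e≡ = e≡ I ; u≤ = u≤ I ; k≤ = k≤ I ; wk = inj₂ (_ , refl , _ , reached I , adj⇒E A) }
      countStep {d = d} {v} {u} _ (none A) bv r yl I =
        counted r yl bv record { c≡ = c≡ I ; e≡ = e≡ I ; u≤ = R< d (reached I) ; k≤ = ≤-trans (s≤s (k≤ I)) (≤-reflexive (sym (cnt-yes (Q? d v) u (reached I , A ∘ E⇒adj)))) ; wk = inj₁ refl }
      countStep {d = d} {v} {u} {k = k} _ reject bv r yl I =
        counted r yl bv record { c≡ = c≡ I ; e≡ = trans (e≡ I) (sym (cnt-no (R? (suc d)) v unreached)) ; u≤ = z≤n ; k≤ = z≤n ; wk = inj₁ refl }
        where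
          -- The k witnesses exhaust the ends of walks with d edges, and none of them has an edge to v.
          unreached : ¬ R (suc d) v
          unreached (x , Rx , Ex) = <-irrefl (c≡ I) (≤-trans (s≤s (≤-trans (k≤ I) (cnt-mono (Q? d v) (u≤ I)))) (cnt-⊂ (Q? d v) (R? d) proj₁ n x (R< d Rx) Rx (λ q → proj₂ q Ex)))
      countStep {d = d} {v} _ confirm bv r yl I =
        counted r yl bv record { c≡ = c≡ I ; e≡ = trans (cong suc (e≡ I)) (sym (cnt-yes (R? (suc d)) v (reached I))) ; u≤ = z≤n ; k≤ = z≤n ; wk = inj₁ refl }
      countStep {d = d} _ (round sz) bv r yl I =
        counted r yl bv record { c≡ = trans (e≡ I) (cong (cnt (R? (suc d))) (size≡ sz)) ; e≡ = refl ; u≤ = z≤n ; k≤ = z≤n ; wk = inj₁ refl }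

      followed : ∀ {y ww d v u j z c e k} → Run w (st 3 d v u j z c e k) y → Yield y ww → Bounded (B w) (st 3 d v u j z c e k) → PathN es z t ww
      followedStep : ∀ {y ww d v u j z c e k ℓ} x → PathStep ℓ (st 3 d v u j z c e k) x → Bounded (B w) x → Run w x y → Yield y ww → PathN es z t (ℓ ∷ ww)
      followed {d = d} {v} {u} {j} {z} {c} {e} {k} (accept s) end bx =
        let (_ , n₂ , s₂ , P₂ , hd) = accept⇒ 3 d v u j z c e k bx s
        in subst (λ t → PathN es z t []) (proj₂ (header≡ {n₂} {s₂} {z} {P₂} hd)) stopN
      followed (move {x = finalY} bv () r) yl bx
      followed (move {v₁} {x = blankY} bv s r) yl bx = case change⇒ _ v₁ bx bv s of λ { (count ()) }
      followed (move {v₁} {x = letterY ℓ} bv s r) (emitY yl) bx = followedStep v₁ (path⇒ ℓ _ v₁ bx bv s) bv r yl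
      followedStep _ (pathStep sub) bv r yl = stepN (sub⇒∈ sub) (followed r yl bv)

    start-bounded : Bounded (B w) (st 0 0 0 0 0 0 0 0 0)
    start-bounded = 0<B w , 0<B w , 0<B w , 0<B w , 0<B w , 0<B w , 0<B w , 0<B w , 0<B w , tt

    run⇒valid : ∀ {ww} → RunY (st 0 0 0 0 0 0 0 0 0) ww → Valid w ww
    run⇒valid (_ , accept s , yl) = case proj₁ (accept⇒ 0 0 0 0 0 0 0 0 0 start-bounded s) of λ ()
    run⇒valid (_ , move {x = finalY} bv () r , yl)
    run⇒valid (_ , move {v₁} {x = letterY ℓ} bv s r , yl) = case path⇒ ℓ _ v₁ start-bounded bv s of λ ()
    run⇒valid {ww} (_ , move {v₁} {x = blankY} bv s r , pause yl) = booted v₁ (change⇒ _ v₁ start-bounded bv s) bv r yl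
      where
        booted : ∀ {y} x → Change (st 0 0 0 0 0 0 0 0 0) x → Bounded (B w) x → Run w x y → Yield y ww → Valid w ww
        booted _ (count ()) bv r yl
        booted _ (boot {n = n} {s₀} {t} (x , eq , cur) s<n t<n) bv r yl with scanned n r yl bv cur (_ , eq)
        ... | es , refl , inR , bv₂ , _ , r₂ , yl₂ =
          let (empty , bv₃ , _ , r₃ , yl₃) = Parsed.counted n s₀ t es eq inR r₂ yl₂ bv₂
                (record { c≡ = sym (cnt-all (Walks.R? n es inR 0) n (λ _ x< → x<)) ; e≡ = refl ; u≤ = z≤n ; k≤ = z≤n ; wk = inj₁ refl })
          in record { n = n ; s = s₀ ; t = t ; es = es ; parse = eq ; inR = inR ; s<n = s<n ; t<n = t<n ; none = empty
                    ; path = Parsed.followed n s₀ t es eq inR r₃ yl₃ bv₃ }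

-- Instances have runs

module MembershipComplete (a : ℕ) where

  open Machine a
  open Membership a public

  module _ (w : Word α) where

    open Transitions w (B w) (w<B w) (3<B w)

    -- The size `n` is written in unary, so all counts and vertices are bounded by the input length;
    -- the cursor may reach the end marker at `suc (length w)`.
    record Small (h d v u j z c e k : ℕ) : Set where
      constructor small
      field
        h≤ : h ≤ 3
        d≤ : d ≤ suc (length w)
        v≤ : v ≤ suc (length w)
        u≤ : u ≤ suc (length w)
        j≤ : j ≤ suc (length w)
        z≤ : z ≤ suc (length w)
        c≤ : c ≤ suc (length w)
        e≤ : e ≤ suc (length w)
        k≤ : k ≤ suc (length w)

    small⇒bounded : ∀ {h d v u j z c e k} → Small h d v u j z c e k → Bounded (B w) (st h d v u j z c e k)
    small⇒bounded (small h d v u j z c e k) = up k , up e , up c , up z , up j , up u , up v , up d , ≤-trans (s≤s h) (3<B w) , tt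
      where
        up : ∀ {x} → x ≤ suc (length w) → x < B w
        up p = ≤-trans (s≤s p) (w<B w)

    blankStep : ∀ {x h d v u j z c e k ww} → Bounded (B w) x → Small h d v u j z c e k → Change x (st h d v u j z c e k) → RunY w (st h d v u j z c e k) ww → RunY w x ww
    blankStep bx sm ch (y , r , yl) = blankY ∷ y , move (small⇒bounded sm) (change⇐ bx (small⇒bounded sm) ch) r , pause yl

    module _ (n s t : ℕ) (es : List (EdgeN a)) (parse : w ≡ encodeN n s t es) (inR : inRange n es) (s<n : s < n) (t<n : t < n) where

      open Parsed w n s t es parse inR
      open Walks n es inR

      M : ℕ
      M = suc (length w)

      1+n≤M : suc n ≤ M
      1+n≤M = ≤-trans (n≤1+n _) (unary-bound {1} n ([] , parse , refl))

      ≤M : ∀ {x} → x ≤ n → x ≤ M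
      ≤M p = ≤-trans (m≤n⇒m≤1+n p) 1+n≤M

      header : ∃ λ P → HeaderIs n s t P × Cur P (encEdges es)
      header = _ , (encEdges es , parse , c) , c
        where
          c : Cur (suc (suc (suc (1 + n) + s) + t)) (encEdges es)
          c = unary-cur t (unary-cur s (unary-cur {1} n ([] , parse , refl)))

      follow : ∀ {z ww} j → z < n → j + length ww ≤ n → PathN es z t ww → RunY w (st 3 0 0 0 j z 0 0 0) ww
      follow {z} j z<n q stopN = _ , accept (accept⇐ {0} {0} {0} {j} {z} {0} {0} {0} {n} {s} {proj₁ header} (proj₁ (proj₂ header))) , end
      follow {z} j z<n q (stepN {x = ℓ} {m} {y = ww} i p) =
        let (y , r , yl) = follow (suc j) (proj₂ (inR i)) (≤-trans (≤-reflexive (sym (+-suc j (length ww)))) q) p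
        in letterY ℓ ∷ y , move (small⇒bounded (sm (suc j) (≤-trans (m≤m+n (suc j) (length ww)) (≤-trans (≤-reflexive (sym (+-suc j (length ww)))) q)) (proj₂ (inR i))))
             (path⇐ (small⇒bounded (sm j (≤-trans (m≤m+n j _) q) z<n)) (small⇒bounded (sm (suc j) (≤-trans (m≤m+n (suc j) (length ww)) (≤-trans (≤-reflexive (sym (+-suc j (length ww)))) q)) (proj₂ (inR i)))) (pathStep (∈⇒sub i))) r , emitY yl
        where
          sm : ∀ {z} j → j ≤ n → z < n → Small 3 0 0 0 j z 0 0 0
          sm j p q = small ≤-refl z≤n z≤n z≤n (≤M p) (≤M (<⇒≤ q)) z≤n z≤n z≤n

      record Fixed (d v u c e k : ℕ) : Set where
        constructor fixed
        field
          d≤ : d ≤ n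
          v≤ : v ≤ n
          u≤ : u ≤ n
          c≤ : c ≤ n
          e≤ : e ≤ n
          k≤ : k ≤ n

      counting : ∀ {d v u j z c e k} → Fixed d v u c e k → j ≤ suc n → z ≤ n → Small 2 d v u j z c e k
      counting (fixed d v u c e k) j z = small (s≤s (s≤s z≤n)) (≤M d) (≤M v) (≤M u) (≤-trans j 1+n≤M) (≤M z) (≤M c) (≤M e) (≤M k)

      countMove : ∀ {d v u j z c e k d′ v′ u′ j′ z′ c′ e′ k′ ww} → Fixed d v u c e k → j ≤ suc n → z ≤ n → Fixed d′ v′ u′ c′ e′ k′ → j′ ≤ suc n → z′ ≤ n →
                  Count (st 2 d v u j z c e k) (st 2 d′ v′ u′ j′ z′ c′ e′ k′) → RunY w (st 2 d′ v′ u′ j′ z′ c′ e′ k′) ww → RunY w (st 2 d v u j z c e k) ww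
      countMove f j≤ z≤ f′ j′≤ z′≤ ch r = blankStep (small⇒bounded (counting f j≤ z≤)) (counting f′ j′≤ z′≤) (count ch) r

      walkTo : ∀ i {z d v u c e k ww} → i ≤ n → R i z → Fixed d v u c e k → RunY w (st 2 d v u (suc i) z c e k) ww → RunY w (st 2 d v u 0 0 c e k) ww
      walkTo zero i≤ z<n f r = countMove f z≤n z≤n f (s≤s z≤n) (<⇒≤ z<n) (begin sizeIs z<n) r
      walkTo (suc i) i≤ (x , Rx , Ex) f r = walkTo i (<⇒≤ i≤) Rx f
        (countMove f (≤-trans i≤ (n≤1+n n)) (<⇒≤ (R< i Rx)) f (s≤s i≤) (<⇒≤ (R< (suc i) (x , Rx , Ex))) (walk (E⇒adj Ex)) r)

      total : ℕ → ℕ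
      total d = cnt (R? d) n

      total≤ : ∀ d → total d ≤ n
      total≤ d = cnt≤ (R? d) n

      -- As `v` is not the end of a walk with `d + 1` edges, no end of a walk with `d` edges has an
      -- edge to `v`. All of them serve as witnesses, and `k` has risen to `total d` when `u`
      -- reaches `n`.
      rejectLoop : ∀ m {d v u e ww} → m + u ≡ n → d ≤ n → v < n → e ≤ n → ¬ R (suc d) v →
                   RunY w (st 2 d (suc v) 0 0 0 (total d) e 0) ww → RunY w (st 2 d v u 0 0 (total d) e (cnt (R? d) u)) ww
      rejectLoop zero {d} refl d≤ v< e≤ nR r =
        countMove (fixed d≤ (<⇒≤ v<) ≤-refl (total≤ d) e≤ (total≤ d)) z≤n z≤n (fixed d≤ v< z≤n (total≤ d) e≤ z≤n) z≤n z≤n reject r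
      rejectLoop (suc m) {d} {v} {u} {e} {ww} eq d≤ v< e≤ nR r = go (R? d u)
        where
          u< : u < n
          u< = ≤-trans (s≤s (m≤n+m u m)) (≤-reflexive eq)
          cu≤ : ∀ u → u ≤ n → cnt (R? d) u ≤ n
          cu≤ u p = ≤-trans (cnt≤ (R? d) u) p
          f : Fixed d v u (total d) e (cnt (R? d) u)
          f = fixed d≤ (<⇒≤ v<) (<⇒≤ u<) (total≤ d) e≤ (cu≤ u (<⇒≤ u<))
          rest : RunY w (st 2 d v (suc u) 0 0 (total d) e (cnt (R? d) (suc u))) ww
          rest = rejectLoop m (trans (+-suc m u) eq) d≤ v< e≤ nR r
          go : Dec (R d u) → RunY w (st 2 d v u 0 0 (total d) e (cnt (R? d) u)) ww
          go (no ¬Ru) = countMove f z≤n z≤n (fixed d≤ (<⇒≤ v<) u< (total≤ d) e≤ (cu≤ u (<⇒≤ u<))) z≤n z≤n (skip sizeIs u<)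
            (subst (λ k → RunY w (st 2 d v (suc u) 0 0 (total d) e k) ww) (cnt-no (R? d) u ¬Ru) rest)
          go (yes Ru) = walkTo d d≤ Ru f (countMove f (s≤s d≤) (<⇒≤ u<) (fixed d≤ (<⇒≤ v<) u< (total≤ d) e≤ (subst (_≤ n) (cnt-yes (R? d) u Ru) (cu≤ (suc u) u<))) z≤n z≤n
            (none (λ A → nR (u , Ru , adj⇒E A)))
            (subst (λ k → RunY w (st 2 d v (suc u) 0 0 (total d) e k) ww) (cnt-yes (R? d) u Ru) rest))

      vertexLoop : ∀ m {d v ww} → m + v ≡ n → d < n → RunY w (st 2 (suc d) 0 0 0 0 (total (suc d)) 0 0) ww → RunY w (st 2 d v 0 0 0 (total d) (cnt (R? (suc d)) v) 0) ww
      vertexLoop zero {d} refl d< r = countMove (fixed (<⇒≤ d<) ≤-refl z≤n (total≤ d) (total≤ (suc d)) z≤n) z≤n z≤n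
        (fixed d< z≤n z≤n (total≤ (suc d)) z≤n z≤n) z≤n z≤n (round sizeIs) r
      vertexLoop (suc m) {d} {v} {ww} eq d< r = go (R? (suc d) v)
        where
          v< : v < n
          v< = ≤-trans (s≤s (m≤n+m v m)) (≤-reflexive eq)
          e≤ : ∀ v → v ≤ n → cnt (R? (suc d)) v ≤ n
          e≤ v p = ≤-trans (cnt≤ (R? (suc d)) v) p
          f : Fixed d v 0 (total d) (cnt (R? (suc d)) v) 0
          f = fixed (<⇒≤ d<) (<⇒≤ v<) z≤n (total≤ d) (e≤ v (<⇒≤ v<)) z≤n
          rest : RunY w (st 2 d (suc v) 0 0 0 (total d) (cnt (R? (suc d)) (suc v)) 0) ww
          rest = vertexLoop m (trans (+-suc m v) eq) d< r
          go : Dec (R (suc d) v) → RunY w (st 2 d v 0 0 0 (total d) (cnt (R? (suc d)) v) 0) ww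
          go (no ¬Rv) = rejectLoop n (+-identityʳ n) (<⇒≤ d<) v< (e≤ v (<⇒≤ v<)) ¬Rv
            (subst (λ e → RunY w (st 2 d (suc v) 0 0 0 (total d) e 0) ww) (cnt-no (R? (suc d)) v ¬Rv) rest)
          go (yes Rv) = walkTo (suc d) d< Rv f (countMove f (s≤s d<) (<⇒≤ v<)
            (fixed (<⇒≤ d<) v< z≤n (total≤ d) (subst (_≤ n) (cnt-yes (R? (suc d)) v Rv) (e≤ (suc v) v<)) z≤n) z≤n z≤n confirm
            (subst (λ e → RunY w (st 2 d (suc v) 0 0 0 (total d) e 0) ww) (cnt-yes (R? (suc d)) v Rv) rest))

      roundLoop : ∀ m {d ww} → m + d ≡ n → RunY w (st 2 n 0 0 0 0 (total n) 0 0) ww → RunY w (st 2 d 0 0 0 0 (total d) 0 0) ww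
      roundLoop zero refl r = r
      roundLoop (suc m) {d} eq r = vertexLoop n (+-identityʳ n) (≤-trans (s≤s (m≤n+m d m)) (≤-reflexive eq)) (roundLoop m (trans (+-suc m d) eq) r)

      scanLoop : ∀ es {P ww} → inRange n es → Cur P (encEdges es) → RunY w (st 2 0 0 0 0 0 n 0 0) ww → RunY w (st 1 0 0 0 P 0 0 0 0) ww
      cursor : ∀ {P x} → Cur P x → Small 1 0 0 0 P 0 0 0 0
      cursor {P} c = small (s≤s z≤n) z≤n z≤n z≤n (≤-trans (≤-reflexive (sym (+-identityʳ P))) (cur-bound {x = []} c)) z≤n z≤n z≤n z≤n
      scanLoop [] {P} inR′ c r = blankStep (small⇒bounded (cursor c)) (counting (fixed z≤n z≤n z≤n ≤-refl z≤n z≤n) z≤n z≤n) (end (read-cur c) sizeIs) r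
      scanLoop ((U , ℓ , V) ∷ es) {P} inR′ c r = blankStep (small⇒bounded (cursor c)) (cursor c₃)
          (scan (record { sized = sizeIs ; U<n = proj₁ (inR′ (here refl)) ; V<n = proj₂ (inR′ (here refl)) ; source = word-block U c₀ ; label = read-cur c₁ ; target = word-block V c₂ }))
          (scanLoop es (inR′ ∘ there) c₃ r)
        where
          c₀ : Cur P (unary U ++ lab ℓ ∷ unary V ++ encEdges es)
          c₀ = subst (Cur P) (encEdge-++ U ℓ V (encEdges es)) c
          c₁ : Cur (suc (P + U)) (lab ℓ ∷ unary V ++ encEdges es)
          c₁ = unary-cur U c₀
          c₂ : Cur (suc (suc (P + U))) (unary V ++ encEdges es)
          c₂ = cur-∷ c₁
          c₃ : Cur (suc (suc (suc (P + U)) + V)) (encEdges es)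
          c₃ = unary-cur V c₂

      valid⇒run : ∀ {ww} → (∀ z → ¬ R n z) → PathN es s t ww → RunY w (st 0 0 0 0 0 0 0 0 0) ww
      valid⇒run {ww} empty p = blankStep (start-bounded w) (cursor (proj₂ (proj₂ header))) (boot (proj₁ (proj₂ header)) s<n t<n)
          (scanLoop es inR (proj₂ (proj₂ header))
            (subst (λ c → RunY w (st 2 0 0 0 0 0 c 0 0) ww) (cnt-all (R? 0) n (λ _ q → q))
              (roundLoop n (+-identityʳ n)
                (blankStep (small⇒bounded (counting {n} {0} {0} {0} {0} {total n} (fixed ≤-refl z≤n z≤n (total≤ n) z≤n z≤n) z≤n z≤n)) (small ≤-refl z≤n z≤n z≤n z≤n (≤M (<⇒≤ s<n)) z≤n z≤n z≤n)
                  (subst (λ c → Change (st 2 n 0 0 0 0 c 0 0) (st 3 0 0 0 0 s 0 0 0)) (sym (cnt-none (R? n) n empty)) (done {d = n} {n = n} {s} {t} {P = proj₁ header} sizeIs (proj₁ (proj₂ header))))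
                  (follow 0 s<n short p)))))
        where
          -- A longer path would contain a walk with `n` edges. The bound keeps the step counter `j`
          -- of phase 3 in range.
          short : length ww ≤ n
          short with length ww ≤? n
          ... | yes q = q
          ... | no q with m≤n⇒∃[o]m+o≡n (<⇒≤ (≰⇒> q))
          ...   | i , eq = ⊥-elim (empty _ (proj₂ (R-down i n (subst (λ j → R j t) (sym (trans (+-comm i n) eq)) (R-path 0 s<n p)))))

  valid⇒dagreach : ∀ {w ww} {L : Language a} → Valid w ww → L ww → DAGREACH L w
  valid⇒dagreach {w} {ww} V l with finEdges n es inR
    where open Valid V
  ... | E , eq = I , trans (encode-encodeN I) (trans encodes (sym parse)) , ww ,
        PathN→Path (Fin.toℕ-fromℕ< s<n) (Fin.toℕ-fromℕ< t<n) (subst (λ es → PathN es s t ww) (sym eq) path) , l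
    where
      open Valid V
      acyclic : ∀ v y → Path E v v y → y ≡ []
      acyclic v y p = Walks.no-cycle n es inR none (Fin.toℕ<n v) (subst (λ es → PathN es (toℕ v) (toℕ v) y) eq (Path→PathN p))
      I : Instance a
      I = record { n = n ; E = E ; s = fromℕ< s<n ; t = fromℕ< t<n ; acyclic = acyclic }
      encodes : encodeN n (toℕ (fromℕ< s<n)) (toℕ (fromℕ< t<n)) (map edgeℕ E) ≡ encodeN n s t es
      encodes rewrite eq | Fin.toℕ-fromℕ< s<n | Fin.toℕ-fromℕ< t<n = refl

  dagreach⇒run : ∀ {w} {L : Language a} → DAGREACH L w → ∃ λ ww → RunY w (st 0 0 0 0 0 0 0 0 0) ww × L ww
  dagreach⇒run {w} (I , eq , ww , p , l) = ww ,
      valid⇒run w n (toℕ s) (toℕ t) (map edgeℕ E) (trans (sym eq) (encode-encodeN I)) inR (Fin.toℕ<n s) (Fin.toℕ<n t)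
        (Walks.acyclic⇒none n (map edgeℕ E) inR ac) (Path→PathN p) , l
    where
      open Instance I
      inR : inRange n (map edgeℕ E)
      inR i with ∈-map⁻ edgeℕ i
      ... | (u , _ , v) , _ , refl = Fin.toℕ<n u , Fin.toℕ<n v
      ac : ∀ {v y} → v < n → PathN (map edgeℕ E) v v y → y ≡ []
      ac {v} {y} v< q = acyclic (fromℕ< v<) y (PathN→Path (Fin.toℕ-fromℕ< v<) (Fin.toℕ-fromℕ< v<) q)

-- Membership in LogCFL

module _ (a : ℕ) (P : DPDA a) where

  open MembershipComplete a
  open PathGrammarCorrect P using (NT; finNT; ruleList; rules⁺; rules⁻; start; grammar-sound; grammar-complete; accS⇒star; star⇒acc; AccS; der⇒gen; gen⇒der; grammar)
  open DPDA P using (q₀; Z₀; final)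

  -- The grammar accepts any vertex as the target of the last edge. In the printed graph an edge
  -- with the final label can only lead to `N`, as the edge formula of that label is false.
  final-target : ∀ w {u v y z} → PathN (edges w) u v y → Yield y z → v ≡ N w
  final-target w (stepN i stopN) end = go (∈-edges⁻ w i) refl
    where
      go : ∀ {e} → IsEdge w e → proj₁ (proj₂ e) ≡ finalY → proj₂ (proj₂ e) ≡ N w
      go (final _ _) _ = refl
      go (inner _ _ ()) refl
  final-target w (stepN i p) (pause yl) = final-target w p yl
  final-target w (stepN i p) (emitY yl) = final-target w p yl

  pathCFG : CFG (2 + (2 + a))
  pathCFG = grammar ruleList

  module _ (w : Word (2 + a)) where

    dagreach⇒derivation : DAGREACH (DPDALang P) w → CFGLang pathCFG (graphWord w)
    dagreach⇒derivation h =
      let (ww , (y , r , yl) , (q , γ , star , f)) = dagreach⇒run {w} {DPDALang P} h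
      in der⇒gen rules⁺ (grammar-complete (suc (N w)) (N w) {edges w} {N w} {y} {ww} (run₀→inOrder w (increasing w) r) yl (star⇒acc star f))

    derivation⇒dagreach : CFGLang pathCFG (graphWord w) → DAGREACH (DPDALang P) w
    derivation⇒dagreach g =
      let (n′ , N′ , es , t , y , ww , eq , io , yl , acc) = grammar-sound (gen⇒der rules⁻ {X = start} refl g)
          (_ , _ , _ , es≡) = encodeN-injective (suc (N w)) n′ 0 0 (N w) N′ (edges w) es eq
          p = subst (λ es → PathN es 0 t y) (sym es≡) (InOrder→PathN io)
          p′ = subst (λ t → PathN (edges w) 0 t y) (final-target w p yl) p
      in valid⇒dagreach {w} {ww} {DPDALang P} (run⇒valid w (y , path→run₀ w (increasing w) p′ , yl)) (accS⇒star acc [])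

  dagreach-in-logcfl : LogCFL (DAGREACH (DPDALang P))
  dagreach-in-logcfl = 2 + (2 + a) , pathCFG , graphWord , graph-logspace , λ w → dagreach⇒derivation w , derivation⇒dagreach w

theorem6 : ((a : ℕ) (P : DPDA a) → LogCFL (DAGREACH (DPDALang P)))
    × Σ ℕ (λ a → Σ (DPDA a) (λ P → LogCFLHard (DAGREACH (DPDALang P))))
theorem6 = dagreach-in-logcfl , 6 , dyckPDA , dagreach-dyck-hard
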